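{- Let \[\delta:=\lim_{x\to\infty}\frac{\#\{\text{primes } p\le x : (1,1,1)\in\mathcal{C}(p)\}}{\#\{\text{primes } p\le x\}},\] assuming this limit exists. Then $\delta<\tfrac12$.
   Context: For a prime $p$, $\mathcal{X}^*(p)$ is the set of nonzero solutions in $\mathbb{F}_p^3$ of $x_1^2+x_2^2+x_3^2=3x_1x_2x_3$. Rotations: $\mathrm{rot}_1(x_1,x_2,x_3)=(x_1,x_3,3x_1x_3-x_2)$, $\mathrm{rot}_2(x_1,x_2,x_3)=(x_3,x_2,3x_2x_3-x_1)$, $\mathrm{rot}_3(x_1,x_2,x_3)=(x_2,3x_2x_3-x_1,x_3)$; $\mathrm{ord}_{p,i}(\mathbf{x})=\min\{n\in\mathbb{Z}_{>0}:\mathrm{rot}_i^n(\mathbf{x})=\mathbf{x}\}$ (equivalently the order of $\begin{pmatrix}0&1\\-1&3x_i\end{pmatrix}$ in $\mathrm{GL}_2(\mathbb{F}_p)$). A point $\mathbf{x}\in\mathcal{X}^*(p)$ is maximal if $\mathrm{ord}_{p,i}(\mathbf{x})\in\{p-1,p+1,2p\}$ for some $i$; the cage $\mathcal{C}(p)$ is the set of all maximal points of $\mathcal{X}^*(p)$. -}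

module Defs where

open import Data.Bool using (Bool; true; false; _∧_; _∨_; not; if_then_else_)
open import Data.Nat using (ℕ; zero; suc; _+_; _*_; _∸_; _^_; _≡ᵇ_; _%_; _≤_; NonZero)
open import Data.Nat.Primality using (prime?)
open import Data.List using (List; filter; length; upTo; map; []; _∷_)
open import Data.Bool.ListAction using (all; any)
open import Data.Bool using (T?)
open import Data.Product using (_×_; _,_)
open import Data.Fin using (Fin; zero; suc)
open import Relation.Nullary.Decidable using (does)
open import Data.Integer using (+_)
open import Data.Rational using (ℚ; 0ℚ; _/_; _-_; ∣_∣; _<_; _≤_)

-- Points of F_p^3, represented by triples of naturals (read modulo p).
Triple : Set
Triple = ℕ × ℕ × ℕ

module Fp (k : ℕ) where
  p : ℕ
  p = suc k

  red : ℕ → ℕ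
  red a = a % p

  sub : ℕ → ℕ → ℕ
  sub a b = (a + (p ∸ (b % p))) % p

  eqF : ℕ → ℕ → Bool
  eqF a b = (a % p) ≡ᵇ (b % p)

  eqT : Triple → Triple → Bool
  eqT (a₁ , a₂ , a₃) (b₁ , b₂ , b₃) = eqF a₁ b₁ ∧ eqF a₂ b₂ ∧ eqF a₃ b₃

  inXstar : Triple → Bool
  inXstar (x₁ , x₂ , x₃) =
    eqF (x₁ * x₁ + x₂ * x₂ + x₃ * x₃) (3 * x₁ * x₂ * x₃)
    ∧ not (eqF x₁ 0 ∧ eqF x₂ 0 ∧ eqF x₃ 0)

  rot : Fin 3 → Triple → Triple
  rot zero             (x₁ , x₂ , x₃) = (red x₁ , red x₃ , sub (3 * x₁ * x₃) x₂)
  rot (suc zero)       (x₁ , x₂ , x₃) = (red x₃ , red x₂ , sub (3 * x₂ * x₃) x₁)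
  rot (suc (suc zero)) (x₁ , x₂ , x₃) = (red x₂ , sub (3 * x₂ * x₃) x₁ , red x₃)

  iter : ℕ → (Triple → Triple) → Triple → Triple
  iter zero    f x = x
  iter (suc n) f x = f (iter n f x)

  ordIs : Fin 3 → Triple → ℕ → Bool
  ordIs i x zero    = false
  ordIs i x (suc n) =
    eqT (iter (suc n) (rot i) x) x
    ∧ all (λ m → not (eqT (iter (suc m) (rot i) x) x)) (upTo n)

  maximal : Triple → Bool
  maximal x = any (λ i → any (ordIs i x) ((p ∸ 1) ∷ (p + 1) ∷ (2 * p) ∷ []))
                  (zero ∷ suc zero ∷ suc (suc zero) ∷ [])

  inCage : Triple → Bool
  inCage x = inXstar x ∧ maximal x

-- (1,1,1) ∈ C(p)   (false for p = 0, which is never prime anyway)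
oneInCage : ℕ → Bool
oneInCage zero    = false
oneInCage (suc k) = Fp.inCage k (1 , 1 , 1)

primeCount : ℕ → ℕ
primeCount x = length (filter prime? (upTo (suc x)))

cageCount : ℕ → ℕ
cageCount x = length (filter (λ p → T? (does (prime? p) ∧ oneInCage p)) (upTo (suc x)))

ratio : ℕ → ℚ
ratio x with primeCount x
... | zero  = 0ℚ
... | suc n = (+ cageCount x) / suc n

-- A sequence of rationals is Cauchy (i.e. it converges to a real limit).
IsCauchy : (ℕ → ℚ) → Set
IsCauchy r = ∀ (ε : ℚ) → 0ℚ < ε →
  Data.Product.∃ λ (N : ℕ) → ∀ m n → N Data.Nat.≤ m → N Data.Nat.≤ n → ∣ r m - r n ∣ < ε
  where import Data.Product; import Data.Nat

{-# OPTIONS --safe #-}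
module Submission where

-- The bound is proved with weighted primes. If (1,1,1) is maximal at p then p is not ±1 mod 5 (else θ² = 3θ - 1 has its roots among
-- the squares of 𝔽_p, and the rotation order divides (p-1)/2), and p is not of the form 5x² + 5xy + 8y² (else rational cubic
-- reciprocity makes θ a cube, and the order divides (p+1)/3). For weights L(p)/p the primes ±2 mod 5 make up one half, and those of
-- the form 5x² + 5xy + 8y² make up 1/12: this is Mertens' theorem for the characters of conductor 5, 3, 15 and for a ring class
-- character of ℚ(√-15), whose values at p are the κ of the Hecke relation. So the cage has weight at most 5/12 + o(1), and partial
-- summation excludes a natural density above 7/16. All of it is finitary: the logarithm is replaced by L(n) = H(nX) - H(X) for
-- a large X, with H the harmonic numbers, and L(1,χ) ≠ 0 is a numerical bound on one partial sum.

open import Data.Nat as ℕ using (ℕ; zero; suc; z≤n; s≤s)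
import Data.Nat.Properties as ℕP
import Data.Nat.Divisibility as ℕD
open import Data.Nat.Primality
open import Data.Integer using (-1ℤ; 0ℤ; 1ℤ)
import Data.Integer.Properties as ℤP
open import Data.Product using (_×_; _,_; proj₁; proj₂; ∃)
open import Data.Sum using (_⊎_; inj₁; inj₂)
open import Data.Empty using (⊥; ⊥-elim)
open import Relation.Nullary using (yes; no; ¬_; Dec)

-- A natural density of primes in a class calls for a prime number theorem, whereas a density for
-- the weights L(p)/p only needs Σ κ(p)L(p)/p to be bounded, which is elementary once L(1) ≠ 0. The
-- assumed convergence makes the transfer possible: a limit of 1/2 or more would keep the ratio
-- above 7/16, a value between 5/12 and 1/2, from some point on. The forms of discriminant -135 have
-- a cyclic class group of order 6, in which 5x² + 5xy + 8y² has order 2. Its primes are singled out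
-- by the characters of order 3 and 6 together with the quadratic ones, hence five series. Two
-- devices stand in for algebraic number theory. As ℚ(√-15) has class number 2, ideals are replaced
-- by homogeneous elements of a graded ring, so that norms, conjugates and descent are polynomial
-- identities. Gauss sums live in the group ring of ℤ/q over ℤ[ω], where coefficients can be read
-- off and no root of unity of order q is adjoined. The cubic law is applied to rational primes ρ ≠
-- 3 only, with the exponent (ρ² - 1)/3, which needs no distinction of ρ modulo 3.

module RingExpressions where
 open import Data.Integer as ℤ using (ℤ)
 open import Tactic.RingSolver.Core.Expression public using (Expr; Κ) renaming (_⊕_ to infixl 6 _:+_; _⊗_ to infixl 7 _:*_; ⊝_ to infix 8 :-_)
 import Data.Integer.Tactic.RingSolver
 import Data.Nat.Tactic.RingSolver
 open import Tactic.RingSolver.NonReflective Data.Integer.Tactic.RingSolver.ring public using () renaming (solve to solveℤ)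
 open import Tactic.RingSolver.NonReflective Data.Nat.Tactic.RingSolver.ring public using () renaming (solve to solveℕ)

 infix 4 _:=_
 _:=_ : ∀ {A : Set} {n} → Expr A n → Expr A n → Expr A n × Expr A n
 _:=_ = _,_

 infixl 6 _:-_
 _:-_ : ∀ {A : Set} {n} → Expr A n → Expr A n → Expr A n
 x :- y = x :+ (:- y)

 infix 9 #_
 #_ : ∀ {n} → ℕ → Expr ℤ n
 # k = Κ (ℤ.+ k)

open RingExpressions

-- Exact rational arithmetic and finite sums

module Rationals where
 open import Data.Integer as ℤ using (ℤ)
 open import Data.Rational using (ℚ; _+_; _*_; _-_; -_; 0ℚ; 1ℚ; _≤_; _<_; _/_; ∣_∣; toℚᵘ; nonNegative; NonNegative)
 open import Data.Rational.Properties
 import Data.Rational.Unnormalised as U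
 import Data.Rational.Unnormalised.Properties as UP
 open import Relation.Nullary.Decidable using (dec⇒maybe)
 open import Relation.Binary.PropositionalEquality
 open import Tactic.RingSolver.Core.AlmostCommutativeRing using (AlmostCommutativeRing; fromCommutativeRing)

 ℚring : AlmostCommutativeRing _ _
 ℚring = fromCommutativeRing +-*-commutativeRing (λ x → dec⇒maybe (0ℚ ≟ x))

 open import Tactic.RingSolver.NonReflective ℚring public using () renaming (solve to solveℚ)

 opaque
  qz : ℤ → ℚ
  qz i = i / 1

  -- The default 1/0 = 0 makes `iv` multiplicative without exception (`iv-*`) and nonnegative
  -- everywhere.
  iv : ℕ → ℚ
  iv zero = 0ℚ
  iv (suc n) = ℤ.+ 1 / suc n

 qn : ℕ → ℚ
 qn n = qz (ℤ.+ n)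

 opaque
  unfolding qz
  qzᵘ : ∀ i → toℚᵘ (qz i) U.≃ U.mkℚᵘ i 0
  qzᵘ i = toℚᵘ-fromℚᵘ (U.mkℚᵘ i 0)

  ivᵘ : ∀ n → toℚᵘ (iv (suc n)) U.≃ U.mkℚᵘ (ℤ.+ 1) n
  ivᵘ n = toℚᵘ-fromℚᵘ (U.mkℚᵘ (ℤ.+ 1) n)

  qz-1 : qz (ℤ.+ 1) ≡ 1ℚ
  qz-1 = refl
  qz-0 : qz (ℤ.+ 0) ≡ 0ℚ
  qz-0 = refl
  iv-0 : iv 0 ≡ 0ℚ
  iv-0 = refl
  iv-1 : iv 1 ≡ 1ℚ
  iv-1 = refl

  qz-+ : ∀ i j → qz (i ℤ.+ j) ≡ qz i + qz j
  qz-+ i j = toℚᵘ-injective (UP.≃-trans (qzᵘ (i ℤ.+ j)) (UP.≃-sym (UP.≃-trans (toℚᵘ-homo-+ (qz i) (qz j))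
    (UP.≃-trans (UP.+-cong (qzᵘ i) (qzᵘ j)) (U.*≡* (cong (ℤ._* (ℤ.+ 1)) (cong₂ ℤ._+_ (ℤP.*-identityʳ i) (ℤP.*-identityʳ j))))))))

  qz-* : ∀ i j → qz (i ℤ.* j) ≡ qz i * qz j
  qz-* i j = toℚᵘ-injective (UP.≃-trans (qzᵘ (i ℤ.* j)) (UP.≃-sym (UP.≃-trans (toℚᵘ-homo-* (qz i) (qz j))
    (UP.≃-trans (UP.*-cong (qzᵘ i) (qzᵘ j)) (U.*≡* refl)))))

  qz-neg : ∀ i → qz (ℤ.- i) ≡ - qz i
  qz-neg i = toℚᵘ-injective (UP.≃-trans (qzᵘ (ℤ.- i)) (UP.≃-sym (UP.≃-trans (toℚᵘ-homo‿- (qz i)) (UP.-‿cong (qzᵘ i)))))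

  qz-mono : ∀ {i j} → i ℤ.≤ j → qz i ≤ qz j
  qz-mono {i} {j} i≤j = toℚᵘ-cancel-≤ (UP.≤-respˡ-≃ (UP.≃-sym (qzᵘ i)) (UP.≤-respʳ-≃ (UP.≃-sym (qzᵘ j))
     (U.*≤* (subst₂ ℤ._≤_ (sym (ℤP.*-identityʳ i)) (sym (ℤP.*-identityʳ j)) i≤j))))

  iv-inv : ∀ n → qn (suc n) * iv (suc n) ≡ 1ℚ
  iv-inv n = toℚᵘ-injective (UP.≃-trans (toℚᵘ-homo-* (qn (suc n)) (iv (suc n)))
    (UP.≃-trans (UP.*-cong (qzᵘ (ℤ.+ suc n)) (ivᵘ n)) (U.*≡* (trans (ℤP.*-identityʳ _) (trans (ℤP.*-identityʳ (ℤ.+ suc n)) (cong ℤ.+_ (trans (sym (ℕP.*-identityˡ (suc n))) (sym (ℕP.*-identityˡ _)))))))))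

  iv-nn : ∀ n → 0ℚ ≤ iv n
  iv-nn zero = ≤-refl
  iv-nn (suc n) = nonNegative⁻¹ (ℤ.+ 1 / suc n) {{normalize-nonNeg 1 (suc n)}}

 qn-+ : ∀ m n → qn (m ℕ.+ n) ≡ qn m + qn n
 qn-+ m n = qz-+ (ℤ.+ m) (ℤ.+ n)

 qn-* : ∀ m n → qn (m ℕ.* n) ≡ qn m * qn n
 qn-* m n = trans (cong qz (ℤP.pos-* m n)) (qz-* (ℤ.+ m) (ℤ.+ n))

 qn-suc : ∀ n → qn (suc n) ≡ 1ℚ + qn n
 qn-suc n = trans (qn-+ 1 n) (cong (_+ qn n) qz-1)

 qn-mono : ∀ {m n} → m ℕ.≤ n → qn m ≤ qn n
 qn-mono p = qz-mono (ℤ.+≤+ p)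

 qn-nn : ∀ n → 0ℚ ≤ qn n
 qn-nn n = subst (_≤ qn n) qz-0 (qn-mono z≤n)

 iv-inv' : ∀ n → 1 ℕ.≤ n → qn n * iv n ≡ 1ℚ
 iv-inv' (suc n) _ = iv-inv n

 ≤-by : ∀ {a b} d → a + d ≡ b → 0ℚ ≤ d → a ≤ b
 ≤-by {a} d refl h = subst (_≤ a + d) (+-identityʳ a) (+-monoʳ-≤ a h)

 nn : ∀ {a} → 0ℚ ≤ a → NonNegative a
 nn = nonNegative

 sub-nn : ∀ {a b} → a ≤ b → 0ℚ ≤ b - a
 sub-nn {a} {b} h = subst (_≤ b - a) (+-inverseʳ a) (+-monoˡ-≤ (- a) h)

 *-nn : ∀ {a b} → 0ℚ ≤ a → 0ℚ ≤ b → 0ℚ ≤ a * b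
 *-nn {a} {b} ha hb = nonNegative⁻¹ _ {{nonNeg*nonNeg⇒nonNeg a {{nn ha}} b {{nn hb}}}}

 +-nn : ∀ {a b} → 0ℚ ≤ a → 0ℚ ≤ b → 0ℚ ≤ a + b
 +-nn {a} {b} ha hb = subst (_≤ a + b) (+-identityˡ 0ℚ) (+-mono-≤ ha hb)

 *-monoˡ : ∀ c {a b} → 0ℚ ≤ c → a ≤ b → c * a ≤ c * b
 *-monoˡ c hc h = *-monoˡ-≤-nonNeg c {{nn hc}} h

 *-monoʳ : ∀ c {a b} → 0ℚ ≤ c → a ≤ b → a * c ≤ b * c
 *-monoʳ c hc h = *-monoʳ-≤-nonNeg c {{nn hc}} h

 *-mono : ∀ {a b c d} → 0ℚ ≤ a → 0ℚ ≤ d → a ≤ b → c ≤ d → a * c ≤ b * d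
 *-mono {a} {b} {c} {d} ha hd h k = ≤-trans (*-monoˡ a ha k) (*-monoʳ d hd h)

 ≤→ : ∀ {a b} → 0ℚ ≤ b - a → a ≤ b
 ≤→ {a} {b} h = ≤-by (b - a) (solveℚ 2 (λ a b → a :+ (b :- a) := b) refl a b) h

 0≤1 : 0ℚ ≤ 1ℚ
 0≤1 = subst (0ℚ ≤_) qz-1 (qn-nn 1)

 ≡→≤ : ∀ {a b : ℚ} → a ≡ b → a ≤ b
 ≡→≤ = ≤-reflexive

 abs≤ : ∀ {a b} → a ≤ b → - a ≤ b → ∣ a ∣ ≤ b
 abs≤ {a} {b} h k with ∣p∣≡p∨∣p∣≡-p a
 ... | inj₁ e = subst (_≤ b) (sym e) h
 ... | inj₂ e = subst (_≤ b) (sym e) k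

 a≤∣a∣ : ∀ a → a ≤ ∣ a ∣
 a≤∣a∣ a with ≤-total 0ℚ a
 ... | inj₁ h = ≤-reflexive (sym (0≤p⇒∣p∣≡p h))
 ... | inj₂ h = ≤-trans h (0≤∣p∣ a)

 -a≤∣a∣ : ∀ a → - a ≤ ∣ a ∣
 -a≤∣a∣ a = subst (- a ≤_) (∣-p∣≡∣p∣ a) (a≤∣a∣ (- a))

 abs-nn : ∀ {a} → 0ℚ ≤ a → ∣ a ∣ ≡ a
 abs-nn = 0≤p⇒∣p∣≡p

 abs-*≤ : ∀ {a b A B} → ∣ a ∣ ≤ A → ∣ b ∣ ≤ B → ∣ a * b ∣ ≤ A * B
 abs-*≤ {a} {b} {A} {B} h k = ≤-trans (≤-reflexive (∣p*q∣≡∣p∣*∣q∣ a b)) (*-mono (0≤∣p∣ a) (≤-trans (0≤∣p∣ b) k) h k)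

 abs-+≤ : ∀ {a b A B} → ∣ a ∣ ≤ A → ∣ b ∣ ≤ B → ∣ a + b ∣ ≤ A + B
 abs-+≤ {a} {b} h k = ≤-trans (∣p+q∣≤∣p∣+∣q∣ a b) (+-mono-≤ h k)

 abs-neg : ∀ {a A} → ∣ a ∣ ≤ A → ∣ - a ∣ ≤ A
 abs-neg {a} {A} h = subst (_≤ A) (sym (∣-p∣≡∣p∣ a)) h

 abs--≤ : ∀ {a b A B} → ∣ a ∣ ≤ A → ∣ b ∣ ≤ B → ∣ a - b ∣ ≤ A + B
 abs--≤ h k = abs-+≤ h (abs-neg k)

 nn→abs : ∀ {a b} → 0ℚ ≤ a → a ≤ b → ∣ a ∣ ≤ b
 nn→abs {a} {b} h k = subst (_≤ b) (sym (abs-nn h)) k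

 cancel-qn : ∀ n {a b} → 1 ℕ.≤ n → qn n * a ≤ qn n * b → a ≤ b
 cancel-qn n {a} {b} h k = subst₂ _≤_ (lem (qn n) (iv n) a (iv-inv' n h)) (lem (qn n) (iv n) b (iv-inv' n h)) (*-monoˡ (iv n) (iv-nn n) k)
  where
  lem' = solveℚ 3 (λ x y a → y :* (x :* a) := (x :* y) :* a) refl
  lem : ∀ x y a → x * y ≡ 1ℚ → y * (x * a) ≡ a
  lem x y a e = trans (lem' x y a) (trans (cong (_* a) e) (*-identityˡ a))

 cancel-qn-≡ : ∀ n {a b} → 1 ℕ.≤ n → qn n * a ≡ qn n * b → a ≡ b
 cancel-qn-≡ n h e = ≤-antisym (cancel-qn n h (≤-reflexive e)) (cancel-qn n h (≤-reflexive (sym e)))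

 iv-* : ∀ m n → iv (m ℕ.* n) ≡ iv m * iv n
 iv-* zero n = trans iv-0 (sym (trans (cong (_* iv n) iv-0) (*-zeroˡ (iv n))))
 iv-* (suc m) zero = trans (cong iv (ℕP.*-zeroʳ m)) (trans iv-0 (sym (trans (cong (iv (suc m) *_) iv-0) (*-zeroʳ (iv (suc m))))))
 iv-* (suc m) (suc n) = cancel-qn-≡ (suc m ℕ.* suc n) (s≤s z≤n) (trans (iv-inv' (suc m ℕ.* suc n) (s≤s z≤n))
   (sym (trans (cong (_* (iv (suc m) * iv (suc n))) (qn-* (suc m) (suc n))) (trans (lem (qn (suc m)) (qn (suc n)) (iv (suc m)) (iv (suc n)))
     (cong₂ _*_ (iv-inv m) (iv-inv n))))))
  where
  lem = solveℚ 4 (λ a b c d → (a :* b) :* (c :* d) := (a :* c) :* (b :* d)) refl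

 iv-anti : ∀ {m n} → 1 ℕ.≤ m → m ℕ.≤ n → iv n ≤ iv m
 iv-anti {m} {n} h k = cancel-qn n (ℕP.≤-trans h k) (subst₂ _≤_ (sym (iv-inv' n (ℕP.≤-trans h k))) refl
   (subst (_≤ qn n * iv m) (iv-inv' m h) (*-monoʳ (iv m) (iv-nn m) (qn-mono k))))

 ≤iv : ∀ n {a b} → 1 ℕ.≤ n → qn n * a ≤ b → a ≤ b * iv n
 ≤iv n {a} {b} h k = cancel-qn n h (≤-trans k (≤-reflexive (sym (trans (solveℚ 3 (λ x b y → x :* (b :* y) := b :* (x :* y)) refl (qn n) b (iv n)) (trans (cong (b *_) (iv-inv' n h)) (*-identityʳ b))))))

 iv≤ : ∀ n {a b} → 1 ℕ.≤ n → b ≤ qn n * a → b * iv n ≤ a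
 iv≤ n {a} {b} h k = cancel-qn n h (≤-trans (≤-reflexive (trans (solveℚ 3 (λ x b y → x :* (b :* y) := b :* (x :* y)) refl (qn n) b (iv n)) (trans (cong (b *_) (iv-inv' n h)) (*-identityʳ b)))) k)

 iv-diff : ∀ n → 1 ℕ.≤ n → iv n - iv (suc n) ≡ iv n * iv (suc n)
 iv-diff n h = trans (cong₂ _-_ (trans (sym (*-identityʳ (iv n))) (cong (iv n *_) (sym (trans (cong (_* iv (suc n)) (sym (qn-suc n))) (iv-inv n)))))
       (trans (sym (*-identityʳ (iv (suc n)))) (cong (iv (suc n) *_) (sym (iv-inv' n h)))))
      (lem (qn n) (iv n) (iv (suc n)))
  where
  lem = solveℚ 3 (λ q a b → a :* ((Κ 1ℚ :+ q) :* b) :- b :* (q :* a) := a :* b) refl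

 -- sums start at 1

 sum : (ℕ → ℚ) → ℕ → ℚ
 sum f zero = 0ℚ
 sum f (suc n) = sum f n + f (suc n)

 sum-cong : ∀ {f g} x → (∀ n → 1 ℕ.≤ n → n ℕ.≤ x → f n ≡ g n) → sum f x ≡ sum g x
 sum-cong zero h = refl
 sum-cong (suc x) h = cong₂ _+_ (sum-cong x (λ n a b → h n a (ℕP.m≤n⇒m≤1+n b))) (h (suc x) (s≤s z≤n) ℕP.≤-refl)

 sum-mono : ∀ {f g} x → (∀ n → 1 ℕ.≤ n → n ℕ.≤ x → f n ≤ g n) → sum f x ≤ sum g x
 sum-mono zero h = ≤-refl
 sum-mono (suc x) h = +-mono-≤ (sum-mono x (λ n a b → h n a (ℕP.m≤n⇒m≤1+n b))) (h (suc x) (s≤s z≤n) ℕP.≤-refl)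

 sum-0 : ∀ x → sum (λ _ → 0ℚ) x ≡ 0ℚ
 sum-0 zero = refl
 sum-0 (suc x) = trans (+-identityʳ _) (sum-0 x)

 sum-vanish : ∀ {f} x → (∀ n → 1 ℕ.≤ n → n ℕ.≤ x → f n ≡ 0ℚ) → sum f x ≡ 0ℚ
 sum-vanish x h = trans (sum-cong x h) (sum-0 x)

 sum-nn : ∀ {f} x → (∀ n → 1 ℕ.≤ n → n ℕ.≤ x → 0ℚ ≤ f n) → 0ℚ ≤ sum f x
 sum-nn {f} x h = subst (_≤ sum f x) (sum-0 x) (sum-mono x h)

 sum-+ : ∀ f g x → sum (λ n → f n + g n) x ≡ sum f x + sum g x
 sum-+ f g zero = sym (+-identityʳ 0ℚ)
 sum-+ f g (suc x) = trans (cong (_+ (f (suc x) + g (suc x))) (sum-+ f g x)) (solveℚ 4 (λ a b c d → (a :+ b) :+ (c :+ d) := (a :+ c) :+ (b :+ d)) refl (sum f x) (sum g x) (f (suc x)) (g (suc x)))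

 sum-*ˡ : ∀ c f x → sum (λ n → c * f n) x ≡ c * sum f x
 sum-*ˡ c f zero = sym (*-zeroʳ c)
 sum-*ˡ c f (suc x) = trans (cong (_+ c * f (suc x)) (sum-*ˡ c f x)) (sym (*-distribˡ-+ c (sum f x) (f (suc x))))

 sum-*ʳ : ∀ c f x → sum (λ n → f n * c) x ≡ sum f x * c
 sum-*ʳ c f x = trans (sum-cong x (λ n _ _ → *-comm (f n) c)) (trans (sum-*ˡ c f x) (*-comm c _))

 sum-neg : ∀ f x → sum (λ n → - f n) x ≡ - sum f x
 sum-neg f zero = refl
 sum-neg f (suc x) = trans (cong (_+ - f (suc x)) (sum-neg f x)) (sym (neg-distrib-+ (sum f x) (f (suc x))))

 sum-- : ∀ f g x → sum (λ n → f n - g n) x ≡ sum f x - sum g x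
 sum-- f g x = trans (sum-+ f (λ n → - g n) x) (cong (sum f x +_) (sum-neg g x))

 sum-swap : ∀ (f : ℕ → ℕ → ℚ) x y → sum (λ n → sum (λ m → f n m) y) x ≡ sum (λ m → sum (λ n → f n m) x) y
 sum-swap f zero y = sym (sum-0 y)
 sum-swap f (suc x) y = trans (cong (_+ sum (f (suc x)) y) (sum-swap f x y)) (sym (sum-+ _ (f (suc x)) y))

 sum-abs : ∀ f x → ∣ sum f x ∣ ≤ sum (λ n → ∣ f n ∣) x
 sum-abs f zero = ≤-refl
 sum-abs f (suc x) = ≤-trans (∣p+q∣≤∣p∣+∣q∣ (sum f x) (f (suc x))) (+-monoˡ-≤ ∣ f (suc x) ∣ (sum-abs f x))

 sum-abs≤ : ∀ {f g} x → (∀ n → 1 ℕ.≤ n → n ℕ.≤ x → ∣ f n ∣ ≤ g n) → ∣ sum f x ∣ ≤ sum g x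
 sum-abs≤ {f} x h = ≤-trans (sum-abs f x) (sum-mono x h)

 sum-split : ∀ f a b → sum f (a ℕ.+ b) ≡ sum f a + sum (λ i → f (a ℕ.+ i)) b
 sum-split f a zero = trans (cong (sum f) (ℕP.+-identityʳ a)) (sym (+-identityʳ _))
 sum-split f a (suc b) = trans (cong (sum f) (ℕP.+-suc a b)) (trans (cong₂ _+_ (sum-split f a b) (cong f (sym (ℕP.+-suc a b)))) (+-assoc (sum f a) (sum (λ i → f (a ℕ.+ i)) b) (f (a ℕ.+ suc b))))

 sum-const : ∀ c x → sum (λ _ → c) x ≡ qn x * c
 sum-const c zero = sym (trans (cong (_* c) qz-0) (*-zeroˡ c))
 sum-const c (suc x) = trans (cong (_+ c) (sum-const c x)) (sym (trans (cong (_* c) (qn-suc x)) (solveℚ 2 (λ q c → (Κ 1ℚ :+ q) :* c := q :* c :+ c) refl (qn x) c)))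

 sum-≤-ext : ∀ {f} {x y} → x ℕ.≤ y → (∀ n → 0ℚ ≤ f n) → sum f x ≤ sum f y
 sum-≤-ext {f} {x} {y} h k = ≤-trans (≤-by _ refl (sum-nn (y ℕ.∸ x) (λ n _ _ → k (x ℕ.+ n))))
   (≤-reflexive (trans (sym (sum-split f x (y ℕ.∸ x))) (cong (sum f) (ℕP.m+[n∸m]≡n h))))

 sum-telescope : ∀ (g : ℕ → ℚ) x → sum (λ n → g n - g (suc n)) x ≡ g 1 - g (suc x)
 sum-telescope g zero = sym (+-inverseʳ (g 1))
 sum-telescope g (suc x) = trans (cong (_+ (g (suc x) - g (suc (suc x)))) (sum-telescope g x)) (solveℚ 3 (λ a b c → (a :- b) :+ (b :- c) := a :- c) refl (g 1) (g (suc x)) (g (suc (suc x))))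

 -- Summation by parts with the boundary weight taken at `suc x`, so that the formula already holds
 -- for the empty sum and every difference of `g` is a forward one.
 abel : ∀ (c g : ℕ → ℚ) x → sum (λ n → c n * g n) x ≡ sum c x * g (suc x) + sum (λ n → sum c n * (g n - g (suc n))) x
 abel c g zero = sym (trans (cong (_+ 0ℚ) (*-zeroˡ (g 1))) (+-identityʳ 0ℚ))
 abel c g (suc x) = trans (cong (_+ c (suc x) * g (suc x)) (abel c g x)) (solveℚ 5 (λ C c a b S → (C :* a :+ S) :+ c :* a := (C :+ c) :* b :+ (S :+ (C :+ c) :* (a :- b))) refl (sum c x) (c (suc x)) (g (suc x)) (g (suc (suc x))) (sum (λ n → sum c n * (g n - g (suc n))) x))

-- Differences of harmonic numbers as a logarithm

module HarmonicLog where
 open import Data.Rational using (ℚ; _+_; _*_; _-_; -_; 0ℚ; 1ℚ; _≤_)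
 open import Data.Rational.Properties
 open import Relation.Binary.PropositionalEquality
 open Rationals

 H : ℕ → ℚ
 H = sum iv

 block : ℕ → ℕ → ℚ
 block n k = sum (λ i → iv (n ℕ.* k ℕ.+ i)) n

 H-block : ∀ n k → H (n ℕ.* suc k) ≡ H (n ℕ.* k) + block n k
 H-block n k = trans (cong H (trans (ℕP.*-suc n k) (ℕP.+-comm n (n ℕ.* k)))) (sum-split iv (n ℕ.* k) n)

 n*iv : ∀ n k → 1 ℕ.≤ n → qn n * iv (n ℕ.* k) ≡ iv k
 n*iv n k h = trans (cong (qn n *_) (iv-* n k)) (trans (sym (*-assoc (qn n) (iv n) (iv k))) (trans (cong (_* iv k) (iv-inv' n h)) (*-identityˡ (iv k))))

 block-≥ : ∀ n k → 1 ℕ.≤ n → iv (suc k) ≤ block n k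
 block-≥ n k h = ≤-trans (≤-reflexive (sym (trans (sum-const (iv (n ℕ.* suc k)) n) (n*iv n (suc k) h))))
  (sum-mono n (λ i a b → iv-anti (ℕP.≤-trans a (ℕP.m≤n+m i (n ℕ.* k))) (subst (n ℕ.* k ℕ.+ i ℕ.≤_) (trans (ℕP.+-comm (n ℕ.* k) n) (sym (ℕP.*-suc n k))) (ℕP.+-monoʳ-≤ (n ℕ.* k) b))))

 block-≤ : ∀ n k → 1 ℕ.≤ n → 1 ℕ.≤ k → block n k ≤ iv k
 block-≤ n k h h' = ≤-trans
  (sum-mono n (λ i a b → iv-anti (ℕP.*-mono-≤ h h') (ℕP.m≤m+n (n ℕ.* k) i)))
  (≤-reflexive (trans (sum-const (iv (n ℕ.* k)) n) (n*iv n k h)))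

 D : ℕ → ℕ → ℚ
 D n k = H (n ℕ.* k) - H k

 D-step : ∀ n k → D n (suc k) ≡ D n k + (block n k - iv (suc k))
 D-step n k = trans (cong (_- H (suc k)) (H-block n k)) (solveℚ 4 (λ a b c d → (a :+ b) :- (c :+ d) := (a :- c) :+ (b :- d)) refl (H (n ℕ.* k)) (block n k) (H k) (iv (suc k)))

 -- Passing from k to k + 1 adds a block of n terms between 1/(n(k+1)) and 1/(nk) and removes
 -- 1/(k+1). Hence `D n k` increases with k while `D n k + 1/k` decreases, and beyond j the function
 -- `D n` varies by at most 1/j.
 D-mono : ∀ n j d → 1 ℕ.≤ n → 1 ℕ.≤ j → D n j ≤ D n (j ℕ.+ d) × D n (j ℕ.+ d) + iv (j ℕ.+ d) ≤ D n j + iv j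
 D-mono n j zero h h' rewrite ℕP.+-identityʳ j = ≤-refl , ≤-refl
 D-mono n j (suc d) h h' rewrite ℕP.+-suc j d with D-mono n j d h h'
 ... | p , q = ≤-trans p (≤-by _ (sym (D-step n (j ℕ.+ d))) (sub-nn (block-≥ n (j ℕ.+ d) h))) ,
   ≤-trans (≤-by (iv (j ℕ.+ d) - block n (j ℕ.+ d)) (trans (cong (λ z → z + iv (suc (j ℕ.+ d)) + (iv (j ℕ.+ d) - block n (j ℕ.+ d))) (D-step n (j ℕ.+ d))) (lem (D n (j ℕ.+ d)) (block n (j ℕ.+ d)) (iv (suc (j ℕ.+ d))) (iv (j ℕ.+ d))))
        (sub-nn (block-≤ n (j ℕ.+ d) h (ℕP.≤-trans h' (ℕP.m≤m+n j d))))) q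
  where
  lem = solveℚ 4 (λ D b i i' → (D :+ (b :- i)) :+ i :+ (i' :- b) := D :+ i') refl

 module Lg (X : ℕ) (X≥1 : 1 ℕ.≤ X) where

  L : ℕ → ℚ
  L n = H (n ℕ.* X) - H X

  L-1 : L 1 ≡ 0ℚ
  L-1 = trans (cong (λ z → H z - H X) (ℕP.*-identityˡ X)) (+-inverseʳ (H X))

  L-step : ∀ n → L (suc n) ≡ L n + block X n
  L-step n = trans (cong (_- H X) (trans (cong H (ℕP.*-comm (suc n) X)) (trans (H-block X n) (cong (λ z → H z + block X n) (ℕP.*-comm X n)))))
     (lem (H (n ℕ.* X)) (block X n) (H X))
    where
    lem = solveℚ 3 (λ a b c → (a :+ b) :- c := (a :- c) :+ b) refl

  L-step-≥ : ∀ n → L n + iv (suc n) ≤ L (suc n)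
  L-step-≥ n = ≤-trans (+-monoʳ-≤ (L n) (block-≥ X n X≥1)) (≤-reflexive (sym (L-step n)))

  L-step-≤ : ∀ n → 1 ℕ.≤ n → L (suc n) ≤ L n + iv n
  L-step-≤ n h = ≤-trans (≤-reflexive (L-step n)) (+-monoʳ-≤ (L n) (block-≤ X n X≥1 h))

  L-mono-step : ∀ n → L n ≤ L (suc n)
  L-mono-step n = ≤-trans (≤-by (iv (suc n)) refl (iv-nn (suc n))) (L-step-≥ n)

  L-mono : ∀ {m n} → m ℕ.≤ n → L m ≤ L n
  L-mono {m} {n} h = subst (λ z → L m ≤ L z) (ℕP.m+[n∸m]≡n h) (go (n ℕ.∸ m))
    where
    go : ∀ d → L m ≤ L (m ℕ.+ d)
    go zero = ≤-reflexive (cong L (sym (ℕP.+-identityʳ m)))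
    go (suc d) = ≤-trans (go d) (≤-trans (L-mono-step (m ℕ.+ d)) (≤-reflexive (cong L (sym (ℕP.+-suc m d)))))

  L-nn : ∀ n → 1 ℕ.≤ n → 0ℚ ≤ L n
  L-nn n h = subst (_≤ L n) L-1 (L-mono h)

  private
    mulD : ∀ m n → L (m ℕ.* n) - L m - L n ≡ D m (n ℕ.* X) - D m X
    mulD m n = trans (cong (λ z → (H z - H X) - L m - L n) (ℕP.*-assoc m n X))
       (lem (H (m ℕ.* (n ℕ.* X))) (H X) (H (m ℕ.* X)) (H (n ℕ.* X)))
      where
      lem = solveℚ 4 (λ a b c d → (a :- b) :- (c :- b) :- (d :- b) := (a :- d) :- (c :- b)) refl

    X+ : ∀ n → 1 ℕ.≤ n → X ℕ.+ (n ℕ.* X ℕ.∸ X) ≡ n ℕ.* X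
    X+ (suc n) h = cong (X ℕ.+_) (ℕP.m+n∸m≡n X (n ℕ.* X))

  -- The defect L(mn) - L(m) - L(n) equals `D m (nX) - D m X` by `mulD`; monotonicity puts it
  -- between 0 and 1/X. A large X therefore makes `L` as additive as desired.
  L-mul-≥ : ∀ m n → 1 ℕ.≤ m → 1 ℕ.≤ n → L m + L n ≤ L (m ℕ.* n)
  L-mul-≥ m n h h' = ≤-by (L (m ℕ.* n) - L m - L n) (lem (L (m ℕ.* n)) (L m) (L n))
      (subst (0ℚ ≤_) (sym (mulD m n)) (sub-nn (subst (λ z → D m X ≤ D m z) (X+ n h') (proj₁ (D-mono m X (n ℕ.* X ℕ.∸ X) h X≥1)))))
    where
    lem = solveℚ 3 (λ a b c → (b :+ c) :+ (a :- b :- c) := a) refl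

  L-mul-≤ : ∀ m n → 1 ℕ.≤ m → 1 ℕ.≤ n → L (m ℕ.* n) ≤ L m + L n + iv X
  L-mul-≤ m n h h' = ≤-by (iv X - (D m (n ℕ.* X) - D m X)) (trans (cong (λ z → L (m ℕ.* n) + (iv X - z)) (sym (mulD m n))) (lem (L (m ℕ.* n)) (L m) (L n) (iv X)))
      (subst (0ℚ ≤_) (lem2 (D m X) (D m (n ℕ.* X)) (iv X) (iv (n ℕ.* X))) (+-nn (sub-nn (subst (λ z → D m z + iv z ≤ D m X + iv X) (X+ n h') (proj₂ (D-mono m X (n ℕ.* X ℕ.∸ X) h X≥1)))) (iv-nn (n ℕ.* X))))
    where
    lem = solveℚ 4 (λ a b c i → a :+ (i :- (a :- b :- c)) := b :+ c :+ i) refl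
    lem2 = solveℚ 4 (λ d d' i i' → ((d :+ i) :- (d' :+ i')) :+ i' := i :- (d' :- d)) refl

  L-≤ : ∀ n → 1 ℕ.≤ n → L n + 1ℚ ≤ qn n
  L-≤ (suc zero) h = ≤-reflexive (trans (cong (_+ 1ℚ) L-1) (trans (+-identityˡ 1ℚ) (sym qz-1)))
  L-≤ (suc (suc n)) h = ≤-trans (+-monoˡ-≤ 1ℚ (≤-trans (L-step-≤ (suc n) (s≤s z≤n)) (+-monoʳ-≤ (L (suc n)) (≤-trans (iv-anti ℕP.≤-refl (s≤s z≤n)) (≤-reflexive iv-1)))))
     (≤-trans (≤-reflexive (lem (L (suc n)))) (≤-trans (+-monoʳ-≤ 1ℚ (L-≤ (suc n) (s≤s z≤n))) (≤-reflexive (sym (qn-suc (suc n))))))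
    where
    lem = solveℚ 1 (λ a → a :+ Κ 1ℚ :+ Κ 1ℚ := Κ 1ℚ :+ (a :+ Κ 1ℚ)) refl

  L-2 : iv 2 ≤ L 2
  L-2 = ≤-trans (≤-reflexive (sym (trans (cong (_+ iv 2) L-1) (+-identityˡ (iv 2))))) (L-step-≥ 1)

  L-2^ : ∀ k → qn k * iv 2 ≤ L (2 ℕ.^ k)
  L-2^ zero = ≤-reflexive (trans (cong (_* iv 2) qz-0) (trans (*-zeroˡ (iv 2)) (sym L-1)))
  L-2^ (suc k) = ≤-trans (≤-reflexive (trans (cong (_* iv 2) (qn-suc k)) (solveℚ 2 (λ a b → (Κ 1ℚ :+ a) :* b := b :+ a :* b) refl (qn k) (iv 2)))) (≤-trans (+-mono-≤ L-2 (L-2^ k)) (L-mul-≥ 2 (2 ℕ.^ k) (s≤s z≤n) (ℕP.m^n>0 2 k)))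

  L-4 : 1ℚ ≤ L 4
  L-4 = ≤-trans (≤-trans (num) (+-monoʳ-≤ (iv 2) (≤-refl {iv 4 + iv 4}))) (≤-trans (≤-reflexive (lem (iv 2) (iv 4)))
      (≤-trans (+-monoˡ-≤ (iv 4) (≤-trans (+-mono-≤ L-2 (iv-anti (s≤s z≤n) (ℕP.n≤1+n 3))) (L-step-≥ 2))) (L-step-≥ 3)))
    where
    lem = solveℚ 2 (λ a b → a :+ (b :+ b) := a :+ b :+ b) refl
    opaque
      unfolding iv
      num : 1ℚ ≤ iv 2 + (iv 4 + iv 4)
      num = Relation.Nullary.Decidable.from-yes (1ℚ ≤? iv 2 + (iv 4 + iv 4))
        where import Relation.Nullary.Decidable

  w : ℕ → ℚ
  w n = L n * iv n

  w-nn : ∀ n → 0ℚ ≤ w n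
  w-nn zero = ≤-reflexive (sym (trans (cong (L 0 *_) iv-0) (*-zeroʳ (L 0))))
  w-nn (suc n) = *-nn (L-nn (suc n) (s≤s z≤n)) (iv-nn (suc n))

  -- From L(n+1) ≤ L(n) + 1/n one gets n L(n+1) ≤ n L(n) + 1, which is at most (n+1) L(n) once L(n)
  -- ≥ 1. This holds from 4 on by `L-4`; the analogue log n / n decreases beyond e.
  w-decr : ∀ n → 4 ℕ.≤ n → w (suc n) ≤ w n
  w-decr n h = ≤iv n 1≤n (≤-trans (≤-reflexive (lem0 (qn n) (L (suc n)) (iv (suc n)))) (iv≤ (suc n) (s≤s z≤n)
     (≤-trans (*-monoˡ (qn n) (qn-nn n) (L-step-≤ n 1≤n)) (≤-trans (≤-reflexive (trans (lem1 (qn n) (L n) (iv n)) (cong (λ z → qn n * L n + z) (iv-inv' n 1≤n))))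
       (≤-trans (+-monoʳ-≤ (qn n * L n) (≤-trans L-4 (L-mono h))) (≤-reflexive (trans (lem2 (qn n) (L n)) (cong (_* L n) (sym (qn-suc n))))))))))
    where
    1≤n = ℕP.≤-trans (s≤s z≤n) h
    lem0 = solveℚ 3 (λ a b c → a :* (b :* c) := (a :* b) :* c) refl
    lem1 = solveℚ 3 (λ a b c → a :* (b :+ c) := a :* b :+ a :* c) refl
    lem2 = solveℚ 2 (λ a b → a :* b :+ b := (Κ 1ℚ :+ a) :* b) refl

  w-diff : ∀ n → 1 ℕ.≤ n → w n - w (suc n) ≤ L n * (iv n * iv (suc n))
  w-diff n h = ≤-trans (+-monoʳ-≤ (w n) (neg-antimono-≤ (*-monoʳ (iv (suc n)) (iv-nn (suc n)) (L-mono-step n))))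
     (≤-reflexive (trans (lem (L n) (iv n) (iv (suc n))) (cong (L n *_) (iv-diff n h))))
    where
    lem = solveℚ 3 (λ a b c → a :* b :- a :* c := a :* (b :- c)) refl

-- Integer square roots and a telescoping potential

module IntegerSqrt where
 open import Data.Rational using (ℚ; _+_; _*_; _-_; -_; 0ℚ; 1ℚ; _≤_)
 open import Data.Rational.Properties
 open import Relation.Binary.PropositionalEquality
 open Rationals

 next : ℕ → ℕ → ℕ
 next n r with suc r ℕ.* suc r ℕ.≤? suc n
 ... | yes _ = suc r
 ... | no _ = r

 -- Computed by unit steps, because partial summation needs exactly the dichotomy `isqrt-step`: the
 -- root is constant from n to n + 1 or n + 1 is the next square.
 isqrt : ℕ → ℕ
 isqrt zero = 0
 isqrt (suc n) = next n (isqrt n)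

 isqrt-spec : ∀ n → isqrt n ℕ.* isqrt n ℕ.≤ n × n ℕ.< suc (isqrt n) ℕ.* suc (isqrt n)
 isqrt-step : ∀ n → isqrt (suc n) ≡ isqrt n ⊎ (isqrt (suc n) ≡ suc (isqrt n) × suc n ≡ suc (isqrt n) ℕ.* suc (isqrt n))

 isqrt-spec zero = z≤n , s≤s z≤n
 isqrt-spec (suc n) with suc (isqrt n) ℕ.* suc (isqrt n) ℕ.≤? suc n
 ... | no ¬p = ℕP.≤-trans (proj₁ (isqrt-spec n)) (ℕP.n≤1+n n) , ℕP.≰⇒> ¬p
 ... | yes p = p , ℕP.≤-<-trans (proj₂ (isqrt-spec n)) (ℕP.*-mono-< (ℕP.n<1+n (suc (isqrt n))) (ℕP.n<1+n (suc (isqrt n))))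

 isqrt-step n with suc (isqrt n) ℕ.* suc (isqrt n) ℕ.≤? suc n
 ... | no ¬p = inj₁ refl
 ... | yes p = inj₂ (refl , ℕP.≤-antisym (proj₂ (isqrt-spec n)) p)

 sq-mono⁻¹ : ∀ {a b} → a ℕ.* a ℕ.< b ℕ.* b → a ℕ.< b
 sq-mono⁻¹ {a} {b} h with a ℕ.<? b
 ... | yes p = p
 ... | no q = ⊥-elim (ℕP.<⇒≱ h (ℕP.*-mono-≤ (ℕP.≮⇒≥ q) (ℕP.≮⇒≥ q)))

 isqrt-≥ : ∀ {a n} → a ℕ.* a ℕ.≤ n → a ℕ.≤ isqrt n
 isqrt-≥ {a} {n} h = ℕP.≤-pred (sq-mono⁻¹ (ℕP.≤-<-trans h (proj₂ (isqrt-spec n))))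

 isqrt-pos : ∀ n → 1 ℕ.≤ n → 1 ℕ.≤ isqrt n
 isqrt-pos n h = isqrt-≥ {1} h

 isqrt-mono : ∀ {m n} → m ℕ.≤ n → isqrt m ℕ.≤ isqrt n
 isqrt-mono {m} h = isqrt-≥ (ℕP.≤-trans (proj₁ (isqrt-spec m)) h)

 isqrt-≤ : ∀ n → isqrt n ℕ.≤ n
 isqrt-≤ zero = z≤n
 isqrt-≤ (suc n) = ℕP.≤-trans (ℕP.m≤m*n (isqrt (suc n)) (isqrt (suc n)) {{ℕ.>-nonZero (isqrt-pos (suc n) (s≤s z≤n))}}) (proj₁ (isqrt-spec (suc n)))

 rq : ℕ → ℚ
 rq n = qn (isqrt n)

 rq-nn : ∀ n → 0ℚ ≤ rq n
 rq-nn n = qn-nn (isqrt n)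

 -- A potential whose decrement dominates √n / (n (n + 1)); constant r makes the first summand exact, and 1 / r pays for the jumps of r.
 V : ℕ → ℚ
 V n = rq n * iv n + iv (isqrt n)

 V-nn : ∀ n → 0ℚ ≤ V n
 V-nn n = +-nn (*-nn (rq-nn n) (iv-nn n)) (iv-nn (isqrt n))

 V-step : ∀ n → 1 ℕ.≤ n → rq n * (iv n * iv (suc n)) ≤ V n - V (suc n)
 V-step n h with isqrt-step n
 ... | inj₁ e = ≤-reflexive (trans (cong (rq n *_) (sym (iv-diff n h))) (trans (solveℚ 4 (λ r a b c → r :* (a :- b) := (r :* a :+ c) :- (r :* b :+ c)) refl (rq n) (iv n) (iv (suc n)) (iv (isqrt n))) (cong (λ z → V n - (qn z * iv (suc n) + iv z)) (sym e))))
 ... | inj₂ (e , e2) = ≤-by (iv r * iv (suc r) - iv (suc r) * iv (suc r)) eq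
      (sub-nn (*-monoʳ (iv (suc r)) (iv-nn (suc r)) (iv-anti (isqrt-pos n h) (ℕP.n≤1+n r))))
  where
  r = isqrt n
  lem = solveℚ 5 (λ r a b c d → r :* (a :- b) :+ (c :- d :- b) := (r :* a :+ c) :- ((Κ 1ℚ :+ r) :* b :+ d)) refl
  eq : rq n * (iv n * iv (suc n)) + (iv r * iv (suc r) - iv (suc r) * iv (suc r)) ≡ V n - V (suc n)
  eq = trans (cong₂ _+_ (cong (rq n *_) (sym (iv-diff n h))) (cong₂ _-_ (sym (iv-diff r (isqrt-pos n h))) (trans (sym (iv-* (suc r) (suc r))) (cong iv (sym e2)))))
     (trans (lem (qn r) (iv n) (iv (suc n)) (iv r) (iv (suc r)))
       (trans (cong (λ z → (qn r * iv n + iv r) - (z * iv (suc n) + iv (suc r))) (sym (qn-suc r))) (cong (λ z → V n - (qn z * iv (suc n) + iv z)) (sym e))))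

 r*iv≤ : ∀ n → 1 ℕ.≤ n → rq n * iv n ≤ iv (isqrt n)
 r*iv≤ n h = iv≤ n h (subst (_≤ qn n * iv r) (trans (cong (_* iv r) (qn-* r r)) (trans (lem (qn r) (iv r)) (trans (cong (qn r *_) (iv-inv' r (isqrt-pos n h))) (*-identityʳ (qn r))))) (*-monoʳ (iv r) (iv-nn r) (qn-mono (proj₁ (isqrt-spec n)))))
  where
  r = isqrt n
  lem = solveℚ 2 (λ a b → (a :* a) :* b := a :* (a :* b)) refl

 V-≤ : ∀ n → 1 ℕ.≤ n → V n ≤ iv (isqrt n) + iv (isqrt n)
 V-≤ n h = +-monoˡ-≤ (iv (isqrt n)) (r*iv≤ n h)

 -- 1/r ≤ 4 r/n  since  n < (r+1)² ≤ 4 r²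
 ivr≤ : ∀ n → 1 ℕ.≤ n → iv (isqrt n) ≤ qn 4 * (rq n * iv n)
 ivr≤ n h = subst (iv r ≤_) (*-assoc (qn 4) (rq n) (iv n)) (≤iv n {iv r} {qn 4 * rq n} h
   (subst (qn n * iv r ≤_) (trans (cong (_* iv r) (trans (qn-* 4 (r ℕ.* r)) (cong (qn 4 *_) (qn-* r r)))) (trans (lem (qn 4) (qn r) (iv r)) (trans (cong (qn 4 * qn r *_) (iv-inv' r r≥1)) (*-identityʳ (qn 4 * qn r)))))
    (*-monoʳ (iv r) (iv-nn r) (qn-mono (ℕP.≤-trans (ℕP.<⇒≤ (proj₂ (isqrt-spec n))) 4r²)))))
  where
  r = isqrt n
  r≥1 = isqrt-pos n h
  lem = solveℚ 3 (λ f a b → (f :* (a :* a)) :* b := f :* a :* (a :* b)) refl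
  e = solveℕ 1 (λ r → Κ 4 :* (r :* r) := (r :+ r) :* (r :+ r)) refl
  4r² : suc r ℕ.* suc r ℕ.≤ 4 ℕ.* (r ℕ.* r)
  4r² = subst (suc r ℕ.* suc r ℕ.≤_) (sym (e r)) (ℕP.*-mono-≤ (ℕP.+-monoˡ-≤ r r≥1) (ℕP.+-monoˡ-≤ r r≥1))

-- Prime factors, valuations and sums over primes

module Valuations where
 open import Data.Nat.Divisibility
 open import Data.Nat.DivMod using (m≡m%n+[m/n]*n; m%n<n)
 open import Data.Nat.Primality.Factorisation using (factorise)
 open import Data.Nat.Induction using (<-wellFounded)
 open import Induction.WellFounded using (Acc; acc)
 open import Data.List using ([]; _∷_)
 open import Data.Nat.ListAction using (product)
 open import Data.List.Relation.Unary.All using (_∷_; [])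
 open import Data.Rational using (ℚ; _+_; _*_; _-_; -_; 0ℚ; 1ℚ; _≤_; ∣_∣)
 open import Data.Rational.Properties
 open import Relation.Binary.PropositionalEquality
 open Rationals

 p≥2 : ∀ {p} → Prime p → 2 ℕ.≤ p
 p≥2 {p} pp = ℕ.nonTrivial⇒n>1 p {{prime⇒nonTrivial pp}}

 p≥1 : ∀ {p} → Prime p → 1 ℕ.≤ p
 p≥1 pp = ℕP.≤-trans (s≤s z≤n) (p≥2 pp)

 prime-div : ∀ n → 2 ℕ.≤ n → ∃ λ p → Prime p × ∃ λ m → n ≡ p ℕ.* m × 1 ℕ.≤ m × m ℕ.< n
 prime-div (suc zero) (s≤s ())
 prime-div (suc (suc n)) _ with factorise (suc (suc n))
 ... | record { factors = []; isFactorisation = () ; factorsPrime = _ }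
 ... | record { factors = p ∷ ps; isFactorisation = eq ; factorsPrime = pp ∷ pps } =
  p , pp , _ , eq , productOfPrimes≥1 pps , subst (λ z → product ps ℕ.< z) (trans (ℕP.*-comm (product ps) p) (sym eq)) (ℕP.m<m*n (product ps) p {{productOfPrimes≢0 pps}} (p≥2 pp))

 prime∣prime : ∀ {p q} → Prime p → Prime q → p ∣ q → p ≡ q
 prime∣prime {p} {q} pp pq d with prime⇒irreducible pq d
 ... | inj₁ refl = ⊥-elim (¬prime[1] pp)
 ... | inj₂ e = e

 quo : ℕ → ℕ → ℕ
 quo zero x = 0
 quo (suc k) x = x ℕ./ suc k

 quo-spec : ∀ p x → 1 ℕ.≤ p → ∃ λ j → j ℕ.< p × x ≡ p ℕ.* quo p x ℕ.+ j
 quo-spec (suc k) x h = x ℕ.% suc k , m%n<n x (suc k) , trans (m≡m%n+[m/n]*n x (suc k)) (trans (ℕP.+-comm (x ℕ.% suc k) _) (cong (ℕ._+ x ℕ.% suc k) (ℕP.*-comm (x ℕ./ suc k) (suc k))))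

 quo-≤ : ∀ p x → 1 ℕ.≤ p → p ℕ.* quo p x ℕ.≤ x
 quo-≤ p x h with quo-spec p x h
 ... | j , _ , e = subst (p ℕ.* quo p x ℕ.≤_) (sym e) (ℕP.m≤m+n _ j)

 quo-> : ∀ p x → 1 ℕ.≤ p → x ℕ.< p ℕ.* suc (quo p x)
 quo-> p x h with quo-spec p x h
 ... | j , j<p , e = subst (ℕ._< p ℕ.* suc (quo p x)) (sym e) (subst (p ℕ.* quo p x ℕ.+ j ℕ.<_) (trans (ℕP.+-comm _ p) (sym (ℕP.*-suc p (quo p x)))) (ℕP.+-monoʳ-< (p ℕ.* quo p x) j<p))

 quo-< : ∀ p x → 2 ℕ.≤ p → 1 ℕ.≤ x → quo p x ℕ.< x
 quo-< p x h hx with quo p x | quo-≤ p x (ℕP.≤-trans (s≤s z≤n) h)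
 ... | zero | _ = hx
 ... | suc k | l = ℕP.<-≤-trans (subst (suc k ℕ.<_) (ℕP.*-comm (suc k) p) (ℕP.m<m*n (suc k) p h)) l

 quo-≥1 : ∀ p x → 1 ℕ.≤ p → p ℕ.≤ x → 1 ℕ.≤ quo p x
 quo-≥1 p x h hx with quo p x | quo-> p x h
 ... | zero | l = ⊥-elim (ℕP.<⇒≱ (subst (x ℕ.<_) (ℕP.*-identityʳ p) l) hx)
 ... | suc k | _ = s≤s z≤n

 ¬∣between : ∀ p q i → 1 ℕ.≤ i → i ℕ.< p → ¬ p ∣ (p ℕ.* q ℕ.+ i)
 ¬∣between p q i h k d = >⇒∤ {{ℕ.>-nonZero h}} k (∣m+n∣m⇒∣n d (m∣m*n q))

 sum-mult : ∀ p (G : ℕ → ℚ) → 1 ℕ.≤ p → (∀ n → ¬ p ∣ n → G n ≡ 0ℚ) → ∀ x → sum G x ≡ sum (λ m → G (p ℕ.* m)) (quo p x)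
 sum-mult p G h z x with quo-spec p x h
 ... | j , j<p , e = trans (cong (sum G) e) (trans (inner (quo p x) j j<p) (outer (quo p x)))
  where
  inner : ∀ q j → j ℕ.< p → sum G (p ℕ.* q ℕ.+ j) ≡ sum G (p ℕ.* q)
  inner q j j<p = trans (sum-split G (p ℕ.* q) j) (trans (cong (λ z → sum G (p ℕ.* q) + z) (sum-vanish j (λ i a b → z (p ℕ.* q ℕ.+ i) (¬∣between p q i a (ℕP.≤-<-trans b j<p))))) (+-identityʳ (sum G (p ℕ.* q))))
  outer : ∀ q → sum G (p ℕ.* q) ≡ sum (λ m → G (p ℕ.* m)) q
  outer zero = cong (sum G) (ℕP.*-zeroʳ p)
  outer (suc q) = trans (cong (sum G) eq) (cong₂ _+_ (trans (inner q (ℕ.pred p) (pr h)) (outer q)) (cong G (sym eq)))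
   where
   pr : ∀ {p} → 1 ℕ.≤ p → ℕ.pred p ℕ.< p
   pr (s≤s _) = ℕP.≤-refl
   sp : ∀ {p} → 1 ℕ.≤ p → suc (ℕ.pred p) ≡ p
   sp (s≤s _) = refl
   eq : p ℕ.* suc q ≡ suc (p ℕ.* q ℕ.+ ℕ.pred p)
   eq = trans (ℕP.*-suc p q) (trans (ℕP.+-comm p (p ℕ.* q)) (trans (cong (p ℕ.* q ℕ.+_) (sym (sp h))) (ℕP.+-suc (p ℕ.* q) (ℕ.pred p))))

 -- The middle argument is fuel. For n ≥ 1 the amount n suffices, since each division by p ≥ 2
 -- lowers the number, and `vf-eq` makes the value independent of any larger amount.
 vf : ℕ → ℕ → ℕ → ℕ
 vf p zero n = 0
 vf p (suc f) n with p ∣? n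
 ... | yes d = suc (vf p f (quotient d))
 ... | no _ = 0

 v : ℕ → ℕ → ℕ
 v p n = vf p n n

 *≥1⇒ : ∀ p {m n} → 1 ℕ.≤ n → n ≡ p ℕ.* m → 1 ℕ.≤ m
 *≥1⇒ p {zero} h e = ⊥-elim (ℕP.<⇒≱ h (ℕP.≤-reflexive (trans e (ℕP.*-zeroʳ p))))
 *≥1⇒ p {suc m} h e = s≤s z≤n

 vf-eq : ∀ p f g n → 2 ℕ.≤ p → 1 ℕ.≤ n → n ℕ.≤ f → n ℕ.≤ g → vf p f n ≡ vf p g n
 vf-eq p zero g n h a b c = ⊥-elim (ℕP.<⇒≱ a b)
 vf-eq p (suc f) zero n h a b c = ⊥-elim (ℕP.<⇒≱ a c)
 vf-eq p (suc f) (suc g) n h a b c with p ∣? n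
 ... | no _ = refl
 ... | yes d@(divides q e) = cong suc (vf-eq p f g q h q≥1 (ℕP.≤-pred (ℕP.<-≤-trans q<n b)) (ℕP.≤-pred (ℕP.<-≤-trans q<n c)))
  where
  q≥1 : 1 ℕ.≤ q
  q≥1 = *≥1⇒ p a (trans e (ℕP.*-comm q p))
  q<n : q ℕ.< n
  q<n = subst (q ℕ.<_) (sym e) (ℕP.m<m*n q p {{ℕ.>-nonZero q≥1}} h)

 v-nd : ∀ p n → ¬ p ∣ n → v p n ≡ 0
 v-nd p zero h = refl
 v-nd p (suc n) h with p ∣? suc n
 ... | yes d = ⊥-elim (h d)
 ... | no _ = refl

 v-mult : ∀ p m → 2 ℕ.≤ p → 1 ℕ.≤ m → v p (p ℕ.* m) ≡ suc (v p m)
 v-mult p m h hm = trans (vf-eq p (p ℕ.* m) (suc (p ℕ.* m)) (p ℕ.* m) h pm≥1 ℕP.≤-refl (ℕP.n≤1+n _)) step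
  where
  pm≥1 : 1 ℕ.≤ p ℕ.* m
  pm≥1 = ℕP.*-mono-≤ (ℕP.≤-trans (s≤s z≤n) h) hm
  step : vf p (suc (p ℕ.* m)) (p ℕ.* m) ≡ suc (v p m)
  step with p ∣? (p ℕ.* m)
  ... | no n = ⊥-elim (n (m∣m*n m))
  ... | yes (divides q e) = cong suc (trans (cong (vf p (p ℕ.* m)) q≡m) (vf-eq p (p ℕ.* m) m m h hm (ℕP.m≤n*m m p {{ℕ.>-nonZero (ℕP.≤-trans (s≤s z≤n) h)}}) ℕP.≤-refl))
   where
   q≡m : q ≡ m
   q≡m = ℕP.*-cancelʳ-≡ q m p {{ℕ.>-nonZero (ℕP.≤-trans (s≤s z≤n) h)}} (trans (sym e) (ℕP.*-comm p m))

 v-1 : ∀ p → 2 ℕ.≤ p → v p 1 ≡ 0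
 v-1 p h = v-nd p 1 (>⇒∤ h)

 -- Factors q are stripped from m one at a time; once none is left, Euclid's lemma shows that q does
 -- not divide pm either.
 v-other : ∀ {p q} m → Prime p → Prime q → q ≢ p → 1 ℕ.≤ m → v q (p ℕ.* m) ≡ v q m
 v-other {p} {q} m pp pq ne h = go m (<-wellFounded m) h
  where
  go : ∀ m → Acc ℕ._<_ m → 1 ℕ.≤ m → v q (p ℕ.* m) ≡ v q m
  go m (acc rs) h with q ∣? m
  ... | no nd = trans (v-nd q (p ℕ.* m) (λ d → lem (euclidsLemma p m pq d))) (sym (v-nd q m nd))
   where
   lem : (q ∣ p) ⊎ (q ∣ m) → ⊥
   lem (inj₁ d) = ne (prime∣prime pq pp d)
   lem (inj₂ d) = nd d
  ... | yes (divides k e) = trans (cong (v q) eq) (trans (v-mult q (p ℕ.* k) (p≥2 pq) (ℕP.*-mono-≤ (p≥1 pp) k≥1)) (trans (cong suc (go k (rs k<m) k≥1)) (trans (sym (v-mult q k (p≥2 pq) k≥1)) (cong (v q) (sym e')))))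
   where
   e' : m ≡ q ℕ.* k
   e' = trans e (ℕP.*-comm k q)
   k≥1 : 1 ℕ.≤ k
   k≥1 = *≥1⇒ q h e'
   k<m : k ℕ.< m
   k<m = subst (k ℕ.<_) (sym e) (ℕP.m<m*n k q {{ℕ.>-nonZero k≥1}} (p≥2 pq))
   eq : p ℕ.* m ≡ q ℕ.* (p ℕ.* k)
   eq = trans (cong (p ℕ.*_) e') (trans (sym (ℕP.*-assoc p q k)) (trans (cong (ℕ._* k) (ℕP.*-comm p q)) (ℕP.*-assoc q p k)))

 onP : (ℕ → ℚ) → ℕ → ℚ
 onP f p with prime? p
 ... | yes _ = f p
 ... | no _ = 0ℚ

 onP-yes : ∀ f {p} → Prime p → onP f p ≡ f p
 onP-yes f {p} pp with prime? p
 ... | yes _ = refl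
 ... | no n = ⊥-elim (n pp)

 onP-elim : ∀ f (Q : ℚ → Set) p → (Prime p → Q (f p)) → Q 0ℚ → Q (onP f p)
 onP-elim f Q p a b with prime? p
 ... | yes pp = a pp
 ... | no _ = b

 sumP : (ℕ → ℚ) → ℕ → ℚ
 sumP f = sum (onP f)

 onP-cong : ∀ {f g} p → (Prime p → f p ≡ g p) → onP f p ≡ onP g p
 onP-cong p h with prime? p
 ... | yes pp = h pp
 ... | no _ = refl

 onP-mono : ∀ {f g} p → (Prime p → f p ≤ g p) → onP f p ≤ onP g p
 onP-mono p h with prime? p
 ... | yes pp = h pp
 ... | no _ = ≤-refl

 onP-+ : ∀ f g p → onP (λ q → f q + g q) p ≡ onP f p + onP g p
 onP-+ f g p with prime? p
 ... | yes pp = refl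
 ... | no _ = sym (+-identityʳ 0ℚ)

 onP-- : ∀ f g p → onP (λ q → f q - g q) p ≡ onP f p - onP g p
 onP-- f g p with prime? p
 ... | yes pp = refl
 ... | no _ = sym (+-inverseʳ 0ℚ)

 onP-* : ∀ c f p → onP (λ q → c * f q) p ≡ c * onP f p
 onP-* c f p with prime? p
 ... | yes pp = refl
 ... | no _ = sym (*-zeroʳ c)

 sumP-cong : ∀ {f g} x → (∀ p → Prime p → p ℕ.≤ x → f p ≡ g p) → sumP f x ≡ sumP g x
 sumP-cong x h = sum-cong x (λ n _ b → onP-cong n (λ pp → h n pp b))

 sumP-mono : ∀ {f g} x → (∀ p → Prime p → p ℕ.≤ x → f p ≤ g p) → sumP f x ≤ sumP g x
 sumP-mono x h = sum-mono x (λ n _ b → onP-mono n (λ pp → h n pp b))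

 sumP-nn : ∀ {f} x → (∀ p → Prime p → p ℕ.≤ x → 0ℚ ≤ f p) → 0ℚ ≤ sumP f x
 sumP-nn {f} x h = sum-nn x (λ n _ b → onP-elim f (0ℚ ≤_) n (λ pp → h n pp b) ≤-refl)

 sumP-+ : ∀ f g x → sumP (λ q → f q + g q) x ≡ sumP f x + sumP g x
 sumP-+ f g x = trans (sum-cong x (λ n _ _ → onP-+ f g n)) (sum-+ (onP f) (onP g) x)

 sumP-- : ∀ f g x → sumP (λ q → f q - g q) x ≡ sumP f x - sumP g x
 sumP-- f g x = trans (sum-cong x (λ n _ _ → onP-- f g n)) (sum-- (onP f) (onP g) x)

 sumP-* : ∀ c f x → sumP (λ q → c * f q) x ≡ c * sumP f x
 sumP-* c f x = trans (sum-cong x (λ n _ _ → onP-* c f n)) (sum-*ˡ c (onP f) x)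

 sumP-abs≤ : ∀ {f g} x → (∀ p → Prime p → p ℕ.≤ x → ∣ f p ∣ ≤ g p) → ∣ sumP f x ∣ ≤ sumP g x
 sumP-abs≤ {f} {g} x h = sum-abs≤ x (λ n _ b → lem n (λ pp → h n pp b))
  where
  lem : ∀ n → (Prime n → ∣ f n ∣ ≤ g n) → ∣ onP f n ∣ ≤ onP g n
  lem n h with prime? n
  ... | yes pp = h pp
  ... | no _ = ≤-refl

 sumP≤sum : ∀ {f} x → (∀ n → 1 ℕ.≤ n → 0ℚ ≤ f n) → sumP f x ≤ sum f x
 sumP≤sum {f} x h = sum-mono x (λ n a _ → onP-elim f (_≤ f n) n (λ _ → ≤-refl) (h n a))

 sumP-swap : ∀ (f : ℕ → ℕ → ℚ) x y → sum (λ n → sumP (f n) y) x ≡ sumP (λ p → sum (λ n → f n p) x) y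
 sumP-swap f x y = trans (sum-swap (λ n p → onP (f n) p) x y) (sum-cong y (λ p _ _ → lem p))
  where
  lem : ∀ p → sum (λ n → onP (f n) p) x ≡ onP (λ p → sum (λ n → f n p) x) p
  lem p with prime? p
  ... | yes _ = refl
  ... | no _ = sum-0 x

 sum-delta : ∀ c p x → 1 ℕ.≤ p → p ℕ.≤ x → (d : ℕ → ℚ) → d p ≡ c → (∀ q → q ≢ p → d q ≡ 0ℚ) → sum d x ≡ c
 sum-delta c p zero h k d e z = ⊥-elim (ℕP.<⇒≱ h k)
 sum-delta c p (suc x) h k d e z with p ℕ.≟ suc x
 ... | yes refl = trans (cong (_+ d (suc x)) (sum-vanish x (λ n _ b → z n (λ { refl → ℕP.<⇒≱ ℕP.≤-refl b })))) (trans (+-identityˡ (d (suc x))) e)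
 ... | no ne = trans (cong₂ _+_ (sum-delta c p x h (ℕP.≤-pred (ℕP.≤∧≢⇒< k ne)) d e z) (z (suc x) (λ e → ne (sym e)))) (+-identityʳ c)

 module Additive (L : ℕ → ℚ) (x : ℕ) where

  -- `L` is additive only up to an error. `ℓ` has the same values at the primes up to x and is
  -- exactly additive on products of such primes, which allows rearrangement by prime factors.
  ℓ : ℕ → ℚ
  ℓ n = sumP (λ p → qn (v p n) * L p) x

  ℓ-1 : ℓ 1 ≡ 0ℚ
  ℓ-1 = trans (sumP-cong {_} {λ _ → 0ℚ} x (λ p pp _ → trans (cong (λ z → qn z * L p) (v-1 p (p≥2 pp))) (trans (cong (_* L p) qz-0) (*-zeroˡ (L p)))))
    (sum-vanish x (λ n _ _ → onP-elim (λ _ → 0ℚ) (_≡ 0ℚ) n (λ _ → refl) refl))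

  ℓ-pm : ∀ p m → Prime p → p ℕ.≤ x → 1 ℕ.≤ m → ℓ (p ℕ.* m) ≡ L p + ℓ m
  ℓ-pm p m pp p≤x h = trans (sum-cong x (λ q _ _ → lem q)) (trans (sum-+ d (onP (λ q → qn (v q m) * L q)) x) (cong (_+ ℓ m) (sum-delta (L p) p x (p≥1 pp) p≤x d d1 d2)))
   where
   d : ℕ → ℚ
   d q with q ℕ.≟ p
   ... | yes _ = L p
   ... | no _ = 0ℚ
   d1 : d p ≡ L p
   d1 with p ℕ.≟ p
   ... | yes _ = refl
   ... | no n = ⊥-elim (n refl)
   d2 : ∀ q → q ≢ p → d q ≡ 0ℚ
   d2 q ne with q ℕ.≟ p
   ... | yes e = ⊥-elim (ne e)
   ... | no n = refl
   rg = solveℚ 2 (λ a b → (Κ 1ℚ :+ a) :* b := b :+ a :* b) refl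
   lem : ∀ q → onP (λ q → qn (v q (p ℕ.* m)) * L q) q ≡ d q + onP (λ q → qn (v q m) * L q) q
   lem q with q ℕ.≟ p
   ... | yes refl = trans (onP-yes _ pp) (trans (cong (λ z → qn z * L p) (v-mult p m (p≥2 pp) h)) (trans (cong (_* L p) (qn-suc (v p m))) (trans (rg (qn (v p m)) (L p)) (cong (λ z → L p + z) (sym (onP-yes (λ q → qn (v q m) * L q) pp))))))
   ... | no ne = trans (onP-cong q (λ pq → cong (λ z → qn z * L q) (v-other m pp pq ne h))) (sym (+-identityˡ (onP (λ q → qn (v q m) * L q) q)))

  Smooth : ℕ → Set
  Smooth n = ∀ p → Prime p → p ∣ n → p ℕ.≤ x

  smooth-≤ : ∀ n → 1 ℕ.≤ n → n ℕ.≤ x → Smooth n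
  smooth-≤ n h k p pp d = ℕP.≤-trans (∣⇒≤ {{ℕ.>-nonZero h}} d) k

  smooth-ind : (Q : ℕ → Set) → Q 1 → (∀ p m → Prime p → p ℕ.≤ x → 1 ℕ.≤ m → Smooth m → Q m → Q (p ℕ.* m)) → ∀ n → 1 ℕ.≤ n → Smooth n → Q n
  smooth-ind Q q1 qs n h s = go n (<-wellFounded n) h s
   where
   go : ∀ n → Acc ℕ._<_ n → 1 ℕ.≤ n → Smooth n → Q n
   go n (acc rs) h s with 2 ℕ.≤? n
   ... | no k = subst Q (ℕP.≤-antisym h (ℕP.≤-pred (ℕP.≰⇒> k))) q1
   ... | yes k with prime-div n k
   ... | p , pp , m , e , m≥1 , m<n = subst Q (sym e) (qs p m pp (s p pp (subst (p ∣_) (sym e) (m∣m*n m))) m≥1 sm (go m (rs m<n) m≥1 sm))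
     where
     sm : Smooth m
     sm q pq d = s q pq (subst (q ∣_) (sym e) (∣n⇒∣m*n p d))

  ℓ-mul : ∀ n m → 1 ℕ.≤ n → Smooth n → 1 ℕ.≤ m → ℓ (n ℕ.* m) ≡ ℓ n + ℓ m
  ℓ-mul n m h s hm = smooth-ind (λ n → 1 ℕ.≤ n × ℓ (n ℕ.* m) ≡ ℓ n + ℓ m)
    (s≤s z≤n , trans (cong ℓ (ℕP.*-identityˡ m)) (sym (trans (cong (_+ ℓ m) ℓ-1) (+-identityˡ (ℓ m)))))
    (λ p k pp p≤x k≥1 _ (_ , ih) → ℕP.*-mono-≤ (p≥1 pp) k≥1 , trans (cong ℓ (ℕP.*-assoc p k m)) (trans (ℓ-pm p (k ℕ.* m) pp p≤x (ℕP.*-mono-≤ k≥1 hm)) (trans (cong (λ z → L p + z) ih) (trans (sym (+-assoc (L p) (ℓ k) (ℓ m))) (cong (_+ ℓ m) (sym (ℓ-pm p k pp p≤x k≥1)))))))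
    n h s .proj₂

-- Chebyshev's upper bound for the sum of L(p) over primes

module ChebyshevBound where
 open import Data.Nat using (_!)
 open import Data.Nat.Divisibility
 open import Data.Nat.Combinatorics using (k![n∸k]!∣n!)
 open import Data.Nat.Induction using (<-wellFounded)
 open import Induction.WellFounded using (Acc; acc)
 open import Data.Rational using (ℚ; _+_; _*_; _-_; -_; 0ℚ; 1ℚ; _≤_; ∣_∣)
 open import Data.Rational.Properties
 open import Relation.Binary.PropositionalEquality
 open Rationals
 open HarmonicLog
 open Valuations

 prime∣! : ∀ {p} n → Prime p → p ∣ n ! → p ℕ.≤ n
 prime∣! zero pp d = ⊥-elim (¬prime[1] (subst Prime (∣1⇒≡1 d) pp))
 prime∣! (suc n) pp d with euclidsLemma (suc n) (n !) pp d
 ... | inj₁ e = ∣⇒≤ e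
 ... | inj₂ e = ℕP.m≤n⇒m≤1+n (prime∣! n pp e)

 ∣!-≤ : ∀ p n → 1 ℕ.≤ p → p ℕ.≤ n → p ∣ n !
 ∣!-≤ p zero h k = ⊥-elim (ℕP.<⇒≱ h k)
 ∣!-≤ p (suc n) h k with p ℕ.≟ suc n
 ... | yes refl = m∣m*n (n !)
 ... | no ne = ∣n⇒∣m*n (suc n) (∣!-≤ p n h (ℕP.≤-pred (ℕP.≤∧≢⇒< k ne)))

 half : ∀ y → ∃ λ k → (y ≡ k ℕ.+ k) ⊎ (y ≡ suc (k ℕ.+ k))
 half zero = 0 , inj₁ refl
 half (suc y) with half y
 ... | k , inj₁ e = k , inj₂ (cong suc e)
 ... | k , inj₂ e = suc k , inj₁ (trans (cong suc e) (cong suc (sym (ℕP.+-suc k k))))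

 sum-even : ∀ f n → (∀ m → f m ≤ f (suc m)) → sum f (n ℕ.+ n) ≤ sum (λ k → f (k ℕ.+ k) + f (k ℕ.+ k)) n
 sum-even f zero h = ≤-refl
 sum-even f (suc n) h = subst (λ z → sum f z ≤ rhs) (sym (cong suc (ℕP.+-suc n n)))
   (≤-trans (≤-reflexive (+-assoc (sum f (n ℕ.+ n)) (f (suc (n ℕ.+ n))) (f (suc (suc (n ℕ.+ n))))))
    (+-mono-≤ (sum-even f n h) (subst (λ z → f (suc (n ℕ.+ n)) + f (suc (suc (n ℕ.+ n))) ≤ f z + f z) (sym (cong suc (ℕP.+-suc n n))) (+-monoˡ-≤ (f (suc (suc (n ℕ.+ n)))) (h (suc (n ℕ.+ n)))))))
  where
  rhs = sum (λ k → f (k ℕ.+ k) + f (k ℕ.+ k)) (suc n)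

 module Chebyshev (X : ℕ) (X≥1 : 1 ℕ.≤ X) where
  open Lg X X≥1

  module Approx (x : ℕ) where
    open Additive L x public

    ℓ-≤ : ∀ n → 1 ℕ.≤ n → Smooth n → ℓ n ≤ L n
    ℓ-≤ n h s = proj₂ (smooth-ind (λ n → 1 ℕ.≤ n × ℓ n ≤ L n) (s≤s z≤n , ≤-reflexive (trans ℓ-1 (sym L-1)))
     (λ p m pp p≤x hm sm (_ , ih) → ℕP.*-mono-≤ (p≥1 pp) hm , ≤-trans (≤-reflexive (ℓ-pm p m pp p≤x hm)) (≤-trans (+-monoʳ-≤ (L p) ih) (L-mul-≥ p m (p≥1 pp) hm)))
     n h s)

    -- Each prime factor that is split off costs 1/X by `L-mul-≤`, and m + 1 ≤ pm lets the bound n/X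
    -- absorb it. The crude count is harmless, because X will be at least x².
    ℓ-≥ : ∀ n → 1 ℕ.≤ n → Smooth n → L n ≤ ℓ n + qn n * iv X
    ℓ-≥ n h s = proj₂ (smooth-ind (λ n → 1 ℕ.≤ n × L n ≤ ℓ n + qn n * iv X)
      (s≤s z≤n , ≤-trans (≤-reflexive (trans L-1 (sym ℓ-1))) (≤-by (qn 1 * iv X) refl (*-nn (qn-nn 1) (iv-nn X))))
     (λ p m pp p≤x hm sm (_ , ih) → ℕP.*-mono-≤ (p≥1 pp) hm , ≤-trans (L-mul-≤ p m (p≥1 pp) hm) (≤-trans (+-monoˡ-≤ (iv X) (+-monoʳ-≤ (L p) ih))
       (≤-trans (≤-reflexive (trans (lem (L p) (ℓ m) (qn m) (iv X)) (cong₂ (λ a b → a + b * iv X) (sym (ℓ-pm p m pp p≤x hm)) (sym (qn-suc m)))))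
         (+-monoʳ-≤ (ℓ (p ℕ.* m)) (*-monoʳ (iv X) (iv-nn X) (qn-mono (sm≤ p m (p≥2 pp) hm)))))))
     n h s)
     where
     lem = solveℚ 4 (λ a b c d → a :+ (b :+ c :* d) :+ d := (a :+ b) :+ (Κ 1ℚ :+ c) :* d) refl
     sm≤ : ∀ p m → 2 ℕ.≤ p → 1 ℕ.≤ m → suc m ℕ.≤ p ℕ.* m
     sm≤ p m h k = subst (suc m ℕ.≤_) (ℕP.*-comm m p) (ℕP.m<m*n m p {{ℕ.>-nonZero k}} h)

    ℓ-! : ∀ n → n ℕ.≤ x → ℓ (n !) ≡ sum ℓ n
    ℓ-! zero h = ℓ-1
    ℓ-! (suc n) h = trans (ℓ-mul (suc n) (n !) (s≤s z≤n) (smooth-≤ (suc n) (s≤s z≤n) h) (ℕP.n≢0⇒n>0 (ℕ.≢-nonZero⁻¹ _ {{n ℕP.!≢0}}))) (trans (cong (λ z → ℓ (suc n) + z) (ℓ-! n (ℕP.<⇒≤ h))) (+-comm (ℓ (suc n)) (sum ℓ n)))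

  θ : ℕ → ℚ
  θ = sumP L

  -- `C` is the central binomial coefficient. Every prime in (n, 2n] divides it, and ℓ(C) = Σ ℓ(k)
  -- over k ≤ 2n minus twice the same sum over k ≤ n. Replacing ℓ by L in the first sum and pairing
  -- consecutive terms bounds it by Σ 2L(2k) over k ≤ n, and L(2k) ≤ ℓ(k) + 3 leaves 6n.
  dyadic : ∀ n → 1 ℕ.≤ n → n ℕ.≤ X → θ (n ℕ.+ n) ≤ θ n + qn 6 * qn n
  dyadic n h n≤X = ≤-trans (≤-reflexive (sum-split (onP L) n n)) (+-monoʳ-≤ (θ n) (≤-trans lower upper))
    where
    open Approx (n ℕ.+ n)
    d : n ! ℕ.* n ! ∣ (n ℕ.+ n) !
    d = subst (λ z → n ! ℕ.* z ! ∣ (n ℕ.+ n) !) (ℕP.m+n∸m≡n n n) (k![n∸k]!∣n! {n ℕ.+ n} {n} (ℕP.m≤m+n n n))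
    C = quotient d
    eq : (n ℕ.+ n) ! ≡ C ℕ.* (n ! ℕ.* n !)
    eq = _∣_.equality d
    !≥1 : ∀ m → 1 ℕ.≤ m !
    !≥1 m = ℕP.n≢0⇒n>0 (ℕ.≢-nonZero⁻¹ _ {{m ℕP.!≢0}})
    C≥1 : 1 ℕ.≤ C
    C≥1 = *≥1⇒ (n ! ℕ.* n !) (!≥1 (n ℕ.+ n)) (trans eq (ℕP.*-comm C _))
    smC : Smooth C
    smC p pp pd = prime∣! (n ℕ.+ n) pp (subst (p ∣_) (sym eq) (∣m⇒∣m*n (n ! ℕ.* n !) pd))
    sm! : Smooth (n !)
    sm! p pp pd = ℕP.≤-trans (prime∣! n pp pd) (ℕP.m≤m+n n n)
    p∣C : ∀ p → Prime p → n ℕ.< p → p ℕ.≤ n ℕ.+ n → p ∣ C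
    p∣C p pp a b with euclidsLemma C (n ! ℕ.* n !) pp (subst (p ∣_) eq (∣!-≤ p (n ℕ.+ n) (p≥1 pp) b))
    ... | inj₁ e = e
    ... | inj₂ e with euclidsLemma (n !) (n !) pp e
    ... | inj₁ e = ⊥-elim (ℕP.<⇒≱ a (prime∣! n pp e))
    ... | inj₂ e = ⊥-elim (ℕP.<⇒≱ a (prime∣! n pp e))
    f : ℕ → ℚ
    f p = qn (v p C) * L p
    f-nn : ∀ p → Prime p → 0ℚ ≤ f p
    f-nn p pp = *-nn (qn-nn (v p C)) (L-nn p (p≥1 pp))
    L≤f : ∀ p → Prime p → n ℕ.< p → p ℕ.≤ n ℕ.+ n → L p ≤ f p
    L≤f p pp a b with p∣C p pp a b
    ... | divides m e = ≤-trans (≤-reflexive (sym (trans (cong (_* L p) qz-1) (*-identityˡ (L p))))) (*-monoʳ (L p) (L-nn p (p≥1 pp)) (qn-mono v≥1))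
     where
     e' : C ≡ p ℕ.* m
     e' = trans e (ℕP.*-comm m p)
     v≥1 : 1 ℕ.≤ v p C
     v≥1 = subst (1 ℕ.≤_) (sym (trans (cong (v p) e') (v-mult p m (p≥2 pp) (*≥1⇒ p C≥1 e')))) (s≤s z≤n)
    lower : sum (λ i → onP L (n ℕ.+ i)) n ≤ ℓ C
    lower = ≤-trans (sum-mono n (λ i a b → onP-mono (n ℕ.+ i) (λ pp → L≤f (n ℕ.+ i) pp (subst (ℕ._≤ n ℕ.+ i) (ℕP.+-comm n 1) (ℕP.+-monoʳ-≤ n a)) (ℕP.+-monoʳ-≤ n b))))
     (≤-by (sum (onP f) n) (trans (+-comm _ (sum (onP f) n)) (sym (sum-split (onP f) n n))) (sumP-nn n (λ p pp _ → f-nn p pp)))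
    ivX≤1 : ∀ k → 1 ℕ.≤ k → k ℕ.≤ X → qn k * iv X ≤ 1ℚ
    ivX≤1 k a b = ≤-trans (*-monoʳ (iv X) (iv-nn X) (qn-mono b)) (≤-reflexive (iv-inv' X X≥1))
    L2≤1 : L 2 ≤ 1ℚ
    L2≤1 = ≤-trans (L-step-≤ 1 (s≤s z≤n)) (≤-reflexive (trans (cong₂ _+_ L-1 iv-1) (+-identityˡ 1ℚ)))
    term : ∀ k → 1 ℕ.≤ k → k ℕ.≤ n → L (k ℕ.+ k) ≤ ℓ k + qn 3
    term k a b = ≤-trans (≤-reflexive (cong L (cong (k ℕ.+_) (sym (ℕP.+-identityʳ k))))) (≤-trans (L-mul-≤ 2 k (s≤s z≤n) a)
     (≤-trans (+-mono-≤ (+-mono-≤ L2≤1 (≤-trans (ℓ-≥ k a (smooth-≤ k a (ℕP.≤-trans b (ℕP.m≤m+n n n)))) (+-monoʳ-≤ (ℓ k) (ivX≤1 k a (ℕP.≤-trans b n≤X)))))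
        (≤-trans (≤-reflexive (sym (trans (cong (_* iv X) qz-1) (*-identityˡ (iv X))))) (ivX≤1 1 (s≤s z≤n) X≥1)))
      (≤-reflexive (trans (lem (ℓ k)) (cong (λ z → ℓ k + z) (sym (trans (qn-+ 2 1) (cong₂ _+_ (trans (qn-+ 1 1) (cong₂ _+_ qz-1 qz-1)) qz-1))))))))
     where
     lem = solveℚ 1 (λ a → Κ 1ℚ :+ (a :+ Κ 1ℚ) :+ Κ 1ℚ := a :+ (Κ 1ℚ :+ Κ 1ℚ :+ Κ 1ℚ)) refl
    split : ℓ C + (sum ℓ n + sum ℓ n) ≡ sum ℓ (n ℕ.+ n)
    split = trans (cong (λ z → ℓ C + z) (cong₂ _+_ (sym (ℓ-! n (ℕP.m≤m+n n n))) (sym (ℓ-! n (ℕP.m≤m+n n n)))))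
     (trans (cong (λ z → ℓ C + z) (sym (ℓ-mul (n !) (n !) (!≥1 n) sm! (!≥1 n)))) (trans (sym (ℓ-mul C (n ! ℕ.* n !) C≥1 smC (ℕP.*-mono-≤ (!≥1 n) (!≥1 n)))) (trans (cong ℓ (sym eq)) (ℓ-! (n ℕ.+ n) ℕP.≤-refl))))
    big : ℓ C + (sum ℓ n + sum ℓ n) ≤ (sum ℓ n + qn n * qn 3) + (sum ℓ n + qn n * qn 3)
    big = ≤-trans (≤-reflexive split) (≤-trans (sum-mono (n ℕ.+ n) (λ k a b → ℓ-≤ k a (smooth-≤ k a b)))
     (≤-trans (sum-even L n L-mono-step) (≤-trans (sum-mono n (λ k a b → +-mono-≤ (term k a b) (term k a b))) (≤-reflexive (trans (sum-+ (λ k → ℓ k + qn 3) (λ k → ℓ k + qn 3) n) (cong₂ _+_ e1 e1))))))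
     where
     e1 : sum (λ k → ℓ k + qn 3) n ≡ sum ℓ n + qn n * qn 3
     e1 = trans (sum-+ ℓ (λ _ → qn 3) n) (cong (λ z → sum ℓ n + z) (sum-const (qn 3) n))
    upper : ℓ C ≤ qn 6 * qn n
    upper = ≤→ (subst (0ℚ ≤_) (trans (solveℚ 4 (λ c s n t → ((s :+ n :* t) :+ (s :+ n :* t)) :- (c :+ (s :+ s)) := (t :+ t) :* n :- c) refl (ℓ C) (sum ℓ n) (qn n) (qn 3)) (cong (λ z → z * qn n - ℓ C) (sym (qn-+ 3 3)))) (sub-nn big))

  -- With h the half of y rounded up, `dyadic` yields 18h + 6h = 24h, and 24h ≤ 18y amounts to 4h ≤
  -- 3y, which holds from y = 2 on.
  chebyshev : ∀ y → y ℕ.≤ X → θ y ≤ qn 18 * qn y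
  chebyshev y = go y (<-wellFounded y)
    where
    go : ∀ y → Acc ℕ._<_ y → y ℕ.≤ X → θ y ≤ qn 18 * qn y
    step : ∀ y h → Acc ℕ._<_ y → y ℕ.≤ X → 1 ℕ.≤ h → h ℕ.< y → y ℕ.≤ h ℕ.+ h → 4 ℕ.* h ℕ.≤ 3 ℕ.* y → θ y ≤ qn 18 * qn y
    step y h (acc rs) y≤X h≥1 h<y y≤2h k = ≤-trans (sum-≤-ext y≤2h (λ n → onP-elim L (0ℚ ≤_) n (λ pp → L-nn n (p≥1 pp)) ≤-refl))
     (≤-trans (dyadic h h≥1 (ℕP.≤-trans (ℕP.<⇒≤ h<y) y≤X)) (≤-trans (+-monoˡ-≤ (qn 6 * qn h) (go h (rs h<y) (ℕP.≤-trans (ℕP.<⇒≤ h<y) y≤X)))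
      (≤-trans (≤-reflexive (trans (cong₂ _+_ (sym (qn-* 18 h)) (sym (qn-* 6 h))) (trans (sym (qn-+ (18 ℕ.* h) (6 ℕ.* h))) refl)))
        (≤-trans (qn-mono (subst₂ ℕ._≤_ (l1 h) (l2 y) (ℕP.*-monoʳ-≤ 6 k))) (≤-reflexive (qn-* 18 y))))))
     where
     l1 = solveℕ 1 (λ h → Κ 6 :* (Κ 4 :* h) := Κ 18 :* h :+ Κ 6 :* h) refl
     l2 = solveℕ 1 (λ h → Κ 6 :* (Κ 3 :* h) := Κ 18 :* h) refl
    triv : ∀ y → θ y ≡ 0ℚ → θ y ≤ qn 18 * qn y
    triv y e = ≤-trans (≤-reflexive e) (*-nn (qn-nn 18) (qn-nn y))
    go y a y≤X with half y
    ... | zero , inj₁ refl = triv 0 refl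
    ... | zero , inj₂ refl = triv 1 refl
    ... | suc k , inj₁ refl = step (suc k ℕ.+ suc k) (suc k) a y≤X (s≤s z≤n) (ℕP.m<m+n (suc k) (s≤s z≤n)) ℕP.≤-refl
       (subst (4 ℕ.* suc k ℕ.≤_) (l k) (ℕP.m≤m+n (4 ℕ.* suc k) (suc k ℕ.+ suc k)))
     where
     l = solveℕ 1 (λ k → Κ 4 :* (Κ 1 :+ k) :+ ((Κ 1 :+ k) :+ (Κ 1 :+ k)) := Κ 3 :* ((Κ 1 :+ k) :+ (Κ 1 :+ k))) refl
    ... | suc k , inj₂ refl = step (suc (suc k ℕ.+ suc k)) (suc (suc k)) a y≤X (s≤s z≤n) (s≤s (ℕP.m<m+n (suc k) (s≤s z≤n))) (ℕP.≤-trans (ℕP.n≤1+n _) (ℕP.≤-reflexive (sym (cong suc (ℕP.+-suc (suc k) (suc k))))))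
       (subst (4 ℕ.* suc (suc k) ℕ.≤_) (l k) (ℕP.m≤m+n (4 ℕ.* suc (suc k)) (k ℕ.+ suc k)))
     where
     l = solveℕ 1 (λ k → Κ 4 :* (Κ 1 :+ ((Κ 1 :+ k))) :+ (k :+ (Κ 1 :+ k)) := Κ 3 :* (Κ 1 :+ ((Κ 1 :+ k) :+ (Κ 1 :+ k)))) refl

-- Hecke series, and convergent sums of L(p) over primes

module Mertens where
 open import Data.Nat.Divisibility using (divides; m∣m*n; ∣m+n∣m⇒∣n) renaming (_∣_ to _∣ℕ_; _∣?_ to _∣ℕ?_)
 open import Data.Rational using (ℚ; _+_; _*_; _-_; -_; 0ℚ; 1ℚ; _≤_; ∣_∣)
 open import Data.Rational.Properties
 open import Relation.Binary.PropositionalEquality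
 open Rationals
 open HarmonicLog
 open IntegerSqrt
 open Valuations
 open ChebyshevBound

 -- What the Mertens argument uses of a series Σ c(n)/n: formally an Euler factor 1/(1 - κ(p)T +
 -- e(p)T²) with T = p^(-s), and partial sums of order √y. At p = 2 a value |κ| = 2 would make |κ|/p
 -- + 1/p² exceed 1 and spoil the contraction in `Z-ind`; hence the sharper bound at 2 and 3.
 record Hecke : Set where
  field
   c κ e : ℕ → ℚ
   κ≤ : ∀ p → ∣ κ p ∣ ≤ qn 2
   e≤ : ∀ p → ∣ e p ∣ ≤ 1ℚ
   κ≤-small : ∀ p → p ℕ.≤ 3 → ∣ κ p ∣ ≤ 1ℚ
   hecke : ∀ p m → Prime p → 1 ℕ.≤ m → ¬ p ∣ℕ m → c (p ℕ.* m) ≡ κ p * c m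
   hecke∣ : ∀ p m → Prime p → 1 ℕ.≤ m → c (p ℕ.* (p ℕ.* m)) ≡ κ p * c (p ℕ.* m) - e p * c m
   K : ℚ
   C≤ : ∀ y → ∣ sum c y ∣ ≤ K * rq y

 module _ where
  V-decr : ∀ n → 1 ℕ.≤ n → V (suc n) ≤ V n
  V-decr n h = ≤→ (≤-trans (*-nn (rq-nn n) (*-nn (iv-nn n) (iv-nn (suc n)))) (V-step n h))

  iv≤2iv : ∀ n → 1 ℕ.≤ n → iv n ≤ qn 2 * iv (suc n)
  iv≤2iv n h = ≤iv (suc n) (s≤s z≤n) (iv≤≡ (qn-mono (subst (suc n ℕ.≤_) (cong (n ℕ.+_) (sym (ℕP.+-identityʳ n))) (ℕP.+-monoˡ-≤ n h))))
   where
   iv≤≡ : qn (suc n) ≤ qn (2 ℕ.* n) → qn (suc n) * iv n ≤ qn 2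
   iv≤≡ k = ≤-trans (*-monoʳ (iv n) (iv-nn n) k) (≤-reflexive (trans (cong (_* iv n) (qn-* 2 n)) (trans (*-assoc (qn 2) (qn n) (iv n)) (trans (cong (qn 2 *_) (iv-inv' n h)) (*-identityʳ (qn 2))))))

  rq-sq : ∀ n → 1 ℕ.≤ n → rq n * (iv n * iv n) ≤ qn 2 * (V n - V (suc n))
  rq-sq n h = ≤-trans (*-monoˡ (rq n) (rq-nn n) (*-monoˡ (iv n) (iv-nn n) (iv≤2iv n h)))
    (≤-trans (≤-reflexive (lem (rq n) (iv n) (qn 2) (iv (suc n)))) (*-monoˡ (qn 2) (qn-nn 2) (V-step n h)))
   where
   lem = solveℚ 4 (λ r a t b → r :* (a :* (t :* b)) := t :* (r :* (a :* b))) refl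

  V-1 : V 1 ≡ qn 2
  V-1 = trans (cong₂ _+_ (trans (cong₂ _*_ qz-1 iv-1) (*-identityˡ 1ℚ)) iv-1) (sym (trans (qn-+ 1 1) (cong₂ _+_ qz-1 qz-1)))

 module Scale (X : ℕ) (X≥1 : 1 ℕ.≤ X) where
  open Lg X X≥1 public
  open Chebyshev X X≥1 public

  -- With r the integer root, n < (r+1)² gives L(n) ≤ 2L(r+1) + 1, and L(r+1) ≤ r by `L-≤`.
  L-r : ∀ n → 1 ℕ.≤ n → L n ≤ qn 3 * rq n
  L-r n h = ≤-trans (L-mono (ℕP.<⇒≤ (proj₂ (isqrt-spec n)))) (≤-trans (L-mul-≤ (suc r) (suc r) (s≤s z≤n) (s≤s z≤n))
    (≤-trans (+-mono-≤ (+-mono-≤ l l) (≤-trans (iv-anti (s≤s z≤n) X≥1) (≤-reflexive iv-1)))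
       (≤-trans (+-monoʳ-≤ (rq n + rq n) (≤-trans (≤-reflexive (sym qz-1)) (qn-mono (isqrt-pos n h)))) (≤-reflexive (trans (lem (rq n)) (cong (_* rq n) (sym (trans (qn-+ 2 1) (cong₂ _+_ (trans (qn-+ 1 1) (cong₂ _+_ qz-1 qz-1)) qz-1)))))))))
   where
   r = isqrt n
   l : L (suc r) ≤ rq n
   l = ≤→ (subst (0ℚ ≤_) (trans (cong (λ z → z - (L (suc r) + 1ℚ)) (qn-suc r)) (solveℚ 2 (λ a b → (Κ 1ℚ :+ a) :- (b :+ Κ 1ℚ) := a :- b) refl (qn r) (L (suc r)))) (sub-nn (L-≤ (suc r) (s≤s z≤n))))
   lem = solveℚ 1 (λ a → a :+ a :+ a := (Κ 1ℚ :+ Κ 1ℚ :+ Κ 1ℚ) :* a) refl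

  L≥0 : ∀ {p} → Prime p → 0ℚ ≤ L p
  L≥0 pp = L-nn _ (p≥1 pp)

  sumLpp : ∀ x → sumP (λ p → L p * (iv p * iv p)) x ≤ qn 12
  sumLpp x = ≤-trans (sumP≤sum x (λ n h → *-nn (L-nn n h) (*-nn (iv-nn n) (iv-nn n)))) (≤-trans (sum-mono x (λ n h _ →
      ≤-trans (*-monoʳ (iv n * iv n) (*-nn (iv-nn n) (iv-nn n)) (L-r n h)) (≤-trans (≤-reflexive (*-assoc (qn 3) (rq n) (iv n * iv n))) (≤-trans (*-monoˡ (qn 3) (qn-nn 3) (rq-sq n h)) (≤-reflexive (trans (sym (*-assoc (qn 3) (qn 2) (V n - V (suc n)))) (cong (_* (V n - V (suc n))) (sym (qn-* 3 2)))))))))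
    (≤-trans (≤-reflexive (trans (sum-*ˡ (qn 6) (λ n → V n - V (suc n)) x) (cong (qn 6 *_) (sum-telescope V x)))) (≤-trans (*-monoˡ (qn 6) (qn-nn 6) (≤-by (V (suc x)) (lem (V 1) (V (suc x))) (V-nn (suc x)))) (≤-reflexive (trans (cong (qn 6 *_) V-1) (sym (qn-* 6 2)))))))
   where
   lem = solveℚ 2 (λ a b → a :- b :+ b := a) refl

  -- Σ (L(n) + 1) (V(n) - V(n+1)) converges, by partial summation
  private
   F : ℕ → ℚ
   F = sum (λ n → (L n + 1ℚ) * (V n - V (suc n)))

   Viv : ∀ n → 1 ℕ.≤ n → iv n * V n ≤ qn 32 * (V n - V (suc n))
   Viv n h = ≤-trans (*-monoˡ (iv n) (iv-nn n) (≤-trans (V-≤ n h) (+-mono-≤ (ivr≤ n h) (ivr≤ n h))))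
     (≤-trans (≤-reflexive (trans (lem (iv n) (qn 4) (rq n)) (cong (_* (rq n * (iv n * iv n))) (trans (sym (qn-+ 4 4)) refl)))) (≤-trans (*-monoˡ (qn 8) (qn-nn 8) (rq-sq n h)) (≤-trans (≤-reflexive (trans (sym (*-assoc (qn 8) (qn 2) (V n - V (suc n)))) (cong (_* (V n - V (suc n))) (sym (qn-* 8 2))))) (*-monoʳ (V n - V (suc n)) (sub-nn (V-decr n h)) (qn-mono (ℕP.m≤m+n 16 16))))))
     where
     lem = solveℚ 3 (λ i f r → i :* (f :* (r :* i) :+ f :* (r :* i)) := (f :+ f) :* (r :* (i :* i))) refl

   -- The boundary term (L + 1)V is carried along on the left. It grows by at most V(n)/n in a step,
   -- which `Viv` bounds by a multiple of the decrement of V, so the right side telescopes.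
   Fclaim : ∀ x → F x + (L (suc x) + 1ℚ) * V (suc x) ≤ V 1 + qn 32 * (V 1 - V (suc x))
   Fclaim zero = ≤-reflexive (trans (cong (λ z → 0ℚ + (z + 1ℚ) * V 1) L-1) (solveℚ 2 (λ a b → Κ 0ℚ :+ (Κ 0ℚ :+ Κ 1ℚ) :* a := a :+ b :* (a :- a)) refl (V 1) (qn 32)))
   Fclaim (suc x) = ≤-trans (+-monoʳ-≤ (F (suc x)) (*-monoʳ (V (suc (suc x))) (V-nn (suc (suc x))) (+-monoˡ-≤ 1ℚ (L-step-≤ (suc x) (s≤s z≤n)))))
     (≤-trans (≤-reflexive (lem (F x) (L (suc x)) (V (suc x)) (V (suc (suc x))) (iv (suc x)))) (≤-trans (+-mono-≤ (Fclaim x) (≤-trans (*-monoˡ (iv (suc x)) (iv-nn (suc x)) (V-decr (suc x) (s≤s z≤n))) (Viv (suc x) (s≤s z≤n)))) (≤-reflexive (lem2 (V 1) (qn 32) (V (suc x)) (V (suc (suc x)))))))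
     where
     lem = solveℚ 5 (λ F l a b i → (F :+ (l :+ Κ 1ℚ) :* (a :- b)) :+ (l :+ i :+ Κ 1ℚ) :* b := (F :+ (l :+ Κ 1ℚ) :* a) :+ i :* b) refl
     lem2 = solveℚ 4 (λ a t b c → (a :+ t :* (a :- b)) :+ t :* (b :- c) := a :+ t :* (a :- c)) refl

  sumLV : ∀ x → sum (λ n → (L n + 1ℚ) * (V n - V (suc n))) x ≤ qn 66
  sumLV x = ≤-trans (≤-by ((L (suc x) + 1ℚ) * V (suc x)) refl (*-nn (+-nn (L-nn (suc x) (s≤s z≤n)) 0≤1) (V-nn (suc x)))) (≤-trans (Fclaim x)
    (≤-trans (+-monoʳ-≤ (V 1) (*-monoˡ (qn 32) (qn-nn 32) (≤-by (V (suc x)) (lem (V 1) (V (suc x))) (V-nn (suc x))))) (≤-reflexive (trans (cong (λ z → z + qn 32 * z) V-1) (trans (cong (λ z → qn 2 + z) (sym (qn-* 32 2))) (trans (sym (qn-+ 2 64)) refl))))))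
   where
   lem = solveℚ 2 (λ a b → a :- b :+ b := a) refl

  w-diff-abs : ∀ n → 1 ℕ.≤ n → ∣ w n - w (suc n) ∣ ≤ (L n + 1ℚ) * (iv n * iv (suc n))
  w-diff-abs n h = abs≤ (≤-trans (w-diff n h) (≤-by P (lem (L n) P) P≥0))
   (≤-trans (≤-reflexive (lem3 (w n) (w (suc n)))) (≤-trans (+-monoˡ-≤ (- w n) (*-monoʳ (iv (suc n)) (iv-nn (suc n)) (L-step-≤ n h)))
     (≤-trans (≤-reflexive (trans (lem2 (L n) (iv n) (iv (suc n))) (cong (λ z → P - L n * z) (iv-diff n h))))
       (≤-by (L n * P + L n * P) (lem4 (L n) P) (+-nn lP lP)))))
   where
   P = iv n * iv (suc n)
   P≥0 : 0ℚ ≤ P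
   P≥0 = *-nn (iv-nn n) (iv-nn (suc n))
   lP : 0ℚ ≤ L n * P
   lP = *-nn (L-nn n h) P≥0
   lem = solveℚ 2 (λ l a → l :* a :+ a := (l :+ Κ 1ℚ) :* a) refl
   lem2 = solveℚ 3 (λ l a b → (l :+ a) :* b :- l :* a := a :* b :- l :* (a :- b)) refl
   lem3 = solveℚ 2 (λ a b → :- (a :- b) := b :- a) refl
   lem4 = solveℚ 2 (λ l a → (a :- l :* a) :+ (l :* a :+ l :* a) := (l :+ Κ 1ℚ) :* a) refl

  -- Chebyshev by partial summation: Σ_{p ≤ x} L(p)/√p = O(√x)
  private
   g : ℕ → ℚ
   g n = iv (isqrt n)

   r-suc : ∀ n → isqrt (suc n) ℕ.≤ suc (isqrt n)
   r-suc n with isqrt-step n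
   ... | inj₁ e = ℕP.≤-trans (ℕP.≤-reflexive e) (ℕP.n≤1+n _)
   ... | inj₂ (e , _) = ℕP.≤-reflexive e

   2r : ∀ n → 1 ℕ.≤ n → suc (isqrt n) ℕ.≤ 2 ℕ.* isqrt n
   2r n h = subst (suc (isqrt n) ℕ.≤_) (cong (isqrt n ℕ.+_) (sym (ℕP.+-identityʳ (isqrt n)))) (ℕP.+-monoˡ-≤ (isqrt n) (isqrt-pos n h))

   -- The weight `g` changes only where the integer root jumps from r to r + 1. There n < (r+1)² ≤
   -- 2r(r+1), so Chebyshev's bound 18n gives θ(n)/(r(r+1)) ≤ 36, and each jump contributes at most
   -- 36.
   jumps : ∀ x → x ℕ.≤ X → sum (λ n → θ n * (g n - g (suc n))) x ≤ qn 36 * rq (suc x)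
   jumps zero _ = *-nn (qn-nn 36) (rq-nn 1)
   jumps (suc x) h with isqrt-step (suc x) | jumps x (ℕP.<⇒≤ h)
   ... | inj₁ e | ih = ≤-trans (+-mono-≤ ih (≤-reflexive (trans (cong (λ z → θ (suc x) * (g (suc x) - iv z)) e) (lem (θ (suc x)) (g (suc x))))))
       (≤-reflexive (trans (+-identityʳ (qn 36 * rq (suc x))) (cong (λ z → qn 36 * qn z) (sym e))))
     where
     lem = solveℚ 2 (λ a b → a :* (b :- b) := Κ 0ℚ) refl
   ... | inj₂ (e , e2) | ih = ≤-trans (+-mono-≤ ih (≤-trans (≤-reflexive (cong (θ (suc x) *_) (trans (cong (λ z → g (suc x) - iv z) e) (iv-diff r r≥1)))) t))
       (≤-reflexive (trans (lem2 (qn 36) (qn r)) (cong (qn 36 *_) (trans (sym (qn-suc r)) (cong qn (sym e))))))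
     where
     r = isqrt (suc x)
     r≥1 = isqrt-pos (suc x) (s≤s z≤n)
     lem2 = solveℚ 2 (λ a b → a :* b :+ a := a :* (Κ 1ℚ :+ b)) refl
     lem3 = solveℚ 3 (λ a b c → (a :* b) :* c := a :* c :* b) refl
     x≤ : 18 ℕ.* suc x ℕ.≤ 36 ℕ.* (r ℕ.* suc r)
     x≤ = ℕP.≤-trans (ℕP.*-monoʳ-≤ 18 (ℕP.≤-trans (ℕP.<⇒≤ (proj₂ (isqrt-spec (suc x)))) (ℕP.*-monoˡ-≤ (suc r) (2r (suc x) (s≤s z≤n))))) (ℕP.≤-reflexive (solveℕ 1 (λ r → Κ 18 :* (Κ 2 :* r :* (Κ 1 :+ r)) := Κ 36 :* (r :* (Κ 1 :+ r))) refl r))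
     t : θ (suc x) * (iv r * iv (suc r)) ≤ qn 36
     t = subst (λ z → θ (suc x) * z ≤ qn 36) (iv-* r (suc r)) (iv≤ (r ℕ.* suc r) {qn 36} {θ (suc x)} (ℕP.*-mono-≤ r≥1 (s≤s z≤n))
          (≤-trans (chebyshev (suc x) h) (≤-trans (≤-reflexive (sym (qn-* 18 (suc x)))) (≤-trans (qn-mono x≤) (≤-reflexive (trans (qn-* 36 (r ℕ.* suc r)) (*-comm (qn 36) (qn (r ℕ.* suc r)))))))))

  sumL√ : ∀ x → 1 ℕ.≤ x → x ℕ.≤ X → sumP (λ p → L p * g p) x ≤ qn 216 * rq x
  sumL√ x hx h = ≤-trans (≤-reflexive (trans (sum-cong x (λ n _ _ → lem0 n)) (abel (onP L) g x))) (≤-trans (+-mono-≤ bd (jumps x h))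
    (≤-trans (≤-reflexive (trans (sym (*-distribʳ-+ (rq (suc x)) (qn 72) (qn 36))) (cong (_* rq (suc x)) (sym (qn-+ 72 36)))))
      (≤-trans (*-monoˡ (qn 108) (qn-nn 108) (qn-mono (ℕP.≤-trans (r-suc x) (2r x hx)))) (≤-reflexive (trans (cong (qn 108 *_) (qn-* 2 (isqrt x))) (trans (sym (*-assoc (qn 108) (qn 2) (rq x))) (cong (_* rq x) (sym (qn-* 108 2)))))))))
   where
   lem0 : ∀ n → onP (λ p → L p * g p) n ≡ onP L n * g n
   lem0 n with prime? n
   ... | yes _ = refl
   ... | no _ = sym (*-zeroˡ (g n))
   r = isqrt (suc x)
   l1 = solveℕ 1 (λ r → Κ 18 :* (Κ 2 :* r :* (Κ 2 :* r)) := r :* (Κ 72 :* r)) refl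
   bd : θ x * g (suc x) ≤ qn 72 * rq (suc x)
   bd = iv≤ r {qn 72 * rq (suc x)} {θ x} (isqrt-pos (suc x) (s≤s z≤n)) (≤-trans (chebyshev x h) (≤-trans (≤-reflexive (sym (qn-* 18 x))) (≤-trans (qn-mono
      (ℕP.≤-trans (ℕP.*-monoʳ-≤ 18 (ℕP.≤-trans (ℕP.n≤1+n x) (ℕP.≤-trans (ℕP.<⇒≤ (proj₂ (isqrt-spec (suc x)))) (ℕP.*-mono-≤ (2r (suc x) (s≤s z≤n)) (2r (suc x) (s≤s z≤n)))))) (ℕP.≤-reflexive (l1 r))))
        (≤-reflexive (trans (qn-* r (72 ℕ.* r)) (cong (qn r *_) (qn-* 72 r)))))))

  private
   rr≤ : ∀ x p → 1 ℕ.≤ p → p ℕ.≤ x → isqrt x ℕ.* isqrt p ℕ.≤ 3 ℕ.* (p ℕ.* isqrt (quo p x))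
   rr≤ x p h k = ℕP.<⇒≤ (sq-mono⁻¹ (ℕP.<-≤-trans (ℕP.≤-<-trans (ℕP.≤-reflexive (l1 (isqrt x) (isqrt p))) s1) s2))
     where
     q = quo p x
     ρ = isqrt q
     q≥1 : 1 ℕ.≤ q
     q≥1 = quo-≥1 p x h k
     l1 = solveℕ 2 (λ a b → (a :* b) :* (a :* b) := (a :* a) :* (b :* b)) refl
     s1 : (isqrt x ℕ.* isqrt x) ℕ.* (isqrt p ℕ.* isqrt p) ℕ.< (p ℕ.* suc q) ℕ.* p
     s1 = ℕP.≤-<-trans (ℕP.*-mono-≤ (proj₁ (isqrt-spec x)) (proj₁ (isqrt-spec p))) (ℕP.*-monoˡ-< p {{ℕ.>-nonZero h}} (quo-> p x h))
     sq≤ : suc q ℕ.≤ (2 ℕ.* ρ) ℕ.* (2 ℕ.* ρ)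
     sq≤ = ℕP.≤-trans (proj₂ (isqrt-spec q)) (ℕP.*-mono-≤ (2r q q≥1) (2r q q≥1))
     l2 = solveℕ 2 (λ p r → (p :* ((Κ 2 :* r) :* (Κ 2 :* r))) :* p :+ Κ 5 :* ((p :* r) :* (p :* r)) := (Κ 3 :* (p :* r)) :* (Κ 3 :* (p :* r))) refl
     s2 : (p ℕ.* suc q) ℕ.* p ℕ.≤ (3 ℕ.* (p ℕ.* ρ)) ℕ.* (3 ℕ.* (p ℕ.* ρ))
     s2 = ℕP.≤-trans (ℕP.*-monoˡ-≤ p (ℕP.*-monoʳ-≤ p sq≤)) (ℕP.≤-trans (ℕP.m≤m+n _ _) (ℕP.≤-reflexive (l2 p ρ)))

  -- This is the error made later when S(x/p) is replaced by S(x). By `rr≤`, 1/(p√(x/p)) is at most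
  -- 3/(√x√p), which reduces the sum to `sumL√` and gives 648 = 3 · 216.
  sumL√/ : ∀ x → 1 ℕ.≤ x → x ℕ.≤ X → sumP (λ p → L p * (iv p * iv (isqrt (quo p x)))) x ≤ qn 648
  sumL√/ x hx h = ≤-trans (sumP-mono x (λ p pp p≤x → t p pp p≤x)) (≤-trans (≤-reflexive (sumP-* (qn 3 * g x) (λ p → L p * g p) x))
    (≤-trans (*-monoˡ (qn 3 * g x) (*-nn (qn-nn 3) (iv-nn (isqrt x))) (sumL√ x hx h)) (≤-reflexive (trans (lem (qn 3) (g x) (qn 216) (rq x)) (trans (cong (λ z → qn 3 * qn 216 * z) (iv-inv' (isqrt x) (isqrt-pos x hx))) (trans (*-identityʳ (qn 3 * qn 216)) (sym (qn-* 3 216))))))))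
   where
   lem = solveℚ 4 (λ a b c d → a :* b :* (c :* d) := a :* c :* (d :* b)) refl
   lem2 = solveℚ 4 (λ l a b c → l :* (a :* (b :* c)) := a :* b :* (l :* c)) refl
   t : ∀ p → Prime p → p ℕ.≤ x → L p * (iv p * iv (isqrt (quo p x))) ≤ qn 3 * g x * (L p * g p)
   t p pp p≤x = ≤-trans (*-monoˡ (L p) (L≥0 pp) (subst₂ _≤_ (iv-* p ρ) (cong (qn 3 *_) (iv-* (isqrt x) (isqrt p))) k)) (≤-reflexive (lem2 (L p) (qn 3) (g x) (g p)))
     where
     ρ = isqrt (quo p x)
     ρ≥1 = isqrt-pos (quo p x) (quo-≥1 p x (p≥1 pp) p≤x)
     k : iv (p ℕ.* ρ) ≤ qn 3 * iv (isqrt x ℕ.* isqrt p)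
     k = ≤iv (isqrt x ℕ.* isqrt p) {iv (p ℕ.* ρ)} {qn 3} (ℕP.*-mono-≤ (isqrt-pos x hx) (isqrt-pos p (p≥1 pp)))
         (iv≤ (p ℕ.* ρ) {qn 3} {qn (isqrt x ℕ.* isqrt p)} (ℕP.*-mono-≤ (p≥1 pp) ρ≥1) (≤-trans (qn-mono (rr≤ x p (p≥1 pp) p≤x)) (≤-reflexive (trans (qn-* 3 (p ℕ.* ρ)) (*-comm (qn 3) (qn (p ℕ.* ρ)))))))

-- Mertens' theorem for a Hecke series with L(1) bounded below

module MertensSeries where
 open import Data.Nat.Divisibility using (divides; m∣m*n) renaming (_∣_ to _∣ℕ_; _∣?_ to _∣ℕ?_)
 open import Data.Nat.Induction using (<-wellFounded)
 open import Induction.WellFounded using (Acc; acc)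
 open import Data.Rational using (ℚ; _+_; _*_; _-_; -_; 0ℚ; 1ℚ; _≤_; ∣_∣)
 open import Data.Rational.Properties
 open import Relation.Binary.PropositionalEquality
 open Rationals
 open IntegerSqrt
 open Valuations
 open Mertens

 private
  #4 : ∀ {n} → Expr ℚ n
  #4 = Κ 1ℚ :+ Κ 1ℚ :+ (Κ 1ℚ :+ Κ 1ℚ)
  #3 : ∀ {n} → Expr ℚ n
  #3 = Κ 1ℚ :+ Κ 1ℚ :+ Κ 1ℚ
  #2 : ∀ {n} → Expr ℚ n
  #2 = Κ 1ℚ :+ Κ 1ℚ

 module Main (Hk : Hecke) where
  open Hecke Hk

  C S E : ℕ → ℚ
  C = sum c
  S = sum (λ n → c n * iv n)
  E = sum (λ n → C n * (iv n - iv (suc n)))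

  K≥0 : 0ℚ ≤ K
  K≥0 = ≤-trans (0≤∣p∣ (C 1)) (≤-trans (C≤ 1) (≤-reflexive (trans (cong (K *_) qz-1) (*-identityʳ K))))

  S-abel : ∀ y → S y ≡ C y * iv (suc y) + E y
  S-abel = abel c iv

  Civ : ∀ x y → 1 ℕ.≤ x → x ℕ.≤ y → ∣ C y * iv (suc y) ∣ ≤ K * iv (isqrt x)
  Civ x y h k = ≤-trans (abs-*≤ (C≤ y) (nn→abs (iv-nn (suc y)) (iv-anti y≥1 (ℕP.n≤1+n y)))) (≤-trans (≤-reflexive (*-assoc K (rq y) (iv y)))
    (*-monoˡ K K≥0 (≤-trans (r*iv≤ y y≥1) (iv-anti (isqrt-pos x h) (isqrt-mono k)))))
   where y≥1 = ℕP.≤-trans h k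

  -- Partial summation produces two boundary terms of size K/√x and the sum of K√n/(n(n+1)), which
  -- telescopes through `V` to at most 2K/√x.
  tail : ∀ x d → 1 ℕ.≤ x → ∣ S (x ℕ.+ d) - S x ∣ ≤ qn 4 * K * iv (isqrt x)
  tail x d h = ≤-trans (≤-reflexive (cong ∣_∣ eq)) (≤-trans (abs-+≤ {C y * iv (suc y) - C x * iv (suc x)} {E y - E x} (abs--≤ (Civ x y h (ℕP.m≤m+n x d)) (Civ x x h ℕP.≤-refl)) Ebd)
     (≤-reflexive (trans (lem2 K (iv (isqrt x))) (cong (λ z → z * K * iv (isqrt x)) (sym four)))))
   where
   y = x ℕ.+ d
   four : qn 4 ≡ (1ℚ + 1ℚ) + (1ℚ + 1ℚ)
   four = trans (qn-+ 2 2) (cong₂ _+_ (trans (qn-+ 1 1) (cong₂ _+_ qz-1 qz-1)) (trans (qn-+ 1 1) (cong₂ _+_ qz-1 qz-1)))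
   lem = solveℚ 4 (λ a b c d → a :+ b :- (c :+ d) := a :- c :+ (b :- d)) refl
   lem2 = solveℚ 2 (λ k i → k :* i :+ k :* i :+ k :* (i :+ i) := #4 :* k :* i) refl
   lem3 = solveℚ 2 (λ a b → a :+ b :- a := b) refl
   eq : S y - S x ≡ (C y * iv (suc y) - C x * iv (suc x)) + (E y - E x)
   eq = trans (cong₂ _-_ (S-abel y) (S-abel x)) (lem (C y * iv (suc y)) (E y) (C x * iv (suc x)) (E x))
   f : ℕ → ℚ
   f i = C (x ℕ.+ i) * (iv (x ℕ.+ i) - iv (suc (x ℕ.+ i)))
   Ed : E y - E x ≡ sum f d
   Ed = trans (cong (_- E x) (sum-split (λ n → C n * (iv n - iv (suc n))) x d)) (lem3 (E x) (sum f d))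
   Ebd : ∣ E y - E x ∣ ≤ K * (iv (isqrt x) + iv (isqrt x))
   Ebd = ≤-trans (≤-reflexive (cong ∣_∣ Ed)) (≤-trans (sum-abs≤ {f} {λ i → K * (V (x ℕ.+ i) - V (x ℕ.+ suc i))} d (λ i a b → t i))
      (≤-trans (≤-reflexive (trans (sum-*ˡ K (λ i → V (x ℕ.+ i) - V (x ℕ.+ suc i)) d) (cong (K *_) (sum-telescope (λ i → V (x ℕ.+ i)) d))))
        (*-monoˡ K K≥0 (≤-trans (≤-by (V (x ℕ.+ suc d)) (lem4 (V (x ℕ.+ 1)) (V (x ℕ.+ suc d))) (V-nn (x ℕ.+ suc d))) (≤-trans (≤-reflexive (cong V (ℕP.+-comm x 1))) (≤-trans (V-decr x h) (V-≤ x h)))))))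
     where
     lem4 = solveℚ 2 (λ a b → a :- b :+ b := a) refl
     t : ∀ i → ∣ f i ∣ ≤ K * (V (x ℕ.+ i) - V (x ℕ.+ suc i))
     t i = ≤-trans (abs-*≤ {C n} {iv n - iv (suc n)} (C≤ n) (nn→abs (sub-nn (iv-anti n≥1 (ℕP.n≤1+n n))) (≤-reflexive (iv-diff n n≥1)))) (≤-trans (≤-reflexive (*-assoc K (rq n) (iv n * iv (suc n))))
            (*-monoˡ K K≥0 (≤-trans (V-step n n≥1) (≤-reflexive (cong (λ z → V n - V z) (sym (ℕP.+-suc x i)))))))
       where
       n = x ℕ.+ i
       n≥1 = ℕP.≤-trans h (ℕP.m≤m+n x i)

  tail≤ : ∀ x y → 1 ℕ.≤ x → x ℕ.≤ y → ∣ S y - S x ∣ ≤ qn 4 * K * iv (isqrt x)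
  tail≤ x y h k = subst (λ z → ∣ S z - S x ∣ ≤ qn 4 * K * iv (isqrt x)) (ℕP.m+[n∸m]≡n k) (tail x (y ℕ.∸ x) h)

  B : ℚ
  B = qn 5 * K

  B≥0 : 0ℚ ≤ B
  B≥0 = *-nn (qn-nn 5) K≥0

  S≤B : ∀ y → ∣ S y ∣ ≤ B
  S≤B zero = B≥0
  S≤B (suc d) = ≤-trans (≤-reflexive (cong ∣_∣ (sym (lem (S 1) (S (suc d)))))) (≤-trans (abs-+≤ {S 1} {S (suc d) - S 1} S1 (tail 1 d (s≤s z≤n)))
     (≤-reflexive (trans (cong (λ z → K + qn 4 * K * z) iv-1) (trans (lem2 K (qn 4)) (cong (_* K) (sym (qn-suc 4)))))))
   where
   lem = solveℚ 2 (λ a b → a :+ (b :- a) := b) refl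
   lem2 = solveℚ 2 (λ k f → k :+ f :* k :* Κ 1ℚ := (Κ 1ℚ :+ f) :* k) refl
   S1 : ∣ S 1 ∣ ≤ K
   S1 = ≤-trans (≤-reflexive (cong (λ z → ∣ 0ℚ + z ∣) (trans (cong (c 1 *_) iv-1) (*-identityʳ (c 1))))) (≤-trans (C≤ 1) (≤-reflexive (trans (cong (K *_) qz-1) (*-identityʳ K))))

  -- Z p y = Σ_{n ≤ y} c(n) v_p(n) / n satisfies a contracting recursion in y
  Z : ℕ → ℕ → ℚ
  Z p = sum (λ n → c n * qn (v p n) * iv n)

  c̃ : ℕ → ℕ → ℚ
  c̃ p m with p ∣ℕ? m
  ... | yes (divides q _) = c q
  ... | no _ = 0ℚ

  c̃-nd : ∀ p m → ¬ p ∣ℕ m → c̃ p m ≡ 0ℚ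
  c̃-nd p m h with p ∣ℕ? m
  ... | yes d = ⊥-elim (h d)
  ... | no _ = refl

  c̃-mult : ∀ p m → 1 ℕ.≤ p → c̃ p (p ℕ.* m) ≡ c m
  c̃-mult p m h with p ∣ℕ? (p ℕ.* m)
  ... | yes (divides q e) = cong c (ℕP.*-cancelʳ-≡ q m p {{ℕ.>-nonZero h}} (trans (sym e) (ℕP.*-comm p m)))
  ... | no n = ⊥-elim (n (m∣m*n m))

  c-pm : ∀ p m → Prime p → 1 ℕ.≤ m → c (p ℕ.* m) ≡ κ p * c m - e p * c̃ p m
  c-pm p m pp h with p ∣ℕ? m
  ... | no nd = trans (hecke p m pp h nd) (solveℚ 2 (λ a b → a := a :- b :* Κ 0ℚ) refl (κ p * c m) (e p))
  ... | yes (divides q e') = trans (cong (λ z → c (p ℕ.* z)) e'') (trans (hecke∣ p q pp (*≥1⇒ p h e'')) (cong (λ z → κ p * c z - e p * c q) (sym e'')))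
   where
   e'' : m ≡ p ℕ.* q
   e'' = trans e' (ℕP.*-comm q p)

  -- Only the multiples n = pm contribute, with v(pm) = 1 + v(m). In the term with e, m itself must
  -- be a multiple of p, so the valuation is at least 2; this accounts for the coefficient of the
  -- second S.
  Z-rec : ∀ p y → Prime p → Z p y ≡ iv p * (κ p * (S (quo p y) + Z p (quo p y))) - iv p * iv p * (e p * (qn 2 * S (quo p (quo p y)) + Z p (quo p (quo p y))))
  Z-rec p y pp = trans (sum-mult p G (p≥1 pp) (λ n nd → trans (cong (λ z → c n * qn z * iv n) (v-nd p n nd)) (z0 (c n) (iv n))) y) (trans (sum-cong y' step)
    (trans (sum-- (λ m → iv p * (κ p * (c m * iv m + c m * qn (v p m) * iv m))) (λ m → iv p * (e p * G2 m)) y') (cong₂ _-_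
       (trans (sum-*ˡ (iv p) (λ m → κ p * (c m * iv m + c m * qn (v p m) * iv m)) y') (cong (iv p *_) (trans (sum-*ˡ (κ p) (λ m → c m * iv m + c m * qn (v p m) * iv m) y') (cong (κ p *_) (sum-+ (λ m → c m * iv m) (λ m → c m * qn (v p m) * iv m) y')))))
       (trans (sum-*ˡ (iv p) (λ m → e p * G2 m) y') (trans (cong (iv p *_) (sum-*ˡ (e p) G2 y')) (trans (cong (λ z → iv p * (e p * z)) second) (fin (iv p) (e p) (qn 2 * S y'' + Z p y''))))))))
   where
   y' = quo p y
   y'' = quo p y'
   G : ℕ → ℚ
   G n = c n * qn (v p n) * iv n
   G2 : ℕ → ℚ
   G2 m = c̃ p m * (1ℚ + qn (v p m)) * iv m
   fin = solveℚ 3 (λ i e x → i :* (e :* (i :* x)) := i :* i :* (e :* x)) refl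
   z0 : ∀ a b → a * qn 0 * b ≡ 0ℚ
   z0 a b = trans (cong (λ z → a * z * b) qz-0) (solveℚ 2 (λ a b → a :* Κ 0ℚ :* b := Κ 0ℚ) refl a b)
   lem = solveℚ 7 (λ k c e t v p m → (k :* c :- e :* t) :* (Κ 1ℚ :+ v) :* (p :* m) := p :* (k :* (c :* m :+ c :* v :* m)) :- p :* (e :* (t :* (Κ 1ℚ :+ v) :* m))) refl
   step : ∀ m → 1 ℕ.≤ m → m ℕ.≤ y' → G (p ℕ.* m) ≡ iv p * (κ p * (c m * iv m + c m * qn (v p m) * iv m)) - iv p * (e p * G2 m)
   step m h _ = trans (cong₂ _*_ (cong₂ _*_ (c-pm p m pp h) (trans (cong qn (v-mult p m (p≥2 pp) h)) (qn-suc (v p m)))) (iv-* p m)) (lem (κ p) (c m) (e p) (c̃ p m) (qn (v p m)) (iv p) (iv m))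
   zero* : ∀ {a} b d → a ≡ 0ℚ → a * b * d ≡ 0ℚ
   zero* b d refl = solveℚ 2 (λ b d → Κ 0ℚ :* b :* d := Κ 0ℚ) refl b d
   lem2 = solveℚ 4 (λ c v p m → c :* (Κ 1ℚ :+ (Κ 1ℚ :+ v)) :* (p :* m) := p :* (#2 :* (c :* m) :+ c :* v :* m)) refl
   second : sum G2 y' ≡ iv p * (qn 2 * S y'' + Z p y'')
   second = trans (sum-mult p G2 (p≥1 pp) (λ n nd → zero* (1ℚ + qn (v p n)) (iv n) (c̃-nd p n nd)) y') (trans (sum-cong y'' step2)
       (trans (sum-*ˡ (iv p) (λ m → qn 2 * (c m * iv m) + c m * qn (v p m) * iv m) y'') (cong (iv p *_) (trans (sum-+ (λ m → qn 2 * (c m * iv m)) (λ m → c m * qn (v p m) * iv m) y'') (cong (_+ Z p y'') (sum-*ˡ (qn 2) (λ m → c m * iv m) y''))))))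
     where
     step2 : ∀ m → 1 ℕ.≤ m → m ℕ.≤ y'' → G2 (p ℕ.* m) ≡ iv p * (qn 2 * (c m * iv m) + c m * qn (v p m) * iv m)
     step2 m h _ = trans (cong₂ _*_ (cong₂ _*_ (c̃-mult p m (p≥1 pp)) (cong (λ z → 1ℚ + z) (trans (cong qn (v-mult p m (p≥2 pp) h)) (qn-suc (v p m))))) (iv-* p m))
        (trans (lem2 (c m) (qn (v p m)) (iv p) (iv m)) (cong (λ z → iv p * (z * (c m * iv m) + c m * qn (v p m) * iv m)) (sym (trans (qn-+ 1 1) (cong₂ _+_ qz-1 qz-1)))))

  Z-ind : ∀ p → Prime p → (A k : ℚ) → 0ℚ ≤ A → ∣ κ p ∣ ≤ k → iv p * (k * (B + A)) + iv p * iv p * (1ℚ * (qn 2 * B + A)) ≤ A → ∀ y → ∣ Z p y ∣ ≤ A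
  Z-ind p pp A k hA hk ineq y = go y (<-wellFounded y)
   where
   go : ∀ y → Acc ℕ._<_ y → ∣ Z p y ∣ ≤ A
   go zero _ = hA
   go (suc y) (acc rs) = ≤-trans (≤-reflexive (cong ∣_∣ (Z-rec p (suc y) pp))) (≤-trans
       (abs--≤ (abs-*≤ (nn→abs (iv-nn p) ≤-refl) (abs-*≤ {κ p} {S y' + Z p y'} hk (abs-+≤ (S≤B y') (go y' (rs y'<)))))
          (abs-*≤ (nn→abs (*-nn (iv-nn p) (iv-nn p)) ≤-refl) (abs-*≤ {e p} {qn 2 * S y'' + Z p y''} (e≤ p) (abs-+≤ {qn 2 * S y''} {Z p y''} (abs-*≤ {qn 2} {S y''} (nn→abs (qn-nn 2) ≤-refl) (S≤B y'')) (go y'' (rs y''<)))))) ineq)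
     where
     y' = quo p (suc y)
     y'' = quo p y'
     y'< : y' ℕ.< suc y
     y'< = quo-< p (suc y) (p≥2 pp) (s≤s z≤n)
     y''< : y'' ℕ.< suc y
     y''< = ℕP.≤-<-trans (ℕP.≤-trans (ℕP.m≤n*m y'' p {{ℕ.>-nonZero (p≥1 pp)}}) (quo-≤ p y' (p≥1 pp))) y'<

  two : qn 2 ≡ 1ℚ + 1ℚ
  two = trans (qn-+ 1 1) (cong₂ _+_ qz-1 qz-1)

  iv-n≤1 : ∀ n p → 1 ℕ.≤ n → n ℕ.≤ p → qn n * iv p ≤ 1ℚ
  iv-n≤1 n p h k = ≤-trans (*-monoˡ (qn n) (qn-nn n) (iv-anti h k)) (≤-reflexive (iv-inv' n h))

  three : qn 3 ≡ 1ℚ + 1ℚ + 1ℚ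
  three = trans (qn-+ 2 1) (cong₂ _+_ two qz-1)
  four : qn 4 ≡ 1ℚ + 1ℚ + (1ℚ + 1ℚ)
  four = trans (qn-+ 2 2) (cong₂ _+_ two two)

  -- The constant 4 is exact at p = 2, where 5/2 + 6/4 = 4. In general 4 - 5u - 6u² = (1 - 2u)(4 +
  -- 3u) with u = 1/p ≤ 1/2.
  Z-small : ∀ p → Prime p → p ℕ.≤ 3 → ∀ y → ∣ Z p y ∣ ≤ qn 4 * B
  Z-small p pp h = Z-ind p pp (qn 4 * B) 1ℚ (*-nn (qn-nn 4) B≥0) (κ≤-small p h)
    (≤-by (B * ((1ℚ - qn 2 * u) * (qn 4 + qn 3 * u))) eq (*-nn B≥0 (*-nn (sub-nn (iv-n≤1 2 p (s≤s z≤n) (p≥2 pp))) (+-nn (qn-nn 4) (*-nn (qn-nn 3) (iv-nn p))))))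
   where
   u = iv p
   T = 1ℚ + 1ℚ
   lem = solveℚ 2 (λ u B → u :* (Κ 1ℚ :* (B :+ #4 :* B)) :+ u :* u :* (Κ 1ℚ :* (#2 :* B :+ #4 :* B)) :+ B :* ((Κ 1ℚ :- #2 :* u) :* (#4 :+ #3 :* u)) := #4 :* B) refl
   eq : (u * (1ℚ * (B + qn 4 * B)) + u * u * (1ℚ * (qn 2 * B + qn 4 * B))) + B * ((1ℚ - qn 2 * u) * (qn 4 + qn 3 * u)) ≡ qn 4 * B
   eq rewrite two | three | four = lem u B

  -- Now κ may reach 2, and the bound must decay like 1/p. The recursion asks for 2 + 14u + 6u² ≤ 6
  -- with u = 1/p, which holds for u ≤ 1/4.
  Z-large : ∀ p → Prime p → 4 ℕ.≤ p → ∀ y → ∣ Z p y ∣ ≤ qn 6 * (B * iv p)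
  Z-large p pp h = Z-ind p pp (qn 6 * (B * iv p)) (qn 2) (*-nn (qn-nn 6) (*-nn B≥0 (iv-nn p))) (κ≤ p)
    (≤-by (B * u * ((1ℚ - qn 4 * u) * (qn 4 + qn 2 * u) + qn 2 * (u * u))) eq (*-nn (*-nn B≥0 (iv-nn p)) (+-nn (*-nn (sub-nn (iv-n≤1 4 p (s≤s z≤n) h)) (+-nn (qn-nn 4) (*-nn (qn-nn 2) (iv-nn p)))) (*-nn (qn-nn 2) (*-nn (iv-nn p) (iv-nn p))))))
   where
   u = iv p
   six : qn 6 ≡ (1ℚ + 1ℚ + (1ℚ + 1ℚ)) + (1ℚ + 1ℚ)
   six = trans (qn-+ 4 2) (cong₂ _+_ four two)
   lem = solveℚ 2 (λ u B → u :* (#2 :* (B :+ (#4 :+ #2) :* (B :* u))) :+ u :* u :* (Κ 1ℚ :* (#2 :* B :+ (#4 :+ #2) :* (B :* u))) :+ B :* u :* ((Κ 1ℚ :- #4 :* u) :* (#4 :+ #2 :* u) :+ #2 :* (u :* u)) := (#4 :+ #2) :* (B :* u)) refl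
   eq : (u * (qn 2 * (B + qn 6 * (B * u))) + u * u * (1ℚ * (qn 2 * B + qn 6 * (B * u)))) + B * u * ((1ℚ - qn 4 * u) * (qn 4 + qn 2 * u) + qn 2 * (u * u)) ≡ qn 6 * (B * u)
   eq rewrite six | two | four = lem u B

  Z≤ : ∀ p → Prime p → ∀ y → ∣ Z p y ∣ ≤ qn 12 * (B * iv p)
  Z≤ p pp y with 4 ℕ.≤? p
  ... | yes h = ≤-trans (Z-large p pp h y) (*-monoʳ (B * iv p) (*-nn B≥0 (iv-nn p)) (qn-mono (ℕP.m≤m+n 6 6)))
  ... | no h = ≤-trans (Z-small p pp p≤3 y) (≤-trans (≤-reflexive (trans (lem (qn 4) B) (cong (qn 4 * B *_) (sym (iv-inv 2))))) (≤-trans (*-monoˡ (qn 4 * B) (*-nn (qn-nn 4) B≥0) (*-monoˡ (qn 3) (qn-nn 3) (iv-anti (p≥1 pp) p≤3)))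
     (≤-reflexive (trans (lem2 (qn 4) B (qn 3) (iv p)) (cong (_* (B * iv p)) (sym (qn-* 4 3)))))))
   where
   p≤3 = ℕP.≤-pred (ℕP.≰⇒> h)
   lem = solveℚ 2 (λ a b → a :* b := a :* b :* Κ 1ℚ) refl
   lem2 = solveℚ 4 (λ a b c d → a :* b :* (c :* d) := a :* c :* (b :* d)) refl

  -- Inserting `Z≤` once more into the recursion, everything except κ(p)S(y/p)/p is of order 1/p²,
  -- and Σ L(p)/p² converges. The constant is 38 = 2 · 12 + 2 + 12.
  Z-main : ∀ p → Prime p → ∀ y → ∣ Z p y - iv p * (κ p * S (quo p y)) ∣ ≤ qn 38 * B * (iv p * iv p)
  Z-main p pp y = ≤-trans (≤-reflexive (cong ∣_∣ (trans (cong (_- iv p * (κ p * S y')) (Z-rec p y pp)) (lem u (κ p) (S y') (Z p y') (u * u * (e p * (qn 2 * S y'' + Z p y'')))))))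
    (≤-trans (abs--≤ (abs-*≤ (nn→abs (iv-nn p) ≤-refl) (abs-*≤ (κ≤ p) (Z≤ p pp y')))
       (abs-*≤ (nn→abs (*-nn (iv-nn p) (iv-nn p)) ≤-refl) (abs-*≤ {e p} {qn 2 * S y'' + Z p y''} (e≤ p) (abs-+≤ {qn 2 * S y''} {Z p y''} (abs-*≤ {qn 2} {S y''} (nn→abs (qn-nn 2) ≤-refl) (S≤B y'')) (Z≤ p pp y'')))))
     (≤-trans (+-monoʳ-≤ (u * (qn 2 * (qn 12 * (B * u)))) (*-monoˡ (u * u) (*-nn (iv-nn p) (iv-nn p)) (*-monoˡ 1ℚ 0≤1 (+-monoʳ-≤ (qn 2 * B) (*-monoˡ (qn 12) (qn-nn 12) (≤-trans (*-monoˡ B B≥0 u≤1) (≤-reflexive (*-identityʳ B))))))))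
       (≤-reflexive (trans (lem2 u (qn 2) (qn 12) B) (cong (λ z → z * B * (u * u)) (trans (cong₂ _+_ (sym (qn-* 2 12)) (sym (qn-+ 2 12))) (sym (qn-+ 24 14))))))))
   where
   u = iv p
   y' = quo p y
   y'' = quo p y'
   u≤1 : u ≤ 1ℚ
   u≤1 = ≤-trans (iv-anti (s≤s z≤n) (p≥1 pp)) (≤-reflexive iv-1)
   lem = solveℚ 5 (λ u k s z r → u :* (k :* (s :+ z)) :- r :- u :* (k :* s) := u :* (k :* z) :- r) refl
   lem2 = solveℚ 4 (λ u t w B → u :* (t :* (w :* (B :* u))) :+ u :* u :* (Κ 1ℚ :* (t :* B :+ w :* B)) := (t :* w :+ (t :+ w)) :* B :* (u :* u)) refl

  -- Sorted by primes, T = Σ c(n)ℓ(n)/n is Σ L(p)Z(p,x), where Z(p,x) is close to κ(p)S(x/p)/p;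
  -- partial summation shows that T is bounded. Replacing S(x/p) by S(x) leaves S(x) · P bounded,
  -- with P the sum in question, and a positive lower bound for S(x) finishes.
  module Final (x X : ℕ) (x≥1 : 1 ℕ.≤ x) (x²≤X : x ℕ.* x ℕ.≤ X) where
   x≤X : x ℕ.≤ X
   x≤X = ℕP.≤-trans (ℕP.m≤m*n x x {{ℕ.>-nonZero x≥1}}) x²≤X
   X≥1 : 1 ℕ.≤ X
   X≥1 = ℕP.≤-trans x≥1 x≤X
   open Scale X X≥1
   open Approx x

   P : ℚ
   P = sumP (λ p → κ p * (L p * iv p)) x

   T : ℚ
   T = sum (λ n → c n * ℓ n * iv n) x

   T-Z : T ≡ sumP (λ p → L p * Z p x) x
   T-Z = trans (sum-cong x (λ n _ _ → trans (lem (c n) (ℓ n) (iv n)) (trans (sym (sumP-* (c n * iv n) (λ p → qn (v p n) * L p) x)) (sum-cong x (λ p _ _ → onP-cong p (λ _ → lem2 (c n) (iv n) (qn (v p n)) (L p)))))))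
      (trans (sumP-swap (λ n p → L p * (c n * qn (v p n) * iv n)) x x) (sumP-cong x (λ p _ _ → sum-*ˡ (L p) (λ n → c n * qn (v p n) * iv n) x)))
     where
     lem = solveℚ 3 (λ a b c → a :* b :* c := a :* c :* b) refl
     lem2 = solveℚ 4 (λ a b c d → a :* b :* (c :* d) := d :* (a :* c :* b)) refl

   -- Summation by parts against w(n) = L(n)/n: the boundary term is bounded because L(n) = O(√n),
   -- the differences because of `sumLV`.
   cL : ∣ sum (λ n → c n * w n) x ∣ ≤ qn 69 * K
   cL = ≤-trans (≤-reflexive (cong ∣_∣ (abel c w x))) (≤-trans (abs-+≤ {C x * w (suc x)} {sum (λ n → C n * (w n - w (suc n))) x}
         (≤-trans (abs-*≤ (C≤ x) (nn→abs (w-nn (suc x)) ≤-refl)) bd)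
         (≤-trans (sum-abs≤ {λ n → C n * (w n - w (suc n))} {λ n → K * ((L n + 1ℚ) * (V n - V (suc n)))} x t) (≤-trans (≤-reflexive (sum-*ˡ K (λ n → (L n + 1ℚ) * (V n - V (suc n))) x)) (*-monoˡ K K≥0 (sumLV x)))))
       (≤-reflexive (trans (lem K (qn 3) (qn 66)) (cong (_* K) (sym (qn-+ 3 66))))))
     where
     lem = solveℚ 3 (λ k a b → k :* a :+ k :* b := (a :+ b) :* k) refl
     lem2 = solveℚ 4 (λ k r a b → k :* r :* (a :* b) := k :* (a :* (r :* b))) refl
     r' = isqrt (suc x)
     bd : K * rq x * w (suc x) ≤ K * qn 3
     bd = ≤-trans (≤-reflexive (*-assoc K (rq x) (w (suc x)))) (*-monoˡ K K≥0 (≤-trans (*-mono (rq-nn x) (w-nn (suc x)) (qn-mono (isqrt-mono (ℕP.n≤1+n x))) (≤-refl {w (suc x)}))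
         (≤-trans (*-monoˡ (rq (suc x)) (rq-nn (suc x)) (*-monoʳ (iv (suc x)) (iv-nn (suc x)) (L-r (suc x) (s≤s z≤n))))
           (≤-trans (≤-reflexive (lem3 (qn r') (qn 3) (iv (suc x)))) (≤-trans (*-monoˡ (qn 3) (qn-nn 3) (≤-trans (*-monoʳ (iv (suc x)) (iv-nn (suc x)) (≤-trans (≤-reflexive (sym (qn-* r' r'))) (qn-mono (proj₁ (isqrt-spec (suc x)))))) (≤-reflexive (iv-inv x)))) (≤-reflexive (*-identityʳ (qn 3))))))))
       where
       lem3 = solveℚ 3 (λ r t i → r :* (t :* r :* i) := t :* (r :* r :* i)) refl
     t : ∀ n → 1 ℕ.≤ n → n ℕ.≤ x → ∣ C n * (w n - w (suc n)) ∣ ≤ K * ((L n + 1ℚ) * (V n - V (suc n)))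
     t n h _ = ≤-trans (abs-*≤ {C n} {w n - w (suc n)} (C≤ n) (w-diff-abs n h)) (≤-trans (≤-reflexive (lem2 K (rq n) (L n + 1ℚ) (iv n * iv (suc n)))) (*-monoˡ K K≥0 (*-monoˡ (L n + 1ℚ) (+-nn (L-nn n h) 0≤1) (V-step n h))))

   c≤ : ∀ n → 1 ℕ.≤ n → ∣ c n ∣ ≤ K * (qn 2 * qn n)
   c≤ (suc n) _ = ≤-trans (≤-reflexive (cong ∣_∣ (lem (C n) (c (suc n))))) (≤-trans (abs--≤ (C≤ (suc n)) (C≤ n)) (≤-trans (+-mono-≤ (*-monoˡ K K≥0 (qn-mono (isqrt-≤ (suc n)))) (*-monoˡ K K≥0 (qn-mono (ℕP.≤-trans (isqrt-≤ n) (ℕP.n≤1+n n)))))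
      (≤-reflexive (trans (lem2 K (qn (suc n))) (cong (λ z → K * (z * qn (suc n))) (sym two))))))
     where
     lem = solveℚ 2 (λ a b → b := a :+ b :- a) refl
     lem2 = solveℚ 2 (λ k n → k :* n :+ k :* n := k :* (#2 :* n)) refl

   -- Here the choice x² ≤ X enters: |c(n)| ≤ 2Kn and |ℓ(n) - L(n)| ≤ n/X bound each of the x terms
   -- by 2Kx/X.
   cdiff : ∣ T - sum (λ n → c n * w n) x ∣ ≤ qn 2 * K
   cdiff = ≤-trans (≤-reflexive (cong ∣_∣ (trans (sym (sum-- (λ n → c n * ℓ n * iv n) (λ n → c n * w n) x)) (sum-cong x (λ n _ _ → lem (c n) (ℓ n) (iv n) (L n))))))
     (≤-trans (sum-abs≤ {λ n → c n * ((ℓ n - L n) * iv n)} {λ n → K * (qn 2 * qn x) * iv X} x t) (≤-trans (≤-reflexive (trans (sum-const (K * (qn 2 * qn x) * iv X) x) (lem3 (qn x) K (qn 2) (iv X))))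
        (≤-trans (*-monoˡ (qn 2 * K) (*-nn (qn-nn 2) K≥0) (≤-trans (*-monoʳ (iv X) (iv-nn X) (≤-trans (≤-reflexive (sym (qn-* x x))) (qn-mono x²≤X))) (≤-reflexive (iv-inv' X X≥1)))) (≤-reflexive (*-identityʳ (qn 2 * K))))))
     where
     lem = solveℚ 4 (λ a b c d → a :* b :* c :- a :* (d :* c) := a :* ((b :- d) :* c)) refl
     lem3 = solveℚ 4 (λ x k t i → x :* (k :* (t :* x) :* i) := t :* k :* (x :* x :* i)) refl
     lem4 = solveℚ 2 (λ a b → :- (a :- b) := b :- a) refl
     lem5 = solveℚ 2 (λ a b → a :+ b :- a := b) refl
     d≤ : ∀ n → 1 ℕ.≤ n → n ℕ.≤ x → ∣ ℓ n - L n ∣ ≤ qn n * iv X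
     d≤ n h k = abs≤ (≤-trans (≤→ (≤-trans (sub-nn (ℓ-≤ n h (smooth-≤ n h k))) (≤-reflexive (lem6 (ℓ n) (L n))))) (*-nn (qn-nn n) (iv-nn X)))
          (≤-trans (≤-reflexive (lem4 (ℓ n) (L n))) (≤-trans (+-monoˡ-≤ (- ℓ n) (ℓ-≥ n h (smooth-≤ n h k))) (≤-reflexive (lem5 (ℓ n) (qn n * iv X)))))
       where
       lem6 = solveℚ 2 (λ a b → b :- a := Κ 0ℚ :- (a :- b)) refl
     t : ∀ n → 1 ℕ.≤ n → n ℕ.≤ x → ∣ c n * ((ℓ n - L n) * iv n) ∣ ≤ K * (qn 2 * qn x) * iv X
     t n h k = ≤-trans (abs-*≤ {c n} {(ℓ n - L n) * iv n} (c≤ n h) (abs-*≤ {ℓ n - L n} {iv n} (d≤ n h k) (nn→abs (iv-nn n) ≤-refl)))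
        (≤-trans (≤-reflexive (trans (lem7 K (qn 2) (qn n) (iv X) (iv n)) (trans (cong (λ z → K * (qn 2 * qn n) * iv X * z) (iv-inv' n h)) (*-identityʳ _)))) (*-monoʳ (iv X) (iv-nn X) (*-monoˡ K K≥0 (*-monoˡ (qn 2) (qn-nn 2) (qn-mono k)))))
       where
       lem7 = solveℚ 5 (λ k t n X i → k :* (t :* n) :* (n :* X :* i) := k :* (t :* n) :* X :* (n :* i)) refl

   T≤ : ∣ T ∣ ≤ qn 71 * K
   T≤ = ≤-trans (≤-reflexive (cong ∣_∣ (solveℚ 2 (λ a b → a := b :+ (a :- b)) refl T (sum (λ n → c n * w n) x)))) (≤-trans (abs-+≤ {sum (λ n → c n * w n) x} {T - sum (λ n → c n * w n) x} cL cdiff) (≤-reflexive (trans (sym (*-distribʳ-+ K (qn 69) (qn 2))) (cong (_* K) (sym (qn-+ 69 2))))))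

   P1 P2 : ℚ
   P1 = sumP (λ p → L p * (iv p * (κ p * S (quo p x)))) x
   P2 = sumP (λ p → L p * (iv p * (κ p * S x))) x

   TP1 : ∣ T - P1 ∣ ≤ qn 38 * B * qn 12
   TP1 = ≤-trans (≤-reflexive (cong ∣_∣ (trans (cong (_- P1) T-Z) (sym (sumP-- (λ p → L p * Z p x) (λ p → L p * (iv p * (κ p * S (quo p x)))) x)))))
     (≤-trans (sumP-abs≤ {λ p → L p * Z p x - L p * (iv p * (κ p * S (quo p x)))} {λ p → qn 38 * B * (L p * (iv p * iv p))} x t) (≤-trans (≤-reflexive (sumP-* (qn 38 * B) (λ p → L p * (iv p * iv p)) x)) (*-monoˡ (qn 38 * B) (*-nn (qn-nn 38) B≥0) (sumLpp x))))
     where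
     lem = solveℚ 3 (λ l z w → l :* z :- l :* w := l :* (z :- w)) refl
     lem2 = solveℚ 3 (λ l a b → l :* (a :* b) := a :* (l :* b)) refl
     t : ∀ p → Prime p → p ℕ.≤ x → ∣ L p * Z p x - L p * (iv p * (κ p * S (quo p x))) ∣ ≤ qn 38 * B * (L p * (iv p * iv p))
     t p pp k = ≤-trans (≤-reflexive (cong ∣_∣ (lem (L p) (Z p x) (iv p * (κ p * S (quo p x)))))) (≤-trans (abs-*≤ (nn→abs (L≥0 pp) ≤-refl) (Z-main p pp x)) (≤-reflexive (lem2 (L p) (qn 38 * B) (iv p * iv p))))

   P12 : ∣ P1 - P2 ∣ ≤ qn 8 * K * qn 648
   P12 = ≤-trans (≤-reflexive (cong ∣_∣ (sym (sumP-- (λ p → L p * (iv p * (κ p * S (quo p x)))) (λ p → L p * (iv p * (κ p * S x))) x))))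
     (≤-trans (sumP-abs≤ {λ p → L p * (iv p * (κ p * S (quo p x))) - L p * (iv p * (κ p * S x))} {λ p → qn 8 * K * (L p * (iv p * iv (isqrt (quo p x))))} x t) (≤-trans (≤-reflexive (sumP-* (qn 8 * K) (λ p → L p * (iv p * iv (isqrt (quo p x)))) x)) (*-monoˡ (qn 8 * K) (*-nn (qn-nn 8) K≥0) (sumL√/ x x≥1 x≤X))))
     where
     lem = solveℚ 5 (λ l i k a b → l :* (i :* (k :* a)) :- l :* (i :* (k :* b)) := l :* (i :* (k :* :- (b :- a)))) refl
     lem2 = solveℚ 6 (λ l i t f k j → l :* (i :* (t :* (f :* k :* j))) := t :* f :* k :* (l :* (i :* j))) refl
     t : ∀ p → Prime p → p ℕ.≤ x → ∣ L p * (iv p * (κ p * S (quo p x))) - L p * (iv p * (κ p * S x)) ∣ ≤ qn 8 * K * (L p * (iv p * iv (isqrt (quo p x))))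
     t p pp k = ≤-trans (≤-reflexive (cong ∣_∣ (lem (L p) (iv p) (κ p) (S q) (S x)))) (≤-trans (abs-*≤ (nn→abs (L≥0 pp) ≤-refl) (abs-*≤ (nn→abs (iv-nn p) ≤-refl) (abs-*≤ {κ p} { - (S x - S q)} (κ≤ p) (abs-neg (tail≤ q x (quo-≥1 p x (p≥1 pp) k) (ℕP.≤-trans (ℕP.m≤n*m q p {{ℕ.>-nonZero (p≥1 pp)}}) (quo-≤ p x (p≥1 pp))))))))
         (≤-reflexive (trans (lem2 (L p) (iv p) (qn 2) (qn 4) K (iv (isqrt q))) (cong (λ z → z * K * (L p * (iv p * iv (isqrt q)))) (sym (qn-* 2 4))))))
       where q = quo p x

   P2-P : P2 ≡ S x * P
   P2-P = trans (sum-cong x (λ p _ _ → onP-cong p (λ _ → (solveℚ 4 (λ l i k s → l :* (i :* (k :* s)) := s :* (k :* (l :* i))) refl) (L p) (iv p) (κ p) (S x)))) (sumP-* (S x) (λ p → κ p * (L p * iv p)) x)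

   D₀ : ℚ
   D₀ = qn 71 * K + (qn 38 * B * qn 12 + qn 8 * K * qn 648)

   SP : ∣ S x * P ∣ ≤ D₀
   SP = ≤-trans (≤-reflexive (cong ∣_∣ (trans (sym P2-P) (solveℚ 3 (λ t a b → b := t :- (t :- a :+ (a :- b))) refl T P1 P2)))) (abs--≤ {T} {(T - P1) + (P1 - P2)} T≤ (abs-+≤ {T - P1} {P1 - P2} TP1 P12))

   bounded : ∀ n₀ → 1 ℕ.≤ n₀ → iv n₀ ≤ S x → ∣ P ∣ ≤ qn n₀ * D₀
   bounded n₀ h k = subst (∣ P ∣ ≤_) (*-comm D₀ (qn n₀)) (subst (_≤ D₀ * qn n₀) (lem (qn n₀) (iv n₀) ∣ P ∣ (iv-inv' n₀ h)) (*-monoʳ (qn n₀) (qn-nn n₀) (≤-trans (*-monoʳ ∣ P ∣ (0≤∣p∣ P) (≤-trans k (a≤∣a∣ (S x)))) (≤-trans (≤-reflexive (sym (∣p*q∣≡∣p∣*∣q∣ (S x) P))) SP))))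
     where
     lem' = solveℚ 3 (λ a b c → b :* c :* a := a :* b :* c) refl
     lem : ∀ a b c → a * b ≡ 1ℚ → b * c * a ≡ c
     lem a b c e = trans (lem' a b c) (trans (cong (_* c) e) (*-identityˡ c))

-- Divergence of the sum of L(p)/p

module MertensLower where
 open import Data.Nat.Induction using (<-wellFounded)
 open import Induction.WellFounded using (Acc; acc)
 open import Data.Rational using (ℚ; _+_; _*_; 1ℚ; _≤_)
 open import Data.Rational.Properties
 open import Relation.Binary.PropositionalEquality
 open Rationals
 open Valuations
 open Mertens

 U : ℕ → ℕ → ℚ
 U p = sum (λ n → qn (v p n))

 U-rec : ∀ p y → Prime p → U p y ≡ qn (quo p y) + U p (quo p y)
 U-rec p y pp = trans (sum-mult p (λ n → qn (v p n)) (p≥1 pp) (λ n nd → trans (cong qn (v-nd p n nd)) qz-0) y)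
  (trans (sum-cong (quo p y) (λ m h _ → trans (cong qn (v-mult p m (p≥2 pp) h)) (qn-suc (v p m)))) (trans (sum-+ (λ _ → 1ℚ) (λ m → qn (v p m)) (quo p y)) (cong (_+ U p (quo p y)) (trans (sum-const 1ℚ (quo p y)) (*-identityʳ (qn (quo p y)))))))

 quo-iv : ∀ p y → 1 ℕ.≤ p → qn (quo p y) ≤ qn y * iv p
 quo-iv p y h = ≤iv p {qn (quo p y)} {qn y} h (≤-trans (≤-reflexive (sym (qn-* p (quo p y)))) (qn-mono (quo-≤ p y h)))

 U≤ : ∀ p y → Prime p → U p y ≤ qn 2 * (qn y * iv p)
 U≤ p y pp = go y (<-wellFounded y)
  where
  go : ∀ y → Acc ℕ._<_ y → U p y ≤ qn 2 * (qn y * iv p)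
  go zero _ = *-nn (qn-nn 2) (*-nn (qn-nn 0) (iv-nn p))
  go (suc y) (acc rs) = ≤-trans (≤-reflexive (U-rec p (suc y) pp)) (≤-trans (+-monoʳ-≤ (qn q) (≤-trans (go q (rs (quo-< p (suc y) (p≥2 pp) (s≤s z≤n))))
      (≤-trans (≤-reflexive (lem2 (qn 2) (qn q) (iv p))) (≤-trans (*-monoˡ (qn q) (qn-nn q) (≤-trans (*-monoˡ (qn 2) (qn-nn 2) (iv-anti (s≤s z≤n) (p≥2 pp))) (≤-reflexive (iv-inv 1)))) (≤-reflexive (*-identityʳ (qn q)))))))
      (≤-trans (+-mono-≤ (quo-iv p (suc y) (p≥1 pp)) (quo-iv p (suc y) (p≥1 pp))) (≤-reflexive (trans (lem (qn (suc y) * iv p)) (cong (_* (qn (suc y) * iv p)) (sym (trans (qn-+ 1 1) (cong₂ _+_ qz-1 qz-1))))))))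
    where
    q = quo p (suc y)
    lem2 = solveℚ 3 (λ t q i → t :* (q :* i) := q :* (t :* i)) refl
    lem = solveℚ 1 (λ a → a :+ a := (Κ 1ℚ :+ Κ 1ℚ) :* a) refl

 module Lower (x X : ℕ) (x≥1 : 1 ℕ.≤ x) (x²≤X : x ℕ.* x ℕ.≤ X) where
  x≤X : x ℕ.≤ X
  x≤X = ℕP.≤-trans (ℕP.m≤m*n x x {{ℕ.>-nonZero x≥1}}) x²≤X
  X≥1 : 1 ℕ.≤ X
  X≥1 = ℕP.≤-trans x≥1 x≤X
  open Scale X X≥1
  open Approx x

  W : ℚ
  W = sumP (λ p → L p * iv p) x

  Σℓ : sum ℓ x ≤ qn 2 * qn x * W
  Σℓ = ≤-trans (≤-reflexive (trans (sumP-swap (λ n p → qn (v p n) * L p) x x) (sumP-cong x (λ p _ _ → sum-*ʳ (L p) (λ n → qn (v p n)) x))))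
    (≤-trans (sumP-mono x (λ p pp _ → ≤-trans (*-monoʳ (L p) (L≥0 pp) (U≤ p x pp)) (≤-reflexive (lem (qn 2) (qn x) (iv p) (L p))))) (≤-reflexive (sumP-* (qn 2 * qn x) (λ p → L p * iv p) x)))
    where
    lem = solveℚ 4 (λ a b c d → a :* (b :* c) :* d := a :* b :* (d :* c)) refl

  ΣL : sum L x ≤ qn 2 * qn x * W + 1ℚ
  ΣL = ≤-trans (sum-mono x (λ n h k → ≤-trans (ℓ-≥ n h (smooth-≤ n h k)) (+-monoʳ-≤ (ℓ n) (*-monoʳ (iv X) (iv-nn X) (qn-mono k)))))
    (≤-trans (≤-reflexive (sum-+ ℓ (λ _ → qn x * iv X) x)) (+-mono-≤ Σℓ (≤-trans (≤-reflexive (trans (sum-const (qn x * iv X) x) (trans (sym (*-assoc (qn x) (qn x) (iv X))) (cong (_* iv X) (sym (qn-* x x))))))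
       (≤-trans (*-monoʳ (iv X) (iv-nn X) (qn-mono x²≤X)) (≤-reflexive (iv-inv' X X≥1))))))

 -- With m = 2^k, the m terms L(n) for m < n ≤ 2m are at least L(m) ≥ k/2. On the other side Σ L(n)
 -- is within 1 of Σ ℓ(n) = Σ L(p)U(p), and U(p) ≤ 2 · 2m/p.
 W-lower : ∀ k X → (h : 1 ℕ.≤ 2 ℕ.^ k ℕ.+ 2 ℕ.^ k) (h' : (2 ℕ.^ k ℕ.+ 2 ℕ.^ k) ℕ.* (2 ℕ.^ k ℕ.+ 2 ℕ.^ k) ℕ.≤ X) → qn k * iv 2 ≤ qn 4 * Lower.W (2 ℕ.^ k ℕ.+ 2 ℕ.^ k) X h h' + 1ℚ
 W-lower k X h h' = cancel-qn m m≥1 (≤-trans lo (≤-trans ΣL (≤-trans (+-monoʳ-≤ (qn 2 * qn (m ℕ.+ m) * W) (≤-trans (≤-reflexive (sym qz-1)) (qn-mono m≥1)))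
   (≤-reflexive (trans (cong₂ (λ a b → a * b * W + qn m) two (qn-+ m m)) (trans (lem (qn m) W) (cong (λ z → qn m * (z * W + 1ℚ)) (sym four))))))))
  where
  open Lower (2 ℕ.^ k ℕ.+ 2 ℕ.^ k) X h h'
  open Scale X X≥1
  m = 2 ℕ.^ k
  m≥1 : 1 ℕ.≤ m
  m≥1 = ℕP.m^n>0 2 k
  two : qn 2 ≡ 1ℚ + 1ℚ
  two = trans (qn-+ 1 1) (cong₂ _+_ qz-1 qz-1)
  four : qn 4 ≡ (1ℚ + 1ℚ) + (1ℚ + 1ℚ)
  four = trans (qn-+ 2 2) (cong₂ _+_ two two)
  lem = solveℚ 2 (λ m W → (Κ 1ℚ :+ Κ 1ℚ) :* (m :+ m) :* W :+ m := m :* (((Κ 1ℚ :+ Κ 1ℚ) :+ (Κ 1ℚ :+ Κ 1ℚ)) :* W :+ Κ 1ℚ)) refl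
  lo : qn m * (qn k * iv 2) ≤ sum L (m ℕ.+ m)
  lo = ≤-trans (*-monoˡ (qn m) (qn-nn m) (L-2^ k)) (≤-trans (≤-reflexive (sym (sum-const (L m) m))) (≤-trans (sum-mono m (λ i a b → L-mono (ℕP.m≤m+n m i)))
     (≤-by (sum L m) (trans (+-comm (sum (λ i → L (m ℕ.+ i)) m) (sum L m)) (sym (sum-split L m m))) (sum-nn m (λ n a b → L-nn n a)))))

-- Dirichlet characters and numerical positivity of L(1,χ)

module Characters where
 open import Data.Nat using (NonZero; _%_)
 open import Data.Nat.DivMod using ([m+n]%n≡m%n; %-distribˡ-*; m%n<n)
 open import Data.Nat.Induction using (<-wellFounded)
 open import Induction.WellFounded using (Acc; acc)
 open import Data.Integer as ℤ using (ℤ)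
 open import Data.Rational using (ℚ; _+_; _*_; _-_; -_; 0ℚ; 1ℚ; _≤_; ∣_∣)
 open import Data.Rational.Properties
 open import Relation.Nullary.Decidable using (from-yes; True; toWitness)
 open import Relation.Binary.PropositionalEquality
 open Rationals
 open IntegerSqrt
 open Valuations
 open Mertens

 abs-qz : ∀ i {n} → ℤ.∣ i ∣ ℕ.≤ n → ∣ qz i ∣ ≤ qn n
 abs-qz (ℤ.+ m) h = nn→abs (qn-nn m) (qn-mono h)
 abs-qz (ℤ.-[1+ m ]) h = subst (λ z → ∣ z ∣ ≤ _) (sym (qz-neg (ℤ.+ suc m))) (abs-neg {qn (suc m)} (nn→abs (qn-nn (suc m)) (qn-mono h)))

 dec≤ : ∀ {a b} {t : True (a ≤? b)} → a ≤ b
 dec≤ {t = t} = toWitness t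

 sumℤ : (ℕ → ℤ) → ℕ → ℤ
 sumℤ f zero = 0ℤ
 sumℤ f (suc n) = sumℤ f n ℤ.+ f (suc n)

 sum-qz : ∀ f y → sum (λ n → qz (f n)) y ≡ qz (sumℤ f y)
 sum-qz f zero = sym qz-0
 sum-qz f (suc y) = trans (cong (_+ qz (f (suc y))) (sum-qz f y)) (sym (qz-+ (sumℤ f y) (f (suc y))))

 -- Rounding: c/n ≥ (c ⌊D/n⌋ − |c|) / D, so sums of c(n)/n are bounded below by an integer computation.
 term-lower : ∀ D → 1 ℕ.≤ D → ∀ (c : ℤ) n → qz (c ℤ.* ℤ.+ quo n D ℤ.- ℤ.+ ℤ.∣ c ∣) * iv D ≤ qz c * iv n
 term-lower D h c zero = ≤-trans (*-monoʳ (iv D) (iv-nn D) (≤-trans (qz-mono neg) (≤-reflexive qz-0))) (≤-reflexive (trans (*-zeroˡ (iv D)) (sym (trans (cong (qz c *_) iv-0) (*-zeroʳ (qz c))))))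
  where
  neg : c ℤ.* ℤ.+ 0 ℤ.- ℤ.+ ℤ.∣ c ∣ ℤ.≤ 0ℤ
  neg = subst (ℤ._≤ 0ℤ) (sym (trans (cong (ℤ._- ℤ.+ ℤ.∣ c ∣) (ℤP.*-zeroʳ c)) (ℤP.+-identityˡ (ℤ.- (ℤ.+ ℤ.∣ c ∣))))) (ℤP.neg-mono-≤ {ℤ.+ 0} {ℤ.+ ℤ.∣ c ∣} (ℤ.+≤+ z≤n))
 term-lower D h c n@(suc _) = iv≤ D {qz c * iv n} h (subst (λ z → z ≤ qn D * (qz c * iv n)) eq (sub≤ (abs≤' )))
  where
  q = quo n D
  n≥1 : 1 ℕ.≤ n
  n≥1 = s≤s z≤n
  eq : qz c * qn q - qn (ℤ.∣ c ∣) ≡ qz (c ℤ.* ℤ.+ q ℤ.- ℤ.+ ℤ.∣ c ∣)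
  eq = sym (trans (qz-+ (c ℤ.* ℤ.+ q) (ℤ.- (ℤ.+ ℤ.∣ c ∣))) (cong₂ _+_ (qz-* c (ℤ.+ q)) (qz-neg (ℤ.+ ℤ.∣ c ∣))))
  δ : ℚ
  δ = qn q - qn D * iv n
  δ≤ : ∣ δ ∣ ≤ 1ℚ
  δ≤ = abs≤ (≤-trans (+-monoˡ-≤ (- (qn D * iv n)) (≤iv n {qn q} {qn D} n≥1 (≤-trans (≤-reflexive (sym (qn-* n q))) (qn-mono (quo-≤ n D n≥1))))) (≤-trans (≤-reflexive (+-inverseʳ (qn D * iv n))) 0≤1))
    (≤-trans (≤-reflexive (lem (qn q) (qn D * iv n))) (≤-trans (+-monoˡ-≤ (- qn q) (iv≤ n {qn (suc q)} {qn D} n≥1 (≤-trans (qn-mono (ℕP.<⇒≤ (quo-> n D n≥1))) (≤-reflexive (qn-* n (suc q)))))) (≤-reflexive (trans (cong (_- qn q) (qn-suc q)) (lem2 (qn q))))))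
   where
   lem = solveℚ 2 (λ a b → :- (a :- b) := b :- a) refl
   lem2 = solveℚ 1 (λ a → (Κ 1ℚ :+ a) :- a := Κ 1ℚ) refl
  abs≤' : qz c * δ ≤ qn (ℤ.∣ c ∣)
  abs≤' = ≤-trans (a≤∣a∣ (qz c * δ)) (≤-trans (abs-*≤ {qz c} {δ} (abs-qz c ℕP.≤-refl) δ≤) (≤-reflexive (*-identityʳ (qn ℤ.∣ c ∣))))
  sub≤ : qz c * δ ≤ qn (ℤ.∣ c ∣) → qz c * qn q - qn (ℤ.∣ c ∣) ≤ qn D * (qz c * iv n)
  sub≤ k = ≤→ (subst (0ℚ ≤_) (solveℚ 5 (λ c q D i a → a :- c :* (q :- D :* i) := D :* (c :* i) :- (c :* q :- a)) refl (qz c) (qn q) (qn D) (iv n) (qn ℤ.∣ c ∣)) (sub-nn k))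

 lowerℤ : (ℕ → ℤ) → ℕ → ℕ → ℤ
 lowerℤ f D = sumℤ (λ n → f n ℤ.* ℤ.+ quo n D ℤ.- ℤ.+ ℤ.∣ f n ∣)

 sum-lower : ∀ f D x → 1 ℕ.≤ D → qz (lowerℤ f D x) * iv D ≤ sum (λ n → qz (f n) * iv n) x
 sum-lower f D x h = ≤-trans (≤-reflexive (trans (cong (_* iv D) (sym (sum-qz (λ n → f n ℤ.* ℤ.+ quo n D ℤ.- ℤ.+ ℤ.∣ f n ∣) x))) (sym (sum-*ʳ (iv D) (λ n → qz (f n ℤ.* ℤ.+ quo n D ℤ.- ℤ.+ ℤ.∣ f n ∣)) x))))
  (sum-mono x (λ n _ _ → term-lower D h (f n) n))

 -- L(1) > 0 from one partial sum: 4K / isqrt x₀ ≤ a / D - 1 / n₀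
 module Low (Hk : Hecke) where
  open Hecke Hk
  open MertensSeries.Main Hk

  S-low : ∀ x₀ y {s t : ℚ} → 1 ℕ.≤ x₀ → x₀ ℕ.≤ y → s ≤ S x₀ → t + qn 4 * K * iv (isqrt x₀) ≤ s → t ≤ S y
  S-low x₀ y {s} {t} h k a b = ≤-trans (≤→ (subst (0ℚ ≤_) (solveℚ 4 (λ t e a b → (a :- (t :+ e)) :+ (e :- (:- (b :- a))) := b :- t) refl t (qn 4 * K * iv (isqrt x₀)) (S x₀) (S y)) (+-nn (sub-nn (≤-trans b a)) (sub-nn (≤-trans (-a≤∣a∣ (S y - S x₀)) (tail≤ x₀ y h k)))))) ≤-refl

 module Char (q : ℕ) .{{_ : NonZero q}} (f : ℕ → ℤ) (K : ℕ) where

  χ : ℕ → ℤ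
  χ n = f (n % q)

  module _ (mult : ∀ {a} → a ℕ.< q → ∀ {b} → b ℕ.< q → χ (a ℕ.* b) ≡ f a ℤ.* f b)
      (vals : ∀ {a} → a ℕ.< q → ℤ.∣ f a ∣ ℕ.≤ 1)
      (period : sumℤ χ q ≡ 0ℤ)
      (bdd : ∀ {a} → a ℕ.< q → ℤ.∣ sumℤ χ a ∣ ℕ.≤ K) where

   χ-mul : ∀ m n → χ (m ℕ.* n) ≡ χ m ℤ.* χ n
   χ-mul m n = trans (cong f (%-distribˡ-* m n q)) (mult (m%n<n m q) (m%n<n n q))

   χ-shift : ∀ n → sumℤ χ (n ℕ.+ q) ≡ sumℤ χ n
   χ-shift zero = period
   χ-shift (suc n) = cong₂ ℤ._+_ (χ-shift n) (cong f ([m+n]%n≡m%n (suc n) q))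

   Cℤ : ∀ y → ℤ.∣ sumℤ χ y ∣ ℕ.≤ K
   Cℤ y = go y (<-wellFounded y)
     where
     go : ∀ y → Acc ℕ._<_ y → ℤ.∣ sumℤ χ y ∣ ℕ.≤ K
     go y (acc rs) with y ℕ.<? q
     ... | yes h = bdd h
     ... | no h = subst (λ z → ℤ.∣ z ∣ ℕ.≤ K) (trans (sym (χ-shift (y ℕ.∸ q))) (cong (sumℤ χ) (ℕP.m∸n+n≡m (ℕP.≮⇒≥ h)))) (go (y ℕ.∸ q) (rs (ℕP.∸-monoʳ-< (ℕ.>-nonZero⁻¹ q) (ℕP.≮⇒≥ h))))

   hecke : Hecke
   hecke = record
     { c = λ n → qz (χ n) ; κ = λ n → qz (χ n) ; e = λ _ → 0ℚ
     ; κ≤ = λ p → ≤-trans (abs-qz (χ p) (vals (m%n<n p q))) (qn-mono (s≤s z≤n))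
     ; e≤ = λ _ → 0≤1
     ; κ≤-small = λ p _ → ≤-trans (abs-qz (χ p) (vals (m%n<n p q))) (≤-reflexive qz-1)
     ; hecke = λ p m _ _ _ → trans (cong qz (χ-mul p m)) (qz-* (χ p) (χ m))
     ; hecke∣ = λ p m _ _ → trans (trans (cong qz (χ-mul p (p ℕ.* m))) (qz-* (χ p) (χ (p ℕ.* m)))) (lem (qz (χ p) * qz (χ (p ℕ.* m))) (qz (χ m)))
     ; K = qn K
     ; C≤ = bound
     }
     where
     lem = solveℚ 2 (λ a b → a := a :- Κ 0ℚ :* b) refl
     bound : ∀ y → ∣ sum (λ n → qz (χ n)) y ∣ ≤ qn K * rq y
     bound zero = *-nn (qn-nn K) (rq-nn 0)
     bound (suc y) = ≤-trans (≤-reflexive (cong ∣_∣ (sum-qz χ (suc y)))) (≤-trans (abs-qz (sumℤ χ (suc y)) (Cℤ (suc y))) (≤-trans (≤-reflexive (sym (*-identityʳ (qn K)))) (*-monoˡ (qn K) (qn-nn K) (≤-trans (≤-reflexive (sym qz-1)) (qn-mono (isqrt-pos (suc y) (s≤s z≤n)))))))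

 -- The Kronecker symbols (5/n), (-3/n) and their product (-15/n), the character of ℚ(√-15).
 f5 f3 f15 : ℕ → ℤ
 f5 1 = 1ℤ
 f5 2 = -1ℤ
 f5 3 = -1ℤ
 f5 4 = 1ℤ
 f5 _ = 0ℤ
 f3 1 = 1ℤ
 f3 2 = -1ℤ
 f3 _ = 0ℤ
 f15 n = f5 (n % 5) ℤ.* f3 (n % 3)

 module χ5 = Char 5 f5 1
 module χ3 = Char 3 f3 1
 module χ15 = Char 15 f15 3

 H5 H3 H15 : Hecke
 H5 = χ5.hecke
  (from-yes (ℕP.allUpTo? (λ a → ℕP.allUpTo? (λ b → χ5.χ (a ℕ.* b) ℤ.≟ f5 a ℤ.* f5 b) 5) 5))
  (from-yes (ℕP.allUpTo? (λ a → ℤ.∣ f5 a ∣ ℕ.≤? 1) 5)) refl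
  (from-yes (ℕP.allUpTo? (λ a → ℤ.∣ sumℤ χ5.χ a ∣ ℕ.≤? 1) 5))
 H3 = χ3.hecke
  (from-yes (ℕP.allUpTo? (λ a → ℕP.allUpTo? (λ b → χ3.χ (a ℕ.* b) ℤ.≟ f3 a ℤ.* f3 b) 3) 3))
  (from-yes (ℕP.allUpTo? (λ a → ℤ.∣ f3 a ∣ ℕ.≤? 1) 3)) refl
  (from-yes (ℕP.allUpTo? (λ a → ℤ.∣ sumℤ χ3.χ a ∣ ℕ.≤? 1) 3))
 H15 = χ15.hecke
  (from-yes (ℕP.allUpTo? (λ a → ℕP.allUpTo? (λ b → χ15.χ (a ℕ.* b) ℤ.≟ f15 a ℤ.* f15 b) 15) 15))
  (from-yes (ℕP.allUpTo? (λ a → ℤ.∣ f15 a ∣ ℕ.≤? 1) 15)) refl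
  (from-yes (ℕP.allUpTo? (λ a → ℤ.∣ sumℤ χ15.χ a ∣ ℕ.≤? 3) 15))

 opaque
  unfolding qz iv
  private
   -- The root of 256 is 16, so the tails are at most 1/4, 1/4 and 3/4. The values L(1,χ), about
   -- 0.43, 0.60 and 1.62, exceed them by more than the rounding errors with denominator 10000 and
   -- the margin 1/100 together.
   num5 : iv 100 + qn 4 * qn 1 * iv (isqrt 256) ≤ qz (lowerℤ χ5.χ 10000 256) * iv 10000
   num5 = dec≤
   num3 : iv 100 + qn 4 * qn 1 * iv (isqrt 256) ≤ qz (lowerℤ χ3.χ 10000 256) * iv 10000
   num3 = dec≤
   num15 : iv 100 + qn 4 * qn 3 * iv (isqrt 256) ≤ qz (lowerℤ χ15.χ 10000 256) * iv 10000
   num15 = dec≤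

  S5 : ∀ y → 256 ℕ.≤ y → iv 100 ≤ MertensSeries.Main.S H5 y
  S5 y h = Low.S-low H5 256 y (s≤s z≤n) h (sum-lower χ5.χ 10000 256 (s≤s z≤n)) num5
  S3 : ∀ y → 256 ℕ.≤ y → iv 100 ≤ MertensSeries.Main.S H3 y
  S3 y h = Low.S-low H3 256 y (s≤s z≤n) h (sum-lower χ3.χ 10000 256 (s≤s z≤n)) num3
  S15 : ∀ y → 256 ℕ.≤ y → iv 100 ≤ MertensSeries.Main.S H15 y
  S15 y h = Low.S-low H15 256 y (s≤s z≤n) h (sum-lower χ15.χ 10000 256 (s≤s z≤n)) num15

-- Divisibility, residues and inverses in ℤ

module Integers where
 open import Data.Nat.GCD using (module Bézout)
 open import Data.Nat.Coprimality using (Coprime; coprime-Bézout)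
 open import Data.Integer as ℤ using (ℤ; _+_; _*_; _-_; -_)
 open import Data.Integer.DivMod using (_%ℕ_; _/ℕ_; a≡a%ℕn+[a/ℕn]*n; n%ℕd<d)
 open import Data.Integer.Divisibility.Signed public using (_∣_; divides; _∣?_; ∣m∣n⇒∣m+n; ∣m∣n⇒∣m-n; ∣m⇒∣-m; ∣n⇒∣m*n; ∣m⇒∣m*n; ∣-refl; ∣⇒∣ᵤ; ∣ᵤ⇒∣; ∣-trans)
 open import Relation.Binary.PropositionalEquality
 open Valuations using (p≥1; p≥2; prime∣prime)

 ⟦_⟧ : ℕ → ℤ
 ⟦ n ⟧ = ℤ.+ n

 ∣ℕ : ∀ {p n} → ⟦ p ⟧ ∣ ⟦ n ⟧ → p ℕD.∣ n
 ∣ℕ = ∣⇒∣ᵤ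

 ℕ∣ : ∀ {p n} → p ℕD.∣ n → ⟦ p ⟧ ∣ ⟦ n ⟧
 ℕ∣ = ∣ᵤ⇒∣

 euclid : ∀ {p} → Prime p → ∀ a b → ⟦ p ⟧ ∣ a * b → (⟦ p ⟧ ∣ a) ⊎ (⟦ p ⟧ ∣ b)
 euclid {p} pp a b d with euclidsLemma ℤ.∣ a ∣ ℤ.∣ b ∣ pp (subst (p ℕD.∣_) (ℤP.abs-* a b) (∣⇒∣ᵤ d))
 ... | inj₁ e = inj₁ (∣ᵤ⇒∣ e)
 ... | inj₂ e = inj₂ (∣ᵤ⇒∣ e)

 euclid-sq : ∀ {p} → Prime p → ∀ a → ⟦ p ⟧ ∣ a * a → ⟦ p ⟧ ∣ a
 euclid-sq pp a d with euclid pp a a d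
 ... | inj₁ e = e
 ... | inj₂ e = e

 ∤-small : ∀ {p n} → 1 ℕ.≤ n → n ℕ.< p → ¬ ⟦ p ⟧ ∣ ⟦ n ⟧
 ∤-small h k d = ℕP.<⇒≱ k (ℕD.∣⇒≤ {{ℕ.>-nonZero h}} (∣ℕ d))

 p∣q : ∀ {p q} → Prime p → Prime q → ⟦ p ⟧ ∣ ⟦ q ⟧ → p ≡ q
 p∣q pp pq d = prime∣prime pp pq (∣ℕ d)

 prime[3] : Prime 3
 prime[3] = Relation.Nullary.Decidable.from-yes (prime? 3)
  where import Relation.Nullary.Decidable
 prime[5] : Prime 5
 prime[5] = Relation.Nullary.Decidable.from-yes (prime? 5)
  where import Relation.Nullary.Decidable

 -- It rules out that p divides both variables of a quadratic form whose value is p.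
 unit∤ : ∀ {p} → Prime p → ∀ k → ⟦ p ⟧ ≢ k * ⟦ p ⟧ * ⟦ p ⟧
 unit∤ {p} pp k e = ℕP.<⇒≱ (p≥2 pp) (ℕD.∣⇒≤ (∣⇒∣ᵤ (divides {⟦ p ⟧} {1ℤ} k (sym e'))))
  where
  e' : k * ⟦ p ⟧ ≡ 1ℤ
  e' = ℤP.*-cancelʳ-≡ (k * ⟦ p ⟧) 1ℤ ⟦ p ⟧ {{ℕ.>-nonZero (p≥1 pp)}} (trans (sym e) (sym (ℤP.*-identityˡ ⟦ p ⟧)))

 coprime-∤ : ∀ {p n} → Prime p → ¬ p ℕD.∣ n → Coprime n p
 coprime-∤ {p} {n} pp nd {d} (d∣n , d∣p) with prime⇒irreducible pp d∣p
 ... | inj₁ e = e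
 ... | inj₂ e = ⊥-elim (nd (subst (ℕD._∣ n) e d∣n))

 inverse : ∀ {p} → Prime p → ∀ t → ¬ ⟦ p ⟧ ∣ t → ∃ λ u → ∃ λ k → t * u ≡ 1ℤ + k * ⟦ p ⟧
 inverse {p} pp t nd with abs-case t | coprime-Bézout (coprime-∤ pp (λ d → nd (∣ᵤ⇒∣ d)))
  where
  abs-case : ∀ t → (t ≡ ⟦ ℤ.∣ t ∣ ⟧) ⊎ (t ≡ - ⟦ ℤ.∣ t ∣ ⟧)
  abs-case (ℤ.+ n) = inj₁ refl
  abs-case (ℤ.-[1+ n ]) = inj₂ refl
 ... | s | Bézout.+- x y eq = fin s
  where
  m = ℤ.∣ t ∣
  base : ⟦ m ⟧ * ⟦ x ⟧ ≡ 1ℤ + ⟦ y ⟧ * ⟦ p ⟧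
  base = trans (sym (ℤP.pos-* m x)) (trans (cong ℤ.+_ (trans (ℕP.*-comm m x) (sym eq))) (trans (ℤP.pos-+ 1 (y ℕ.* p)) (cong (λ z → 1ℤ + z) (ℤP.pos-* y p))))
  fin : (t ≡ ⟦ m ⟧) ⊎ (t ≡ - ⟦ m ⟧) → _
  fin (inj₁ e) = ⟦ x ⟧ , ⟦ y ⟧ , trans (cong (_* ⟦ x ⟧) e) base
  fin (inj₂ e) = - ⟦ x ⟧ , ⟦ y ⟧ , trans (cong (_* (- ⟦ x ⟧)) e) (trans (solveℤ 2 (λ a b → (:- a) :* (:- b) := a :* b) refl ⟦ m ⟧ ⟦ x ⟧) base)
 ... | s | Bézout.-+ x y eq = fin s
  where
  m = ℤ.∣ t ∣
  base : 1ℤ + ⟦ x ⟧ * ⟦ m ⟧ ≡ ⟦ y ⟧ * ⟦ p ⟧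
  base = trans (cong (λ z → 1ℤ + z) (sym (ℤP.pos-* x m))) (trans (sym (ℤP.pos-+ 1 (x ℕ.* m))) (trans (cong ℤ.+_ eq) (ℤP.pos-* y p)))
  b2 : ⟦ m ⟧ * (- ⟦ x ⟧) ≡ 1ℤ + (- ⟦ y ⟧) * ⟦ p ⟧
  b2 = trans (l1 ⟦ m ⟧ ⟦ x ⟧) (trans (cong (λ z → 1ℤ - z) base) (l2 ⟦ y ⟧ ⟦ p ⟧))
   where
   l1 = solveℤ 2 (λ a b → a :* (:- b) := # 1 :- (# 1 :+ b :* a)) refl
   l2 = solveℤ 2 (λ a b → # 1 :- a :* b := # 1 :+ (:- a) :* b) refl
  fin : (t ≡ ⟦ m ⟧) ⊎ (t ≡ - ⟦ m ⟧) → _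
  fin (inj₁ e) = - ⟦ x ⟧ , - ⟦ y ⟧ , trans (cong (_* (- ⟦ x ⟧)) e) b2
  fin (inj₂ e) = ⟦ x ⟧ , - ⟦ y ⟧ , trans (cong (_* ⟦ x ⟧) e) (trans (solveℤ 2 (λ a b → (:- a) :* b := a :* (:- b)) refl ⟦ m ⟧ ⟦ x ⟧) b2)

 reduce : ∀ p → 1 ℕ.≤ p → ∀ a → ∃ λ r → r ℕ.< p × ∃ λ k → a ≡ ⟦ r ⟧ + k * ⟦ p ⟧
 reduce (suc n) h a = a %ℕ suc n , n%ℕd<d a (suc n) , a /ℕ suc n , a≡a%ℕn+[a/ℕn]*n a (suc n)

-- Norm forms of discriminant -15 and Fermat's descent

module NormForms where
 open import Data.Bool using (Bool; true; false; _xor_)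
 open import Data.Nat.Induction using (<-wellFounded)
 open import Induction.WellFounded using (Acc; acc)
 open import Data.Integer as ℤ using (ℤ; _+_; _*_; _-_; -_)
 open import Relation.Nullary.Decidable using (_×-dec_)
 open import Relation.Binary.PropositionalEquality
 open Valuations using (p≥1; prime∣prime; prime-div; *≥1⇒)
 open Integers

 Pt : Set
 Pt = ℤ × ℤ

 -- Homogeneous elements of the ring of Q(√-3,√5) graded over Q(√-15): degree false is ℤ ⊕ ℤμ with μ² = 3μ - 6,
 -- degree true is ℤε ⊕ ℤν with ε = (√5 - √-3)/2 and ν = √-3, so that ε² = 2 - μ, εν = μ, ν² = -3.
 private
  c2 = ⟦ 2 ⟧
  c3 = ⟦ 3 ⟧
  c6 = ⟦ 6 ⟧

 mul : Bool → Bool → Pt → Pt → Pt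
 mul false false (a , b) (s , t) = a * s - c6 * (b * t) , a * t + b * s + c3 * (b * t)
 mul false true  (a , b) (s , t) = a * s + c3 * (b * s) - c3 * (b * t) , a * t + c2 * (b * s)
 mul true  false (a , b) (s , t) = a * s + c3 * (t * a) - c3 * (b * t) , s * b + c2 * (t * a)
 mul true  true  (a , b) (s , t) = c2 * (a * s) - c3 * (b * t) , a * t + b * s - a * s

 -- These represent the two classes of forms of discriminant -15. The Hilbert class field of ℚ(√-15)
 -- is ℚ(√-3,√5), and an ideal outside the principal class is represented there by an element of
 -- degree `true`, so no ideals are needed.
 N : Bool → Pt → ℤ
 N false (s , t) = s * s + c3 * (s * t) + c6 * (t * t)
 N true  (s , t) = c2 * (s * s) - c3 * (s * t) + c3 * (t * t)

 conj : Bool → Pt → Pt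
 conj false (s , t) = s + c3 * t , - t
 conj true  (s , t) = s , s - t

 scale : ℤ → Pt → Pt
 scale k (s , t) = k * s , k * t

 private
  n0 : ∀ {n} → Expr ℤ n → Expr ℤ n → Expr ℤ n
  n0 s t = s :* s :+ # 3 :* (s :* t) :+ # 6 :* (t :* t)
  n1 : ∀ {n} → Expr ℤ n → Expr ℤ n → Expr ℤ n
  n1 s t = # 2 :* (s :* s) :- # 3 :* (s :* t) :+ # 3 :* (t :* t)
  x00 : ∀ {n} → Expr ℤ n → Expr ℤ n → Expr ℤ n → Expr ℤ n → Expr ℤ n
  x00 a b s t = a :* s :- # 6 :* (b :* t)
  y00 : ∀ {n} → Expr ℤ n → Expr ℤ n → Expr ℤ n → Expr ℤ n → Expr ℤ n
  y00 a b s t = a :* t :+ b :* s :+ # 3 :* (b :* t)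
  x01 : ∀ {n} → Expr ℤ n → Expr ℤ n → Expr ℤ n → Expr ℤ n → Expr ℤ n
  x01 a b s t = a :* s :+ # 3 :* (b :* s) :- # 3 :* (b :* t)
  y01 : ∀ {n} → Expr ℤ n → Expr ℤ n → Expr ℤ n → Expr ℤ n → Expr ℤ n
  y01 a b s t = a :* t :+ # 2 :* (b :* s)
  x11 : ∀ {n} → Expr ℤ n → Expr ℤ n → Expr ℤ n → Expr ℤ n → Expr ℤ n
  x11 a b s t = # 2 :* (a :* s) :- # 3 :* (b :* t)
  y11 : ∀ {n} → Expr ℤ n → Expr ℤ n → Expr ℤ n → Expr ℤ n → Expr ℤ n
  y11 a b s t = a :* t :+ b :* s :- a :* s

 N-mul : ∀ i j v w → N (i xor j) (mul i j v w) ≡ N i v * N j w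
 N-mul false false (a , b) (s , t) = solveℤ 4 (λ a b s t → n0 (x00 a b s t) (y00 a b s t) := n0 a b :* n0 s t) refl a b s t
 N-mul false true (a , b) (s , t) = solveℤ 4 (λ a b s t → n1 (x01 a b s t) (y01 a b s t) := n0 a b :* n1 s t) refl a b s t
 N-mul true false (a , b) (s , t) = solveℤ 4 (λ a b s t → n1 (a :* s :+ # 3 :* (t :* a) :- # 3 :* (b :* t)) (y01 s t a b) := n1 a b :* n0 s t) refl a b s t
 N-mul true true (a , b) (s , t) = solveℤ 4 (λ a b s t → n0 (x11 a b s t) (y11 a b s t) := n1 a b :* n1 s t) refl a b s t

 N-conj : ∀ i v → N i (conj i v) ≡ N i v
 N-conj false (s , t) = solveℤ 2 (λ s t → n0 (s :+ # 3 :* t) (:- t) := n0 s t) refl s t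
 N-conj true (s , t) = solveℤ 2 (λ s t → n1 s (s :- t) := n1 s t) refl s t

 N-scale : ∀ i k v → N i (scale k v) ≡ k * k * N i v
 N-scale false k (s , t) = solveℤ 3 (λ k s t → n0 (k :* s) (k :* t) := k :* k :* n0 s t) refl k s t
 N-scale true k (s , t) = solveℤ 3 (λ k s t → n1 (k :* s) (k :* t) := k :* k :* n1 s t) refl k s t

 conj-conj : ∀ i v → conj i (conj i v) ≡ v
 conj-conj false (s , t) = cong₂ _,_ (e1 s t) (e2 t)
  where
  e1 = solveℤ 2 (λ s t → s :+ # 3 :* t :+ # 3 :* :- t := s) refl
  e2 = solveℤ 1 (λ t → :- (:- t) := t) refl
 conj-conj true (s , t) = cong (s ,_) (solveℤ 2 (λ s t → s :- (s :- t) := t) refl s t)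

 conj-mul : ∀ j i π v → mul j (j xor i) (conj j π) (mul j i π v) ≡ scale (N j π) v
 conj-mul false false (a , b) (s , t) = cong₂ _,_ (e1 a b s t) (e2 a b s t)
  where
  e1 = solveℤ 4 (λ a b s t → x00 (a :+ # 3 :* b) (:- b) (x00 a b s t) (y00 a b s t) := n0 a b :* s) refl
  e2 = solveℤ 4 (λ a b s t → y00 (a :+ # 3 :* b) (:- b) (x00 a b s t) (y00 a b s t) := n0 a b :* t) refl
 conj-mul false true (a , b) (s , t) = cong₂ _,_ (e1 a b s t) (e2 a b s t)
  where
  e1 = solveℤ 4 (λ a b s t → x01 (a :+ # 3 :* b) (:- b) (x01 a b s t) (y01 a b s t) := n0 a b :* s) refl
  e2 = solveℤ 4 (λ a b s t → y01 (a :+ # 3 :* b) (:- b) (x01 a b s t) (y01 a b s t) := n0 a b :* t) refl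
 conj-mul true false (a , b) (s , t) = cong₂ _,_ (e1 a b s t) (e2 a b s t)
  where
  e1 = solveℤ 4 (λ a b s t → x11 a (a :- b) (a :* s :+ # 3 :* (t :* a) :- # 3 :* (b :* t)) (y01 s t a b) := n1 a b :* s) refl
  e2 = solveℤ 4 (λ a b s t → y11 a (a :- b) (a :* s :+ # 3 :* (t :* a) :- # 3 :* (b :* t)) (y01 s t a b) := n1 a b :* t) refl
 conj-mul true true (a , b) (s , t) = cong₂ _,_ (e1 a b s t) (e2 a b s t)
  where
  e1 = solveℤ 4 (λ a b s t → a :* x11 a b s t :+ # 3 :* (y11 a b s t :* a) :- # 3 :* ((a :- b) :* y11 a b s t) := n1 a b :* s) refl
  e2 = solveℤ 4 (λ a b s t → y01 (x11 a b s t) (y11 a b s t) a (a :- b) := n1 a b :* t) refl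

 conj-mul' : ∀ j i π v → mul j (j xor i) π (mul j i (conj j π) v) ≡ scale (N j π) v
 conj-mul' j i π v = trans (cong (λ z → mul j (j xor i) z (mul j i (conj j π) v)) (sym (conj-conj j π))) (trans (conj-mul j i (conj j π) v) (cong (λ z → scale z v) (N-conj j π)))

 mul-scale : ∀ j i k π v → mul j i π (scale k v) ≡ scale k (mul j i π v)
 mul-scale false false k (a , b) (s , t) = cong₂ _,_ (e1 k a b s t) (e2 k a b s t)
  where
  e1 = solveℤ 5 (λ k a b s t → x00 a b (k :* s) (k :* t) := k :* x00 a b s t) refl
  e2 = solveℤ 5 (λ k a b s t → y00 a b (k :* s) (k :* t) := k :* y00 a b s t) refl
 mul-scale false true k (a , b) (s , t) = cong₂ _,_ (e1 k a b s t) (e2 k a b s t)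
  where
  e1 = solveℤ 5 (λ k a b s t → x01 a b (k :* s) (k :* t) := k :* x01 a b s t) refl
  e2 = solveℤ 5 (λ k a b s t → y01 a b (k :* s) (k :* t) := k :* y01 a b s t) refl
 mul-scale true false k (a , b) (s , t) = cong₂ _,_ (e1 k a b s t) (e2 k a b s t)
  where
  e1 = solveℤ 5 (λ k a b s t → a :* (k :* s) :+ # 3 :* (k :* t :* a) :- # 3 :* (b :* (k :* t)) := k :* (a :* s :+ # 3 :* (t :* a) :- # 3 :* (b :* t))) refl
  e2 = solveℤ 5 (λ k a b s t → y01 (k :* s) (k :* t) a b := k :* y01 s t a b) refl
 mul-scale true true k (a , b) (s , t) = cong₂ _,_ (e1 k a b s t) (e2 k a b s t)
  where
  e1 = solveℤ 5 (λ k a b s t → x11 a b (k :* s) (k :* t) := k :* x11 a b s t) refl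
  e2 = solveℤ 5 (λ k a b s t → y11 a b (k :* s) (k :* t) := k :* y11 a b s t) refl

 scale-inj : ∀ p → 1 ℕ.≤ p → ∀ {v w} → scale ⟦ p ⟧ v ≡ scale ⟦ p ⟧ w → v ≡ w
 scale-inj (suc n) _ {s , t} {s' , t'} e = cong₂ _,_ (ℤP.*-cancelˡ-≡ ⟦ suc n ⟧ s s' (cong proj₁ e)) (ℤP.*-cancelˡ-≡ ⟦ suc n ⟧ t t' (cong proj₂ e))

 infix 4 _∣∣_
 _∣∣_ : ℤ → Pt → Set
 k ∣∣ (s , t) = (k ∣ s) × (k ∣ t)

 _∣∣?_ : ∀ k v → Dec (k ∣∣ v)
 k ∣∣? (s , t) = (k ∣? s) ×-dec (k ∣? t)

 ∣∣-scale : ∀ k v → k ∣∣ scale k v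
 ∣∣-scale k (s , t) = divides s (ℤP.*-comm k s) , divides t (ℤP.*-comm k t)

 ∣∣⇒scale : ∀ k v → k ∣∣ v → ∃ λ w → v ≡ scale k w
 ∣∣⇒scale k (s , t) (divides a e , divides b f) = (a , b) , cong₂ _,_ (trans e (ℤP.*-comm a k)) (trans f (ℤP.*-comm b k))

 private
  cancel : ∀ {p} → Prime p → ∀ k z → ¬ ⟦ p ⟧ ∣ k → ⟦ p ⟧ ∣ k * z → ⟦ p ⟧ ∣ z
  cancel pp k z n d with euclid pp k z d
  ... | inj₁ e = ⊥-elim (n e)
  ... | inj₂ e = e

 -- the discriminating coordinate: p ∣ N u and p ∣ crd u force p ∣ u
 crd : Bool → Pt → ℤ
 crd false = proj₂
 crd true = proj₁

 crd-full : ∀ {p} → Prime p → p ≢ 3 → ∀ k u → ⟦ p ⟧ ∣ N k u → ⟦ p ⟧ ∣ crd k u → ⟦ p ⟧ ∣∣ u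
 crd-full {p} pp ne false (A , B) d e = euclid-sq pp A (subst (⟦ p ⟧ ∣_) (solveℤ 2 (λ A B → n0 A B :- (# 3 :* A :+ # 6 :* B) :* B := A :* A) refl A B) (∣m∣n⇒∣m-n d (∣n⇒∣m*n (c3 * A + c6 * B) e))) , e
 crd-full {p} pp ne true (A , B) d e = e , euclid-sq pp B (cancel pp c3 (B * B) (λ f → ne (p∣q pp prime[3] f)) (subst (⟦ p ⟧ ∣_) (solveℤ 2 (λ A B → n1 A B :- (# 2 :* A :- # 3 :* B) :* A := # 3 :* (B :* B)) refl A B) (∣m∣n⇒∣m-n d (∣n⇒∣m*n (c2 * A - c3 * B) e))))

 -- The product of the discriminating coordinates of π̄v and πv, multiplied by 3 when both degrees
 -- are `true`, is a combination of N(π) and N(v). Euclid's lemma then selects one of the two; this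
 -- is what makes π behave as a prime element.
 crd-prod : ∀ {p} → Prime p → p ≢ 3 → ∀ j i π v → ⟦ p ⟧ ∣ N j π → ⟦ p ⟧ ∣ N i v → (⟦ p ⟧ ∣ crd (j xor i) (mul j i (conj j π) v)) ⊎ (⟦ p ⟧ ∣ crd (j xor i) (mul j i π v))
 crd-prod {p} pp ne false false (a , b) (s , t) d e = euclid pp _ _ (subst (⟦ p ⟧ ∣_) (solveℤ 4 (λ a b s t → t :* t :* n0 a b :- b :* b :* n0 s t := y00 (a :+ # 3 :* b) (:- b) s t :* y00 a b s t) refl a b s t) (∣m∣n⇒∣m-n (∣n⇒∣m*n (t * t) d) (∣n⇒∣m*n (b * b) e)))
 crd-prod {p} pp ne false true (a , b) (s , t) d e = euclid pp _ _ (subst (⟦ p ⟧ ∣_) (solveℤ 4 (λ a b s t → s :* s :* n0 a b :- # 3 :* (b :* b) :* n1 s t := x01 (a :+ # 3 :* b) (:- b) s t :* x01 a b s t) refl a b s t) (∣m∣n⇒∣m-n (∣n⇒∣m*n (s * s) d) (∣n⇒∣m*n (c3 * (b * b)) e)))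
 crd-prod {p} pp ne true false (a , b) (s , t) d e = euclid pp _ _ (subst (⟦ p ⟧ ∣_) (solveℤ 4 (λ a b s t → a :* a :* n0 s t :- # 3 :* (t :* t) :* n1 a b := (a :* s :+ # 3 :* (t :* a) :- # 3 :* ((a :- b) :* t)) :* (a :* s :+ # 3 :* (t :* a) :- # 3 :* (b :* t))) refl a b s t) (∣m∣n⇒∣m-n (∣n⇒∣m*n (a * a) e) (∣n⇒∣m*n (c3 * (t * t)) d)))
 crd-prod {p} pp ne true true (a , b) (s , t) d e = euclid pp _ _ (cancel pp c3 _ (λ f → ne (p∣q pp prime[3] f)) (subst (⟦ p ⟧ ∣_) (solveℤ 4 (λ a b s t → a :* a :* n1 s t :- s :* s :* n1 a b := # 3 :* (y11 a (a :- b) s t :* y11 a b s t)) refl a b s t) (∣m∣n⇒∣m-n (∣n⇒∣m*n (a * a) e) (∣n⇒∣m*n (s * s) d))))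

 module _ {p : ℕ} (pp : Prime p) (ne3 : p ≢ 3) (j : Bool) (π : Pt) (Nπ : N j π ≡ ⟦ p ⟧) where

  π̄ : Pt
  π̄ = conj j π

  Nπ̄ : N j π̄ ≡ ⟦ p ⟧
  Nπ̄ = trans (N-conj j π) Nπ

  -- divisibility by π, tested after multiplication by π̄
  D D̄ : Bool → Pt → Set
  D i v = ⟦ p ⟧ ∣∣ mul j i π̄ v
  D̄ i v = ⟦ p ⟧ ∣∣ mul j i π v

  p∣Nprod : ∀ i ρ v → ⟦ p ⟧ ∣ N i v → ⟦ p ⟧ ∣ N (j xor i) (mul j i ρ v)
  p∣Nprod i ρ v d = subst (⟦ p ⟧ ∣_) (sym (N-mul j i ρ v)) (∣n⇒∣m*n (N j ρ) d)

  D-or : ∀ i v → ⟦ p ⟧ ∣ N i v → D i v ⊎ D̄ i v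
  D-or i v d with crd-prod pp ne3 j i π v (divides 1ℤ (trans Nπ (sym (ℤP.*-identityˡ ⟦ p ⟧)))) d
  ... | inj₁ e = inj₁ (crd-full pp ne3 (j xor i) (mul j i π̄ v) (p∣Nprod i π̄ v d) e)
  ... | inj₂ e = inj₂ (crd-full pp ne3 (j xor i) (mul j i π v) (p∣Nprod i π v d) e)

  D⇒ : ∀ i v → D i v → ∃ λ w → v ≡ mul j (j xor i) π w
  D⇒ i v d with ∣∣⇒scale ⟦ p ⟧ (mul j i π̄ v) d
  ... | w , e = w , scale-inj p (p≥1 pp) (trans (cong (λ z → scale z v) (sym Nπ)) (trans (sym (conj-mul' j i π v)) (trans (cong (mul j (j xor i) π) e) (mul-scale j (j xor i) ⟦ p ⟧ π w))))

  D̄⇒ : ∀ i v → D̄ i v → ∃ λ w → v ≡ mul j (j xor i) π̄ w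
  D̄⇒ i v d with ∣∣⇒scale ⟦ p ⟧ (mul j i π v) d
  ... | w , e = w , scale-inj p (p≥1 pp) (trans (cong (λ z → scale z v) (sym Nπ)) (trans (sym (conj-mul j i π v)) (trans (cong (mul j (j xor i) π̄) e) (mul-scale j (j xor i) ⟦ p ⟧ π̄ w))))

  ⇒D : ∀ i w → D (j xor i) (mul j i π w)
  ⇒D i w = subst (⟦ p ⟧ ∣∣_) (sym (trans (conj-mul j i π w) (cong (λ z → scale z w) Nπ))) (∣∣-scale ⟦ p ⟧ w)

  ⇒D̄ : ∀ i w → D̄ (j xor i) (mul j i π̄ w)
  ⇒D̄ i w = subst (⟦ p ⟧ ∣∣_) (sym (trans (conj-mul' j i π w) (cong (λ z → scale z w) Nπ))) (∣∣-scale ⟦ p ⟧ w)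

  p∣∣⇒ : ∀ i ρ v → ⟦ p ⟧ ∣∣ v → ⟦ p ⟧ ∣∣ mul j i ρ v
  p∣∣⇒ i ρ v d with ∣∣⇒scale ⟦ p ⟧ v d
  ... | w , e = subst (λ z → ⟦ p ⟧ ∣∣ z) (sym (trans (cong (mul j i ρ) e) (mul-scale j i ⟦ p ⟧ ρ w))) (∣∣-scale ⟦ p ⟧ (mul j i ρ w))

 private
  -- p ∤ b (degree 0), p ∤ 2b - a (degree 1)
  no-ram₀ : ∀ {p} → Prime p → ∀ a b → N false (a , b) ≡ ⟦ p ⟧ → ¬ ⟦ p ⟧ ∣ b
  no-ram₀ {p} pp a b e d = absurd d (euclid-sq pp a (subst (⟦ p ⟧ ∣_) (eq a b) (∣m∣n⇒∣m-n (divides 1ℤ (trans e (sym (ℤP.*-identityˡ ⟦ p ⟧)))) (∣n⇒∣m*n (c3 * a + c6 * b) d))))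
   where
   eq = solveℤ 2 (λ a b → n0 a b :- (# 3 :* a :+ # 6 :* b) :* b := a :* a) refl
   eq2 = solveℤ 3 (λ a b p → n0 (a :* p) (b :* p) := n0 a b :* p :* p) refl
   absurd : ⟦ p ⟧ ∣ b → ⟦ p ⟧ ∣ a → ⊥
   absurd (divides b' eb) (divides a' ea) = unit∤ pp (N false (a' , b')) (trans (sym e) (trans (cong₂ (λ x y → N false (x , y)) ea eb) (eq2 a' b' ⟦ p ⟧)))

  no-ram₁ : ∀ {p} → Prime p → p ≢ 5 → ∀ a b → N true (a , b) ≡ ⟦ p ⟧ → ¬ ⟦ p ⟧ ∣ (c2 * b - a)
  no-ram₁ {p} pp ne5 a b e d = absurd d (euclid-sq pp b (cancel pp ⟦ 5 ⟧ (b * b) (λ g → ne5 (p∣q pp prime[5] g)) (subst (⟦ p ⟧ ∣_) (eq a b) (∣m∣n⇒∣m-n (divides 1ℤ (trans e (sym (ℤP.*-identityˡ ⟦ p ⟧)))) (∣n⇒∣m*n (c2 * (c2 * b - a) - ⟦ 5 ⟧ * b) d)))))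
   where
   eq = solveℤ 2 (λ a b → n1 a b :- (# 2 :* (# 2 :* b :- a) :- # 5 :* b) :* (# 2 :* b :- a) := # 5 :* (b :* b)) refl
   eq2 = solveℤ 3 (λ a b p → n1 (a :* p) (b :* p) := n1 a b :* p :* p) refl
   eq3 = solveℤ 2 (λ a b → a := # 2 :* b :- (# 2 :* b :- a)) refl
   eq4 = solveℤ 3 (λ b f p → # 2 :* (b :* p) :- f :* p := (# 2 :* b :- f) :* p) refl
   absurd : ⟦ p ⟧ ∣ (c2 * b - a) → ⟦ p ⟧ ∣ b → ⊥
   absurd (divides f ef) (divides b' eb) = unit∤ pp (N true (c2 * b' - f , b')) (trans (sym e) (trans (cong₂ (λ x y → N true (x , y)) ea eb) (eq2 (c2 * b' - f) b' ⟦ p ⟧)))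
     where
     ea : a ≡ (c2 * b' - f) * ⟦ p ⟧
     ea = trans (eq3 a b) (trans (cong₂ (λ x y → c2 * x - y) eb ef) (eq4 b' f ⟦ p ⟧))

  sub∣ : ∀ {p u v u' v'} → p ∣∣ (u , v) → p ∣∣ (u' , v') → (p ∣ u - u') × (p ∣ v - v')
  sub∣ (a , b) (c , d) = ∣m∣n⇒∣m-n a c , ∣m∣n⇒∣m-n b d

 module _ {p : ℕ} (pp : Prime p) (ne3 : p ≢ 3) (ne5 : p ≢ 5) where
  private
   ∤3 : ¬ ⟦ p ⟧ ∣ c3
   ∤3 d = ne3 (p∣q pp prime[3] d)
   ∤15 : ¬ ⟦ p ⟧ ∣ ⟦ 15 ⟧
   ∤15 d with euclid pp c3 ⟦ 5 ⟧ d
   ... | inj₁ e = ∤3 e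
   ... | inj₂ e = ne5 (p∣q pp prime[5] e)

  -- π v ≡ π̄ v ≡ 0 gives (π - π̄) v ≡ 0, and π - π̄ is b √-15 or (2b - a) √-3
  D-both : ∀ j i π v → (Nπ : N j π ≡ ⟦ p ⟧) → ⟦ p ⟧ ∣∣ mul j i (conj j π) v → ⟦ p ⟧ ∣∣ mul j i π v → ⟦ p ⟧ ∣∣ v
  D-both false false (a , b) (s , t) e d d' =
    fin s (subst (⟦ p ⟧ ∣_) (e1 a b s t) (∣m⇒∣-m (∣m∣n⇒∣m+n (∣n⇒∣m*n c3 (proj₁ x)) (∣n⇒∣m*n ⟦ 12 ⟧ (proj₂ x))))) ,
    fin t (subst (⟦ p ⟧ ∣_) (e2 a b s t) (∣m∣n⇒∣m+n (∣n⇒∣m*n c2 (proj₁ x)) (∣n⇒∣m*n c3 (proj₂ x))))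
   where
   x = sub∣ d d'
   fin : ∀ z → ⟦ p ⟧ ∣ ⟦ 15 ⟧ * (b * z) → ⟦ p ⟧ ∣ z
   fin z h = cancel pp b z (no-ram₀ pp a b e) (cancel pp ⟦ 15 ⟧ (b * z) ∤15 h)
   e1 = solveℤ 4 (λ a b s t → :- (# 3 :* (x00 (a :+ # 3 :* b) (:- b) s t :- x00 a b s t) :+ # 12 :* (y00 (a :+ # 3 :* b) (:- b) s t :- y00 a b s t)) := # 15 :* (b :* s)) refl
   e2 = solveℤ 4 (λ a b s t → # 2 :* (x00 (a :+ # 3 :* b) (:- b) s t :- x00 a b s t) :+ # 3 :* (y00 (a :+ # 3 :* b) (:- b) s t :- y00 a b s t) := # 15 :* (b :* t)) refl

  D-both false true (a , b) (s , t) e d d' =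
    fin s (subst (⟦ p ⟧ ∣_) (e1 a b s t) (∣m∣n⇒∣m-n (∣n⇒∣m*n c3 (proj₁ x)) (∣n⇒∣m*n c6 (proj₂ x)))) ,
    fin t (subst (⟦ p ⟧ ∣_) (e2 a b s t) (∣m∣n⇒∣m-n (∣n⇒∣m*n ⟦ 4 ⟧ (proj₁ x)) (∣n⇒∣m*n c3 (proj₂ x))))
   where
   x = sub∣ d d'
   fin : ∀ z → ⟦ p ⟧ ∣ ⟦ 15 ⟧ * (b * z) → ⟦ p ⟧ ∣ z
   fin z h = cancel pp b z (no-ram₀ pp a b e) (cancel pp ⟦ 15 ⟧ (b * z) ∤15 h)
   e1 = solveℤ 4 (λ a b s t → # 3 :* (x01 (a :+ # 3 :* b) (:- b) s t :- x01 a b s t) :- # 6 :* (y01 (a :+ # 3 :* b) (:- b) s t :- y01 a b s t) := # 15 :* (b :* s)) refl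
   e2 = solveℤ 4 (λ a b s t → # 4 :* (x01 (a :+ # 3 :* b) (:- b) s t :- x01 a b s t) :- # 3 :* (y01 (a :+ # 3 :* b) (:- b) s t :- y01 a b s t) := # 15 :* (b :* t)) refl
  D-both true false (a , b) (s , t) e d d' =
    cancel pp (c2 * b - a) s (no-ram₁ pp ne5 a b e) (subst (⟦ p ⟧ ∣_) (e1 a b s t) (∣m⇒∣-m (proj₂ x))) ,
    cancel pp (c2 * b - a) t (no-ram₁ pp ne5 a b e) (cancel pp c3 ((c2 * b - a) * t) ∤3 (subst (⟦ p ⟧ ∣_) (e2 a b s t) (proj₁ x)))
   where
   x = sub∣ d d'
   e1 = solveℤ 4 (λ a b s t → :- (y01 s t a (a :- b) :- y01 s t a b) := (# 2 :* b :- a) :* s) refl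
   e2 = solveℤ 4 (λ a b s t → a :* s :+ # 3 :* (t :* a) :- # 3 :* ((a :- b) :* t) :- (a :* s :+ # 3 :* (t :* a) :- # 3 :* (b :* t)) := # 3 :* ((# 2 :* b :- a) :* t)) refl
  D-both true true (a , b) (s , t) e d d' =
    cancel pp (c2 * b - a) s (no-ram₁ pp ne5 a b e) (subst (⟦ p ⟧ ∣_) (e1 a b s t) (∣m⇒∣-m (proj₂ x))) ,
    cancel pp (c2 * b - a) t (no-ram₁ pp ne5 a b e) (cancel pp c3 ((c2 * b - a) * t) ∤3 (subst (⟦ p ⟧ ∣_) (e2 a b s t) (proj₁ x)))
   where
   x = sub∣ d d'
   e1 = solveℤ 4 (λ a b s t → :- (y11 a (a :- b) s t :- y11 a b s t) := (# 2 :* b :- a) :* s) refl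
   e2 = solveℤ 4 (λ a b s t → x11 a (a :- b) s t :- x11 a b s t := # 3 :* ((# 2 :* b :- a) :* t)) refl

 private
  rootOf₀ : ∀ {p} → Prime p → ∀ s t → ⟦ p ⟧ ∣ N false (s , t) → ¬ ⟦ p ⟧ ∣∣ (s , t) → ∃ λ r → ⟦ p ⟧ ∣ N false (r , 1ℤ)
  rootOf₀ {p} pp s t d nd with ⟦ p ⟧ ∣? t
  ... | yes e = ⊥-elim (nd (euclid-sq pp s (subst (⟦ p ⟧ ∣_) (solveℤ 2 (λ s t → n0 s t :- (# 3 :* s :+ # 6 :* t) :* t := s :* s) refl s t) (∣m∣n⇒∣m-n d (∣n⇒∣m*n (c3 * s + c6 * t) e))) , e))
  ... | no n with inverse pp t n
  ... | u , k , e = s * u , subst (⟦ p ⟧ ∣_) (eq s t u) (∣m∣n⇒∣m-n (∣m⇒∣m*n (u * u) d) (∣m⇒∣m*n (c3 * (s * u) + c6 * (t * u + 1ℤ)) (divides k (trans (cong (_- 1ℤ) e) (l k ⟦ p ⟧)))))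
   where
   l = solveℤ 2 (λ k p → # 1 :+ k :* p :- # 1 := k :* p) refl
   eq = solveℤ 3 (λ s t u → n0 s t :* (u :* u) :- (t :* u :- # 1) :* (# 3 :* (s :* u) :+ # 6 :* (t :* u :+ # 1)) := n0 (s :* u) (# 1)) refl

 -- Degree `true` is reduced to degree `false` by multiplication with ε, the point (1,0), whose norm
 -- is 2. Hence the exclusion of p = 2.
 rootOf : ∀ {p} → Prime p → p ≢ 2 → ∀ i v → ⟦ p ⟧ ∣ N i v → ¬ ⟦ p ⟧ ∣∣ v → ∃ λ r → ⟦ p ⟧ ∣ N false (r , 1ℤ)
 rootOf pp ne2 false (s , t) = rootOf₀ pp s t
 rootOf {p} pp ne2 true (s , t) d nd = rootOf₀ pp _ _ (subst (⟦ p ⟧ ∣_) (sym (N-mul true true (1ℤ , 0ℤ) (s , t))) (∣n⇒∣m*n c2 d))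
   (λ x → nd (h s (subst (⟦ p ⟧ ∣_) (e1 s t) (proj₁ x)) , subst (⟦ p ⟧ ∣_) (e3 s t) (∣m∣n⇒∣m+n (subst (⟦ p ⟧ ∣_) (e2 s t) (proj₂ x)) (h s (subst (⟦ p ⟧ ∣_) (e1 s t) (proj₁ x))))))
  where
  h : ∀ z → ⟦ p ⟧ ∣ c2 * z → ⟦ p ⟧ ∣ z
  h z = cancel pp c2 z (λ d → ne2 (p∣q pp prime[2] d))
  e1 = solveℤ 2 (λ s t → x11 (# 1) (# 0) s t := # 2 :* s) refl
  e2 = solveℤ 2 (λ s t → y11 (# 1) (# 0) s t := t :- s) refl
  e3 = solveℤ 2 (λ s t → t :- s :+ s := t) refl

 sq-nonneg : ∀ a → 0ℤ ℤ.≤ a * a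
 sq-nonneg (ℤ.+ n) = subst (0ℤ ℤ.≤_) (ℤP.pos-* n n) (ℤ.+≤+ z≤n)
 sq-nonneg (ℤ.-[1+ n ]) = ℤ.+≤+ z≤n

 N-nonneg : ∀ i v → ∃ λ n → N i v ≡ ⟦ n ⟧
 N-nonneg i v = ℤ.∣ N i v ∣ , sym (ℤP.0≤i⇒+∣i∣≡i (pos i v))
  where
  e0 = solveℤ 2 (λ s t → # 4 :* n0 s t := (# 2 :* s :+ # 3 :* t) :* (# 2 :* s :+ # 3 :* t) :+ # 15 :* (t :* t)) refl
  e1 = solveℤ 2 (λ s t → # 8 :* n1 s t := (# 4 :* s :- # 3 :* t) :* (# 4 :* s :- # 3 :* t) :+ # 15 :* (t :* t)) refl
  pos : ∀ i v → 0ℤ ℤ.≤ N i v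
  pos false (s , t) = ℤP.*-cancelˡ-≤-pos 0ℤ (N false (s , t)) ⟦ 4 ⟧ (subst (0ℤ ℤ.≤_) (sym (e0 s t)) (ℤP.+-mono-≤ (sq-nonneg (c2 * s + c3 * t)) (ℤP.*-monoˡ-≤-nonNeg ⟦ 15 ⟧ (sq-nonneg t))))
  pos true (s , t) = ℤP.*-cancelˡ-≤-pos 0ℤ (N true (s , t)) ⟦ 8 ⟧ (subst (0ℤ ℤ.≤_) (sym (e1 s t)) (ℤP.+-mono-≤ (sq-nonneg (⟦ 4 ⟧ * s - c3 * t)) (ℤP.*-monoˡ-≤-nonNeg ⟦ 15 ⟧ (sq-nonneg t))))

 Elt : ℕ → Set
 Elt p = ∃ λ j → ∃ λ π → N j π ≡ ⟦ p ⟧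

 -- The prime 3 ramifies, and ν = √-3, the point (0,1) of degree `true`, generates the prime above
 -- it. Modulo 3 both norms reduce to a multiple of s², which gives 3 | s.
 div3 : ∀ i v → ⟦ 3 ⟧ ∣ N i v → ∃ λ w → v ≡ mul true (true xor i) (0ℤ , 1ℤ) w
 div3 false (s , t) d = fin (euclid-sq prime[3] s (subst (⟦ 3 ⟧ ∣_) (eq s t) (∣m∣n⇒∣m-n d (∣m⇒∣m*n (s * t + c2 * (t * t)) ∣-refl))))
  where
  eq = solveℤ 2 (λ s t → n0 s t :- # 3 :* y01 s t t t := s :* s) refl
  e1 = solveℤ 2 (λ s t → s :* # 3 := x11 (# 0) (# 1) t (:- s)) refl
  e2 = solveℤ 2 (λ s t → t := y11 (# 0) (# 1) t (:- s)) refl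
  fin : ⟦ 3 ⟧ ∣ s → ∃ λ w → (s , t) ≡ mul true true (0ℤ , 1ℤ) w
  fin (divides s' e) = (t , - s') , cong₂ _,_ (trans e (e1 s' t)) (e2 s' t)
 div3 true (s , t) d = fin (euclid-sq prime[3] s (subst (⟦ 3 ⟧ ∣_) (eq s t) (∣m∣n⇒∣m-n (∣n⇒∣m*n c2 d) (∣m⇒∣m*n (s * s - c2 * (s * t) + c2 * (t * t)) ∣-refl))))
  where
  eq = solveℤ 2 (λ s t → # 2 :* n1 s t :- # 3 :* (s :* s :- # 2 :* (s :* t) :+ # 2 :* (t :* t)) := s :* s) refl
  e1 = solveℤ 2 (λ s t → s :* # 3 := # 0 :* t :+ # 3 :* (:- s :* # 0) :- # 3 :* (# 1 :* :- s)) refl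
  e2 = solveℤ 2 (λ s t → t := y01 t (:- s) (# 0) (# 1)) refl
  fin : ⟦ 3 ⟧ ∣ s → ∃ λ w → (s , t) ≡ mul true false (0ℤ , 1ℤ) w
  fin (divides s' e) = (t , - s') , cong₂ _,_ (trans e (e1 s' t)) (e2 s' t)

 private
  -- Fermat descent: an element of norm k p is divided by elements of norm q for the primes q ∣ k
  module Descent {p : ℕ} (pp : Prime p) (ih : ∀ {q} → q ℕ.< p → Prime q → ∀ i v → ⟦ q ⟧ ∣ N i v → ¬ ⟦ q ⟧ ∣∣ v → Elt q) where

   descend : ∀ k → Acc ℕ._<_ k → 1 ℕ.≤ k → k ℕ.< p → ∀ i v → N i v ≡ ⟦ k ℕ.* p ⟧ → Elt p

   by-elt : ∀ k → Acc ℕ._<_ k → 1 ℕ.≤ k → k ℕ.< p → ∀ i v w q m → k ≡ q ℕ.* m → Prime q → m ℕ.< k → ∀ j ρ → N j ρ ≡ ⟦ q ⟧ → v ≡ mul j (j xor i) ρ w → N i v ≡ ⟦ k ℕ.* p ⟧ → Elt p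
   by-elt k (acc rs) k≥1 k<p i v w q m ek pq m<k j ρ Nρ ev Nv = descend m (rs m<k) (*≥1⇒ q k≥1 ek) (ℕP.<-trans m<k k<p) (j xor i) w Nw
     where
     xx : ∀ j i → j xor (j xor i) ≡ i
     xx false i = refl
     xx true false = refl
     xx true true = refl
     Nw : N (j xor i) w ≡ ⟦ m ℕ.* p ⟧
     Nw = ℤP.*-cancelˡ-≡ ⟦ q ⟧ _ _ {{ℕ.>-nonZero (p≥1 pq)}} (trans (cong (_* N (j xor i) w) (sym Nρ)) (trans (sym (N-mul j (j xor i) ρ w)) (trans (cong₂ N (xx j i) (sym ev)) (trans Nv (trans (cong ⟦_⟧ (trans (cong (ℕ._* p) ek) (ℕP.*-assoc q m p))) (ℤP.pos-* q (m ℕ.* p)))))))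

   descend k a k≥1 k<p i v Nv with 2 ℕ.≤? k
   ... | no n = i , v , trans Nv (cong ⟦_⟧ (trans (cong (ℕ._* p) (ℕP.≤-antisym (ℕP.≤-pred (ℕP.≰⇒> n)) k≥1)) (ℕP.*-identityˡ p)))
   ... | yes k≥2 with prime-div k k≥2
   ... | q , pq , m , ek , m≥1 , m<k with q ℕ.≟ 3
   ... | yes refl = by-elt k a k≥1 k<p i v (proj₁ d3) 3 m ek pq m<k true (0ℤ , 1ℤ) refl (proj₂ d3) Nv
     where
     q∣N : ⟦ 3 ⟧ ∣ N i v
     q∣N = subst (⟦ 3 ⟧ ∣_) (sym Nv) (ℕ∣ (subst (λ z → 3 ℕD.∣ z ℕ.* p) (sym ek) (ℕD.∣m⇒∣m*n p (ℕD.m∣m*n m))))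
     d3 = div3 i v q∣N
   ... | no ne3 = go (⟦ q ⟧ ∣∣? v)
     where
     q<p : q ℕ.< p
     q<p = ℕP.≤-<-trans (subst (q ℕ.≤_) (sym ek) (ℕP.m≤m*n q m {{ℕ.>-nonZero m≥1}})) k<p
     q∣N : ⟦ q ⟧ ∣ N i v
     q∣N = subst (⟦ q ⟧ ∣_) (sym Nv) (ℕ∣ (subst (λ z → q ℕD.∣ z ℕ.* p) (sym ek) (ℕD.∣m⇒∣m*n p (ℕD.m∣m*n m))))
     go : Dec (⟦ q ⟧ ∣∣ v) → Elt p
     go (no nd) with ih q<p pq i v q∣N nd
     ... | j , ρ , Nρ with D-or pq ne3 j ρ Nρ i v q∣N
     ... | inj₁ dd = by-elt k a k≥1 k<p i v (proj₁ x) q m ek pq m<k j ρ Nρ (proj₂ x) Nv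
      where x = D⇒ pq ne3 j ρ Nρ i v dd
     ... | inj₂ dd = by-elt k a k≥1 k<p i v (proj₁ x) q m ek pq m<k j (conj j ρ) (Nπ̄ pq ne3 j ρ Nρ) (proj₂ x) Nv
      where x = D̄⇒ pq ne3 j ρ Nρ i v dd
     go (yes d) with ∣∣⇒scale ⟦ q ⟧ v d
     ... | w , ew = down a
      where
      q≢0 = ℕ.>-nonZero (p≥1 pq)
      eqN : ⟦ q ⟧ * (⟦ q ⟧ * N i w) ≡ ⟦ q ⟧ * ⟦ m ℕ.* p ⟧
      eqN = trans (sym (ℤP.*-assoc ⟦ q ⟧ ⟦ q ⟧ (N i w))) (trans (sym (N-scale i ⟦ q ⟧ w)) (trans (cong (N i) (sym ew)) (trans Nv (trans (cong ⟦_⟧ (trans (cong (ℕ._* p) ek) (ℕP.*-assoc q m p))) (ℤP.pos-* q (m ℕ.* p))))))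
      qN : ⟦ q ⟧ * N i w ≡ ⟦ m ℕ.* p ⟧
      qN = ℤP.*-cancelˡ-≡ ⟦ q ⟧ _ _ {{q≢0}} eqN
      q∣m : q ℕD.∣ m
      q∣m with euclidsLemma m p pq (∣ℕ (divides (N i w) (trans (sym qN) (ℤP.*-comm ⟦ q ⟧ (N i w)))))
      ... | inj₁ x = x
      ... | inj₂ x = ⊥-elim (ℕP.<⇒≢ q<p (prime∣prime pq pp x))
      m' = ℕD.quotient q∣m
      em : m ≡ q ℕ.* m'
      em = trans (ℕD._∣_.equality q∣m) (ℕP.*-comm m' q)
      m'≤m : m' ℕ.≤ m
      m'≤m = subst (m' ℕ.≤_) (sym em) (ℕP.m≤n*m m' q {{q≢0}})
      Nw : N i w ≡ ⟦ m' ℕ.* p ⟧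
      Nw = ℤP.*-cancelˡ-≡ ⟦ q ⟧ _ _ {{q≢0}} (trans qN (trans (cong ⟦_⟧ (trans (cong (ℕ._* p) em) (ℕP.*-assoc q m' p))) (ℤP.pos-* q (m' ℕ.* p))))
      down : Acc ℕ._<_ k → Elt p
      down (acc rs) = descend m' (rs (ℕP.≤-<-trans m'≤m m<k)) (*≥1⇒ q m≥1 em) (ℕP.≤-<-trans m'≤m (ℕP.<-trans m<k k<p)) i w Nw

  -- For a centred root of absolute value n the norm is kp with k < p, as the descent requires.
  small : ∀ {p} → Prime p → ∀ n → 2 ℕ.* n ℕ.≤ p → 7 ℕ.≤ p → (n ℕ.* n ℕ.+ 3 ℕ.* n) ℕ.+ 6 ℕ.< p ℕ.* p
  small {p} pp n h k = ℕP.*-cancelˡ-< 4 _ _ (ℕP.≤-<-trans (subst (ℕ._≤ (p ℕ.* p ℕ.+ 6 ℕ.* p) ℕ.+ 24) (e1 n) (ℕP.+-monoˡ-≤ 24 (ℕP.+-mono-≤ (ℕP.*-mono-≤ h h) (ℕP.*-monoʳ-≤ 6 h)))) s2)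
   where
   e1 = solveℕ 1 (λ n → ((Κ 2 :* n) :* (Κ 2 :* n) :+ Κ 6 :* (Κ 2 :* n)) :+ Κ 24 := Κ 4 :* ((n :* n :+ Κ 3 :* n) :+ Κ 6)) refl
   e2 = solveℕ 1 (λ p → (p :* p :+ Κ 7 :* p) :+ Κ 2 :* (p :* p) := Κ 3 :* (p :* p) :+ Κ 7 :* p) refl
   p7 : 7 ℕ.* p ℕ.≤ p ℕ.* p
   p7 = ℕP.*-monoˡ-≤ p k
   s2 : (p ℕ.* p ℕ.+ 6 ℕ.* p) ℕ.+ 24 ℕ.< 4 ℕ.* (p ℕ.* p)
   s2 = ℕP.<-≤-trans (ℕP.+-mono-≤-< (ℕP.+-monoʳ-≤ (p ℕ.* p) (ℕP.≤-trans (ℕP.*-monoˡ-≤ p (ℕP.n≤1+n 6)) p7)) (ℕP.<-≤-trans (ℕP.m≤m+n 25 24) (ℕP.*-mono-≤ k k))) (ℕP.≤-trans (ℕP.m≤m+n _ (p ℕ.* p)) (ℕP.≤-reflexive (solveℕ 1 (λ p → ((p :* p :+ p :* p) :+ p :* p) :+ p :* p := Κ 4 :* (p :* p)) refl p)))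

 centred : ∀ p → 1 ℕ.≤ p → ∀ r → ∃ λ r' → 2 ℕ.* ℤ.∣ r' ∣ ℕ.≤ p × ∃ λ k → r' ≡ r + k * ⟦ p ⟧
 centred p h r with reduce p h r
 ... | a , a<p , k , e with 2 ℕ.* a ℕ.≤? p
 ... | yes le = ⟦ a ⟧ , le , - k , trans (solveℤ 3 (λ a k p → a := a :+ k :* p :+ :- k :* p) refl ⟦ a ⟧ k ⟦ p ⟧) (cong (_+ (- k) * ⟦ p ⟧) (sym e))
 ... | no nle = - ⟦ p ℕ.∸ a ⟧ , subst (λ z → 2 ℕ.* z ℕ.≤ p) (sym (ℤP.∣-i∣≡∣i∣ ⟦ p ℕ.∸ a ⟧)) b , - k - 1ℤ , trans (cong -_ (trans (sym (ℤP.⊖-≥ (ℕP.<⇒≤ a<p))) (sym (ℤP.m-n≡m⊖n p a)))) (trans (l ⟦ a ⟧ k ⟦ p ⟧) (cong (_+ (- k - 1ℤ) * ⟦ p ⟧) (sym e)))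
  where
  l = solveℤ 3 (λ a k p → :- (p :- a) := a :+ k :* p :+ (:- k :- # 1) :* p) refl
  b : 2 ℕ.* (p ℕ.∸ a) ℕ.≤ p
  b = ℕP.+-cancelʳ-≤ (2 ℕ.* a) _ _ (ℕP.≤-trans (ℕP.≤-reflexive (trans (sym (ℕP.*-distribˡ-+ 2 (p ℕ.∸ a) a)) (cong (2 ℕ.*_) (ℕP.m∸n+n≡m (ℕP.<⇒≤ a<p))))) (ℕP.≤-trans (ℕP.≤-reflexive (cong (p ℕ.+_) (ℕP.+-identityʳ p))) (ℕP.+-monoʳ-≤ p (ℕP.<⇒≤ (ℕP.≰⇒> nle)))))

 private
  N1≤ : ∀ r → N false (r , 1ℤ) ℤ.≤ ⟦ (ℤ.∣ r ∣ ℕ.* ℤ.∣ r ∣ ℕ.+ 3 ℕ.* ℤ.∣ r ∣) ℕ.+ 6 ⟧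
  N1≤ (ℤ.+ n) = ℤP.≤-reflexive (trans (solveℤ 1 (λ r → n0 r (# 1) := r :* r :+ # 3 :* r :+ # 6) refl ⟦ n ⟧) (trans (cong₂ (λ x y → x + y + c6) (sym (ℤP.pos-* n n)) (sym (ℤP.pos-* 3 n))) refl))
  N1≤ r@(ℤ.-[1+ m ]) = ℤP.≤-trans (subst (N false (r , 1ℤ) ℤ.≤_) (solveℤ 1 (λ n → n0 (:- n) (# 1) :+ # 6 :* n := n0 n (# 1)) refl ⟦ suc m ⟧) (subst (ℤ._≤ N false (r , 1ℤ) + c6 * ⟦ suc m ⟧) (ℤP.+-identityʳ _) (ℤP.+-monoʳ-≤ (N false (r , 1ℤ)) (ℤ.+≤+ z≤n)))) (N1≤ (ℤ.+ suc m))

 private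
  N1-pos : ∀ r → ⟦ 15 ⟧ ℤ.≤ ⟦ 4 ⟧ * N false (r , 1ℤ)
  N1-pos r = subst (⟦ 15 ⟧ ℤ.≤_) (sym (solveℤ 1 (λ r → # 4 :* n0 r (# 1) := (# 2 :* r :+ # 3) :* (# 2 :* r :+ # 3) :+ # 15) refl r)) (subst (ℤ._≤ (c2 * r + c3) * (c2 * r + c3) + ⟦ 15 ⟧) (ℤP.+-identityˡ ⟦ 15 ⟧) (ℤP.+-monoˡ-≤ ⟦ 15 ⟧ (sq-nonneg (c2 * r + c3))))

 -- A centred root of s² + 3s + 6 modulo p starts the descent, whose result may have either degree.
 -- The primes 2, 3 and 5 are the norms of ε, √-3 and √5 = 2ε + ν.
 elt-exists : ∀ p → Prime p → ∀ i v → ⟦ p ⟧ ∣ N i v → ¬ ⟦ p ⟧ ∣∣ v → Elt p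
 elt-exists p = go p (<-wellFounded p)
  where
  go : ∀ p → Acc ℕ._<_ p → Prime p → ∀ i v → ⟦ p ⟧ ∣ N i v → ¬ ⟦ p ⟧ ∣∣ v → Elt p
  big : ∀ p → Acc ℕ._<_ p → Prime p → 7 ℕ.≤ p → ∀ i v → ⟦ p ⟧ ∣ N i v → ¬ ⟦ p ⟧ ∣∣ v → Elt p
  big p (acc rs) pp p≥7 i v d nd with rootOf pp (λ { refl → ℕP.<⇒≱ (ℕP.m≤m+n 3 4) p≥7 }) i v d nd
  ... | r , dr with centred p (p≥1 pp) r
  ... | r' , hr , k , er with N-nonneg false (r' , 1ℤ)
  ... | n , en = Descent.descend pp (λ q<p → go _ (rs q<p)) m (<-wellFounded m) m≥1 m<p false (r' , 1ℤ) (trans en (cong ⟦_⟧ (ℕD._∣_.equality p∣n)))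
   where
   eqN = solveℤ 3 (λ r k p → n0 r (# 1) :+ p :* (k :* (# 2 :* r :+ k :* p :+ # 3)) := n0 (r :+ k :* p) (# 1)) refl
   p∣n : p ℕD.∣ n
   p∣n = ∣ℕ (subst (⟦ p ⟧ ∣_) (trans (eqN r k ⟦ p ⟧) (trans (cong (λ z → N false (z , 1ℤ)) (sym er)) en)) (∣m∣n⇒∣m+n dr (∣m⇒∣m*n (k * (c2 * r + k * ⟦ p ⟧ + c3)) ∣-refl)))
   m = ℕD.quotient p∣n
   n<p² : n ℕ.< p ℕ.* p
   n<p² = ℕP.≤-<-trans (ℤP.drop‿+≤+ (subst (ℤ._≤ ⟦ (ℤ.∣ r' ∣ ℕ.* ℤ.∣ r' ∣ ℕ.+ 3 ℕ.* ℤ.∣ r' ∣) ℕ.+ 6 ⟧) en (N1≤ r'))) (small pp ℤ.∣ r' ∣ hr p≥7)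
   m<p : m ℕ.< p
   m<p = ℕP.*-cancelʳ-< p m p (subst (ℕ._< p ℕ.* p) (ℕD._∣_.equality p∣n) n<p²)
   n≢0 : n ≢ 0
   n≢0 e0 = ℕP.<⇒≱ (s≤s z≤n) (ℤP.drop‿+≤+ (ℤP.≤-trans (N1-pos r') (ℤP.≤-reflexive (cong (⟦ 4 ⟧ *_) (trans en (cong ⟦_⟧ e0))))))
   m≥1 : 1 ℕ.≤ m
   m≥1 = *≥1⇒ p (ℕP.n≢0⇒n>0 n≢0) (trans (ℕD._∣_.equality p∣n) (ℕP.*-comm m p))
  go 0 _ pp = ⊥-elim (¬prime[0] pp)
  go 1 _ pp = ⊥-elim (¬prime[1] pp)
  go 2 _ pp _ _ _ _ = true , (1ℤ , 0ℤ) , refl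
  go 3 _ pp _ _ _ _ = true , (0ℤ , 1ℤ) , refl
  go 4 _ pp = ⊥-elim (composite⇒¬prime composite[4] pp)
  go 5 _ pp _ _ _ _ = true , (⟦ 2 ⟧ , 1ℤ) , refl
  go 6 _ pp = ⊥-elim (composite⇒¬prime composite[6] pp)
  go p@(suc (suc (suc (suc (suc (suc (suc _))))))) a pp = big p a pp (s≤s (s≤s (s≤s (s≤s (s≤s (s≤s (s≤s z≤n)))))))

-- The ring class character of conductor 3 and its Hecke relations

module RingClassWeights where
 open import Data.Bool using (Bool; true; false; _xor_)
 open import Data.Integer as ℤ using (ℤ)
 open import Data.List using (List; []; _∷_; map; filter; cartesianProduct)
 open import Data.List.Membership.Propositional using (_∈_)
 open import Data.List.Membership.Propositional.Properties using (∈-map⁺; ∈-map⁻; ∈-filter⁺; ∈-filter⁻; ∈-cartesianProduct⁺)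
 open import Data.List.Membership.Propositional.Properties.WithK using (unique∧set⇒bag)
 open import Data.List.Relation.Binary.BagAndSetEquality using (∼bag⇒↭)
 open import Data.List.Relation.Binary.Permutation.Propositional using (_↭_; refl; prep; swap; trans)
 open import Data.List.Relation.Unary.Any using (here; there)
 open import Data.List.Relation.Unary.All using (All; []; _∷_)
 import Data.List.Relation.Unary.All as All
 open import Data.List.Relation.Unary.AllPairs using ([]; _∷_)
 open import Data.List.Relation.Unary.Unique.Propositional using (Unique)
 import Data.List.Relation.Unary.Unique.Propositional.Properties as U
 open import Data.Rational using (ℚ; _+_; _*_; 0ℚ; 1ℚ; ∣_∣)
 open import Data.Rational.Properties
 open import Function.Bundles using (mk⇔)
 open import Relation.Nullary.Decidable using (from-yes; map′; _×-dec_)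
 open import Relation.Unary using (Decidable)
 open import Relation.Binary.PropositionalEquality as E using (_≡_; _≢_; cong; cong₂; sym; subst)
 open Rationals
 open Valuations using (p≥1)
 open Integers
 open NormForms

 data Z3 : Set where
  z0 z1 z2 : Z3

 inc neg : Z3 → Z3
 inc z0 = z1
 inc z1 = z2
 inc z2 = z0
 neg z0 = z0
 neg z1 = z2
 neg z2 = z1

 infixl 6 _⊞_
 infixl 7 _⊠_
 _⊞_ _⊠_ : Z3 → Z3 → Z3
 z0 ⊞ y = y
 z1 ⊞ y = inc y
 z2 ⊞ y = inc (inc y)
 z0 ⊠ y = z0
 z1 ⊠ y = y
 z2 ⊠ y = neg y

 _≟3_ : (x y : Z3) → Dec (x ≡ y)
 z0 ≟3 z0 = yes E.refl
 z0 ≟3 z1 = no λ ()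
 z0 ≟3 z2 = no λ ()
 z1 ≟3 z0 = no λ ()
 z1 ≟3 z1 = yes E.refl
 z1 ≟3 z2 = no λ ()
 z2 ≟3 z0 = no λ ()
 z2 ≟3 z1 = no λ ()
 z2 ≟3 z2 = yes E.refl

 all3 : {P : Z3 → Set} → Decidable P → Dec (∀ x → P x)
 all3 {P} d = map′ to (λ f → f z0 , f z1 , f z2) (d z0 ×-dec d z1 ×-dec d z2)
  where
  to : P z0 × P z1 × P z2 → ∀ x → P x
  to (a , b , c) z0 = a
  to (a , b , c) z1 = b
  to (a , b , c) z2 = c

 resN : ℕ → Z3
 resN zero = z0
 resN (suc n) = inc (resN n)

 res : ℤ → Z3
 res (ℤ.+ n) = resN n
 res (ℤ.-[1+ n ]) = neg (resN (suc n))

 private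
  inc-⊞ : ∀ x y → inc x ⊞ y ≡ inc (x ⊞ y)
  inc-⊞ = from-yes (all3 λ x → all3 λ y → (inc x ⊞ y) ≟3 inc (x ⊞ y))
  ⊖-inc : ∀ x y → inc x ⊞ neg (inc y) ≡ x ⊞ neg y
  ⊖-inc = from-yes (all3 λ x → all3 λ y → (inc x ⊞ neg (inc y)) ≟3 (x ⊞ neg y))
  ⊞-0 : ∀ x → x ⊞ z0 ≡ x
  ⊞-0 = from-yes (all3 λ x → (x ⊞ z0) ≟3 x)
  neg-⊞ : ∀ x y → neg (inc (x ⊞ inc y)) ≡ neg (inc x) ⊞ neg (inc y)
  neg-⊞ = from-yes (all3 λ x → all3 λ y → neg (inc (x ⊞ inc y)) ≟3 (neg (inc x) ⊞ neg (inc y)))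
  ⊞-comm : ∀ x y → x ⊞ y ≡ y ⊞ x
  ⊞-comm = from-yes (all3 λ x → all3 λ y → (x ⊞ y) ≟3 (y ⊞ x))
  neg-neg : ∀ x → neg (neg x) ≡ x
  neg-neg = from-yes (all3 λ x → neg (neg x) ≟3 x)
  inc-⊠ : ∀ x y → inc x ⊠ y ≡ y ⊞ x ⊠ y
  inc-⊠ = from-yes (all3 λ x → all3 λ y → (inc x ⊠ y) ≟3 (y ⊞ x ⊠ y))
  neg-⊠ : ∀ x y → neg (x ⊠ y) ≡ neg x ⊠ y
  neg-⊠ = from-yes (all3 λ x → all3 λ y → neg (x ⊠ y) ≟3 (neg x ⊠ y))

 resN-+ : ∀ m n → resN (m ℕ.+ n) ≡ resN m ⊞ resN n
 resN-+ zero n = E.refl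
 resN-+ (suc m) n = E.trans (cong inc (resN-+ m n)) (sym (inc-⊞ (resN m) (resN n)))

 res-⊖ : ∀ m n → res (m ℤ.⊖ n) ≡ resN m ⊞ neg (resN n)
 res-⊖ m zero = sym (⊞-0 (resN m))
 res-⊖ zero (suc n) = E.refl
 res-⊖ (suc m) (suc n) = E.trans (cong res (ℤP.[1+m]⊖[1+n]≡m⊖n m n)) (E.trans (res-⊖ m n) (sym (⊖-inc (resN m) (resN n))))

 res-+ : ∀ i j → res (i ℤ.+ j) ≡ res i ⊞ res j
 res-+ (ℤ.+ m) (ℤ.+ n) = resN-+ m n
 res-+ (ℤ.+ m) (ℤ.-[1+ n ]) = res-⊖ m (suc n)
 res-+ (ℤ.-[1+ m ]) (ℤ.+ n) = E.trans (res-⊖ n (suc m)) (⊞-comm (resN n) _)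
 res-+ (ℤ.-[1+ m ]) (ℤ.-[1+ n ]) = E.trans (cong neg (cong inc (E.trans (cong resN (sym (ℕP.+-suc m n))) (resN-+ m (suc n))))) (neg-⊞ (resN m) (resN n))

 res-neg : ∀ i → res (ℤ.- i) ≡ neg (res i)
 res-neg (ℤ.+ zero) = E.refl
 res-neg (ℤ.+ (suc n)) = E.refl
 res-neg (ℤ.-[1+ n ]) = sym (neg-neg (resN (suc n)))

 res-* : ∀ i j → res (i ℤ.* j) ≡ res i ⊠ res j
 res-* (ℤ.+ m) j = go m
  where
  go : ∀ m → res ((ℤ.+ m) ℤ.* j) ≡ resN m ⊠ res j
  go zero = E.refl
  go (suc m) = E.trans (cong res (l (ℤ.+ m) j)) (E.trans (res-+ j ((ℤ.+ m) ℤ.* j)) (E.trans (cong (res j ⊞_) (go m)) (sym (inc-⊠ (resN m) (res j)))))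
    where
    l = solveℤ 2 (λ a b → (# 1 :+ a) :* b := b :+ a :* b) E.refl
 res-* (ℤ.-[1+ m ]) j = E.trans (cong res (sym (ℤP.neg-distribˡ-* (ℤ.+ suc m) j))) (E.trans (res-neg ((ℤ.+ suc m) ℤ.* j)) (E.trans (cong neg (res-* (ℤ.+ suc m) j)) (neg-⊠ (resN (suc m)) (res j))))

 record Res (a : ℤ) (x : Z3) : Set where
  constructor mk
  field prf : res a ≡ x

 private
  var : ∀ a → Res a (res a)
  var a = mk E.refl
  _R+_ : ∀ {a b x y} → Res a x → Res b y → Res (a ℤ.+ b) (x ⊞ y)
  _R+_ {a} {b} (mk p) (mk q) = mk (E.trans (res-+ a b) (cong₂ _⊞_ p q))
  _R-_ : ∀ {a b x y} → Res a x → Res b y → Res (a ℤ.- b) (x ⊞ neg y)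
  _R-_ {a} {b} (mk p) (mk q) = mk (E.trans (res-+ a (ℤ.- b)) (cong₂ _⊞_ p (E.trans (res-neg b) (cong neg q))))
  _R*_ : ∀ {a b x y} → Res a x → Res b y → Res (a ℤ.* b) (x ⊠ y)
  _R*_ {a} {b} (mk p) (mk q) = mk (E.trans (res-* a b) (cong₂ _⊠_ p q))
  R-_ : ∀ {a x} → Res a x → Res (ℤ.- a) (neg x)
  R-_ {a} (mk p) = mk (E.trans (res-neg a) (cong neg p))
  infixl 6 _R+_ _R-_
  infixl 7 _R*_

 -- twice the real part of the cubic ring class character ψ of conductor 3, with ψ = ts in degree 0 and ψ = 2 + 2ts in degree 1
 val : Z3 → ℤ
 val z0 = ℤ.+ 2
 val _ = -1ℤ

 -- Modulo 3 one has μ² = 0, so t/s = ts turns products into sums and vanishes on the order of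
 -- conductor 3. The shift in degree `true` is forced by ψ(ε²) = 2ψ(ε) with ε² = 2 - μ. The
 -- condition s = 0 singles out the elements of norm divisible by 3, which get weight 0.
 ω : Bool → Z3 → Z3 → ℤ
 ω _ z0 _ = 0ℤ
 ω false s t = val (t ⊠ s)
 ω true s t = val (z2 ⊞ z2 ⊠ (t ⊠ s))

 W : Bool → Pt → ℤ
 W i (s , t) = ω i (res s) (res t)

 mulR : Bool → Bool → Z3 × Z3 → Z3 × Z3 → Z3 × Z3
 mulR false false (a , b) (s , t) = a ⊠ s , a ⊠ t ⊞ b ⊠ s
 mulR false true  (a , b) (s , t) = a ⊠ s , a ⊠ t ⊞ z2 ⊠ (b ⊠ s)
 mulR true  false (a , b) (s , t) = a ⊠ s , s ⊠ b ⊞ z2 ⊠ (t ⊠ a)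
 mulR true  true  (a , b) (s , t) = z2 ⊠ (a ⊠ s) , a ⊠ t ⊞ b ⊠ s ⊞ neg (a ⊠ s)

 conjR : Bool → Z3 × Z3 → Z3 × Z3
 conjR false (s , t) = s , neg t
 conjR true (s , t) = s , s ⊞ neg t

 res² : Pt → Z3 × Z3
 res² (s , t) = res s , res t

 private
  Res² : ∀ {a b x y} → Res a x → Res b y → res² (a , b) ≡ (x , y)
  Res² (mk p) (mk q) = cong₂ _,_ p q
  k2 : Res ⟦ 2 ⟧ z2
  k2 = mk E.refl
  k3 : Res ⟦ 3 ⟧ z0
  k3 = mk E.refl
  k6 : Res ⟦ 6 ⟧ z0
  k6 = mk E.refl

 res-mul : ∀ i j v w → res² (mul i j v w) ≡ mulR i j (res² v) (res² w)
 res-mul false false (a , b) (s , t) = E.trans (Res² (var a R* var s R- k6 R* (var b R* var t)) (var a R* var t R+ var b R* var s R+ k3 R* (var b R* var t))) (cong₂ _,_ (⊞-0 _) (⊞-0 _))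
 res-mul false true (a , b) (s , t) = E.trans (Res² (var a R* var s R+ k3 R* (var b R* var s) R- k3 R* (var b R* var t)) (var a R* var t R+ k2 R* (var b R* var s))) (cong₂ _,_ (E.trans (⊞-0 _) (⊞-0 _)) E.refl)
 res-mul true false (a , b) (s , t) = E.trans (Res² (var a R* var s R+ k3 R* (var t R* var a) R- k3 R* (var b R* var t)) (var s R* var b R+ k2 R* (var t R* var a))) (cong₂ _,_ (E.trans (⊞-0 _) (⊞-0 _)) E.refl)
 res-mul true true (a , b) (s , t) = E.trans (Res² (k2 R* (var a R* var s) R- k3 R* (var b R* var t)) (var a R* var t R+ var b R* var s R- var a R* var s)) (cong₂ _,_ (⊞-0 _) E.refl)

 res-conj : ∀ i v → res² (conj i v) ≡ conjR i (res² v)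
 res-conj false (s , t) = E.trans (Res² (var s R+ k3 R* var t) (R- var t)) (cong₂ _,_ (⊞-0 _) E.refl)
 res-conj true (s , t) = Res² (var s) (var s R- var t)

 ω² : Bool → Z3 × Z3 → ℤ
 ω² i (s , t) = ω i s t

 -- 2cos(a + b) + 2cos(a - b) = 2cos a · 2cos b
 W-mul : ∀ j i π w → W (j xor i) (mul j i π w) ℤ.+ W (j xor i) (mul j i (conj j π) w) ≡ W j π ℤ.* W i w
 W-mul j i π w = E.trans (cong₂ (λ x y → ω² (j xor i) x ℤ.+ ω² (j xor i) y) (res-mul j i π w) (E.trans (res-mul j i (conj j π) w) (cong (λ z → mulR j i z (res² w)) (res-conj j π))))
   (fin j i (res (proj₁ π)) (res (proj₂ π)) (res (proj₁ w)) (res (proj₂ w)))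
  where
  d : ∀ j i → Dec (∀ a b s t → ω² (j xor i) (mulR j i (a , b) (s , t)) ℤ.+ ω² (j xor i) (mulR j i (conjR j (a , b)) (s , t)) ≡ ω j a b ℤ.* ω i s t)
  d j i = all3 λ a → all3 λ b → all3 λ s → all3 λ t → ω² (j xor i) (mulR j i (a , b) (s , t)) ℤ.+ ω² (j xor i) (mulR j i (conjR j (a , b)) (s , t)) ℤ.≟ ω j a b ℤ.* ω i s t
  fin : ∀ j i a b s t → ω² (j xor i) (mulR j i (a , b) (s , t)) ℤ.+ ω² (j xor i) (mulR j i (conjR j (a , b)) (s , t)) ≡ ω j a b ℤ.* ω i s t
  fin false false = from-yes (d false false)
  fin false true = from-yes (d false true)
  fin true false = from-yes (d true false)
  fin true true = from-yes (d true true)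

 W-scale : ∀ i k v → res k ≢ z0 → W i (scale k v) ≡ W i v
 W-scale i k (s , t) h = E.trans (cong₂ (ω i) (res-* k s) (res-* k t)) (fin i (res k) h (res s) (res t))
  where
  fin : ∀ i x → x ≢ z0 → ∀ s t → ω i (x ⊠ s) (x ⊠ t) ≡ ω i s t
  fin i z0 h = ⊥-elim (h E.refl)
  fin i z1 h s t = E.refl
  fin false z2 h = from-yes (all3 λ s → all3 λ t → ω false (neg s) (neg t) ℤ.≟ ω false s t)
  fin true z2 h = from-yes (all3 λ s → all3 λ t → ω true (neg s) (neg t) ℤ.≟ ω true s t)

 ∣W∣≤2 : ∀ i v → ℤ.∣ W i v ∣ ℕ.≤ 2
 ∣W∣≤2 i (s , t) = fin i (res s) (res t)
  where
  fin : ∀ i s t → ℤ.∣ ω i s t ∣ ℕ.≤ 2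
  fin false = from-yes (all3 λ s → all3 λ t → ℤ.∣ ω false s t ∣ ℕ.≤? 2)
  fin true = from-yes (all3 λ s → all3 λ t → ℤ.∣ ω true s t ∣ ℕ.≤? 2)

 3∣⇒res : ∀ s → ⟦ 3 ⟧ ∣ s → res s ≡ z0
 3∣⇒res s (divides q e) = E.trans (cong res e) (E.trans (res-* q ⟦ 3 ⟧) (lem (res q)))
  where
  lem : ∀ x → x ⊠ z0 ≡ z0
  lem = from-yes (all3 λ x → (x ⊠ z0) ≟3 z0)

 res⇒3∣ : ∀ s → res s ≡ z0 → ⟦ 3 ⟧ ∣ s
 res⇒3∣ s e with reduce 3 (s≤s z≤n) s
 ... | r , r<3 , k , e' = subst (⟦ 3 ⟧ ∣_) (sym e') (subst (λ z → ⟦ 3 ⟧ ∣ ⟦ z ⟧ ℤ.+ k ℤ.* ⟦ 3 ⟧) (sym (r0 r r<3 (E.trans (sym (E.trans (cong res e') (E.trans (res-+ ⟦ r ⟧ (k ℤ.* ⟦ 3 ⟧)) (E.trans (cong (resN r ⊞_) (3∣⇒res (k ℤ.* ⟦ 3 ⟧) (∣n⇒∣m*n k ∣-refl))) (⊞-0 (resN r)))))) e))) (subst (⟦ 3 ⟧ ∣_) (sym (ℤP.+-identityˡ (k ℤ.* ⟦ 3 ⟧))) (∣n⇒∣m*n k ∣-refl)))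
  where
  r0 : ∀ r → r ℕ.< 3 → resN r ≡ z0 → r ≡ 0
  r0 0 _ _ = E.refl
  r0 1 _ ()
  r0 2 _ ()
  r0 (suc (suc (suc r))) (s≤s (s≤s (s≤s ()))) _

 module _ {A : Set} where
  sumL : (A → ℚ) → List A → ℚ
  sumL f [] = 0ℚ
  sumL f (x ∷ xs) = f x + sumL f xs

  sumL-cong : ∀ {f g} xs → (∀ v → v ∈ xs → f v ≡ g v) → sumL f xs ≡ sumL g xs
  sumL-cong [] h = E.refl
  sumL-cong (x ∷ xs) h = cong₂ _+_ (h x (here E.refl)) (sumL-cong xs (λ v m → h v (there m)))

  sumL-↭ : ∀ f {xs ys} → xs ↭ ys → sumL f xs ≡ sumL f ys
  sumL-↭ f refl = E.refl
  sumL-↭ f (prep x p) = cong (λ z → f x + z) (sumL-↭ f p)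
  sumL-↭ f {_ ∷ _ ∷ xs} {_ ∷ _ ∷ ys} (swap x y p) = E.trans (cong (λ z → f x + (f y + z)) (sumL-↭ f p)) (lem (f x) (f y) (sumL f ys))
    where
    lem = solveℚ 3 (λ a b c → a :+ (b :+ c) := b :+ (a :+ c)) E.refl
  sumL-↭ f (trans p q) = E.trans (sumL-↭ f p) (sumL-↭ f q)

  -- Sums over shells are compared through their sets of members, which avoids explicit bijections
  -- between lists.
  sumL-set : ∀ f {xs ys} → Unique xs → Unique ys → (∀ v → v ∈ xs → v ∈ ys) → (∀ v → v ∈ ys → v ∈ xs) → sumL f xs ≡ sumL f ys
  sumL-set f ux uy h k = sumL-↭ f (∼bag⇒↭ (unique∧set⇒bag ux uy (λ {v} → mk⇔ (h v) (k v))))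

  sumL-+ : ∀ f g xs → sumL (λ v → f v + g v) xs ≡ sumL f xs + sumL g xs
  sumL-+ f g [] = sym (+-identityʳ 0ℚ)
  sumL-+ f g (x ∷ xs) = E.trans (cong (λ z → (f x + g x) + z) (sumL-+ f g xs)) (lem (f x) (g x) (sumL f xs) (sumL g xs))
    where
    lem = solveℚ 4 (λ a b c d → (a :+ b) :+ (c :+ d) := (a :+ c) :+ (b :+ d)) E.refl

  sumL-* : ∀ c f xs → sumL (λ v → c * f v) xs ≡ c * sumL f xs
  sumL-* c f [] = sym (*-zeroʳ c)
  sumL-* c f (x ∷ xs) = E.trans (cong (λ z → c * f x + z) (sumL-* c f xs)) (sym (*-distribˡ-+ c (f x) (sumL f xs)))

  sumL-0 : ∀ {f} xs → (∀ v → v ∈ xs → f v ≡ 0ℚ) → sumL f xs ≡ 0ℚ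
  sumL-0 [] h = E.refl
  sumL-0 (x ∷ xs) h = E.trans (cong₂ _+_ (h x (here E.refl)) (sumL-0 xs (λ v m → h v (there m)))) (+-identityʳ 0ℚ)

 ind : {P : Set} → Dec P → ℚ
 ind (yes _) = 1ℚ
 ind (no _) = 0ℚ

 ind-yes : ∀ {P : Set} (d : Dec P) → P → ind d ≡ 1ℚ
 ind-yes (yes _) _ = E.refl
 ind-yes (no n) p = ⊥-elim (n p)

 ind-no : ∀ {P : Set} (d : Dec P) → ¬ P → ind d ≡ 0ℚ
 ind-no (yes p) n = ⊥-elim (n p)
 ind-no (no _) _ = E.refl

 sumL-map : ∀ {A B : Set} (f : B → ℚ) (g : A → B) xs → sumL f (map g xs) ≡ sumL (λ v → f (g v)) xs
 sumL-map f g [] = E.refl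
 sumL-map f g (x ∷ xs) = cong (λ z → f (g x) + z) (sumL-map f g xs)

 sumL-filter : ∀ {A : Set} {P : A → Set} (P? : Decidable P) f xs → sumL f (filter P? xs) ≡ sumL (λ v → f v * ind (P? v)) xs
 sumL-filter P? f [] = E.refl
 sumL-filter P? f (x ∷ xs) with P? x
 ... | yes _ = cong₂ _+_ (sym (*-identityʳ (f x))) (sumL-filter P? f xs)
 ... | no _ = E.trans (sumL-filter P? f xs) (E.trans (sym (+-identityˡ _)) (cong (_+ sumL (λ v → f v * ind (P? v)) xs) (sym (*-zeroʳ (f x)))))

 range : ℕ → List ℤ
 range zero = 0ℤ ∷ []
 range (suc B) = ℤ.+ suc B ∷ ℤ.-[1+ B ] ∷ range B

 ∈-range⁻ : ∀ B {s} → s ∈ range B → ℤ.∣ s ∣ ℕ.≤ B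
 ∈-range⁻ zero (here E.refl) = z≤n
 ∈-range⁻ (suc B) (here E.refl) = ℕP.≤-refl
 ∈-range⁻ (suc B) (there (here E.refl)) = ℕP.≤-refl
 ∈-range⁻ (suc B) (there (there m)) = ℕP.m≤n⇒m≤1+n (∈-range⁻ B m)

 ∈-range : ∀ B s → ℤ.∣ s ∣ ℕ.≤ B → s ∈ range B
 ∈-range zero s h = here (ℤP.∣i∣≡0⇒i≡0 (ℕP.n≤0⇒n≡0 h))
 ∈-range (suc B) s h with ℤ.∣ s ∣ ℕ.≟ suc B
 ... | no ne = there (there (∈-range B s (ℕP.≤-pred (ℕP.≤∧≢⇒< h ne))))
 ∈-range (suc B) (ℤ.+ n) h | yes e = here (cong ℤ.+_ e)
 ∈-range (suc B) (ℤ.-[1+ n ]) h | yes e = there (here (cong ℤ.-[1+_] (ℕP.suc-injective e)))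

 range-unique : ∀ B → Unique (range B)
 range-unique zero = [] ∷ []
 range-unique (suc B) = ((λ ()) ∷ All.tabulate (λ {x} m e → ℕP.<⇒≱ ℕP.≤-refl (subst (λ z → ℤ.∣ z ∣ ℕ.≤ B) (sym e) (∈-range⁻ B m)))) ∷ (All.tabulate (λ {x} m e → ℕP.<⇒≱ ℕP.≤-refl (subst (λ z → ℤ.∣ z ∣ ℕ.≤ B) (sym e) (∈-range⁻ B m)))) ∷ range-unique B

 box : ℕ → List Pt
 box B = cartesianProduct (range B) (range B)

 box-unique : ∀ B → Unique (box B)
 box-unique B = U.cartesianProduct⁺ (range-unique B) (range-unique B)

 ∈-box : ∀ B s t → ℤ.∣ s ∣ ℕ.≤ B → ℤ.∣ t ∣ ℕ.≤ B → (s , t) ∈ box B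
 ∈-box B s t h k = ∈-cartesianProduct⁺ (∈-range B s h) (∈-range B t k)

 sq-abs : ∀ a → a ℤ.* a ≡ ⟦ ℤ.∣ a ∣ ℕ.* ℤ.∣ a ∣ ⟧
 sq-abs (ℤ.+ n) = sym (ℤP.pos-* n n)
 sq-abs (ℤ.-[1+ n ]) = E.refl

 -- In each degree, 8N - 5s² and 8N - 15t² are nonnegative combinations of squares.
 crd-bound : ∀ i s t n → N i (s , t) ≡ ⟦ n ⟧ → 5 ℕ.* (ℤ.∣ s ∣ ℕ.* ℤ.∣ s ∣) ℕ.≤ 8 ℕ.* n × 15 ℕ.* (ℤ.∣ t ∣ ℕ.* ℤ.∣ t ∣) ℕ.≤ 8 ℕ.* n
 crd-bound i s t n e = conv 5 s (by 5 s (proj₁ (x i)) (proj₁ (proj₂ (x i))) (proj₁ (proj₂ (proj₂ (x i))))) , conv 15 t (by 15 t (proj₁ (proj₂ (proj₂ (proj₂ (x i))))) (proj₁ (proj₂ (proj₂ (proj₂ (proj₂ (x i)))))) (proj₂ (proj₂ (proj₂ (proj₂ (proj₂ (x i)))))))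
  where
  conv : ∀ k a → ⟦ k ⟧ ℤ.* (a ℤ.* a) ℤ.≤ ⟦ 8 ⟧ ℤ.* ⟦ n ⟧ → k ℕ.* (ℤ.∣ a ∣ ℕ.* ℤ.∣ a ∣) ℕ.≤ 8 ℕ.* n
  conv k a h = ℤP.drop‿+≤+ (E.subst₂ ℤ._≤_ (E.trans (cong (⟦ k ⟧ ℤ.*_) (sq-abs a)) (sym (ℤP.pos-* k (ℤ.∣ a ∣ ℕ.* ℤ.∣ a ∣)))) (sym (ℤP.pos-* 8 n)) h)
  by : ∀ k a r → 0ℤ ℤ.≤ r → ⟦ k ⟧ ℤ.* (a ℤ.* a) ℤ.+ r ≡ ⟦ 8 ⟧ ℤ.* N i (s , t) → ⟦ k ⟧ ℤ.* (a ℤ.* a) ℤ.≤ ⟦ 8 ⟧ ℤ.* ⟦ n ⟧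
  by k a r h eq = ℤP.≤-trans (subst (ℤ._≤ ⟦ k ⟧ ℤ.* (a ℤ.* a) ℤ.+ r) (ℤP.+-identityʳ _) (ℤP.+-monoʳ-≤ (⟦ k ⟧ ℤ.* (a ℤ.* a)) h)) (ℤP.≤-reflexive (E.trans eq (cong (⟦ 8 ⟧ ℤ.*_) e)))
  nn* : ∀ k a → 0ℤ ℤ.≤ ⟦ k ⟧ ℤ.* (a ℤ.* a)
  nn* k a = ℤP.≤-trans (ℤP.≤-reflexive (sym (ℤP.*-zeroʳ ⟦ k ⟧))) (ℤP.*-monoˡ-≤-nonNeg ⟦ k ⟧ (sq-nonneg a))
  e1 = solveℤ 2 (λ s t → # 5 :* (s :* s) :+ # 3 :* ((s :+ # 4 :* t) :* (s :+ # 4 :* t)) := # 8 :* (s :* s :+ # 3 :* (s :* t) :+ # 6 :* (t :* t))) E.refl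
  e2 = solveℤ 2 (λ s t → # 15 :* (t :* t) :+ (# 2 :* ((# 2 :* s :+ # 3 :* t) :* (# 2 :* s :+ # 3 :* t)) :+ # 15 :* (t :* t)) := # 8 :* (s :* s :+ # 3 :* (s :* t) :+ # 6 :* (t :* t))) E.refl
  e3 = solveℤ 2 (λ s t → # 5 :* (s :* s) :+ (# 5 :* (s :* s) :+ # 6 :* ((s :- # 2 :* t) :* (s :- # 2 :* t))) := # 8 :* (# 2 :* (s :* s) :- # 3 :* (s :* t) :+ # 3 :* (t :* t))) E.refl
  e4 = solveℤ 2 (λ s t → # 15 :* (t :* t) :+ # 1 :* ((# 4 :* s :- # 3 :* t) :* (# 4 :* s :- # 3 :* t)) := # 8 :* (# 2 :* (s :* s) :- # 3 :* (s :* t) :+ # 3 :* (t :* t))) E.refl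
  x : ∀ i → ∃ λ r → 0ℤ ℤ.≤ r × ⟦ 5 ⟧ ℤ.* (s ℤ.* s) ℤ.+ r ≡ ⟦ 8 ⟧ ℤ.* N i (s , t) × ∃ λ r' → 0ℤ ℤ.≤ r' × ⟦ 15 ⟧ ℤ.* (t ℤ.* t) ℤ.+ r' ≡ ⟦ 8 ⟧ ℤ.* N i (s , t)
  x false = _ , nn* 3 (s ℤ.+ ⟦ 4 ⟧ ℤ.* t) , e1 s t , _ , ℤP.+-mono-≤ (nn* 2 (⟦ 2 ⟧ ℤ.* s ℤ.+ ⟦ 3 ⟧ ℤ.* t)) (nn* 15 t) , e2 s t
  x true = _ , ℤP.+-mono-≤ (nn* 5 s) (nn* 6 (s ℤ.- ⟦ 2 ⟧ ℤ.* t)) , e3 s t , _ , nn* 1 (⟦ 4 ⟧ ℤ.* s ℤ.- ⟦ 3 ⟧ ℤ.* t) , e4 s t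

 small-sq : ∀ a n → 5 ℕ.* (a ℕ.* a) ℕ.≤ 8 ℕ.* n → a ℕ.≤ n
 small-sq a n h with a ℕ.≤? n
 ... | yes p = p
 ... | no q = ⊥-elim (ℕP.<⇒≱ (ℕP.<-≤-trans (ℕP.<-≤-trans (s≤s (ℕP.m≤m+n (8 ℕ.* n) (4 ℕ.+ (2 ℕ.* n ℕ.+ 5 ℕ.* (n ℕ.* n))))) (ℕP.≤-reflexive (l n))) (ℕP.*-monoʳ-≤ 5 (ℕP.*-mono-≤ (ℕP.≰⇒> q) (ℕP.≰⇒> q)))) h)
  where
  l = solveℕ 1 (λ n → (Κ 1 :+ (Κ 8 :* n :+ (Κ 4 :+ (Κ 2 :* n :+ Κ 5 :* (n :* n))))) := Κ 5 :* ((Κ 1 :+ n) :* (Κ 1 :+ n))) E.refl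

 shell : Bool → ℕ → List Pt
 shell i n = filter (λ v → N i v ℤ.≟ ⟦ n ⟧) (box n)

 shell-unique : ∀ i n → Unique (shell i n)
 shell-unique i n = U.filter⁺ (λ v → N i v ℤ.≟ ⟦ n ⟧) (box-unique n)

 ∈-shell : ∀ i n v → N i v ≡ ⟦ n ⟧ → v ∈ shell i n
 ∈-shell i n (s , t) e = ∈-filter⁺ (λ v → N i v ℤ.≟ ⟦ n ⟧) (∈-box n s t (small-sq _ n (proj₁ (crd-bound i s t n e)))
    (small-sq _ n (ℕP.≤-trans (ℕP.*-monoˡ-≤ (ℤ.∣ t ∣ ℕ.* ℤ.∣ t ∣) (ℕP.m≤m+n 5 10)) (proj₂ (crd-bound i s t n e))))) e

 ∈-shell⁻ : ∀ i n v → v ∈ shell i n → N i v ≡ ⟦ n ⟧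
 ∈-shell⁻ i n v m = proj₂ (∈-filter⁻ (λ v → N i v ℤ.≟ ⟦ n ⟧) {xs = box n} m)

 wt : Bool → Pt → ℚ
 wt i v = qz (W i v)

 -- Each ideal is counted twice, the units being ±1; for instance `cs false 1` is 4. The Hecke
 -- relations are linear in these sums, so no normalisation is made.
 cs : Bool → ℕ → ℚ
 cs i n = sumL (wt i) (shell i n)

 xx : ∀ j i → j xor (j xor i) ≡ i
 xx false i = E.refl
 xx true false = E.refl
 xx true true = E.refl

 module Mult (j : Bool) (ρ : Pt) (q : ℕ) (q≥1 : 1 ℕ.≤ q) (Nρ : N j ρ ≡ ⟦ q ⟧) (i : Bool) (m : ℕ) where

  mults : List Pt
  mults = map (mul j i ρ) (shell i m)

  mults-unique : Unique mults
  mults-unique = U.map⁺ (λ {x} {y} e → scale-inj q q≥1 (E.trans (E.trans (cong (λ z → scale z x) (sym Nρ)) (sym (conj-mul j i ρ x))) (E.trans (cong (mul j (j xor i) (conj j ρ)) e) (E.trans (conj-mul j i ρ y) (cong (λ z → scale z y) Nρ))))) (shell-unique i m)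

  mults⊆ : ∀ v → v ∈ mults → v ∈ shell (j xor i) (q ℕ.* m)
  mults⊆ v h with ∈-map⁻ (mul j i ρ) h
  ... | w , w∈ , E.refl = ∈-shell (j xor i) (q ℕ.* m) _ (E.trans (N-mul j i ρ w) (E.trans (cong₂ ℤ._*_ Nρ (∈-shell⁻ i m w w∈)) (sym (ℤP.pos-* q m))))

  ⊆mults : ∀ w → mul j i ρ w ∈ shell (j xor i) (q ℕ.* m) → mul j i ρ w ∈ mults
  ⊆mults w h = ∈-map⁺ (mul j i ρ) (∈-shell i m w (ℤP.*-cancelˡ-≡ ⟦ q ⟧ _ _ {{ℕ.>-nonZero q≥1}} (E.trans (cong (ℤ._* N i w) (sym Nρ)) (E.trans (sym (N-mul j i ρ w)) (E.trans (∈-shell⁻ (j xor i) (q ℕ.* m) _ h) (ℤP.pos-* q m))))))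

 c̃s : ∀ (p : ℕ) (i : Bool) (m : ℕ) → ℚ
 c̃s p i m with p ℕD.∣? m
 ... | yes (ℕD.divides q _) = cs i q
 ... | no _ = 0ℚ

 module _ {p : ℕ} (pp : Prime p) (ne3 : p ≢ 3) (i : Bool) (m : ℕ) where
  private
    P? : Decidable (λ v → ⟦ p ⟧ ∣∣ v)
    P? v = ⟦ p ⟧ ∣∣? v
    sh = shell i (p ℕ.* m)

    res-p : res ⟦ p ⟧ ≢ z0
    res-p e = ne3 (sym (p∣q prime[3] pp (res⇒3∣ ⟦ p ⟧ e)))

    Np : ∀ {v w} → v ∈ sh → v ≡ scale ⟦ p ⟧ w → ⟦ p ⟧ ℤ.* N i w ≡ ⟦ m ⟧
    Np {v} {w} v∈ e = ℤP.*-cancelˡ-≡ ⟦ p ⟧ _ _ {{ℕ.>-nonZero (p≥1 pp)}} (E.trans (sym (ℤP.*-assoc ⟦ p ⟧ ⟦ p ⟧ (N i w))) (E.trans (sym (N-scale i ⟦ p ⟧ w)) (E.trans (cong (N i) (sym e)) (E.trans (∈-shell⁻ i (p ℕ.* m) v v∈) (ℤP.pos-* p m)))))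

  sum-p∣ : sumL (wt i) (filter P? sh) ≡ c̃s p i m
  sum-p∣ with p ℕD.∣? m
  ... | no nd = sumL-0 (filter P? sh) (λ v v∈ → ⊥-elim (bad v (∈-filter⁻ P? {xs = sh} v∈)))
    where
    bad : ∀ v → v ∈ sh × ⟦ p ⟧ ∣∣ v → ⊥
    bad v (a , b) with ∣∣⇒scale ⟦ p ⟧ v b
    ... | w , e = nd (∣ℕ (divides (N i w) (E.trans (sym (Np a e)) (ℤP.*-comm ⟦ p ⟧ (N i w)))))
  ... | yes (ℕD.divides q e) = E.trans (sumL-set (wt i) (U.filter⁺ P? (shell-unique i (p ℕ.* m))) (U.map⁺ (scale-inj p (p≥1 pp)) (shell-unique i q)) to from)
       (E.trans (sumL-map (wt i) (scale ⟦ p ⟧) (shell i q)) (sumL-cong (shell i q) (λ v _ → cong qz (W-scale i ⟦ p ⟧ v res-p))))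
    where
    p≢0 = ℕ.>-nonZero (p≥1 pp)
    to : ∀ v → v ∈ filter P? sh → v ∈ map (scale ⟦ p ⟧) (shell i q)
    to v v∈ with ∈-filter⁻ P? {xs = sh} v∈
    ... | a , b with ∣∣⇒scale ⟦ p ⟧ v b
    ... | w , ew = subst (_∈ map (scale ⟦ p ⟧) (shell i q)) (sym ew) (∈-map⁺ (scale ⟦ p ⟧) (∈-shell i q w (ℤP.*-cancelˡ-≡ ⟦ p ⟧ _ _ {{p≢0}} (E.trans (Np a ew) (E.trans (cong ⟦_⟧ (E.trans e (ℕP.*-comm q p))) (ℤP.pos-* p q))))))
    from : ∀ v → v ∈ map (scale ⟦ p ⟧) (shell i q) → v ∈ filter P? sh
    from v v∈ with ∈-map⁻ (scale ⟦ p ⟧) v∈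
    ... | w , w∈ , E.refl = ∈-filter⁺ P? (∈-shell i (p ℕ.* m) _ (E.trans (N-scale i ⟦ p ⟧ w) (E.trans (cong ((⟦ p ⟧ ℤ.* ⟦ p ⟧) ℤ.*_) (∈-shell⁻ i q w w∈)) (E.trans (ℤP.*-assoc ⟦ p ⟧ ⟦ p ⟧ ⟦ q ⟧) (E.trans (cong (⟦ p ⟧ ℤ.*_) (sym (ℤP.pos-* p q))) (E.trans (sym (ℤP.pos-* p (p ℕ.* q))) (cong (λ z → ⟦ p ℕ.* z ⟧) (sym (E.trans e (ℕP.*-comm q p)))))))))) (∣∣-scale ⟦ p ⟧ w)

  hecke-inert : (∀ i v → ⟦ p ⟧ ∣ N i v → ⟦ p ⟧ ∣∣ v) → cs i (p ℕ.* m) ≡ c̃s p i m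
  hecke-inert h = E.trans (sumL-set (wt i) (shell-unique i (p ℕ.* m)) (U.filter⁺ P? (shell-unique i (p ℕ.* m)))
      (λ v v∈ → ∈-filter⁺ P? v∈ (h i v (subst (⟦ p ⟧ ∣_) (sym (E.trans (∈-shell⁻ i (p ℕ.* m) v v∈) (ℤP.pos-* p m))) (∣m⇒∣m*n ⟦ m ⟧ ∣-refl)))) (λ v v∈ → proj₁ (∈-filter⁻ P? {xs = sh} v∈))) sum-p∣

 module _ {p : ℕ} (pp : Prime p) (ne3 : p ≢ 3) (j : Bool) (π : Pt) (Nπ : N j π ≡ ⟦ p ⟧) (i : Bool) (m : ℕ) where
  private
    k = j xor i
    sh = shell k (p ℕ.* m)
    D? : Decidable (D pp ne3 j π Nπ k)
    D? v = ⟦ p ⟧ ∣∣? mul j k (conj j π) v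
    D̄? : Decidable (D̄ pp ne3 j π Nπ k)
    D̄? v = ⟦ p ⟧ ∣∣? mul j k π v
    p∣N : ∀ v → v ∈ sh → ⟦ p ⟧ ∣ N k v
    p∣N v v∈ = subst (⟦ p ⟧ ∣_) (sym (E.trans (∈-shell⁻ k (p ℕ.* m) v v∈) (ℤP.pos-* p m))) (∣m⇒∣m*n ⟦ m ⟧ ∣-refl)
    module M = Mult j π p (p≥1 pp) Nπ i m
    module M̄ = Mult j (conj j π) p (p≥1 pp) (Nπ̄ pp ne3 j π Nπ) i m

    to : ∀ v → v ∈ sh → D pp ne3 j π Nπ k v → v ∈ M.mults
    to v v∈ d with subst (λ z → ∃ λ w → v ≡ mul j z π w) (xx j i) (D⇒ pp ne3 j π Nπ k v d)
    ... | w , E.refl = M.⊆mults w v∈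
    tō : ∀ v → v ∈ sh → D̄ pp ne3 j π Nπ k v → v ∈ M̄.mults
    tō v v∈ d with subst (λ z → ∃ λ w → v ≡ mul j z (conj j π) w) (xx j i) (D̄⇒ pp ne3 j π Nπ k v d)
    ... | w , E.refl = M̄.⊆mults w v∈

    sumD : sumL (wt k) (filter D? sh) ≡ sumL (λ w → wt k (mul j i π w)) (shell i m)
    sumD = E.trans (sumL-set (wt k) (U.filter⁺ D? (shell-unique k (p ℕ.* m))) M.mults-unique (λ v h → to v (proj₁ (∈-filter⁻ D? {xs = sh} h)) (proj₂ (∈-filter⁻ D? {xs = sh} h))) from) (sumL-map (wt k) (mul j i π) (shell i m))
      where
      from : ∀ v → v ∈ M.mults → v ∈ filter D? sh
      from v h with ∈-map⁻ (mul j i π) h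
      ... | w , _ , e = ∈-filter⁺ D? (M.mults⊆ v h) (subst (D pp ne3 j π Nπ k) (sym e) (⇒D pp ne3 j π Nπ i w))

    sumD̄ : sumL (wt k) (filter D̄? sh) ≡ sumL (λ w → wt k (mul j i (conj j π) w)) (shell i m)
    sumD̄ = E.trans (sumL-set (wt k) (U.filter⁺ D̄? (shell-unique k (p ℕ.* m))) M̄.mults-unique (λ v h → tō v (proj₁ (∈-filter⁻ D̄? {xs = sh} h)) (proj₂ (∈-filter⁻ D̄? {xs = sh} h))) from) (sumL-map (wt k) (mul j i (conj j π)) (shell i m))
      where
      from : ∀ v → v ∈ M̄.mults → v ∈ filter D̄? sh
      from v h with ∈-map⁻ (mul j i (conj j π)) h
      ... | w , _ , e = ∈-filter⁺ D̄? (M̄.mults⊆ v h) (subst (D̄ pp ne3 j π Nπ k) (sym e) (⇒D̄ pp ne3 j π Nπ i w))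

    sumDD : sumL (wt k) (filter D? sh) + sumL (wt k) (filter D̄? sh) ≡ wt j π * cs i m
    sumDD = E.trans (cong₂ _+_ sumD sumD̄) (E.trans (sym (sumL-+ (λ w → wt k (mul j i π w)) (λ w → wt k (mul j i (conj j π) w)) (shell i m)))
      (E.trans (sumL-cong (shell i m) (λ w _ → E.trans (sym (qz-+ (W k (mul j i π w)) (W k (mul j i (conj j π) w)))) (E.trans (cong qz (W-mul j i π w)) (qz-* (W j π) (W i w))))) (sumL-* (wt j π) (wt i) (shell i m))))

  -- Inclusion and exclusion: an element of norm pm is divisible by π or by π̄, and by both exactly
  -- when p divides it. The two parts are the images of the shell of norm m under π and π̄, and
  -- their weights add up by `W-mul`.
  hecke-split : p ≢ 5 → cs k (p ℕ.* m) + c̃s p k m ≡ wt j π * cs i m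
  hecke-split ne5 = E.trans (cong (cs k (p ℕ.* m) +_) (E.trans (sym (sum-p∣ pp ne3 k m)) (sumL-filter P? (wt k) sh))) (E.trans (sym (sumL-+ (wt k) (λ v → wt k v * ind (P? v)) sh))
     (E.trans (sumL-cong sh pt) (E.trans (sumL-+ (λ v → wt k v * ind (D? v)) (λ v → wt k v * ind (D̄? v)) sh) (E.trans (sym (cong₂ _+_ (sumL-filter D? (wt k) sh) (sumL-filter D̄? (wt k) sh))) sumDD))))
    where
    P? : Decidable (λ v → ⟦ p ⟧ ∣∣ v)
    P? v = ⟦ p ⟧ ∣∣? v
    l1 = solveℚ 1 (λ a → a :+ a :* Κ 1ℚ := a :* Κ 1ℚ :+ a :* Κ 1ℚ) E.refl
    l2 = solveℚ 1 (λ a → a :+ a :* Κ 0ℚ := a :* Κ 1ℚ :+ a :* Κ 0ℚ) E.refl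
    l3 = solveℚ 1 (λ a → a :+ a :* Κ 0ℚ := a :* Κ 0ℚ :+ a :* Κ 1ℚ) E.refl
    pt : ∀ v → v ∈ sh → wt k v + wt k v * ind (P? v) ≡ wt k v * ind (D? v) + wt k v * ind (D̄? v)
    pt v v∈ = go (D? v) (D̄? v) (P? v)
      where
      go : (d : Dec (D pp ne3 j π Nπ k v)) (d̄ : Dec (D̄ pp ne3 j π Nπ k v)) (q : Dec (⟦ p ⟧ ∣∣ v)) → wt k v + wt k v * ind q ≡ wt k v * ind d + wt k v * ind d̄
      go (yes a) (yes b) (yes _) = l1 (wt k v)
      go (yes a) (yes b) (no n) = ⊥-elim (n (D-both pp ne3 ne5 j k π v Nπ a b))
      go (yes a) (no b) (no _) = l2 (wt k v)
      go (no a) (yes b) (no _) = l3 (wt k v)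
      go (no a) d̄ (yes c) = ⊥-elim (a (p∣∣⇒ pp ne3 j π Nπ k (conj j π) v c))
      go d (no b) (yes c) = ⊥-elim (b (p∣∣⇒ pp ne3 j π Nπ k π v c))
      go (no a) (no b) _ = ⊥-elim (or (D-or pp ne3 j π Nπ k v (p∣N v v∈)))
        where
        or : D pp ne3 j π Nπ k v ⊎ D̄ pp ne3 j π Nπ k v → ⊥
        or (inj₁ x) = a x
        or (inj₂ x) = b x

  hecke-ramified : conj j π ≡ π → (∀ w → W k (mul j i π w) ≡ W i w) → cs k (p ℕ.* m) ≡ cs i m
  hecke-ramified eq hw = E.trans (sumL-set (wt k) (shell-unique k (p ℕ.* m)) M.mults-unique (λ v v∈ → to v v∈ (d v (D-or pp ne3 j π Nπ k v (p∣N v v∈)))) M.mults⊆) (E.trans (sumL-map (wt k) (mul j i π) (shell i m)) (sumL-cong (shell i m) (λ w _ → cong qz (hw w))))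
    where
    d : ∀ v → D pp ne3 j π Nπ k v ⊎ D̄ pp ne3 j π Nπ k v → D pp ne3 j π Nπ k v
    d v (inj₁ x) = x
    d v (inj₂ x) = subst (λ z → ⟦ p ⟧ ∣∣ mul j k z v) (sym eq) x

 hecke-3 : ∀ i m → cs i (3 ℕ.* m) ≡ 0ℚ
 hecke-3 i m = sumL-0 (shell i (3 ℕ.* m)) (λ v v∈ → E.trans (cong qz (W0 i v (subst (⟦ 3 ⟧ ∣_) (sym (E.trans (∈-shell⁻ i (3 ℕ.* m) v v∈) (ℤP.pos-* 3 m))) (∣m⇒∣m*n ⟦ m ⟧ ∣-refl)))) qz-0)
  where
  W0 : ∀ i v → ⟦ 3 ⟧ ∣ N i v → W i v ≡ 0ℤ
  W0 i (s , t) d = cong (λ z → ω i z (res t)) (3∣⇒res s (3∣s i s t d))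
    where
    3∣s : ∀ i s t → ⟦ 3 ⟧ ∣ N i (s , t) → ⟦ 3 ⟧ ∣ s
    3∣s i s t d with div3 i (s , t) d
    3∣s false s t d | (x , y) , e = subst (⟦ 3 ⟧ ∣_) (sym (E.trans (cong proj₁ e) (l x y))) (∣m⇒∣m*n (ℤ.- y) ∣-refl)
      where
      l = solveℤ 2 (λ x y → # 2 :* (# 0 :* x) :- # 3 :* (# 1 :* y) := # 3 :* (:- y)) E.refl
    3∣s true s t d | (x , y) , e = subst (⟦ 3 ⟧ ∣_) (sym (E.trans (cong proj₁ e) (l x y))) (∣m⇒∣m*n (ℤ.- y) ∣-refl)
      where
      l = solveℤ 2 (λ x y → # 0 :* x :+ # 3 :* (y :* # 0) :- # 3 :* (# 1 :* y) := # 3 :* (:- y)) E.refl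

 -- The point (2,1) of degree `true` is √5. It is its own conjugate and ψ vanishes on it, so
 -- multiplication by it preserves weights.
 hecke-5 : ∀ i m → cs (true xor i) (5 ℕ.* m) ≡ cs i m
 hecke-5 i m = hecke-ramified prime[5] (λ ()) true (⟦ 2 ⟧ , ⟦ 1 ⟧) E.refl i m E.refl (λ w → E.trans (cong (ω² (true xor i)) (res-mul true i (⟦ 2 ⟧ , ⟦ 1 ⟧) w)) (fin i (res (proj₁ w)) (res (proj₂ w))))
  where
  fin : ∀ i s t → ω² (true xor i) (mulR true i (z2 , z1) (s , t)) ≡ ω i s t
  fin false = from-yes (all3 λ s → all3 λ t → ω² true (mulR true false (z2 , z1) (s , t)) ℤ.≟ ω false s t)
  fin true = from-yes (all3 λ s → all3 λ t → ω² false (mulR true true (z2 , z1) (s , t)) ℤ.≟ ω true s t)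

-- Cancellation in lattice sums and the two ring class series

module FormSeries where
 open import Data.Bool using (Bool; true; false)
 open import Data.Integer as ℤ using (ℤ)
 open import Data.List using (List; []; _∷_; map; cartesianProduct; _++_)
 open import Data.List.Membership.Propositional using (_∈_)
 open import Data.List.Membership.Propositional.Properties using (∈-filter⁺; ∈-filter⁻; ∈-cartesianProduct⁺)
 import Data.List.Relation.Unary.Unique.Propositional.Properties as U
 open import Data.Rational using (ℚ; _+_; _*_; _-_; -_; 0ℚ; 1ℚ; _≤_; ∣_∣)
 open import Data.Rational.Properties
 open import Relation.Nullary.Decidable using (from-yes; _×-dec_)
 open import Relation.Unary using (Decidable)
 open import Relation.Binary.PropositionalEquality
 open Rationals
 open IntegerSqrt
 open Valuations using (p≥1; p≥2; quo; sum-delta)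
 open Integers
 open NormForms
 open RingClassWeights
 open Mertens
 open Characters using (abs-qz; term-lower; module Low)

 sumL-++ : ∀ {A : Set} (f : A → ℚ) xs ys → sumL f (xs ++ ys) ≡ sumL f xs + sumL f ys
 sumL-++ f [] ys = sym (+-identityˡ _)
 sumL-++ f (x ∷ xs) ys = trans (cong (λ z → f x + z) (sumL-++ f xs ys)) (sym (+-assoc (f x) (sumL f xs) (sumL f ys)))

 sumL-× : ∀ {A B : Set} (f : A × B → ℚ) xs ys → sumL f (cartesianProduct xs ys) ≡ sumL (λ s → sumL (λ t → f (s , t)) ys) xs
 sumL-× f [] ys = refl
 sumL-× f (x ∷ xs) ys = trans (sumL-++ f (map (x ,_) ys) (cartesianProduct xs ys)) (cong₂ _+_ (sumL-map f (x ,_) ys) (sumL-× f xs ys))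

 sum-sumL : ∀ {A : Set} (f : ℕ → A → ℚ) xs y → sum (λ n → sumL (f n) xs) y ≡ sumL (λ v → sum (λ n → f n v) y) xs
 sum-sumL f [] y = sum-0 y
 sum-sumL f (x ∷ xs) y = trans (sum-+ (λ n → f n x) (λ n → sumL (f n) xs) y) (cong (λ z → sum (λ n → f n x) y + z) (sum-sumL f xs y))

 cut : ℕ → (ℕ → ℚ) → ℕ → ℚ
 cut y f n with (1 ℕ.≤? n) ×-dec (n ℕ.≤? y)
 ... | yes _ = f n
 ... | no _ = 0ℚ

 sum-cut : ∀ f y m → sum (λ n → ind (⟦ m ⟧ ℤ.≟ ⟦ n ⟧) * f n) y ≡ cut y f m
 sum-cut f y m with (1 ℕ.≤? m) ×-dec (m ℕ.≤? y)
 ... | yes (h , k) = sum-delta (f m) m y h k _ (trans (cong (_* f m) (ind-yes (⟦ m ⟧ ℤ.≟ ⟦ m ⟧) refl)) (*-identityˡ (f m))) (λ q ne → trans (cong (_* f q) (ind-no (⟦ m ⟧ ℤ.≟ ⟦ q ⟧) (λ e → ne (sym (ℤP.+-injective e))))) (*-zeroˡ (f q)))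
 ... | no n = sum-vanish y (λ q h k → trans (cong (_* f q) (ind-no (⟦ m ⟧ ℤ.≟ ⟦ q ⟧) (λ e → n (subst (λ z → 1 ℕ.≤ z × z ℕ.≤ y) (sym (ℤP.+-injective e)) (h , k))))) (*-zeroˡ (f q)))

 rect : ℕ → ℕ → List Pt
 rect A B = cartesianProduct (range A) (range B)

 nrm : Bool → Pt → ℕ
 nrm i v = ℤ.∣ N i v ∣

 N-nrm : ∀ i v → N i v ≡ ⟦ nrm i v ⟧
 N-nrm i v with N-nonneg i v
 ... | n , e = trans e (cong ⟦_⟧ (sym (cong ℤ.∣_∣ e)))

 sq< : ∀ a n B k → k ℕ.* (a ℕ.* a) ℕ.≤ 8 ℕ.* n → 8 ℕ.* n ℕ.< k ℕ.* (suc B ℕ.* suc B) → a ℕ.≤ B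
 sq< a n B k h l = ℕP.≤-pred (sq-mono⁻¹ (ℕP.*-cancelˡ-< k (a ℕ.* a) (suc B ℕ.* suc B) (ℕP.≤-<-trans h l)))

 -- The shells of norm at most y fill an ellipse, which the rectangle contains by `crd-bound`. The
 -- series thus becomes a double sum that can be evaluated row by row.
 region : ∀ i f y A B → 8 ℕ.* y ℕ.< 5 ℕ.* (suc A ℕ.* suc A) → 8 ℕ.* y ℕ.< 15 ℕ.* (suc B ℕ.* suc B) →
         sum (λ n → cs i n * f n) y ≡ sumL (λ v → wt i v * cut y f (nrm i v)) (rect A B)
 region i f y A B hA hB = trans (sum-cong y (λ n h k → trans (cong (_* f n) (shell-rect n k)) (trans (*-comm (sumL (λ v → wt i v * ind (P? n v)) (rect A B)) (f n)) (sym (sumL-* (f n) (λ v → wt i v * ind (P? n v)) (rect A B))))))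
   (trans (sum-sumL (λ n v → f n * (wt i v * ind (P? n v))) (rect A B) y) (sumL-cong (rect A B) (λ v _ → trans (sum-cong y (λ n _ _ → l (f n) (wt i v) (ind (P? n v)))) (trans (sum-*ˡ (wt i v) (λ n → ind (P? n v) * f n) y)
       (cong (wt i v *_) (trans (sum-cong y (λ n _ _ → cong (λ z → ind (z ℤ.≟ ⟦ n ⟧) * f n) (N-nrm i v))) (sum-cut f y (nrm i v))))))))
  where
  l = solveℚ 3 (λ a b c → a :* (b :* c) := b :* (c :* a)) refl
  P? : ∀ n → Decidable (λ v → N i v ≡ ⟦ n ⟧)
  P? n v = N i v ℤ.≟ ⟦ n ⟧
  ru = U.cartesianProduct⁺ (range-unique A) (range-unique B)
  in-rect : ∀ n s t → n ℕ.≤ y → N i (s , t) ≡ ⟦ n ⟧ → (s , t) ∈ rect A B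
  in-rect n s t k e = ∈-cartesianProduct⁺ (∈-range A s (sq< _ n A 5 (proj₁ (crd-bound i s t n e)) (ℕP.≤-<-trans (ℕP.*-monoʳ-≤ 8 k) hA)))
            (∈-range B t (sq< _ n B 15 (proj₂ (crd-bound i s t n e)) (ℕP.≤-<-trans (ℕP.*-monoʳ-≤ 8 k) hB)))
  shell-rect : ∀ n → n ℕ.≤ y → cs i n ≡ sumL (λ v → wt i v * ind (P? n v)) (rect A B)
  shell-rect n k = trans (sumL-set (wt i) (shell-unique i n) (U.filter⁺ (P? n) ru) (λ v m → ∈-filter⁺ (P? n) (in-rect n (proj₁ v) (proj₂ v) k (∈-shell⁻ i n v m)) (∈-shell⁻ i n v m))
        (λ v m → ∈-shell i n v (proj₂ (∈-filter⁻ (P? n) {xs = rect A B} m)))) (sumL-filter (P? n) (wt i) (rect A B))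

 I : (ℤ → ℚ) → ℤ → ℕ → ℚ
 I h a zero = 0ℚ
 I h a (suc n) = h a + I h (ℤ.suc a) n

 I-snoc : ∀ h a n → I h a (suc n) ≡ I h a n + h (a ℤ.+ ⟦ n ⟧)
 I-snoc h a zero = trans (+-comm (h a) 0ℚ) (cong (λ z → 0ℚ + h z) (sym (ℤP.+-identityʳ a)))
 I-snoc h a (suc n) = trans (cong (λ z → h a + z) (I-snoc h (ℤ.suc a) n)) (trans (sym (+-assoc (h a) (I h (ℤ.suc a) n) (h (ℤ.suc a ℤ.+ ⟦ n ⟧)))) (cong (λ z → I h a (suc n) + h z) (solveℤ 2 (λ a n → # 1 :+ a :+ n := a :+ (# 1 :+ n)) refl a ⟦ n ⟧)))

 range-I : ∀ h B → sumL h (range B) ≡ I h (ℤ.- ⟦ B ⟧) (suc (B ℕ.+ B))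
 range-I h zero = refl
 range-I h (suc B) = trans (cong (λ z → h (ℤ.+ suc B) + (h (ℤ.-[1+ B ]) + z)) (range-I h B))
   (trans (lem (h (ℤ.+ suc B)) (h (ℤ.-[1+ B ])) (I h (ℤ.- ⟦ B ⟧) (suc (B ℕ.+ B)))) (cong (λ x → h (ℤ.-[1+ B ]) + x) (trans (trans (cong (λ z → I h (ℤ.- ⟦ B ⟧) (suc (B ℕ.+ B)) + h z) (sym e)) (sym (I-snoc h (ℤ.- ⟦ B ⟧) (suc (B ℕ.+ B))))) (cong₂ (I h) (sucneg B) (cong suc (sym (ℕP.+-suc B B)))))))
  where
  lem = solveℚ 3 (λ a b c → a :+ (b :+ c) := b :+ (c :+ a)) refl
  sucneg : ∀ B → ℤ.- ⟦ B ⟧ ≡ ℤ.suc (ℤ.-[1+ B ])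
  sucneg zero = refl
  sucneg (suc B) = refl
  l = solveℤ 1 (λ b → :- b :+ (# 1 :+ (b :+ b)) := # 1 :+ b) refl
  e : ℤ.- ⟦ B ⟧ ℤ.+ ⟦ suc (B ℕ.+ B) ⟧ ≡ ℤ.+ suc B
  e = trans (cong (λ z → ℤ.- ⟦ B ⟧ ℤ.+ z) (trans (ℤP.pos-+ 1 (B ℕ.+ B)) (cong (λ z → 1ℤ ℤ.+ z) (ℤP.pos-+ B B)))) (l ⟦ B ⟧)

 -- a telescoping summand restricted to a convex set
 module Convex (G : ℤ → ℚ) (G≥0 : ∀ t → 0ℚ ≤ G t) (G≤2 : ∀ t → G t ≤ qn 2) {P : ℤ → Set} (P? : Decidable P)
           (conv : ∀ t → P t → ¬ P (ℤ.suc t) → ∀ k → ¬ P (ℤ.suc t ℤ.+ ⟦ k ⟧)) where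

  f : ℤ → ℚ
  f t = (G (ℤ.suc t) - G t) * ind (P? t)

  out : ∀ a n → (∀ k → ¬ P (a ℤ.+ ⟦ k ⟧)) → I f a n ≡ 0ℚ
  out a zero h = refl
  out a (suc n) h = trans (cong₂ _+_ (trans (cong ((G (ℤ.suc a) - G a) *_) (ind-no (P? a) (λ p → h 0 (subst P (sym (ℤP.+-identityʳ a)) p)))) (*-zeroʳ (G (ℤ.suc a) - G a))) (out (ℤ.suc a) n (λ k p → h (suc k) (subst P (solveℤ 2 (λ a k → # 1 :+ a :+ k := a :+ (# 1 :+ k)) refl a ⟦ k ⟧) p)))) (+-identityʳ 0ℚ)

  inside : ∀ a n → P a → ∃ λ e → I f a n ≡ G e - G a
  inside a zero p = a , sym (+-inverseʳ (G a))
  inside a (suc n) p with P? (ℤ.suc a)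
  ... | yes q with inside (ℤ.suc a) n q
  ... | e , eq = e , trans (cong₂ _+_ (trans (cong ((G (ℤ.suc a) - G a) *_) (ind-yes (P? a) p)) (*-identityʳ (G (ℤ.suc a) - G a))) eq) (solveℚ 3 (λ a b c → (b :- a) :+ (c :- b) := c :- a) refl (G a) (G (ℤ.suc a)) (G e))
  inside a (suc n) p | no q = ℤ.suc a , trans (cong₂ _+_ (trans (cong ((G (ℤ.suc a) - G a) *_) (ind-yes (P? a) p)) (*-identityʳ (G (ℤ.suc a) - G a))) (out (ℤ.suc a) n (conv a p q))) (+-identityʳ (G (ℤ.suc a) - G a))

  bounded : ∀ a n → ∣ I f a n ∣ ≤ qn 2
  bounded a zero = qn-nn 2
  bounded a (suc n) with P? a
  ... | yes p = go (inside a (suc n) p)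
    where
    lem = solveℚ 2 (λ a b → :- (a :- b) := b :- a) refl
    le : ∀ x y → G x - G y ≤ qn 2
    le x y = ≤-trans (+-monoʳ-≤ (G x) (neg-antimono-≤ (G≥0 y))) (≤-trans (≤-reflexive (+-identityʳ (G x))) (G≤2 x))
    go : (∃ λ e → I f a (suc n) ≡ G e - G a) → ∣ (G (ℤ.suc a) - G a) * 1ℚ + I f (ℤ.suc a) n ∣ ≤ qn 2
    go (e , eq) = subst (λ z → ∣ z ∣ ≤ qn 2) (trans (sym eq) (cong (λ z → (G (ℤ.suc a) - G a) * z + I f (ℤ.suc a) n) (ind-yes (P? a) p))) (abs≤ (le e a) (≤-trans (≤-reflexive (lem (G e) (G a))) (le a e)))
  ... | no p = subst (λ z → ∣ z ∣ ≤ qn 2) (sym (trans (cong (_+ I f (ℤ.suc a) n) (*-zeroʳ (G (ℤ.suc a) - G a))) (+-identityˡ (I f (ℤ.suc a) n)))) (bounded (ℤ.suc a) n)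

 -- along a line of direction t the weight telescopes

 γ : Z3 → ℤ
 γ z0 = 0ℤ
 γ z1 = ℤ.+ 2
 γ z2 = ℤ.+ 1

 gg : Bool → Z3 → Z3 → ℤ
 gg false s t = γ t
 gg true s t = γ (t ⊞ s)

 ω-tel : ∀ i s t → s ≢ z0 → ω i s t ≡ gg i s (inc t) ℤ.- gg i s t
 ω-tel i z0 t h = ⊥-elim (h refl)
 ω-tel false z1 = λ t _ → from-yes (all3 λ t → ω false z1 t ℤ.≟ gg false z1 (inc t) ℤ.- gg false z1 t) t
 ω-tel false z2 = λ t _ → from-yes (all3 λ t → ω false z2 t ℤ.≟ gg false z2 (inc t) ℤ.- gg false z2 t) t
 ω-tel true z1 = λ t _ → from-yes (all3 λ t → ω true z1 t ℤ.≟ gg true z1 (inc t) ℤ.- gg true z1 t) t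
 ω-tel true z2 = λ t _ → from-yes (all3 λ t → ω true z2 t ℤ.≟ gg true z2 (inc t) ℤ.- gg true z2 t) t

 γ-bounds : ∀ x → (0ℤ ℤ.≤ γ x) × (γ x ℤ.≤ ℤ.+ 2)
 γ-bounds z0 = ℤ.+≤+ z≤n , ℤ.+≤+ z≤n
 γ-bounds z1 = ℤ.+≤+ z≤n , ℤ.+≤+ (s≤s (s≤s z≤n))
 γ-bounds z2 = ℤ.+≤+ z≤n , ℤ.+≤+ (s≤s z≤n)

 gg-bounds : ∀ i s t → (0ℤ ℤ.≤ gg i s t) × (gg i s t ℤ.≤ ℤ.+ 2)
 gg-bounds false s t = γ-bounds t
 gg-bounds true s t = γ-bounds (t ⊞ s)

 lead : Bool → ℤ
 lead false = ⟦ 6 ⟧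
 lead true = ⟦ 3 ⟧

 -- On a row, N is quadratic in t with second difference twice `lead`. If N grows from t to t + 1,
 -- it keeps growing, so the points of a row with N ≤ y form an interval.
 N-step : ∀ i s t k → N i (s , 1ℤ ℤ.+ t ℤ.+ k) ≡ N i (s , 1ℤ ℤ.+ t) ℤ.+ (k ℤ.* (N i (s , 1ℤ ℤ.+ t) ℤ.- N i (s , t)) ℤ.+ lead i ℤ.* (k ℤ.* (k ℤ.+ 1ℤ)))
 N-step false = solveℤ 3 (λ s t k → s :* s :+ # 3 :* (s :* (# 1 :+ t :+ k)) :+ # 6 :* ((# 1 :+ t :+ k) :* (# 1 :+ t :+ k)) := (s :* s :+ # 3 :* (s :* (# 1 :+ t)) :+ # 6 :* ((# 1 :+ t) :* (# 1 :+ t))) :+ (k :* ((s :* s :+ # 3 :* (s :* (# 1 :+ t)) :+ # 6 :* ((# 1 :+ t) :* (# 1 :+ t))) :- (s :* s :+ # 3 :* (s :* t) :+ # 6 :* (t :* t))) :+ # 6 :* (k :* (k :+ # 1)))) refl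
 N-step true = solveℤ 3 (λ s t k → # 2 :* (s :* s) :- # 3 :* (s :* (# 1 :+ t :+ k)) :+ # 3 :* ((# 1 :+ t :+ k) :* (# 1 :+ t :+ k)) := (# 2 :* (s :* s) :- # 3 :* (s :* (# 1 :+ t)) :+ # 3 :* ((# 1 :+ t) :* (# 1 :+ t))) :+ (k :* ((# 2 :* (s :* s) :- # 3 :* (s :* (# 1 :+ t)) :+ # 3 :* ((# 1 :+ t) :* (# 1 :+ t))) :- (# 2 :* (s :* s) :- # 3 :* (s :* t) :+ # 3 :* (t :* t))) :+ # 3 :* (k :* (k :+ # 1)))) refl

 module Row (i : Bool) (s : ℤ) (y : ℕ) where
  P : ℤ → Set
  P t = nrm i (s , t) ℕ.≤ y
  P? : Decidable P
  P? t = nrm i (s , t) ℕ.≤? y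

  lead≥0 : ∀ i k → 0ℤ ℤ.≤ lead i ℤ.* (⟦ k ⟧ ℤ.* (⟦ k ⟧ ℤ.+ 1ℤ))
  lead≥0 false k = subst (0ℤ ℤ.≤_) (trans (ℤP.pos-* 6 (k ℕ.* (k ℕ.+ 1))) (cong (⟦ 6 ⟧ ℤ.*_) (ℤP.pos-* k (k ℕ.+ 1)))) (ℤ.+≤+ z≤n)
  lead≥0 true k = subst (0ℤ ℤ.≤_) (trans (ℤP.pos-* 3 (k ℕ.* (k ℕ.+ 1))) (cong (⟦ 3 ⟧ ℤ.*_) (ℤP.pos-* k (k ℕ.+ 1)))) (ℤ.+≤+ z≤n)

  conv : ∀ t → P t → ¬ P (ℤ.suc t) → ∀ k → ¬ P (ℤ.suc t ℤ.+ ⟦ k ⟧)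
  conv t p q k r = q (ℤP.drop‿+≤+ (subst (ℤ._≤ ⟦ y ⟧) (N-nrm i (s , ℤ.suc t)) (ℤP.≤-trans (subst (ℤ._≤ N i (s , ℤ.suc t ℤ.+ ⟦ k ⟧)) (ℤP.+-identityʳ _) (subst (N i (s , ℤ.suc t) ℤ.+ 0ℤ ℤ.≤_) (sym (N-step i s t ⟦ k ⟧)) (ℤP.+-monoʳ-≤ (N i (s , ℤ.suc t)) (ℤP.+-mono-≤ inc≥0 (lead≥0 i k))))) (subst (ℤ._≤ ⟦ y ⟧) (sym (N-nrm i (s , ℤ.suc t ℤ.+ ⟦ k ⟧))) (ℤ.+≤+ r)))))
    where
    d≥0 : 0ℤ ℤ.≤ N i (s , ℤ.suc t) ℤ.- N i (s , t)
    d≥0 = ℤP.i≤j⇒0≤j-i (subst₂ ℤ._≤_ (sym (N-nrm i (s , t))) (sym (N-nrm i (s , ℤ.suc t))) (ℤ.+≤+ (ℕP.≤-trans p (ℕP.<⇒≤ (ℕP.≰⇒> q)))))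
    inc≥0 : 0ℤ ℤ.≤ ⟦ k ⟧ ℤ.* (N i (s , ℤ.suc t) ℤ.- N i (s , t))
    inc≥0 = subst (ℤ._≤ ⟦ k ⟧ ℤ.* (N i (s , ℤ.suc t) ℤ.- N i (s , t))) (ℤP.*-zeroʳ ⟦ k ⟧) (ℤP.*-monoˡ-≤-nonNeg ⟦ k ⟧ d≥0)

  G : ℤ → ℚ
  G t = qz (gg i (res s) (res t))

  module C = Convex G (λ t → ≤-trans (≤-reflexive (sym qz-0)) (qz-mono (proj₁ (gg-bounds i (res s) (res t))))) (λ t → qz-mono (proj₂ (gg-bounds i (res s) (res t)))) P? conv

  s≢0⇒nrm≥1 : s ≢ 0ℤ → ∀ t → 1 ℕ.≤ nrm i (s , t)
  s≢0⇒nrm≥1 ne t with nrm i (s , t) | N-nrm i (s , t)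
  ... | suc _ | _ = s≤s z≤n
  ... | zero | e = ⊥-elim (ne (ℤP.∣i∣≡0⇒i≡0 (sq0 ℤ.∣ s ∣ (proj₁ (crd-bound i s t 0 e)))))
    where
    sq0 : ∀ a → 5 ℕ.* (a ℕ.* a) ℕ.≤ 0 → a ≡ 0
    sq0 zero _ = refl

  one : ℕ → ℚ
  one _ = 1ℚ

  cut-ind : s ≢ 0ℤ → ∀ t → cut y one (nrm i (s , t)) ≡ ind (P? t)
  cut-ind ne t with (1 ℕ.≤? nrm i (s , t)) ×-dec (nrm i (s , t) ℕ.≤? y)
  ... | yes (_ , k) = sym (ind-yes (P? t) k)
  ... | no n = sym (ind-no (P? t) (λ k → n (s≢0⇒nrm≥1 ne t , k)))

  -- If 3 divides s, all weights of the row vanish. Otherwise s ≠ 0, no point of the row has norm 0,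
  -- and the weights telescope over an interval, leaving the difference of two values in [0,2].
  row : ∀ B → ∣ sumL (λ t → wt i (s , t) * cut y one (nrm i (s , t))) (range B) ∣ ≤ qn 2
  row B with res s ≟3 z0
  ... | yes e = subst (λ z → ∣ z ∣ ≤ qn 2) (sym (sumL-0 (range B) (λ t _ → trans (cong (λ z → qz (ω i z (res t)) * cut y one (nrm i (s , t))) e) (trans (cong (_* cut y one (nrm i (s , t))) (qz0 i (res t))) (*-zeroˡ (cut y one (nrm i (s , t)))))))) (qn-nn 2)
    where
    qz0 : ∀ i t → qz (ω i z0 t) ≡ 0ℚ
    qz0 false t = qz-0
    qz0 true t = qz-0
  ... | no ne = subst (λ z → ∣ z ∣ ≤ qn 2) (sym (trans (sumL-cong (range B) (λ t _ → cong₂ _*_ (tel t) (cut-ind (λ { refl → ne refl }) t))) (range-I C.f B))) (C.bounded (ℤ.- ⟦ B ⟧) (suc (B ℕ.+ B)))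
    where
    tel : ∀ t → wt i (s , t) ≡ G (ℤ.suc t) - G t
    tel t = trans (cong qz (trans (ω-tel i (res s) (res t) ne) (cong (λ z → gg i (res s) z ℤ.- gg i (res s) (res t)) (sym (res-+ 1ℤ t))))) (trans (qz-+ (gg i (res s) (res (ℤ.suc t))) (ℤ.- gg i (res s) (res t))) (cong (λ z → G (ℤ.suc t) + z) (qz-neg (gg i (res s) (res t)))))

 sumL-abs≤ : ∀ {A : Set} (f : A → ℚ) b xs → (∀ v → ∣ f v ∣ ≤ b) → ∣ sumL f xs ∣ ≤ sumL (λ _ → b) xs
 sumL-abs≤ f b [] h = ≤-refl
 sumL-abs≤ f b (x ∷ xs) h = abs-+≤ {f x} {sumL f xs} (h x) (sumL-abs≤ f b xs h)

 sum-range : ∀ B → sumL (λ _ → qn 2) (range B) ≡ qn (2 ℕ.* suc (B ℕ.+ B))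
 sum-range zero = +-identityʳ (qn 2)
 sum-range (suc B) = trans (cong (λ z → qn 2 + (qn 2 + z)) (sum-range B)) (trans (cong (λ z → qn 2 + z) (sym (qn-+ 2 (2 ℕ.* suc (B ℕ.+ B))))) (trans (sym (qn-+ 2 (2 ℕ.+ 2 ℕ.* suc (B ℕ.+ B)))) (cong qn (solveℕ 1 (λ B → Κ 2 :+ (Κ 2 :+ Κ 2 :* (Κ 1 :+ (B :+ B))) := Κ 2 :* (Κ 1 :+ ((Κ 1 :+ B) :+ (Κ 1 :+ B)))) refl B))))

 -- With r the root of y, at most 4r + 1 rows meet the ellipse and each sums to at most 2 in
 -- absolute value. Counting points alone would only give order y.
 C-bound : ∀ i y → ∣ sum (cs i) y ∣ ≤ qn 10 * rq y
 C-bound i zero = *-nn (qn-nn 10) (rq-nn 0)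
 C-bound i y@(suc y-1) = subst (λ z → ∣ z ∣ ≤ qn 10 * rq y) (sym (trans (sum-cong y (λ n _ _ → sym (*-identityʳ (cs i n)))) (trans (region i (λ _ → 1ℚ) y (2 ℕ.* r) (2 ℕ.* r) h5 (ℕP.<-≤-trans h5 (ℕP.*-monoˡ-≤ (suc (2 ℕ.* r) ℕ.* suc (2 ℕ.* r)) (ℕP.m≤m+n 5 10)))) (sumL-× (λ v → wt i v * cut y (λ _ → 1ℚ) (nrm i v)) (range (2 ℕ.* r)) (range (2 ℕ.* r))))))
    (≤-trans (sumL-abs≤ _ (qn 2) (range (2 ℕ.* r)) (λ s → Row.row i s y (2 ℕ.* r))) (≤-trans (≤-reflexive (sum-range (2 ℕ.* r))) (≤-trans (qn-mono le) (≤-reflexive (qn-* 10 r)))))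
  where
  r = isqrt y
  r≥1 = isqrt-pos y (s≤s z≤n)
  h5 : 8 ℕ.* y ℕ.< 5 ℕ.* (suc (2 ℕ.* r) ℕ.* suc (2 ℕ.* r))
  h5 = ℕP.≤-trans (s≤s (ℕP.*-monoʳ-≤ 8 (ℕP.≤-pred (proj₂ (isqrt-spec y))))) (ℕP.≤-trans (ℕP.m≤m+n _ (12 ℕ.* (r ℕ.* r) ℕ.+ 4 ℕ.* r ℕ.+ 4)) (ℕP.≤-reflexive (solveℕ 1 (λ r → (Κ 1 :+ (Κ 8 :* (r :+ r :* (Κ 1 :+ r)))) :+ (Κ 12 :* (r :* r) :+ Κ 4 :* r :+ Κ 4) := Κ 5 :* ((Κ 1 :+ (Κ 2 :* r)) :* (Κ 1 :+ (Κ 2 :* r)))) refl r)))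
  le : 2 ℕ.* suc (2 ℕ.* r ℕ.+ 2 ℕ.* r) ℕ.≤ 10 ℕ.* r
  le = ℕP.≤-trans (ℕP.≤-reflexive (l1 r)) (ℕP.≤-trans (ℕP.+-monoˡ-≤ (8 ℕ.* r) (ℕP.*-monoʳ-≤ 2 r≥1)) (ℕP.≤-reflexive (l2 r)))
    where
    l1 = solveℕ 1 (λ r → Κ 2 :* (Κ 1 :+ (Κ 2 :* r :+ Κ 2 :* r)) := Κ 2 :* Κ 1 :+ Κ 8 :* r) refl
    l2 = solveℕ 1 (λ r → Κ 2 :* r :+ Κ 8 :* r := Κ 10 :* r) refl

 data Cls (p : ℕ) : Set where
  is3 : p ≡ 3 → Cls p
  is5 : p ≡ 5 → Cls p
  split : p ≢ 3 → p ≢ 5 → ∀ j π → N j π ≡ ⟦ p ⟧ → (p ℕ.≤ 3 → ℤ.∣ W j π ∣ ℕ.≤ 1) → Cls p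
  inert : p ≢ 3 → p ≢ 5 → (∀ i v → ⟦ p ⟧ ∣ N i v → ⟦ p ⟧ ∣∣ v) → Cls p

 cls : ∀ p → Prime p → Cls p
 cls p pp with p ℕ.≟ 3 | p ℕ.≟ 5 | p ℕ.≟ 2
 ... | yes e | _ | _ = is3 e
 ... | no _ | yes e | _ = is5 e
 -- The element of norm 2 is ε, of weight -1; so |κ(2)| ≤ 1, as the contraction at 2 demands.
 ... | no n3 | no n5 | yes refl = split n3 n5 true (1ℤ , 0ℤ) refl (λ _ → s≤s z≤n)
 ... | no n3 | no n5 | no n2 with ℕP.anyUpTo? (λ r → ⟦ p ⟧ ∣? N false (⟦ r ⟧ , 1ℤ)) p
 ... | yes (r , _ , d) = fromElt (elt-exists p pp false (⟦ r ⟧ , 1ℤ) d (λ x → ∤-small (s≤s z≤n) (p≥2 pp) (proj₂ x)))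
  where
  fromElt : Elt p → Cls p
  fromElt (j , π , e) = split n3 n5 j π e (λ h → ⊥-elim (ge p pp n2 n3 h))
    where
    ge : ∀ p → Prime p → p ≢ 2 → p ≢ 3 → p ℕ.≤ 3 → ⊥
    ge 0 pp _ _ _ = ¬prime[0] pp
    ge 1 pp _ _ _ = ¬prime[1] pp
    ge 2 _ n _ _ = n refl
    ge 3 _ _ n _ = n refl
    ge (suc (suc (suc (suc _)))) _ _ _ (s≤s (s≤s (s≤s ())))
 ... | no none = inert n3 n5 h
  where
  eqN = solveℤ 3 (λ r k p → (r :+ k :* p) :* (r :+ k :* p) :+ # 3 :* ((r :+ k :* p) :* # 1) :+ # 6 :* (# 1 :* # 1) :- p :* (k :* (# 2 :* r :+ k :* p :+ # 3)) := r :* r :+ # 3 :* (r :* # 1) :+ # 6 :* (# 1 :* # 1)) refl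
  noroot : (∃ λ r → ⟦ p ⟧ ∣ N false (r , 1ℤ)) → ⊥
  noroot (r , d) with reduce p (p≥1 pp) r
  ... | r₀ , r₀<p , k , refl = none (r₀ , r₀<p , subst (⟦ p ⟧ ∣_) (eqN ⟦ r₀ ⟧ k ⟦ p ⟧) (∣m∣n⇒∣m-n d (∣m⇒∣m*n (k ℤ.* (ℤ.+ 2 ℤ.* ⟦ r₀ ⟧ ℤ.+ k ℤ.* ⟦ p ⟧ ℤ.+ ℤ.+ 3)) ∣-refl)))
  h : ∀ i v → ⟦ p ⟧ ∣ N i v → ⟦ p ⟧ ∣∣ v
  h i v d with ⟦ p ⟧ ∣∣? v
  ... | yes x = x
  ... | no n = ⊥-elim (noroot (rootOf pp n2 i v d n))

 -- the two L-series Σ (c₀ ± c₁)(n) / n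

 sgn : Bool → ℚ → ℚ
 sgn false _ = 1ℚ
 sgn true σ = σ

 -- The sign σ twists by the genus character, which is -1 in degree `true`: σ = 1 belongs to the
 -- class group character of order 3, σ = -1 to the one of order 6.
 module Series (σ : ℚ) (σσ : σ * σ ≡ 1ℚ) (∣σ∣ : ∣ σ ∣ ≤ 1ℚ) where

  c : ℕ → ℚ
  c n = cs false n + σ * cs true n

  κ' e' : ∀ {p} → Cls p → ℚ
  κ' (is3 _) = 0ℚ
  κ' (is5 _) = σ
  κ' (split _ _ j π _ _) = wt j π * sgn j σ
  κ' (inert _ _ _) = 0ℚ
  e' (is3 _) = 0ℚ
  e' (is5 _) = 0ℚ
  e' (split _ _ _ _ _ _) = 1ℚ
  e' (inert _ _ _) = - 1ℚ

  κ e : ℕ → ℚ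
  κ p with prime? p
  ... | yes pp = κ' (cls p pp)
  ... | no _ = 0ℚ
  e p with prime? p
  ... | yes pp = e' (cls p pp)
  ... | no _ = 0ℚ

  κ-prime : ∀ {p} → Prime p → ∃ λ pp → κ p ≡ κ' (cls p pp) × e p ≡ e' (cls p pp)
  κ-prime {p} pp with prime? p
  ... | yes qq = qq , refl , refl
  ... | no n = ⊥-elim (n pp)

  sgn≤ : ∀ j → ∣ sgn j σ ∣ ≤ 1ℚ
  sgn≤ false = ≤-refl
  sgn≤ true = ∣σ∣

  1≤2 : 1ℚ ≤ qn 2
  1≤2 = ≤-trans (≤-reflexive (sym qz-1)) (qn-mono (s≤s z≤n))

  κ'≤ : ∀ {p} (x : Cls p) → ∣ κ' x ∣ ≤ qn 2
  κ'≤ (is3 _) = qn-nn 2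
  κ'≤ (is5 _) = ≤-trans ∣σ∣ 1≤2
  κ'≤ (split _ _ j π _ _) = ≤-trans (abs-*≤ {wt j π} {sgn j σ} (abs-qz (W j π) (∣W∣≤2 j π)) (sgn≤ j)) (≤-reflexive (*-identityʳ (qn 2)))
  κ'≤ (inert _ _ _) = qn-nn 2

  κ'≤-small : ∀ {p} (x : Cls p) → p ℕ.≤ 3 → ∣ κ' x ∣ ≤ 1ℚ
  κ'≤-small (is3 _) _ = 0≤1
  κ'≤-small (is5 _) _ = ∣σ∣
  κ'≤-small (split _ _ j π _ h) k = ≤-trans (abs-*≤ {wt j π} {sgn j σ} (abs-qz (W j π) (h k)) (sgn≤ j)) (≤-reflexive (trans (*-identityʳ (qn 1)) qz-1))
  κ'≤-small (inert _ _ _) _ = 0≤1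

  e'≤ : ∀ {p} (x : Cls p) → ∣ e' x ∣ ≤ 1ℚ
  e'≤ (is3 _) = 0≤1
  e'≤ (is5 _) = 0≤1
  e'≤ (split _ _ _ _ _ _) = ≤-refl
  e'≤ (inert _ _ _) = ≤-refl

  move : ∀ a b {d} → a + b ≡ d → a ≡ d - b
  move a b refl = solveℚ 2 (λ a b → a := a :+ b :- b) refl a b

  c̃ : ℕ → ℕ → ℚ
  c̃ p m = c̃s p false m + σ * c̃s p true m

  relation : ∀ {p} → Prime p → (x : Cls p) → ∀ m → c (p ℕ.* m) ≡ κ' x * c m - e' x * c̃ p m
  relation pp (is3 refl) m = trans (cong₂ (λ a b → a + σ * b) (hecke-3 false m) (hecke-3 true m)) (solveℚ 3 (λ s a b → Κ 0ℚ :+ s :* Κ 0ℚ := Κ 0ℚ :* a :- Κ 0ℚ :* b) refl σ (c m) (c̃ 3 m))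
  relation pp (is5 refl) m = trans (cong₂ (λ a b → a + σ * b) (hecke-5 true m) (hecke-5 false m))
     (trans (cong (_+ σ * cs false m) (trans (sym (*-identityˡ (cs true m))) (cong (_* cs true m) (sym σσ)))) (l σ (cs false m) (cs true m) (c̃ 5 m)))
    where
    l = solveℚ 4 (λ s a b d → (s :* s) :* b :+ s :* a := s :* (a :+ s :* b) :- Κ 0ℚ :* d) refl
  relation {p} pp (split n3 n5 false π e _) m = trans (cong₂ (λ a b → a + σ * b) (move (cs false (p ℕ.* m)) (c̃s p false m) (hecke-split pp n3 false π e false m n5)) (move (cs true (p ℕ.* m)) (c̃s p true m) (hecke-split pp n3 false π e true m n5)))
     (l σ (wt false π) (cs false m) (cs true m) (c̃s p false m) (c̃s p true m))
    where
    l = solveℚ 6 (λ s w a b x y → (w :* a :- x) :+ s :* (w :* b :- y) := (w :* Κ 1ℚ) :* (a :+ s :* b) :- Κ 1ℚ :* (x :+ s :* y)) refl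
  relation {p} pp (split n3 n5 true π e _) m = trans (cong₂ (λ a b → a + σ * b) (move (cs false (p ℕ.* m)) (c̃s p false m) (hecke-split pp n3 true π e true m n5)) (move (cs true (p ℕ.* m)) (c̃s p true m) (hecke-split pp n3 true π e false m n5)))
     (trans (cong (λ z → (z - c̃s p false m) + σ * (wt true π * cs false m - c̃s p true m)) (trans (sym (*-identityˡ (wt true π * cs true m))) (cong (_* (wt true π * cs true m)) (sym σσ))))
       (l σ (wt true π) (cs false m) (cs true m) (c̃s p false m) (c̃s p true m)))
    where
    l = solveℚ 6 (λ s w a b x y → ((s :* s) :* (w :* b) :- x) :+ s :* (w :* a :- y) := (w :* s) :* (a :+ s :* b) :- Κ 1ℚ :* (x :+ s :* y)) refl
  relation {p} pp (inert n3 n5 h) m = trans (cong₂ (λ a b → a + σ * b) (hecke-inert pp n3 false m h) (hecke-inert pp n3 true m h)) (solveℚ 2 (λ a b → a := Κ 0ℚ :* b :- (:- Κ 1ℚ) :* a) refl (c̃ p m) (c m))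

  c̃-nd : ∀ p m → ¬ p ℕD.∣ m → c̃ p m ≡ 0ℚ
  c̃-nd p m h with p ℕD.∣? m
  ... | yes d = ⊥-elim (h d)
  ... | no _ = solveℚ 1 (λ s → Κ 0ℚ :+ s :* Κ 0ℚ := Κ 0ℚ) refl σ

  c̃-mult : ∀ p m → 1 ℕ.≤ p → c̃ p (p ℕ.* m) ≡ c m
  c̃-mult p m h with p ℕD.∣? (p ℕ.* m)
  ... | yes (ℕD.divides q e) = cong c (ℕP.*-cancelʳ-≡ q m p {{ℕ.>-nonZero h}} (trans (sym e) (ℕP.*-comm p m)))
  ... | no n = ⊥-elim (n (ℕD.m∣m*n m))

  C≤ : ∀ y → ∣ sum c y ∣ ≤ qn 20 * rq y
  C≤ y = ≤-trans (≤-reflexive (cong ∣_∣ (trans (sum-+ (cs false) (λ n → σ * cs true n) y) (cong (λ z → sum (cs false) y + z) (sum-*ˡ σ (cs true) y)))))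
    (≤-trans (abs-+≤ {sum (cs false) y} {σ * sum (cs true) y} (C-bound false y) (abs-*≤ {σ} {sum (cs true) y} ∣σ∣ (C-bound true y))) (≤-reflexive (trans (l (qn 10) (rq y)) (cong (_* rq y) (sym (qn-+ 10 10))))))
    where
    l = solveℚ 2 (λ a r → a :* r :+ Κ 1ℚ :* (a :* r) := (a :+ a) :* r) refl

  abstract
    hecke-nd : ∀ p m → Prime p → 1 ℕ.≤ m → ¬ p ℕD.∣ m → c (p ℕ.* m) ≡ κ p * c m
    hecke-nd p m pp h nd with κ-prime pp
    ... | pp' , ek , ee = trans (relation pp' (cls p pp') m) (trans (cong₂ (λ a b → a * c m - e' (cls p pp') * b) (sym ek) (c̃-nd p m nd)) (l (κ p * c m) (e' (cls p pp'))))
      where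
      l : ∀ a b → a - b * 0ℚ ≡ a
      l = solveℚ 2 (λ a b → a :- b :* Κ 0ℚ := a) refl

    hecke-d : ∀ p m → Prime p → 1 ℕ.≤ m → c (p ℕ.* (p ℕ.* m)) ≡ κ p * c (p ℕ.* m) - e p * c m
    hecke-d p m pp h with κ-prime pp
    ... | pp' , ek , ee = trans (relation pp' (cls p pp') (p ℕ.* m)) (cong₂ _-_ (cong (_* c (p ℕ.* m)) (sym ek)) (cong₂ _*_ (sym ee) (c̃-mult p m (p≥1 pp))))

  κ≤ : ∀ p → ∣ κ p ∣ ≤ qn 2
  κ≤ p with prime? p
  ... | yes pp = κ'≤ (cls p pp)
  ... | no _ = qn-nn 2

  κ≤-small : ∀ p → p ℕ.≤ 3 → ∣ κ p ∣ ≤ 1ℚ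
  κ≤-small p h with prime? p
  ... | yes pp = κ'≤-small (cls p pp) h
  ... | no _ = 0≤1

  e≤ : ∀ p → ∣ e p ∣ ≤ 1ℚ
  e≤ p with prime? p
  ... | yes pp = e'≤ (cls p pp)
  ... | no _ = 0≤1

  H : Hecke
  H = record { c = c ; κ = κ ; e = e ; κ≤ = κ≤ ; e≤ = e≤ ; κ≤-small = κ≤-small ; hecke = hecke-nd ; hecke∣ = hecke-d ; K = qn 20 ; C≤ = C≤ }

 sumZ : {A : Set} → (A → ℤ) → List A → ℤ
 sumZ f [] = 0ℤ
 sumZ f (x ∷ xs) = f x ℤ.+ sumZ f xs

 term : ℕ → ℕ → ℤ → ℕ → ℤ
 term D y w n with (1 ℕ.≤? n) ×-dec (n ℕ.≤? y)
 ... | yes _ = w ℤ.* ⟦ quo n D ⟧ ℤ.- ⟦ ℤ.∣ w ∣ ⟧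
 ... | no _ = 0ℤ

 lower : ℤ → Bool → ℕ → ℕ → ℕ → ℕ → ℤ
 lower σ i D y A B = sumZ (λ s → sumZ (λ t → term D y (σ ℤ.* W i (s , t)) (nrm i (s , t))) (range B)) (range A)

 sumZ-≤ : ∀ {A : Set} (f : A → ℤ) (g : A → ℚ) d xs → (∀ v → qz (f v) * d ≤ g v) → qz (sumZ f xs) * d ≤ sumL g xs
 sumZ-≤ f g d [] h = ≤-reflexive (trans (cong (_* d) qz-0) (*-zeroˡ d))
 sumZ-≤ f g d (x ∷ xs) h = ≤-trans (≤-reflexive (trans (cong (_* d) (qz-+ (f x) (sumZ f xs))) (*-distribʳ-+ d (qz (f x)) (qz (sumZ f xs))))) (+-mono-≤ (h x) (sumZ-≤ f g d xs h))

 term-≤ : ∀ D y w n → 1 ℕ.≤ D → qz (term D y w n) * iv D ≤ qz w * cut y iv n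
 term-≤ D y w n h with (1 ℕ.≤? n) ×-dec (n ℕ.≤? y)
 ... | yes _ = term-lower D h w n
 ... | no _ = ≤-reflexive (trans (cong (_* iv D) qz-0) (trans (*-zeroˡ (iv D)) (sym (*-zeroʳ (qz w)))))

 lower-≤ : ∀ σ i D y A B → 1 ℕ.≤ D → 8 ℕ.* y ℕ.< 5 ℕ.* (suc A ℕ.* suc A) → 8 ℕ.* y ℕ.< 15 ℕ.* (suc B ℕ.* suc B) →
          qz (lower σ i D y A B) * iv D ≤ qz σ * sum (λ n → cs i n * iv n) y
 lower-≤ σ i D y A B h hA hB = ≤-trans (sumZ-≤ _ (λ s → sumL (λ t → qz σ * (wt i (s , t) * cut y iv (nrm i (s , t)))) (range B)) (iv D) (range A) (λ s → sumZ-≤ _ _ (iv D) (range B) (λ t →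
      ≤-trans (term-≤ D y (σ ℤ.* W i (s , t)) (nrm i (s , t)) h) (≤-reflexive (trans (cong (_* cut y iv (nrm i (s , t))) (qz-* σ (W i (s , t)))) (*-assoc (qz σ) (wt i (s , t)) (cut y iv (nrm i (s , t)))))))))
  (≤-reflexive (trans (sym (sumL-× (λ v → qz σ * (wt i v * cut y iv (nrm i v))) (range A) (range B))) (trans (sumL-* (qz σ) (λ v → wt i v * cut y iv (nrm i v)) (rect A B)) (cong (qz σ *_) (sym (region i iv y A B hA hB))))))

 module Cert (σ : ℤ) (σσ : qz σ * qz σ ≡ 1ℚ) (∣σ∣ : ∣ qz σ ∣ ≤ 1ℚ) where
  open Series (qz σ) σσ ∣σ∣ public
  open MertensSeries.Main H using (S)

  S-split : ∀ y → S y ≡ qz 1ℤ * sum (λ n → cs false n * iv n) y + qz σ * sum (λ n → cs true n * iv n) y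
  S-split y = trans (sum-cong y (λ n _ _ → (solveℚ 4 (λ a s b i → (a :+ s :* b) :* i := a :* i :+ s :* (b :* i)) refl) (cs false n) (qz σ) (cs true n) (iv n))) (trans (sum-+ (λ n → cs false n * iv n) (λ n → qz σ * (cs true n * iv n)) y) (cong₂ _+_ (trans (sym (*-identityˡ (sum (λ n → cs false n * iv n) y))) (cong (_* sum (λ n → cs false n * iv n) y) (sym qz-1))) (sum-*ˡ (qz σ) (λ n → cs true n * iv n) y)))

  S-low : ∀ D x A B → 1 ℕ.≤ D → 1 ℕ.≤ x → 8 ℕ.* x ℕ.< 5 ℕ.* (suc A ℕ.* suc A) → 8 ℕ.* x ℕ.< 15 ℕ.* (suc B ℕ.* suc B) → ∀ {t} →
          t + qn 4 * qn 20 * iv (isqrt x) ≤ qz (lower 1ℤ false D x A B ℤ.+ lower σ true D x A B) * iv D → ∀ y → x ℕ.≤ y → t ≤ S y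
  S-low D x A B h hx hA hB {t} num y k = Low.S-low H x y {t = t} hx k S₀ num
    where
    a = lower 1ℤ false D x A B
    b = lower σ true D x A B
    S₀ : qz (a ℤ.+ b) * iv D ≤ S x
    S₀ = ≤-trans (≤-reflexive (trans (cong (_* iv D) (qz-+ a b)) (*-distribʳ-+ (iv D) (qz a) (qz b)))) (≤-trans (+-mono-≤ (lower-≤ 1ℤ false D x A B h hA hB) (lower-≤ σ true D x A B h hA hB)) (≤-reflexive (sym (S-split x))))

-- Numerical positivity for the ring class series

module FormCertificates where
 open import Data.Bool using (true; false)
 open import Data.Integer as ℤ using (ℤ)
 open import Data.Rational using (_+_; _*_; 1ℚ; _≤_; ∣_∣)
 open import Data.Rational.Properties
 open import Relation.Binary.PropositionalEquality
 open Rationals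
 open IntegerSqrt
 open FormSeries
 open Characters using (dec≤)

 opaque
  unfolding qz
  σσ₊ : qz 1ℤ * qz 1ℤ ≡ 1ℚ
  σσ₊ = refl
  σσ₋ : qz -1ℤ * qz -1ℤ ≡ 1ℚ
  σσ₋ = refl
  ∣σ₊∣ : ∣ qz 1ℤ ∣ ≤ 1ℚ
  ∣σ₊∣ = ≤-refl
  ∣σ₋∣ : ∣ qz -1ℤ ∣ ≤ 1ℚ
  ∣σ₋∣ = ≤-refl

 module C₊ = Cert 1ℤ σσ₊ ∣σ₊∣
 module C₋ = Cert -1ℤ σσ₋ ∣σ₋∣

 opaque
  unfolding qz iv
  -- With K = 20 the tail beyond 2500 is bounded by 80/50, which explains the long partial sum. The
  -- half-sides 63 and 36 are the least possible: 8 · 2500 is below 5 · 64² = 20480 and 15 · 37² =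
  -- 20535, but above 5 · 63² and 15 · 36².
  num₊ : iv 100 + qn 4 * qn 20 * iv (isqrt 2500) ≤ qz (lower 1ℤ false 100000 2500 63 36 ℤ.+ lower 1ℤ true 100000 2500 63 36) * iv 100000
  num₊ = dec≤
  num₋ : iv 100 + qn 4 * qn 20 * iv (isqrt 2500) ≤ qz (lower 1ℤ false 100000 2500 63 36 ℤ.+ lower -1ℤ true 100000 2500 63 36) * iv 100000
  num₋ = dec≤

 S₊ : ∀ y → 2500 ℕ.≤ y → iv 100 ≤ MertensSeries.Main.S C₊.H y
 S₊ = C₊.S-low 100000 2500 63 36 (ℕP.m≤m+n 1 99999) (ℕP.m≤m+n 1 2499) (ℕP.m≤m+n 20001 479) (ℕP.m≤m+n 20001 534) num₊

 S₋ : ∀ y → 2500 ℕ.≤ y → iv 100 ≤ MertensSeries.Main.S C₋.H y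
 S₋ = C₋.S-low 100000 2500 63 36 (ℕP.m≤m+n 1 99999) (ℕP.m≤m+n 1 2499) (ℕP.m≤m+n 20001 479) (ℕP.m≤m+n 20001 534) num₋

-- The Frobenius map in rings of characteristic p

module FrobeniusMap where
 open import Level using (0ℓ)
 open import Algebra using (CommutativeRing)
 open import Data.Nat using (_!)
 open import Data.Nat.DivMod using (m/n*n≡m)
 open import Data.Nat.Combinatorics using (_C_; nCk≡n!/k![n-k]!; nCn≡1; k![n∸k]!∣n!)
 open import Data.Fin using (zero; suc; toℕ; inject₁)
 import Data.Fin.Properties as FP
 open import Data.Vec.Functional using (Vector; tail; init; last)
 open import Data.List using (List; []; _∷_)
 open import Relation.Binary.PropositionalEquality as E using (_≡_; cong; subst)
 open Valuations using (p≥1)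
 open ChebyshevBound using (prime∣!; ∣!-≤)

 p∣pCk : ∀ {p} → Prime p → ∀ k → 1 ℕ.≤ k → k ℕ.< p → p ℕD.∣ (p C k)
 p∣pCk {p} pp k h l = fin (euclidsLemma (p C k) (k ! ℕ.* (p ℕ.∸ k) !) pp (subst (p ℕD.∣_) (E.sym eq) (∣!-≤ p p (p≥1 pp) ℕP.≤-refl)))
  where
  instance
   nz : ℕ.NonZero (k ! ℕ.* (p ℕ.∸ k) !)
   nz = ℕP.m*n≢0 (k !) ((p ℕ.∸ k) !) {{k ℕP.!≢0}} {{(p ℕ.∸ k) ℕP.!≢0}}
  eq : (p C k) ℕ.* (k ! ℕ.* (p ℕ.∸ k) !) ≡ p !
  eq = E.trans (cong (ℕ._* (k ! ℕ.* (p ℕ.∸ k) !)) (nCk≡n!/k![n-k]! (ℕP.<⇒≤ l))) (m/n*n≡m (k![n∸k]!∣n! (ℕP.<⇒≤ l)))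
  fin : (p ℕD.∣ (p C k)) ⊎ (p ℕD.∣ (k ! ℕ.* (p ℕ.∸ k) !)) → p ℕD.∣ (p C k)
  fin (inj₁ d) = d
  fin (inj₂ d) with euclidsLemma (k !) ((p ℕ.∸ k) !) pp d
  ... | inj₁ e = ⊥-elim (ℕP.<⇒≱ l (prime∣! k pp e))
  ... | inj₂ e = ⊥-elim (ℕP.<⇒≱ (ℕP.∸-monoʳ-< {p} {k} {0} h (ℕP.<⇒≤ l)) (prime∣! (p ℕ.∸ k) pp e))

 module Frobenius (R : CommutativeRing 0ℓ 0ℓ) (p : ℕ) (pp : Prime p) where
  open CommutativeRing R hiding (zero)
  open import Algebra.Properties.Semiring.Exp semiring public
  open import Algebra.Properties.CommutativeSemiring.Exp commutativeSemiring public using (^-distrib-*)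
  open import Algebra.Properties.Semiring.Mult semiring public renaming (_×_ to _·_)
  open import Algebra.Properties.Semiring.Sum semiring using (sum; sum-cong-≋; sum-init-last; sum-replicate-zero)
  import Algebra.Properties.CommutativeSemiring.Binomial commutativeSemiring as B
  open import Relation.Binary.Reasoning.Setoid setoid

  module _ (char : ∀ x → p · x ≈ 0#) where

   private
    sum-0 : ∀ n (t : Vector Carrier n) → (∀ i → t i ≈ 0#) → sum t ≈ 0#
    sum-0 n t h = trans (sum-cong-≋ h) (sum-replicate-zero n)

    ·-0 : ∀ n → n · 0# ≈ 0#
    ·-0 zero = refl
    ·-0 (suc n) = trans (+-identityˡ (n · 0#)) (·-0 n)

   interior : ∀ k x → 1 ℕ.≤ k → k ℕ.< p → (p C k) · x ≈ 0#
   interior k x h l with p∣pCk pp k h l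
   ... | ℕD.divides q e = trans (×-congˡ e) (trans (sym (×-assocˡ x q p)) (trans (×-congʳ q (char x)) (·-0 q)))

   expand : ∀ n → n ≡ p → ∀ x y → B.binomialExpansion x y n ≈ x ^ n + y ^ n
   expand zero e x y = ⊥-elim (¬prime[0] (subst Prime (E.sym e) pp))
   expand (suc n) e x y = begin
    t zero + sum (tail t)                     ≈⟨ +-congˡ (sum-init-last (tail t)) ⟩
    t zero + (sum (init (tail t)) + last (tail t)) ≈⟨ +-cong t0 (+-cong (sum-0 n (init (tail t)) mid) tl) ⟩
    y ^ suc n + (0# + x ^ suc n)              ≈⟨ +-congˡ (+-identityˡ (x ^ suc n)) ⟩
    y ^ suc n + x ^ suc n                     ≈⟨ +-comm (y ^ suc n) (x ^ suc n) ⟩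
    x ^ suc n + y ^ suc n                     ∎
    where
    t : Vector Carrier (suc (suc n))
    t = B.binomialTerm x y (suc n)
    t0 : t zero ≈ y ^ suc n
    t0 = trans (×-homo-1 _) (*-identityˡ (y ^ suc n))
    mid : ∀ i → init (tail t) i ≈ 0#
    mid i = interior' (toℕ (suc (inject₁ i))) _ (s≤s z≤n) (s≤s (subst (ℕ._< n) (E.sym (FP.toℕ-inject₁ i)) (FP.toℕ<n i)))
     where
     interior' : ∀ k z → 1 ℕ.≤ k → k ℕ.< suc n → (suc n C k) · z ≈ 0#
     interior' = subst (λ m → ∀ k z → 1 ℕ.≤ k → k ℕ.< m → (m C k) · z ≈ 0#) (E.sym e) interior
    tl : last (tail t) ≈ x ^ suc n
    tl = trans (×-congˡ (E.trans (cong (suc n C_) (FP.toℕ-fromℕ (suc n))) (nCn≡1 (suc n)))) (trans (×-homo-1 _) (trans (*-cong (^-congʳ x (FP.toℕ-fromℕ (suc n))) (^-congʳ y (E.trans (cong (suc n ℕ.∸_) (FP.toℕ-fromℕ (suc n))) (ℕP.n∸n≡0 (suc n))))) (*-identityʳ (x ^ suc n))))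

   frobenius-+ : ∀ x y → (x + y) ^ p ≈ x ^ p + y ^ p
   frobenius-+ x y = trans (B.theorem p x y) (expand p E.refl x y)

   0^p : 0# ^ p ≈ 0#
   0^p = go p E.refl
    where
    go : ∀ n → n ≡ p → 0# ^ n ≈ 0#
    go zero e = ⊥-elim (¬prime[0] (subst Prime (E.sym e) pp))
    go (suc n) e = zeroˡ (0# ^ n)

   -- The argument `s` is any list sum satisfying the two defining equations up to the equality of
   -- the ring; `Fam-frob` applies it to sums formed in the group ring before reduction modulo p.
   frobenius-sum : ∀ {A : Set} (f : A → Carrier) (s : (A → Carrier) → List A → Carrier) → (∀ g → s g [] ≈ 0#) → (∀ g x xs → s g (x ∷ xs) ≈ g x + s g xs) →
          ∀ xs → s f xs ^ p ≈ s (λ a → f a ^ p) xs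
   frobenius-sum f s s0 s+ [] = trans (^-congˡ p (s0 f)) (trans 0^p (sym (s0 (λ a → f a ^ p))))
   frobenius-sum f s s0 s+ (x ∷ xs) = trans (^-congˡ p (s+ f x xs)) (trans (frobenius-+ (f x) (s f xs)) (trans (+-congˡ (frobenius-sum f s s0 s+ xs)) (sym (s+ (λ a → f a ^ p) x xs))))

 -- Reduction modulo n keeps the carrier and the operations and only coarsens the equality, so every
 -- identity of R passes to the quotient through `lift`.
 module Quotient (R : CommutativeRing 0ℓ 0ℓ) (n : ℕ) where
  open CommutativeRing R hiding (zero)
  open import Algebra.Properties.Semiring.Mult semiring renaming (_×_ to _·_)
  open import Algebra.Properties.CommutativeMonoid.Mult +-commutativeMonoid using (×-distrib-+)
  open import Algebra.Properties.Ring ring using (-‿distribʳ-*; -0#≈0#; -‿+-comm)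
  open import Relation.Binary.Reasoning.Setoid setoid

  infix 4 _≈ₙ_
  _≈ₙ_ : Carrier → Carrier → Set
  x ≈ₙ y = ∃ λ z → x ≈ y + n · z

  private
   ·-0 : ∀ n → n · 0# ≈ 0#
   ·-0 zero = refl
   ·-0 (suc n) = trans (+-identityˡ (n · 0#)) (·-0 n)

   ·-neg : ∀ n x → n · (- x) ≈ - (n · x)
   ·-neg zero x = sym -0#≈0#
   ·-neg (suc n) x = trans (+-congˡ (·-neg n x)) (-‿+-comm x (n · x))

   medial : ∀ a b c d → (a + b) + (c + d) ≈ (a + c) + (b + d)
   medial a b c d = begin
    (a + b) + (c + d) ≈⟨ +-assoc a b (c + d) ⟩
    a + (b + (c + d)) ≈⟨ +-congˡ (sym (+-assoc b c d)) ⟩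
    a + ((b + c) + d) ≈⟨ +-congˡ (+-congʳ (+-comm b c)) ⟩
    a + ((c + b) + d) ≈⟨ +-congˡ (+-assoc c b d) ⟩
    a + (c + (b + d)) ≈⟨ +-assoc a c (b + d) ⟨
    (a + c) + (b + d) ∎

  lift : ∀ {x y} → x ≈ y → x ≈ₙ y
  lift {x} {y} e = 0# , trans e (trans (sym (+-identityʳ y)) (+-congˡ (sym (·-0 n))))

  ≈ₙ-sym : ∀ {x y} → x ≈ₙ y → y ≈ₙ x
  ≈ₙ-sym {x} {y} (z , e) = - z , (begin
   y                          ≈⟨ +-identityʳ y ⟨
   y + 0#                     ≈⟨ +-congˡ (-‿inverseʳ (n · z)) ⟨
   y + (n · z + - (n · z))    ≈⟨ +-assoc y (n · z) _ ⟨
   (y + n · z) + - (n · z)    ≈⟨ +-cong (sym e) (sym (·-neg n z)) ⟩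
   x + n · (- z)              ∎)

  ≈ₙ-trans : ∀ {x y w} → x ≈ₙ y → y ≈ₙ w → x ≈ₙ w
  ≈ₙ-trans {x} {y} {w} (z , e) (z' , e') = z' + z , (begin
   x                      ≈⟨ e ⟩
   y + n · z              ≈⟨ +-congʳ e' ⟩
   (w + n · z') + n · z   ≈⟨ +-assoc w _ _ ⟩
   w + (n · z' + n · z)   ≈⟨ +-congˡ (sym (×-distrib-+ z' z n)) ⟩
   w + n · (z' + z)       ∎)

  +-congₙ : ∀ {x y u v} → x ≈ₙ y → u ≈ₙ v → x + u ≈ₙ y + v
  +-congₙ {x} {y} {u} {v} (z , e) (z' , e') = z + z' , (begin
   x + u                          ≈⟨ +-cong e e' ⟩
   (y + n · z) + (v + n · z')     ≈⟨ medial y (n · z) v (n · z') ⟩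
   (y + v) + (n · z + n · z')     ≈⟨ +-congˡ (sym (×-distrib-+ z z' n)) ⟩
   (y + v) + n · (z + z')         ∎)

  *-congˡₙ : ∀ a {x y} → x ≈ₙ y → a * x ≈ₙ a * y
  *-congˡₙ a {x} {y} (z , e) = a * z , (begin
   a * x              ≈⟨ *-congˡ e ⟩
   a * (y + n · z)    ≈⟨ distribˡ a y (n · z) ⟩
   a * y + a * n · z  ≈⟨ +-congˡ (×-comm-* n a z) ⟩
   a * y + n · (a * z) ∎)

  *-congₙ : ∀ {x y u v} → x ≈ₙ y → u ≈ₙ v → x * u ≈ₙ y * v
  *-congₙ {x} {y} {u} {v} p q = ≈ₙ-trans (*-congˡₙ x q) (≈ₙ-trans (lift (*-comm x v)) (≈ₙ-trans (*-congˡₙ v p) (lift (*-comm v y))))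

  -‿congₙ : ∀ {x y} → x ≈ₙ y → - x ≈ₙ - y
  -‿congₙ {x} {y} (z , e) = - z , trans (-‿cong e) (trans (sym (-‿+-comm y (n · z))) (+-congˡ (sym (·-neg n z))))

  quotient : CommutativeRing 0ℓ 0ℓ
  quotient = record
   { Carrier = Carrier ; _≈_ = _≈ₙ_ ; _+_ = _+_ ; _*_ = _*_ ; -_ = -_ ; 0# = 0# ; 1# = 1#
   ; isCommutativeRing = record
    { isRing = record
     { +-isAbelianGroup = record
      { isGroup = record
       { isMonoid = record
        { isSemigroup = record
         { isMagma = record { isEquivalence = record { refl = lift refl ; sym = ≈ₙ-sym ; trans = ≈ₙ-trans } ; ∙-cong = +-congₙ }
         ; assoc = λ x y z → lift (+-assoc x y z) }
        ; identity = (λ x → lift (+-identityˡ x)) , (λ x → lift (+-identityʳ x)) }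
       ; inverse = (λ x → lift (-‿inverseˡ x)) , (λ x → lift (-‿inverseʳ x))
       ; ⁻¹-cong = -‿congₙ }
      ; comm = λ x y → lift (+-comm x y) }
     ; *-cong = *-congₙ
     ; *-assoc = λ x y z → lift (*-assoc x y z)
     ; *-identity = (λ x → lift (*-identityˡ x)) , (λ x → lift (*-identityʳ x))
     ; distrib = (λ x y z → lift (distribˡ x y z)) , (λ x y z → lift (distribʳ x y z)) }
    ; *-comm = λ x y → lift (*-comm x y) } }

  open import Algebra.Properties.Semiring.Mult (CommutativeRing.semiring quotient) using () renaming (_×_ to _·ₙ_)

  private
   ·-same : ∀ m x → m ·ₙ x ≡ m · x
   ·-same zero x = E.refl
   ·-same (suc m) x = cong (x +_) (·-same m x)

  quotient-char : ∀ x → n ·ₙ x ≈ₙ 0#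
  quotient-char x = x , trans (reflexive (·-same n x)) (sym (+-identityˡ (n · x)))

-- The ring ℤ[ω] and its congruences

module Eisenstein where
 open import Level using (0ℓ)
 open import Algebra using (CommutativeRing)
 open import Data.Integer as ℤ using (ℤ; _+_; _*_; _-_; -_)
 open import Data.Maybe using (Maybe; just; nothing)
 open import Relation.Binary.PropositionalEquality
 open import Tactic.RingSolver.Core.AlmostCommutativeRing using (AlmostCommutativeRing; fromCommutativeRing)
 open Integers

 -- ℤ[ω], ω² + ω + 1 = 0

 E : Set
 E = ℤ × ℤ

 infixl 6 _⊕_
 infixl 7 _⊗_
 infix 8 ⊝_
 _⊕_ _⊗_ : E → E → E
 x ⊕ y = proj₁ x + proj₁ y , proj₂ x + proj₂ y
 x ⊗ y = proj₁ x * proj₁ y - proj₂ x * proj₂ y , proj₁ x * proj₂ y + proj₂ x * proj₁ y - proj₂ x * proj₂ y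
 ⊝_ : E → E
 ⊝ x = - proj₁ x , - proj₂ x

 0E 1E ωE : E
 0E = 0ℤ , 0ℤ
 1E = 1ℤ , 0ℤ
 ωE = 0ℤ , 1ℤ

 ι : ℤ → E
 ι a = a , 0ℤ

 private
  ⊗-assoc₁ = solveℤ 6 (λ a b c d e f → (a :* c :- b :* d) :* e :- (a :* d :+ b :* c :- b :* d) :* f := a :* (c :* e :- d :* f) :- b :* (c :* f :+ d :* e :- d :* f)) refl
  ⊗-assoc₂ = solveℤ 6 (λ a b c d e f → (a :* c :- b :* d) :* f :+ (a :* d :+ b :* c :- b :* d) :* e :- (a :* d :+ b :* c :- b :* d) :* f := a :* (c :* f :+ d :* e :- d :* f) :+ b :* (c :* e :- d :* f) :- b :* (c :* f :+ d :* e :- d :* f)) refl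
  comm₁ = solveℤ 4 (λ a b c d → a :* c :- b :* d := c :* a :- d :* b) refl
  comm₂ = solveℤ 4 (λ a b c d → a :* d :+ b :* c :- b :* d := c :* b :+ d :* a :- d :* b) refl
  id₁ = solveℤ 2 (λ a b → # 1 :* a :- # 0 :* b := a) refl
  id₂ = solveℤ 2 (λ a b → # 1 :* b :+ # 0 :* a :- # 0 :* b := b) refl
  dist₁ = solveℤ 6 (λ a b c d e f → a :* (c :+ e) :- b :* (d :+ f) := a :* c :- b :* d :+ (a :* e :- b :* f)) refl
  dist₂ = solveℤ 6 (λ a b c d e f → a :* (d :+ f) :+ b :* (c :+ e) :- b :* (d :+ f) := a :* d :+ b :* c :- b :* d :+ (a :* f :+ b :* e :- b :* f)) refl

 ⊗-comm : ∀ x y → x ⊗ y ≡ y ⊗ x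
 ⊗-comm (a , b) (c , d) = cong₂ _,_ (comm₁ a b c d) (comm₂ a b c d)

 ⊗-assoc : ∀ x y z → (x ⊗ y) ⊗ z ≡ x ⊗ (y ⊗ z)
 ⊗-assoc (a , b) (c , d) (e , f) = cong₂ _,_ (⊗-assoc₁ a b c d e f) (⊗-assoc₂ a b c d e f)

 ⊗-identityˡ : ∀ x → 1E ⊗ x ≡ x
 ⊗-identityˡ (a , b) = cong₂ _,_ (id₁ a b) (id₂ a b)

 ⊗-distribˡ : ∀ x y z → x ⊗ (y ⊕ z) ≡ x ⊗ y ⊕ x ⊗ z
 ⊗-distribˡ (a , b) (c , d) (e , f) = cong₂ _,_ (dist₁ a b c d e f) (dist₂ a b c d e f)

 E-ring : CommutativeRing 0ℓ 0ℓ
 E-ring = record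
  { Carrier = E ; _≈_ = _≡_ ; _+_ = _⊕_ ; _*_ = _⊗_ ; -_ = ⊝_ ; 0# = 0E ; 1# = 1E
  ; isCommutativeRing = record
   { isRing = record
    { +-isAbelianGroup = record
     { isGroup = record
      { isMonoid = record
       { isSemigroup = record
        { isMagma = record { isEquivalence = isEquivalence ; ∙-cong = cong₂ _⊕_ }
        ; assoc = λ x y z → cong₂ _,_ (ℤP.+-assoc (proj₁ x) (proj₁ y) (proj₁ z)) (ℤP.+-assoc (proj₂ x) (proj₂ y) (proj₂ z)) }
       ; identity = (λ x → cong₂ _,_ (ℤP.+-identityˡ (proj₁ x)) (ℤP.+-identityˡ (proj₂ x))) , (λ x → cong₂ _,_ (ℤP.+-identityʳ (proj₁ x)) (ℤP.+-identityʳ (proj₂ x))) }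
      ; inverse = (λ x → cong₂ _,_ (ℤP.+-inverseˡ (proj₁ x)) (ℤP.+-inverseˡ (proj₂ x))) , (λ x → cong₂ _,_ (ℤP.+-inverseʳ (proj₁ x)) (ℤP.+-inverseʳ (proj₂ x)))
      ; ⁻¹-cong = cong ⊝_ }
     ; comm = λ x y → cong₂ _,_ (ℤP.+-comm (proj₁ x) (proj₁ y)) (ℤP.+-comm (proj₂ x) (proj₂ y)) }
    ; *-cong = cong₂ _⊗_
    ; *-assoc = ⊗-assoc
    ; *-identity = ⊗-identityˡ , (λ x → trans (⊗-comm x 1E) (⊗-identityˡ x))
    ; distrib = ⊗-distribˡ , (λ x y z → trans (⊗-comm (y ⊕ z) x) (trans (⊗-distribˡ x y z) (cong₂ _⊕_ (⊗-comm x y) (⊗-comm x z)))) }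
   ; *-comm = ⊗-comm } }

 E-almost : AlmostCommutativeRing 0ℓ 0ℓ
 E-almost = fromCommutativeRing E-ring isZero
  where
  isZero : ∀ x → Maybe (0E ≡ x)
  isZero (ℤ.+ zero , ℤ.+ zero) = just refl
  isZero _ = nothing

 open import Tactic.RingSolver.NonReflective E-almost public using () renaming (solve to solveE)

 open CommutativeRing E-ring public using () renaming (+-assoc to ⊕-assoc; +-comm to ⊕-comm; +-identityˡ to ⊕-identityˡ; +-identityʳ to ⊕-identityʳ; zeroˡ to ⊗-zeroˡ; zeroʳ to ⊗-zeroʳ; *-identityʳ to ⊗-identityʳ; distribʳ to ⊗-distribʳ; -‿inverseʳ to ⊕-inverseʳ)
 open import Algebra.Properties.Semiring.Exp (CommutativeRing.semiring E-ring) public using () renaming (_^_ to _^E_; ^-assocʳ to ^E-assocʳ; ^-homo-* to ^E-homo-*)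
 open import Algebra.Properties.CommutativeSemiring.Exp (CommutativeRing.commutativeSemiring E-ring) public using () renaming (^-distrib-* to ^E-distrib-*)

 conjE : E → E
 conjE x = proj₁ x - proj₂ x , - proj₂ x

 conj-⊕ : ∀ x y → conjE (x ⊕ y) ≡ conjE x ⊕ conjE y
 conj-⊕ (a , b) (c , d) = cong₂ _,_ (solveℤ 4 (λ a b c d → a :+ c :- (b :+ d) := a :- b :+ (c :- d)) refl a b c d) (ℤP.neg-distrib-+ b d)

 conj-⊗ : ∀ x y → conjE (x ⊗ y) ≡ conjE x ⊗ conjE y
 conj-⊗ (a , b) (c , d) = cong₂ _,_ (l a b c d) (l2 a b c d)
  where
  l = solveℤ 4 (λ a b c d → a :* c :- b :* d :- (a :* d :+ b :* c :- b :* d) := (a :- b) :* (c :- d) :- (:- b) :* (:- d)) refl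
  l2 = solveℤ 4 (λ a b c d → :- (a :* d :+ b :* c :- b :* d) := (a :- b) :* (:- d) :+ (:- b) :* (c :- d) :- (:- b) :* (:- d)) refl

 conj-invol : ∀ x → conjE (conjE x) ≡ x
 conj-invol (a , b) = cong₂ _,_ (solveℤ 2 (λ a b → a :- b :- :- b := a) refl a b) (ℤP.neg-involutive b)

 normE : E → ℤ
 normE x = proj₁ x * proj₁ x - proj₁ x * proj₂ x + proj₂ x * proj₂ x

 x⊗conj : ∀ x → x ⊗ conjE x ≡ ι (normE x)
 x⊗conj (a , b) = cong₂ _,_ (l a b) (l2 a b)
  where
  l = solveℤ 2 (λ a b → a :* (a :- b) :- b :* (:- b) := a :* a :- a :* b :+ b :* b) refl
  l2 = solveℤ 2 (λ a b → a :* (:- b) :+ b :* (a :- b) :- b :* (:- b) := # 0) refl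

 norm-⊗ : ∀ x y → normE (x ⊗ y) ≡ normE x * normE y
 norm-⊗ (a , b) (c , d) = solveℤ 4 (λ a b c d → (a :* c :- b :* d) :* (a :* c :- b :* d) :- (a :* c :- b :* d) :* (a :* d :+ b :* c :- b :* d) :+ (a :* d :+ b :* c :- b :* d) :* (a :* d :+ b :* c :- b :* d) := (a :* a :- a :* b :+ b :* b) :* (c :* c :- c :* d :+ d :* d)) refl a b c d

 norm-conj : ∀ x → normE (conjE x) ≡ normE x
 norm-conj (a , b) = solveℤ 2 (λ a b → (a :- b) :* (a :- b) :- (a :- b) :* (:- b) :+ (:- b) :* (:- b) := a :* a :- a :* b :+ b :* b) refl a b

 ι-⊗ : ∀ a b → ι (a * b) ≡ ι a ⊗ ι b
 ι-⊗ a b = cong₂ _,_ (l a b) (l2 a b)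
  where
  l = solveℤ 2 (λ a b → a :* b := a :* b :- # 0 :* # 0) refl
  l2 = solveℤ 2 (λ a b → # 0 := a :* # 0 :+ # 0 :* b :- # 0 :* # 0) refl

 ι-⊗-scale : ∀ k x → ι k ⊗ x ≡ (k * proj₁ x , k * proj₂ x)
 ι-⊗-scale k (a , b) = cong₂ _,_ (l k a b) (l2 k a b)
  where
  l = solveℤ 3 (λ k a b → k :* a :- # 0 :* b := k :* a) refl
  l2 = solveℤ 3 (λ k a b → k :* b :+ # 0 :* a :- # 0 :* b := k :* b) refl

 ι-^ : ∀ a n → ι (a ℤ.^ n) ≡ ι a ^E n
 ι-^ a zero = refl
 ι-^ a (suc n) = trans (ι-⊗ a (a ℤ.^ n)) (cong (ι a ⊗_) (ι-^ a n))

 ι-cancel : ∀ k → .{{ℤ.NonZero k}} → ∀ {x y} → ι k ⊗ x ≡ ι k ⊗ y → x ≡ y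
 ι-cancel k {x} {y} e = cong₂ _,_ (ℤP.*-cancelˡ-≡ k (proj₁ x) (proj₁ y) (cong proj₁ e')) (ℤP.*-cancelˡ-≡ k (proj₂ x) (proj₂ y) (cong proj₂ e'))
  where
  e' = trans (sym (ι-⊗-scale k x)) (trans e (ι-⊗-scale k y))

 infix 4 _≋_[_]
 record _≋_[_] (x y : E) (n : ℕ) : Set where
  constructor _,_
  field
   wit : E
   eqn : x ≡ y ⊕ ι ⟦ n ⟧ ⊗ wit

 module _ {n : ℕ} where
  ≋-refl : ∀ {x} → x ≋ x [ n ]
  ≋-refl {x} = 0E , (solveE 2 (λ x k → x := x :+ k :* Κ 0E) refl) x (ι ⟦ n ⟧)

  ≋-reflexive : ∀ {x y} → x ≡ y → x ≋ y [ n ]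
  ≋-reflexive refl = ≋-refl

  ≋-sym : ∀ {x y} → x ≋ y [ n ] → y ≋ x [ n ]
  ≋-sym {x} {y} (z , refl) = ⊝ z , (solveE 3 (λ y k z → y := y :+ k :* z :+ k :* (:- z)) refl) y (ι ⟦ n ⟧) z

  ≋-trans : ∀ {x y w} → x ≋ y [ n ] → y ≋ w [ n ] → x ≋ w [ n ]
  ≋-trans {w = w} (z , refl) (z' , refl) = z' ⊕ z , (solveE 4 (λ w k a b → w :+ k :* a :+ k :* b := w :+ k :* (a :+ b)) refl) w (ι ⟦ n ⟧) z' z

  ≋-⊗ : ∀ {x y u v} → x ≋ y [ n ] → u ≋ v [ n ] → x ⊗ u ≋ y ⊗ v [ n ]
  ≋-⊗ {y = y} {v = v} (z , refl) (z' , refl) = _ , (solveE 5 (λ y v k a b → (y :+ k :* a) :* (v :+ k :* b) := y :* v :+ k :* (y :* b :+ a :* v :+ k :* a :* b)) refl) y v (ι ⟦ n ⟧) z z'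

  ≋-⊕ : ∀ {x y u v} → x ≋ y [ n ] → u ≋ v [ n ] → x ⊕ u ≋ y ⊕ v [ n ]
  ≋-⊕ {y = y} {v = v} (z , refl) (z' , refl) = _ , (solveE 5 (λ y v k a b → (y :+ k :* a) :+ (v :+ k :* b) := (y :+ v) :+ k :* (a :+ b)) refl) y v (ι ⟦ n ⟧) z z'

  ≋-^ : ∀ {x y} m → x ≋ y [ n ] → x ^E m ≋ y ^E m [ n ]
  ≋-^ zero p = ≋-refl
  ≋-^ (suc m) p = ≋-⊗ p (≋-^ m p)

  ≋-conj : ∀ {x y} → x ≋ y [ n ] → conjE x ≋ conjE y [ n ]
  ≋-conj {y = y} (z , refl) = conjE z , trans (conj-⊕ y (ι ⟦ n ⟧ ⊗ z)) (cong (conjE y ⊕_) (trans (conj-⊗ (ι ⟦ n ⟧) z) (cong (_⊗ conjE z) ι-conj)))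

   where
   ι-conj : conjE (ι ⟦ n ⟧) ≡ ι ⟦ n ⟧
   ι-conj = cong₂ _,_ (ℤP.+-identityʳ ⟦ n ⟧) refl

  ι-≋ : ∀ {a b} → ⟦ n ⟧ ∣ (a - b) → ι a ≋ ι b [ n ]
  ι-≋ {a} {b} (divides q e) = ι q , cong₂ _,_ (trans (l a b) (trans (cong (b +_) e) (l2 b q ⟦ n ⟧))) (l3 q ⟦ n ⟧)
   where
   l = solveℤ 2 (λ a b → a := b :+ (a :- b)) refl
   l2 = solveℤ 3 (λ b q n → b :+ q :* n := b :+ (n :* q :- # 0 :* # 0)) refl
   l3 = solveℤ 2 (λ q n → # 0 := # 0 :+ (n :* # 0 :+ # 0 :* q :- # 0 :* # 0)) refl

  ≋⇒∣₁ : ∀ {x y} → x ≋ y [ n ] → ⟦ n ⟧ ∣ (proj₁ x - proj₁ y)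
  ≋⇒∣₁ {y = y} (z , refl) = divides (proj₁ z) (solveℤ 4 (λ y k a b → y :+ (k :* a :- # 0 :* b) :- y := a :* k) refl (proj₁ y) ⟦ n ⟧ (proj₁ z) (proj₂ z))

  ≋⇒∣₂ : ∀ {x y} → x ≋ y [ n ] → ⟦ n ⟧ ∣ (proj₂ x - proj₂ y)
  ≋⇒∣₂ {y = y} (z , refl) = divides (proj₂ z) (solveℤ 4 (λ y k a b → y :+ (k :* b :+ # 0 :* a :- # 0 :* b) :- y := b :* k) refl (proj₂ y) ⟦ n ⟧ (proj₁ z) (proj₂ z))

  ∣⇒≋ : ∀ {x y} → ⟦ n ⟧ ∣ (proj₁ x - proj₁ y) → ⟦ n ⟧ ∣ (proj₂ x - proj₂ y) → x ≋ y [ n ]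
  ∣⇒≋ {x} {y} (divides a e) (divides b f) = (a , b) , cong₂ _,_ (trans (l (proj₁ x) (proj₁ y)) (trans (cong (proj₁ y +_) e) (l2 (proj₁ y) a b ⟦ n ⟧))) (trans (l (proj₂ x) (proj₂ y)) (trans (cong (proj₂ y +_) f) (l3 (proj₂ y) a b ⟦ n ⟧)))
   where
   l = solveℤ 2 (λ a b → a := b :+ (a :- b)) refl
   l2 = solveℤ 4 (λ y a b n → y :+ a :* n := y :+ (n :* a :- # 0 :* b)) refl
   l3 = solveℤ 4 (λ y a b n → y :+ b :* n := y :+ (n :* b :+ # 0 :* a :- # 0 :* b)) refl

-- Congruences modulo p: Fermat, Lagrange and Euler

module PrimeField where
 open import Algebra using (CommutativeRing)
 open import Data.Integer as ℤ using (ℤ; _+_; _*_; _-_; -_; _^_)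
 open import Data.Vec using (Vec; []; _∷_)
 open import Relation.Binary.PropositionalEquality
 open Valuations using (p≥1; p≥2)
 open Integers
 open FrobeniusMap
 open Eisenstein

 infix 4 _≡_[mod_]
 record _≡_[mod_] (a b : ℤ) (n : ℕ) : Set where
  constructor cg
  field d : ⟦ n ⟧ ∣ (a - b)

 module _ {n : ℕ} where
  ≡m-refl : ∀ {a} → a ≡ a [mod n ]
  ≡m-refl {a} = cg (divides 0ℤ (ℤP.+-inverseʳ a))
  ≡m-reflexive : ∀ {a b} → a ≡ b → a ≡ b [mod n ]
  ≡m-reflexive refl = ≡m-refl
  ≡m-sym : ∀ {a b} → a ≡ b [mod n ] → b ≡ a [mod n ]
  ≡m-sym {a} {b} (cg d) = cg (subst (⟦ n ⟧ ∣_) (solveℤ 2 (λ a b → :- (a :- b) := b :- a) refl a b) (∣m⇒∣-m d))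
  ≡m-trans : ∀ {a b c} → a ≡ b [mod n ] → b ≡ c [mod n ] → a ≡ c [mod n ]
  ≡m-trans {a} {b} {c} (cg d) (cg e) = cg (subst (⟦ n ⟧ ∣_) (solveℤ 3 (λ a b c → (a :- b) :+ (b :- c) := a :- c) refl a b c) (∣m∣n⇒∣m+n d e))
  ≡m-* : ∀ {a b c d} → a ≡ b [mod n ] → c ≡ d [mod n ] → a * c ≡ b * d [mod n ]
  ≡m-* {a} {b} {c} {d} (cg x) (cg y) = cg (subst (⟦ n ⟧ ∣_) (solveℤ 4 (λ a b c d → c :* (a :- b) :+ b :* (c :- d) := a :* c :- b :* d) refl a b c d) (∣m∣n⇒∣m+n (∣n⇒∣m*n c x) (∣n⇒∣m*n b y)))
  ≡m-+ : ∀ {a b c d} → a ≡ b [mod n ] → c ≡ d [mod n ] → a + c ≡ b + d [mod n ]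
  ≡m-+ {a} {b} {c} {d} (cg x) (cg y) = cg (subst (⟦ n ⟧ ∣_) (solveℤ 4 (λ a b c d → (a :- b) :+ (c :- d) := a :+ c :- (b :+ d)) refl a b c d) (∣m∣n⇒∣m+n x y))
  ≡m-^ : ∀ {a b} k → a ≡ b [mod n ] → a ^ k ≡ b ^ k [mod n ]
  ≡m-^ zero h = ≡m-refl
  ≡m-^ (suc k) h = ≡m-* h (≡m-^ k h)
  ∣⇒≡m0 : ∀ {a} → ⟦ n ⟧ ∣ a → a ≡ 0ℤ [mod n ]
  ∣⇒≡m0 {a} d = cg (subst (⟦ n ⟧ ∣_) (sym (ℤP.+-identityʳ a)) d)
  ≡m0⇒∣ : ∀ {a} → a ≡ 0ℤ [mod n ] → ⟦ n ⟧ ∣ a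
  ≡m0⇒∣ {a} (cg d) = subst (⟦ n ⟧ ∣_) (ℤP.+-identityʳ a) d

 cancel-m : ∀ {p} → Prime p → ∀ c {a b} → ¬ ⟦ p ⟧ ∣ c → c * a ≡ c * b [mod p ] → a ≡ b [mod p ]
 cancel-m {p} pp c {a} {b} n (cg d) = fin (euclid pp c (a - b) (subst (⟦ p ⟧ ∣_) (l c a b) d))
  where
  l = solveℤ 3 (λ c a b → c :* a :- c :* b := c :* (a :- b)) refl
  fin : (⟦ p ⟧ ∣ c) ⊎ (⟦ p ⟧ ∣ (a - b)) → a ≡ b [mod p ]
  fin (inj₁ e) = ⊥-elim (n e)
  fin (inj₂ e) = cg e

 ∤-^ : ∀ {p} → Prime p → ∀ a n → ¬ ⟦ p ⟧ ∣ a → ¬ ⟦ p ⟧ ∣ a ^ n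
 ∤-^ pp a zero h d = ∤-small (s≤s z≤n) (p≥2 pp) d
 ∤-^ pp a (suc n) h d with euclid pp a (a ^ n) d
 ... | inj₁ e = h e
 ... | inj₂ e = ∤-^ pp a n h e

 module FrobE (p : ℕ) (pp : Prime p) where
  module Q = Quotient E-ring p
  module F = Frobenius Q.quotient p pp
  open import Algebra.Properties.Semiring.Mult (CommutativeRing.semiring E-ring) using () renaming (_×_ to _·_)

  ·-ι : ∀ n z → n · z ≡ ι ⟦ n ⟧ ⊗ z
  ·-ι zero z = sym (⊗-zeroˡ z)
  ·-ι (suc n) z = trans (cong (z ⊕_) (·-ι n z)) (sym (trans (cong (λ k → ι k ⊗ z) (ℤP.pos-+ 1 n)) (trans (⊗-distribʳ z (ι 1ℤ) (ι ⟦ n ⟧)) (cong (_⊕ ι ⟦ n ⟧ ⊗ z) (⊗-identityˡ z)))))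

  to≋ : ∀ {x y} → x Q.≈ₙ y → x ≋ y [ p ]
  to≋ {x} {y} (z , e) = z , trans e (cong (y ⊕_) (·-ι p z))

  ^-eq : ∀ x n → x F.^ n ≡ x ^E n
  ^-eq x zero = refl
  ^-eq x (suc n) = cong (x ⊗_) (^-eq x n)

  frobE : ∀ x y → (x ⊕ y) ^E p ≋ x ^E p ⊕ y ^E p [ p ]
  frobE x y = ≋-trans (≋-reflexive (sym (^-eq (x ⊕ y) p))) (≋-trans (to≋ (F.frobenius-+ Q.quotient-char x y)) (≋-reflexive (cong₂ _⊕_ (^-eq x p) (^-eq y p))))

 ι-mod : ∀ {n a b} → a ≡ b [mod n ] → ι a ≋ ι b [ n ]
 ι-mod (cg d) = ι-≋ d

 mod-ι : ∀ {n a b} → ι a ≋ ι b [ n ] → a ≡ b [mod n ]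
 mod-ι h = cg (≋⇒∣₁ h)

 -- Induction on the residue; the additivity of the p-th power is taken from ℤ[ω] by means of `ι`.
 fermat : ∀ {p} → Prime p → ∀ a → a ^ p ≡ a [mod p ]
 fermat {p} pp a with reduce p (p≥1 pp) a
 ... | r , _ , k , e = ≡m-trans (≡m-^ p a≡r) (≡m-trans (nat r) (≡m-sym a≡r))
  where
  open FrobE p pp
  l = solveℤ 3 (λ r k p → r :+ k :* p :- r := k :* p) refl
  a≡r : a ≡ ⟦ r ⟧ [mod p ]
  a≡r = cg (divides k (trans (cong (_- ⟦ r ⟧) e) (l ⟦ r ⟧ k ⟦ p ⟧)))
  1^ : ∀ n → 1ℤ ^ n ≡ 1ℤ
  1^ zero = refl
  1^ (suc n) = trans (ℤP.*-identityˡ (1ℤ ^ n)) (1^ n)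
  0^ : ∀ n → 1 ℕ.≤ n → 0ℤ ^ n ≡ 0ℤ
  0^ (suc n) _ = refl
  nat : ∀ r → ⟦ r ⟧ ^ p ≡ ⟦ r ⟧ [mod p ]
  nat zero = ≡m-reflexive (0^ p (p≥1 pp))
  nat (suc r) = mod-ι (≋-trans (≋-reflexive (ι-^ ⟦ suc r ⟧ p)) (≋-trans (frobE 1E (ι ⟦ r ⟧)) (≋-trans (≋-reflexive (cong₂ _⊕_ (trans (sym (ι-^ 1ℤ p)) (cong ι (1^ p))) (sym (ι-^ ⟦ r ⟧ p)))) (≋-⊕ (≋-refl {p} {1E}) (ι-mod (nat r))))))

 fermat' : ∀ {p} → Prime p → ∀ p' → p ≡ suc p' → ∀ a → ¬ ⟦ p ⟧ ∣ a → a ^ p' ≡ 1ℤ [mod p ]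
 fermat' {p} pp p' refl a h = cancel-m pp a h (≡m-trans (fermat pp a) (≡m-reflexive (sym (ℤP.*-identityʳ a))))

 -- monic polynomials are given by their lower coefficients

 eval : ∀ {d} → Vec ℤ d → ℤ → ℤ
 eval [] x = 1ℤ
 eval (c ∷ cs) x = c + x * eval cs x

 addmul : ∀ {d} → Vec ℤ (suc d) → ℤ → Vec ℤ d → Vec ℤ (suc d)
 addmul (c ∷ cs) r [] = (c + r) ∷ cs
 addmul (c ∷ cs) r (k ∷ ks) = (c + r * k) ∷ addmul cs r ks

 eval-addmul : ∀ {d} (f : Vec ℤ (suc d)) r (g : Vec ℤ d) x → eval (addmul f r g) x ≡ eval f x + r * eval g x
 eval-addmul (c ∷ cs) r [] x = solveℤ 3 (λ c r y → c :+ r :+ y := c :+ y :+ r :* # 1) refl c r (x * eval cs x)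
 eval-addmul (c ∷ cs) r (k ∷ ks) x = trans (cong (λ z → c + r * k + x * z) (eval-addmul cs r ks x)) (solveℤ 6 (λ c r k x f g → c :+ r :* k :+ x :* (f :+ r :* g) := c :+ x :* f :+ r :* (k :+ x :* g)) refl c r k x (eval cs x) (eval ks x))

 quot : ∀ {d} → Vec ℤ (suc d) → ℤ → Vec ℤ d
 quot {zero} f r = []
 quot {suc d} (c ∷ f) r = addmul f r (quot f r)

 eval-quot : ∀ {d} (f : Vec ℤ (suc d)) r x → eval f x - eval f r ≡ (x - r) * eval (quot f r) x
 eval-quot {zero} (c ∷ []) r x = solveℤ 3 (λ c x r → c :+ x :* # 1 :- (c :+ r :* # 1) := (x :- r) :* # 1) refl c x r
 eval-quot {suc d} (c ∷ f) r x = trans (l c x r (eval f x) (eval f r)) (trans (cong (λ z → (x - r) * eval f x + r * z) (eval-quot f r x)) (trans (l2 x r (eval f x) (eval (quot f r) x)) (cong ((x - r) *_) (sym (eval-addmul f r (quot f r) x)))))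
  where
  l = solveℤ 5 (λ c x r f g → c :+ x :* f :- (c :+ r :* g) := (x :- r) :* f :+ r :* (f :- g)) refl
  l2 = solveℤ 4 (λ x r f q → (x :- r) :* f :+ r :* ((x :- r) :* q) := (x :- r) :* (f :+ r :* q)) refl

 lagrange : ∀ {p} → Prime p → ∀ d (f : Vec ℤ d) (r : ℕ → ℤ) → (∀ i → i ℕ.≤ d → ⟦ p ⟧ ∣ eval f (r i)) → (∀ i j → i ℕ.< j → j ℕ.≤ d → ¬ ⟦ p ⟧ ∣ (r i - r j)) → ⊥
 lagrange pp zero [] r root dist = ∤-small (s≤s z≤n) (p≥2 pp) (root 0 z≤n)
 lagrange {p} pp (suc d) f r root dist = lagrange pp d (quot f (r (suc d))) r root' (λ i j a b → dist i j a (ℕP.m≤n⇒m≤1+n b))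
  where
  root' : ∀ i → i ℕ.≤ d → ⟦ p ⟧ ∣ eval (quot f (r (suc d))) (r i)
  root' i h = fin (euclid pp (r i - r (suc d)) _ (subst (⟦ p ⟧ ∣_) (eval-quot f (r (suc d)) (r i)) (∣m∣n⇒∣m-n (root i (ℕP.m≤n⇒m≤1+n h)) (root (suc d) ℕP.≤-refl))))
   where
   fin : (⟦ p ⟧ ∣ (r i - r (suc d))) ⊎ (⟦ p ⟧ ∣ eval (quot f (r (suc d))) (r i)) → ⟦ p ⟧ ∣ eval (quot f (r (suc d))) (r i)
   fin (inj₁ e) = ⊥-elim (dist i (suc d) (s≤s h) ℕP.≤-refl e)
   fin (inj₂ e) = e

 zeros : ∀ d → Vec ℤ d
 zeros zero = []
 zeros (suc d) = 0ℤ ∷ zeros d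

 eval-zeros : ∀ d x → eval (zeros d) x ≡ x ^ d
 eval-zeros zero x = refl
 eval-zeros (suc d) x = trans (ℤP.+-identityˡ _) (cong (x *_) (eval-zeros d x))

 eval-pow-1 : ∀ d x → eval (-1ℤ ∷ zeros d) x ≡ x ^ suc d - 1ℤ
 eval-pow-1 d x = trans (cong (λ z → -1ℤ + x * z) (eval-zeros d x)) (ℤP.+-comm -1ℤ (x * x ^ d))

 -- For q = 3m + 1 this provides a cubic non-residue, on which the vanishing of the character sum
 -- rests.
 non-root : ∀ {p} → Prime p → ∀ m → 1 ℕ.≤ m → suc m ℕ.< p → ∃ λ a → ¬ (⟦ p ⟧ ∣ ⟦ suc a ⟧) × ¬ (⟦ suc a ⟧ ^ m ≡ 1ℤ [mod p ])
 non-root {p} pp m@(suc m') h m<p with ℕP.anyUpTo? (λ a → Relation.Nullary.¬? (⟦ p ⟧ ∣? (⟦ suc a ⟧ ^ m - 1ℤ))) (suc m)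
 ... | yes (a , a<m , n) = a , ∤-small (s≤s z≤n) (ℕP.≤-<-trans a<m m<p) , (λ { (cg d) → n d })
 ... | no none = ⊥-elim (lagrange pp m (-1ℤ ∷ zeros m') (λ i → ⟦ suc i ⟧) root dist)
  where
  root : ∀ i → i ℕ.≤ m → ⟦ p ⟧ ∣ eval (-1ℤ ∷ zeros m') ⟦ suc i ⟧
  root i i≤m with ⟦ p ⟧ ∣? (⟦ suc i ⟧ ^ m - 1ℤ)
  ... | yes d = subst (⟦ p ⟧ ∣_) (sym (eval-pow-1 m' ⟦ suc i ⟧)) d
  ... | no n = ⊥-elim (none (i , s≤s i≤m , n))
  dist : ∀ i j → i ℕ.< j → j ℕ.≤ m → ¬ ⟦ p ⟧ ∣ (⟦ suc i ⟧ - ⟦ suc j ⟧)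
  dist i j i<j j≤m d = ∤-small {p} {suc j ℕ.∸ suc i} (ℕP.m<n⇒0<n∸m (s≤s i<j)) (ℕP.≤-<-trans (ℕP.m∸n≤m (suc j) (suc i)) (ℕP.≤-<-trans (s≤s j≤m) m<p))
    (subst (⟦ p ⟧ ∣_) (trans (l ⟦ suc i ⟧ ⟦ suc j ⟧) (trans (ℤP.m-n≡m⊖n (suc j) (suc i)) (ℤP.⊖-≥ (s≤s (ℕP.<⇒≤ i<j))))) (∣m⇒∣-m d))
   where
   l = solveℤ 2 (λ a b → :- (a :- b) := b :- a) refl

 -- Euler's criterion: a^h ≡ 1 with p = 2h + 1 forces a to be a square, as X^h - 1 has the roots 1², …, h² already
 euler : ∀ {p} → Prime p → ∀ h' → p ≡ suc (suc h' ℕ.+ suc h') → ∀ a → a ^ suc h' ≡ 1ℤ [mod p ] → ∃ λ s → s * s ≡ a [mod p ]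
 euler {p} pp h' ep a (cg ha) with ℕP.anyUpTo? (λ s → ⟦ p ⟧ ∣? (⟦ suc s ⟧ * ⟦ suc s ⟧ - a)) (suc h')
 ... | yes (s , _ , d) = ⟦ suc s ⟧ , cg d
 ... | no none = ⊥-elim (lagrange pp h (-1ℤ ∷ zeros h') r root dist)
  where
  h = suc h'
  h<p : h ℕ.< p
  h<p = subst (h ℕ.<_) (sym ep) (s≤s (ℕP.m≤m+n h h))
  r : ℕ → ℤ
  r i with i ℕ.<? h
  ... | yes _ = ⟦ suc i ⟧ * ⟦ suc i ⟧
  ... | no _ = a
  ^2 : ∀ x n → (x * x) ^ n ≡ x ^ (n ℕ.+ n)
  ^2 x zero = refl
  ^2 x (suc n) = trans (cong (x * x *_) (^2 x n)) (trans (ℤP.*-assoc x x _) (cong (λ z → x * x ^ z) (sym (ℕP.+-suc n n))))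
  root : ∀ i → i ℕ.≤ h → ⟦ p ⟧ ∣ eval (-1ℤ ∷ zeros h') (r i)
  root i _ with i ℕ.<? h
  ... | yes i<h = subst (⟦ p ⟧ ∣_) (sym (eval-pow-1 h' (⟦ suc i ⟧ * ⟦ suc i ⟧))) (subst (λ z → ⟦ p ⟧ ∣ (z - 1ℤ)) (sym (^2 ⟦ suc i ⟧ h)) (_≡_[mod_].d (fermat' pp (h ℕ.+ h) ep ⟦ suc i ⟧ (∤-small (s≤s z≤n) (ℕP.≤-<-trans i<h h<p)))))
  ... | no _ = subst (⟦ p ⟧ ∣_) (sym (eval-pow-1 h' a)) ha
  dist : ∀ i j → i ℕ.< j → j ℕ.≤ h → ¬ ⟦ p ⟧ ∣ (r i - r j)
  dist i j i<j j≤h d with i ℕ.<? h | j ℕ.<? h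
  ... | no n | _ = n (ℕP.<-≤-trans i<j j≤h)
  ... | yes i<h | no _ = none (i , i<h , d)
  ... | yes i<h | yes j<h = fin (euclid pp (⟦ suc j ⟧ - ⟦ suc i ⟧) (⟦ suc j ⟧ + ⟦ suc i ⟧) (subst (⟦ p ⟧ ∣_) (l ⟦ suc i ⟧ ⟦ suc j ⟧) (∣m⇒∣-m d)))
   where
   l = solveℤ 2 (λ a b → :- (a :* a :- b :* b) := (b :- a) :* (b :+ a)) refl
   fin : (⟦ p ⟧ ∣ (⟦ suc j ⟧ - ⟦ suc i ⟧)) ⊎ (⟦ p ⟧ ∣ (⟦ suc j ⟧ + ⟦ suc i ⟧)) → ⊥
   fin (inj₁ x) = ∤-small {p} {suc j ℕ.∸ suc i} (ℕP.m<n⇒0<n∸m (s≤s i<j)) (ℕP.≤-<-trans (ℕP.m∸n≤m (suc j) (suc i)) (ℕP.≤-<-trans j<h h<p))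
     (subst (⟦ p ⟧ ∣_) (trans (ℤP.m-n≡m⊖n (suc j) (suc i)) (ℤP.⊖-≥ (s≤s (ℕP.<⇒≤ i<j)))) x)
   fin (inj₂ x) = ∤-small {p} {suc j ℕ.+ suc i} (s≤s z≤n) (subst (suc j ℕ.+ suc i ℕ.<_) (sym ep) (s≤s (ℕP.+-mono-≤ j<h i<h))) (subst (⟦ p ⟧ ∣_) (sym (ℤP.pos-+ (suc j) (suc i))) x)

-- The group ring of ℤ/q over ℤ[ω]

module GroupRing where
 open import Level using (0ℓ)
 open import Algebra using (CommutativeRing)
 open import Data.Fin using (Fin; toℕ; fromℕ<)
 import Data.Fin.Properties as FP
 open import Data.Integer as ℤ using (ℤ; _+_; _*_; _-_; -_)
 open import Data.List using (List; []; _∷_; map; allFin)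
 open import Data.List.Membership.Propositional using (_∈_)
 open import Data.List.Membership.Propositional.Properties using (∈-map⁺; ∈-allFin)
 open import Data.List.Membership.Propositional.Properties.WithK using (unique∧set⇒bag)
 open import Data.List.Relation.Binary.BagAndSetEquality using (∼bag⇒↭)
 open import Data.List.Relation.Binary.Permutation.Propositional using (_↭_; refl; prep; swap; trans)
 open import Data.List.Relation.Unary.Any using (here; there)
 open import Data.List.Relation.Unary.All using (All; []; _∷_)
 import Data.List.Relation.Unary.All as All
 open import Data.List.Relation.Unary.AllPairs using ([]; _∷_)
 open import Data.List.Relation.Unary.Unique.Propositional using (Unique)
 import Data.List.Relation.Unary.Unique.Propositional.Properties as U
 open import Function.Bundles using (mk⇔)
 open import Relation.Binary.PropositionalEquality as E using (_≡_; _≢_; cong; cong₂; sym; subst)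
 open Integers
 open Eisenstein
 open PrimeField

 module _ {A : Set} where
  sumE : (A → E) → List A → E
  sumE f [] = 0E
  sumE f (x ∷ xs) = f x ⊕ sumE f xs

  sumE-cong : ∀ {f g} xs → (∀ v → f v ≡ g v) → sumE f xs ≡ sumE g xs
  sumE-cong [] h = E.refl
  sumE-cong (x ∷ xs) h = cong₂ _⊕_ (h x) (sumE-cong xs h)

  sumE-0 : ∀ {f} xs → All (λ v → f v ≡ 0E) xs → sumE f xs ≡ 0E
  sumE-0 [] [] = E.refl
  sumE-0 (x ∷ xs) (h ∷ hs) = cong₂ _⊕_ h (sumE-0 xs hs)

  sumE-⊕ : ∀ f g xs → sumE (λ v → f v ⊕ g v) xs ≡ sumE f xs ⊕ sumE g xs
  sumE-⊕ f g [] = E.refl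
  sumE-⊕ f g (x ∷ xs) = E.trans (cong (f x ⊕ g x ⊕_) (sumE-⊕ f g xs)) (l (f x) (g x) (sumE f xs) (sumE g xs))
   where
   l = solveE 4 (λ a b c d → (a :+ b) :+ (c :+ d) := (a :+ c) :+ (b :+ d)) E.refl

  sumE-⊗ : ∀ c f xs → sumE (λ v → c ⊗ f v) xs ≡ c ⊗ sumE f xs
  sumE-⊗ c f [] = sym (⊗-zeroʳ c)
  sumE-⊗ c f (x ∷ xs) = E.trans (cong (c ⊗ f x ⊕_) (sumE-⊗ c f xs)) (sym (⊗-distribˡ c (f x) (sumE f xs)))

  sumE-↭ : ∀ f {xs ys} → xs ↭ ys → sumE f xs ≡ sumE f ys
  sumE-↭ f refl = E.refl
  sumE-↭ f (prep x p) = cong (f x ⊕_) (sumE-↭ f p)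
  sumE-↭ f {_ ∷ _ ∷ xs} {_ ∷ _ ∷ ys} (swap x y p) = E.trans (cong (λ z → f x ⊕ (f y ⊕ z)) (sumE-↭ f p)) (l (f x) (f y) (sumE f ys))
   where
   l = solveE 3 (λ a b c → a :+ (b :+ c) := b :+ (a :+ c)) E.refl
  sumE-↭ f (trans p q) = E.trans (sumE-↭ f p) (sumE-↭ f q)

  sumE-conj : ∀ f xs → conjE (sumE f xs) ≡ sumE (λ v → conjE (f v)) xs
  sumE-conj f [] = E.refl
  sumE-conj f (x ∷ xs) = E.trans (conj-⊕ (f x) (sumE f xs)) (cong (conjE (f x) ⊕_) (sumE-conj f xs))

  sumE-single : ∀ f x {xs} → Unique xs → x ∈ xs → (∀ y → y ≢ x → f y ≡ 0E) → sumE f xs ≡ f x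
  sumE-single f x {_ ∷ xs} (a ∷ u) (here E.refl) h = E.trans (cong (f x ⊕_) (sumE-0 xs (All.map (λ {y} ne → h y (λ e → ne (sym e))) a))) (⊕-identityʳ (f x))
  sumE-single f x {y ∷ xs} (a ∷ u) (there m) h = E.trans (cong₂ _⊕_ (h y (λ { E.refl → All.lookup a m E.refl })) (sumE-single f x u m h)) (⊕-identityˡ (f x))

 sumE-map : ∀ {A B : Set} (f : B → E) (g : A → B) xs → sumE f (map g xs) ≡ sumE (λ v → f (g v)) xs
 sumE-map f g [] = E.refl
 sumE-map f g (x ∷ xs) = cong (f (g x) ⊕_) (sumE-map f g xs)

 sumE-swap : ∀ {A B : Set} (f : A → B → E) xs ys → sumE (λ x → sumE (f x) ys) xs ≡ sumE (λ y → sumE (λ x → f x y) xs) ys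
 sumE-swap f [] ys = sym (sumE-0 ys (All.tabulate (λ _ → E.refl)))
 sumE-swap f (x ∷ xs) ys = E.trans (cong (sumE (f x) ys ⊕_) (sumE-swap f xs ys)) (sym (sumE-⊕ (f x) (λ y → sumE (λ x → f x y) xs) ys))

 -- This replaces ℤ[ω,ζ] with ζ of order q. A Gauss sum becomes the character itself, seen as a
 -- function, and the comparison of powers of ζ becomes the evaluation of a coefficient, here always
 -- the one at 1.
 module Cyclic (q : ℕ) (q≥1 : 1 ℕ.≤ q) where

  infix 4 _~_
  _~_ : ℤ → ℤ → Set
  a ~ b = a ≡ b [mod q ]

  red : ℤ → Fin q
  red a = fromℕ< (proj₁ (proj₂ (reduce q q≥1 a)))

  red-~ : ∀ a → a ~ ⟦ toℕ (red a) ⟧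
  red-~ a with reduce q q≥1 a
  ... | r , r<q , k , e = cg (divides k (E.trans (cong₂ _-_ e (cong ⟦_⟧ (FP.toℕ-fromℕ< r<q))) (l ⟦ r ⟧ k ⟦ q ⟧)))
   where
   l = solveℤ 3 (λ r k p → r :+ k :* p :- r := k :* p) E.refl

  toℕ-~ : ∀ {i j : Fin q} → ⟦ toℕ i ⟧ ~ ⟦ toℕ j ⟧ → i ≡ j
  toℕ-~ {i} {j} (cg d) = FP.toℕ-injective (go (ℕP.<-cmp (toℕ i) (toℕ j)))
   where
   open import Relation.Binary.Definitions using (Tri; tri<; tri≈; tri>)
   l = solveℤ 2 (λ a b → :- (a :- b) := b :- a) E.refl
   bad : ∀ a b → b ℕ.< q → a ℕ.< b → ¬ ⟦ q ⟧ ∣ (⟦ b ⟧ - ⟦ a ⟧)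
   bad a b b<q a<b x = ∤-small {q} {b ℕ.∸ a} (ℕP.m<n⇒0<n∸m a<b) (ℕP.≤-<-trans (ℕP.m∸n≤m b a) b<q) (subst (⟦ q ⟧ ∣_) (E.trans (ℤP.m-n≡m⊖n b a) (ℤP.⊖-≥ (ℕP.<⇒≤ a<b))) x)
   go : Tri (toℕ i ℕ.< toℕ j) (toℕ i ≡ toℕ j) (toℕ j ℕ.< toℕ i) → toℕ i ≡ toℕ j
   go (tri< a _ _) = ⊥-elim (bad (toℕ i) (toℕ j) (FP.toℕ<n j) a (subst (⟦ q ⟧ ∣_) (l ⟦ toℕ i ⟧ ⟦ toℕ j ⟧) (∣m⇒∣-m d)))
   go (tri≈ _ e _) = e
   go (tri> _ _ c) = ⊥-elim (bad (toℕ j) (toℕ i) (FP.toℕ<n i) c d)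

  S : (ℤ → E) → E
  S f = sumE (λ i → f ⟦ toℕ i ⟧) (allFin q)

  Periodic : (ℤ → E) → Set
  Periodic f = ∀ {a b} → a ~ b → f a ≡ f b

  S-cong : ∀ {f g} → (∀ a → f a ≡ g a) → S f ≡ S g
  S-cong h = sumE-cong (allFin q) (λ i → h ⟦ toℕ i ⟧)

  S-⊕ : ∀ f g → S (λ a → f a ⊕ g a) ≡ S f ⊕ S g
  S-⊕ f g = sumE-⊕ (λ i → f ⟦ toℕ i ⟧) (λ i → g ⟦ toℕ i ⟧) (allFin q)

  S-⊗ : ∀ c f → S (λ a → c ⊗ f a) ≡ c ⊗ S f
  S-⊗ c f = sumE-⊗ c (λ i → f ⟦ toℕ i ⟧) (allFin q)

  S-⊗ʳ : ∀ c f → S (λ a → f a ⊗ c) ≡ S f ⊗ c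
  S-⊗ʳ c f = E.trans (S-cong (λ a → ⊗-comm (f a) c)) (E.trans (S-⊗ c f) (⊗-comm c (S f)))

  S-swap : ∀ (f : ℤ → ℤ → E) → S (λ a → S (f a)) ≡ S (λ b → S (λ a → f a b))
  S-swap f = sumE-swap (λ i j → f ⟦ toℕ i ⟧ ⟦ toℕ j ⟧) (allFin q) (allFin q)

  S-reindex : ∀ f → Periodic f → (σ τ : ℤ → ℤ) → (∀ {a b} → a ~ b → σ a ~ σ b) → (∀ {a b} → a ~ b → τ a ~ τ b) →
          (∀ a → σ (τ a) ~ a) → (∀ a → τ (σ a) ~ a) → S (λ a → f (σ a)) ≡ S f
  S-reindex f per σ τ hσ hτ στ τσ = E.trans (sumE-cong (allFin q) (λ i → per (red-~ (σ ⟦ toℕ i ⟧)))) (E.trans (sym (sumE-map (λ i → f ⟦ toℕ i ⟧) π (allFin q))) (sumE-↭ (λ i → f ⟦ toℕ i ⟧) (∼bag⇒↭ (unique∧set⇒bag (U.map⁺ inj (U.allFin⁺ q)) (U.allFin⁺ q) (λ {v} → mk⇔ (λ _ → ∈-allFin v) (λ _ → surj v))))))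
   where
   π : Fin q → Fin q
   π i = red (σ ⟦ toℕ i ⟧)
   inj : ∀ {i j} → π i ≡ π j → i ≡ j
   inj {i} {j} e = toℕ-~ (≡m-trans (≡m-sym (τσ ⟦ toℕ i ⟧)) (≡m-trans (hτ (≡m-trans (red-~ (σ ⟦ toℕ i ⟧)) (≡m-trans (≡m-reflexive (cong (λ k → ⟦ toℕ k ⟧) e)) (≡m-sym (red-~ (σ ⟦ toℕ j ⟧)))))) (τσ ⟦ toℕ j ⟧)))
   surj : ∀ v → v ∈ map π (allFin q)
   surj v = subst (_∈ map π (allFin q)) e (∈-map⁺ π (∈-allFin (red (τ ⟦ toℕ v ⟧))))
     where
     e : π (red (τ ⟦ toℕ v ⟧)) ≡ v
     e = toℕ-~ (≡m-trans (≡m-sym (red-~ (σ ⟦ toℕ (red (τ ⟦ toℕ v ⟧)) ⟧))) (≡m-trans (hσ (≡m-sym (red-~ (τ ⟦ toℕ v ⟧)))) (στ ⟦ toℕ v ⟧)))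

  ~-+ : ∀ {a b c d} → a ~ b → c ~ d → a + c ~ b + d
  ~-+ = ≡m-+
  ~-neg : ∀ {a b} → a ~ b → - a ~ - b
  ~-neg {a} {b} (cg d) = cg (subst (⟦ q ⟧ ∣_) (l a b) (∣m⇒∣-m d))
   where
   l = solveℤ 2 (λ a b → :- (a :- b) := :- a :- :- b) E.refl
  ~-- : ∀ {a b c d} → a ~ b → c ~ d → a - c ~ b - d
  ~-- x y = ~-+ x (~-neg y)

  c-~ : ∀ c {a b} → a ~ b → c - a ~ c - b
  c-~ c h = ~-- (≡m-refl {q} {c}) h

  ~-c : ∀ c {a b} → a ~ b → a - c ~ b - c
  ~-c c h = ~-- h (≡m-refl {q} {c})

  S-shift : ∀ f → Periodic f → ∀ k → S (λ a → f (a - k)) ≡ S f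
  S-shift f per k = S-reindex f per (λ a → a - k) (λ a → a + k) (λ h → ~-- h ≡m-refl) (λ h → ~-+ h ≡m-refl) (λ a → ≡m-reflexive (l a k)) (λ a → ≡m-reflexive (l2 a k))
   where
   l = solveℤ 2 (λ a k → a :+ k :- k := a) E.refl
   l2 = solveℤ 2 (λ a k → a :- k :+ k := a) E.refl

  S-reflect : ∀ f → Periodic f → ∀ c → S (λ a → f (c - a)) ≡ S f
  S-reflect f per c = S-reindex f per (λ a → c - a) (λ a → c - a) (c-~ c) (c-~ c) (λ a → ≡m-reflexive (l c a)) (λ a → ≡m-reflexive (l c a))
   where
   l = solveℤ 2 (λ c a → c :- (c :- a) := a) E.refl

  -- the group ring of ℤ/q as periodic functions under convolution

  record GR : Set where
   constructor gr
   field
     at : ℤ → E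
     per : Periodic at
  open GR public

  infix 4 _≐_
  _≐_ : GR → GR → Set
  f ≐ g = ∀ c → at f c ≡ at g c

  infixl 6 _+g_
  infixl 7 _*g_
  _+g_ _*g_ : GR → GR → GR
  f +g g = gr (λ c → at f c ⊕ at g c) (λ h → cong₂ _⊕_ (per f h) (per g h))
  f *g g = gr (λ c → S (λ a → at f a ⊗ at g (c - a))) (λ h → S-cong (λ a → cong (at f a ⊗_) (per g (~-c a h))))
  -g_ : GR → GR
  -g f = gr (λ c → ⊝ at f c) (λ h → cong ⊝_ (per f h))
  0g : GR
  0g = gr (λ _ → 0E) (λ _ → E.refl)

  pick : ∀ {P : Set} → Dec P → E → E
  pick (yes _) e = e
  pick (no _) e = 0E

  pick-yes : ∀ {P : Set} (d : Dec P) e → P → pick d e ≡ e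
  pick-yes (yes _) e p = E.refl
  pick-yes (no n) e p = ⊥-elim (n p)

  pick-no : ∀ {P : Set} (d : Dec P) e → ¬ P → pick d e ≡ 0E
  pick-no (yes p) e n = ⊥-elim (n p)
  pick-no (no _) e n = E.refl

  single : E → ℤ → GR
  single e k = gr (λ c → pick (⟦ q ⟧ ∣? (c - k)) e) eq
   where
   eq : Periodic (λ c → pick (⟦ q ⟧ ∣? (c - k)) e)
   eq {a} {b} h with ⟦ q ⟧ ∣? (a - k) | ⟦ q ⟧ ∣? (b - k)
   ... | yes _ | yes _ = E.refl
   ... | no _ | no _ = E.refl
   ... | yes x | no n = ⊥-elim (n (_≡_[mod_].d (≡m-trans (≡m-sym h) (cg x))))
   ... | no n | yes y = ⊥-elim (n (_≡_[mod_].d (≡m-trans h (cg y))))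

  S-single : ∀ e k h → Periodic h → S (λ a → at (single e k) a ⊗ h a) ≡ e ⊗ h k
  S-single e k h per = E.trans (sumE-single (λ i → at (single e k) ⟦ toℕ i ⟧ ⊗ h ⟦ toℕ i ⟧) (red k) (U.allFin⁺ q) (∈-allFin (red k)) off)
     (cong₂ _⊗_ (pick-yes (⟦ q ⟧ ∣? (⟦ toℕ (red k) ⟧ - k)) e (_≡_[mod_].d (≡m-sym (red-~ k)))) (per (≡m-sym (red-~ k))))
   where
   off : ∀ i → i ≢ red k → at (single e k) ⟦ toℕ i ⟧ ⊗ h ⟦ toℕ i ⟧ ≡ 0E
   off i ne = E.trans (cong (_⊗ h ⟦ toℕ i ⟧) (pick-no (⟦ q ⟧ ∣? (⟦ toℕ i ⟧ - k)) e (λ d → ne (toℕ-~ (≡m-trans (cg d) (red-~ k)))))) (⊗-zeroˡ (h ⟦ toℕ i ⟧))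

  1g : GR
  1g = single 1E 0ℤ

  *g-cong : ∀ {f f' g g'} → f ≐ f' → g ≐ g' → f *g g ≐ f' *g g'
  *g-cong h k c = S-cong (λ a → cong₂ _⊗_ (h a) (k (c - a)))

  *g-comm : ∀ f g → f *g g ≐ g *g f
  *g-comm f g c = E.trans (sym (S-reflect (λ a → at f a ⊗ at g (c - a)) (λ h → cong₂ _⊗_ (per f h) (per g (c-~ c h))) c))
    (S-cong (λ a → E.trans (⊗-comm (at f (c - a)) (at g (c - (c - a)))) (cong (λ z → at g z ⊗ at f (c - a)) (l c a))))
   where
   l = solveℤ 2 (λ c a → c :- (c :- a) := a) E.refl

  *g-assoc : ∀ f g h → (f *g g) *g h ≐ f *g (g *g h)
  *g-assoc f g h c = E.trans (S-cong (λ a → E.trans (sym (S-⊗ʳ (at h (c - a)) (λ b → at f b ⊗ at g (a - b)))) (S-cong (λ b → ⊗-assoc (at f b) (at g (a - b)) (at h (c - a))))))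
    (E.trans (S-swap (λ a b → at f b ⊗ (at g (a - b) ⊗ at h (c - a)))) (S-cong (λ b → E.trans (S-⊗ (at f b) (λ a → at g (a - b) ⊗ at h (c - a))) (cong (at f b ⊗_)
      (E.trans (S-cong (λ a → cong (λ z → at g (a - b) ⊗ at h z) (l c a b))) (S-shift (λ a → at g a ⊗ at h (c - b - a)) (λ k → cong₂ _⊗_ (per g k) (per h (c-~ (c - b) k))) b))))))
   where
   l = solveℤ 3 (λ c a b → c :- a := c :- b :- (a :- b)) E.refl

  *g-identityˡ : ∀ f → 1g *g f ≐ f
  *g-identityˡ f c = E.trans (S-single 1E 0ℤ (λ a → at f (c - a)) (λ h → per f (c-~ c h))) (E.trans (⊗-identityˡ (at f (c - 0ℤ))) (cong (at f) (ℤP.+-identityʳ c)))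

  *g-distribˡ : ∀ f g h → f *g (g +g h) ≐ f *g g +g f *g h
  *g-distribˡ f g h c = E.trans (S-cong (λ a → ⊗-distribˡ (at f a) (at g (c - a)) (at h (c - a)))) (S-⊕ (λ a → at f a ⊗ at g (c - a)) (λ a → at f a ⊗ at h (c - a)))

  GR-ring : CommutativeRing 0ℓ 0ℓ
  GR-ring = record
   { Carrier = GR ; _≈_ = _≐_ ; _+_ = _+g_ ; _*_ = _*g_ ; -_ = -g_ ; 0# = 0g ; 1# = 1g
   ; isCommutativeRing = record
     { isRing = record
       { +-isAbelianGroup = record
        { isGroup = record
         { isMonoid = record
          { isSemigroup = record
           { isMagma = record { isEquivalence = record { refl = λ c → E.refl ; sym = λ h c → sym (h c) ; trans = λ h k c → E.trans (h c) (k c) } ; ∙-cong = λ h k c → cong₂ _⊕_ (h c) (k c) }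
           ; assoc = λ f g h c → ⊕-assoc (at f c) (at g c) (at h c) }
          ; identity = (λ f c → ⊕-identityˡ (at f c)) , (λ f c → ⊕-identityʳ (at f c)) }
         ; inverse = (λ f c → E.trans (⊕-comm (⊝ at f c) (at f c)) (⊕-inverseʳ (at f c))) , (λ f c → ⊕-inverseʳ (at f c))
         ; ⁻¹-cong = λ h c → cong ⊝_ (h c) }
        ; comm = λ f g c → ⊕-comm (at f c) (at g c) }
       ; *-cong = λ {x} {y} {u} {v} → *g-cong {x} {y} {u} {v}
       ; *-assoc = *g-assoc
       ; *-identity = *g-identityˡ , (λ f c → E.trans (*g-comm f 1g c) (*g-identityˡ f c))
       ; distrib = *g-distribˡ , (λ f g h c → E.trans (*g-comm (g +g h) f c) (E.trans (*g-distribˡ f g h c) (cong₂ _⊕_ (*g-comm f g c) (*g-comm f h c)))) }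
     ; *-comm = *g-comm } }

  single-* : ∀ e k e' k' → single e k *g single e' k' ≐ single (e ⊗ e') (k + k')
  single-* e k e' k' c = E.trans (S-single e k (λ a → at (single e' k') (c - a)) (λ h → per (single e' k') (c-~ c h))) (fin (⟦ q ⟧ ∣? (c - k - k')) (⟦ q ⟧ ∣? (c - (k + k'))))
   where
   l = solveℤ 3 (λ c k k' → c :- k :- k' := c :- (k :+ k')) E.refl
   fin : (d : Dec (⟦ q ⟧ ∣ (c - k - k'))) (d' : Dec (⟦ q ⟧ ∣ (c - (k + k')))) → e ⊗ pick d e' ≡ pick d' (e ⊗ e')
   fin (yes _) (yes _) = E.refl
   fin (no _) (no _) = ⊗-zeroʳ e
   fin (yes x) (no n) = ⊥-elim (n (subst (⟦ q ⟧ ∣_) (l c k k') x))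
   fin (no n) (yes x) = ⊥-elim (n (subst (⟦ q ⟧ ∣_) (sym (l c k k')) x))

  sumG : ∀ {A : Set} → (A → GR) → List A → GR
  sumG f [] = 0g
  sumG f (x ∷ xs) = f x +g sumG f xs

  sumG-at : ∀ {A : Set} (f : A → GR) xs c → at (sumG f xs) c ≡ sumE (λ x → at (f x) c) xs
  sumG-at f [] c = E.refl
  sumG-at f (x ∷ xs) c = cong (at (f x) c ⊕_) (sumG-at f xs c)

  decompose : ∀ f → f ≐ sumG (λ i → single (at f ⟦ toℕ i ⟧) ⟦ toℕ i ⟧) (allFin q)
  decompose f c = sym (E.trans (sumG-at (λ i → single (at f ⟦ toℕ i ⟧) ⟦ toℕ i ⟧) (allFin q) c) (E.trans (sumE-single (λ i → at (single (at f ⟦ toℕ i ⟧) ⟦ toℕ i ⟧) c) (red c) (U.allFin⁺ q) (∈-allFin (red c)) off)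
     (E.trans (pick-yes (⟦ q ⟧ ∣? (c - ⟦ toℕ (red c) ⟧)) (at f ⟦ toℕ (red c) ⟧) (_≡_[mod_].d (red-~ c))) (per f (≡m-sym (red-~ c))))))
   where
   off : ∀ i → i ≢ red c → at (single (at f ⟦ toℕ i ⟧) ⟦ toℕ i ⟧) c ≡ 0E
   off i ne = pick-no (⟦ q ⟧ ∣? (c - ⟦ toℕ i ⟧)) (at f ⟦ toℕ i ⟧) (λ d → ne (toℕ-~ (≡m-trans (≡m-sym (cg d)) (red-~ c))))

-- Cubic characters, Gauss sums and Jacobi sums

module CubicGaussSums where
 open import Algebra using (CommutativeRing)
 open import Data.Fin using (Fin; toℕ)
 open import Data.Integer as ℤ using (ℤ; _+_; _*_; _-_; -_; _^_)
 open import Data.List using (List; []; _∷_; allFin)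
 open import Data.List.Membership.Propositional.Properties using (∈-allFin)
 import Data.List.Relation.Unary.Unique.Propositional.Properties as U
 open import Relation.Nullary.Decidable using (from-yes)
 open import Relation.Binary.PropositionalEquality hiding (J)
 open Valuations using (p≥1; p≥2)
 open Integers
 open FrobeniusMap
 open Eisenstein
 open PrimeField
 open GroupRing
 open RingClassWeights using (Z3; z0; z1; z2; _⊞_; all3)

 private
  dm : ∀ {n a b} → a ≡ b [mod n ] → ⟦ n ⟧ ∣ (a - b)
  dm = _≡_[mod_].d

 module Masses (q : ℕ) (pq : Prime q) where
  open Cyclic q (p≥1 pq) public

  Fam : (Fin q → E) → (Fin q → ℤ) → GR
  Fam e k = sumG (λ i → single (e i) (k i)) (allFin q)

  -- A unit t permutes ℤ/q, so exactly one mass, that of the inverse of t, is moved to 1.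
  Fam-at : ∀ t (e : Fin q → E) → ¬ ⟦ q ⟧ ∣ t → ∃ λ i₀ → (⟦ toℕ i₀ ⟧ * t ≡ 1ℤ [mod q ]) × at (Fam e (λ i → t * ⟦ toℕ i ⟧)) 1ℤ ≡ e i₀
  Fam-at t e n with inverse pq t n
  ... | u , k , eq = red u , inv , trans (sumG-at (λ i → single (e i) (t * ⟦ toℕ i ⟧)) (allFin q) 1ℤ)
      (trans (sumE-single (λ i → at (single (e i) (t * ⟦ toℕ i ⟧)) 1ℤ) (red u) (U.allFin⁺ q) (∈-allFin (red u)) off) (pick-yes (⟦ q ⟧ ∣? (1ℤ - t * ⟦ toℕ (red u) ⟧)) (e (red u)) (dm (≡m-sym inv'))))
   where
   l = solveℤ 2 (λ k q → # 1 :+ k :* q :- # 1 := k :* q) refl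
   tu : t * u ≡ 1ℤ [mod q ]
   tu = cg (divides k (trans (cong (_- 1ℤ) eq) (l k ⟦ q ⟧)))
   inv' : t * ⟦ toℕ (red u) ⟧ ≡ 1ℤ [mod q ]
   inv' = ≡m-trans (≡m-* (≡m-refl {q} {t}) (≡m-sym (red-~ u))) tu
   inv : ⟦ toℕ (red u) ⟧ * t ≡ 1ℤ [mod q ]
   inv = ≡m-trans (≡m-reflexive (ℤP.*-comm ⟦ toℕ (red u) ⟧ t)) inv'
   off : ∀ i → i ≢ red u → at (single (e i) (t * ⟦ toℕ i ⟧)) 1ℤ ≡ 0E
   off i ne = pick-no (⟦ q ⟧ ∣? (1ℤ - t * ⟦ toℕ i ⟧)) (e i) (λ d → ne (toℕ-~ (cancel-m pq t n (≡m-trans (≡m-sym (cg d)) (≡m-sym inv')))))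

  module ModP (p : ℕ) (pp : Prime p) where
   module Q = Quotient GR-ring p
   module F = Frobenius Q.quotient p pp
   open import Algebra.Properties.Semiring.Mult (CommutativeRing.semiring GR-ring) using () renaming (_×_ to _·_)

   ·-at : ∀ n h c → at (n · h) c ≡ ι ⟦ n ⟧ ⊗ at h c
   ·-at zero h c = sym (⊗-zeroˡ (at h c))
   ·-at (suc n) h c = trans (cong (at h c ⊕_) (·-at n h c)) (sym (trans (cong (λ k → ι k ⊗ at h c) (ℤP.pos-+ 1 n)) (trans (⊗-distribʳ (at h c) (ι 1ℤ) (ι ⟦ n ⟧)) (cong (_⊕ ι ⟦ n ⟧ ⊗ at h c) (⊗-identityˡ (at h c))))))

   to-at : ∀ {x y} → x Q.≈ₙ y → ∀ c → at x c ≋ at y c [ p ]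
   to-at {x} {y} (h , e) c = at h c , trans (e c) (cong (at y c ⊕_) (·-at p h c))

   -- Modulo p the p-th power is additive, and the power of a single mass has the exponent
   -- multiplied by p.
   Fam-frob : ∀ e k → Fam e k F.^ p Q.≈ₙ Fam (λ i → e i ^E p) (λ i → ⟦ p ⟧ * k i)
   Fam-frob e k = Q.≈ₙ-trans {Fam e k F.^ p} {sumG (λ i → single (e i) (k i) F.^ p) (allFin q)} {Fam (λ i → e i ^E p) (λ i → ⟦ p ⟧ * k i)}
       (F.frobenius-sum Q.quotient-char (λ i → single (e i) (k i)) sumG (λ _ → Q.lift {0g} {0g} (λ c → refl)) (λ g x xs → Q.lift {g x +g sumG g xs} {g x +g sumG g xs} (λ c → refl)) (allFin q))
       (Q.lift {sumG (λ i → single (e i) (k i) F.^ p) (allFin q)} {Fam (λ i → e i ^E p) (λ i → ⟦ p ⟧ * k i)} (λ c → trans (sumG-at (λ i → single (e i) (k i) F.^ p) (allFin q) c) (trans (sumE-cong (allFin q) (λ i → single-^ p (e i) (k i) c)) (sym (sumG-at (λ i → single (e i ^E p) (⟦ p ⟧ * k i)) (allFin q) c)))))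
     where
     single-^ : ∀ n e k → single e k F.^ n ≐ single (e ^E n) (⟦ n ⟧ * k)
     single-^ zero e k c = refl
     single-^ (suc n) e k c = trans (*g-cong {single e k} {single e k} {single e k F.^ n} {single (e ^E n) (⟦ n ⟧ * k)} (λ _ → refl) (single-^ n e k) c) (trans (single-* e k (e ^E n) (⟦ n ⟧ * k) c) (cong (λ z → at (single (e ^E suc n) z) c) (l k)))
       where
       l : ∀ k → k + ⟦ n ⟧ * k ≡ ⟦ suc n ⟧ * k
       l k = trans (solveℤ 2 (λ k n → k :+ n :* k := (# 1 :+ n) :* k) refl k ⟦ n ⟧) (cong (_* k) (sym (ℤP.pos-+ 1 n)))

 wp : Z3 → E
 wp z0 = 1E
 wp z1 = ωE
 wp z2 = ωE ⊗ ωE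

 private
  _≟E_ : (x y : E) → Dec (x ≡ y)
  _≟E_ = Data.Product.Properties.≡-dec ℤ._≟_ ℤ._≟_
   where import Data.Product.Properties

 wp-⊞ : ∀ x y → wp (x ⊞ y) ≡ wp x ⊗ wp y
 wp-⊞ = from-yes (all3 λ x → all3 λ y → wp (x ⊞ y) ≟E (wp x ⊗ wp y))
 wp³ : ∀ x → wp x ⊗ (wp x ⊗ wp x) ≡ 1E
 wp³ = from-yes (all3 λ x → (wp x ⊗ (wp x ⊗ wp x)) ≟E 1E)
 wp-conj : ∀ x → conjE (wp x) ≡ wp x ⊗ wp x
 wp-conj = from-yes (all3 λ x → conjE (wp x) ≟E (wp x ⊗ wp x))
 wp-x⊗conj : ∀ x → wp x ⊗ conjE (wp x) ≡ 1E
 wp-x⊗conj = from-yes (all3 λ x → (wp x ⊗ conjE (wp x)) ≟E 1E)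

 module CubicGauss (q m : ℕ) (pq : Prime q) (ne3 : q ≢ 3) (qe : q ≡ suc (3 ℕ.* m)) (m≥1 : 1 ℕ.≤ m) (z : ℤ) (hz : ⟦ q ⟧ ∣ (z * z + z + 1ℤ)) where
  open Masses q pq public

  zp : Z3 → ℤ
  zp z0 = 1ℤ
  zp z1 = z
  zp z2 = z * z

  z³ : z * (z * z) ≡ 1ℤ [mod q ]
  z³ = cg (subst (⟦ q ⟧ ∣_) (solveℤ 1 (λ z → (z :- # 1) :* (z :* z :+ z :+ # 1) := z :* (z :* z) :- # 1) refl z) (∣n⇒∣m*n (z - 1ℤ) hz))

  zp-⊞ : ∀ x y → zp (x ⊞ y) ≡ zp x * zp y [mod q ]
  zp-⊞ z0 y = ≡m-reflexive (sym (ℤP.*-identityˡ (zp y)))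
  zp-⊞ z1 z0 = ≡m-reflexive (sym (ℤP.*-identityʳ z))
  zp-⊞ z1 z1 = ≡m-refl
  zp-⊞ z1 z2 = ≡m-sym z³
  zp-⊞ z2 z0 = ≡m-reflexive (sym (ℤP.*-identityʳ (z * z)))
  zp-⊞ z2 z1 = ≡m-trans (≡m-sym z³) (≡m-reflexive (sym (ℤP.*-assoc z z z)))
  zp-⊞ z2 z2 = ≡m-trans (≡m-reflexive (sym (ℤP.*-identityʳ z))) (≡m-trans (≡m-* (≡m-refl {q} {z}) (≡m-sym z³)) (≡m-reflexive (solveℤ 1 (λ z → z :* (z :* (z :* z)) := z :* z :* (z :* z)) refl z)))

  z≢1 : ¬ z ≡ 1ℤ [mod q ]
  z≢1 (cg d) = ne3 (p∣q pq prime[3] (subst (⟦ q ⟧ ∣_) (solveℤ 1 (λ z → z :* z :+ z :+ # 1 :- (z :- # 1) :* (z :+ # 2) := # 3) refl z) (∣m∣n⇒∣m-n hz (∣m⇒∣m*n (z + ℤ.+ 2) d))))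

  z²≢1 : ¬ z * z ≡ 1ℤ [mod q ]
  z²≢1 h = z≢1 (≡m-trans (≡m-sym (≡m-trans (≡m-* (≡m-refl {q} {z}) h) (≡m-reflexive (ℤP.*-identityʳ z)))) z³)

  z²≢z : ¬ z * z ≡ z [mod q ]
  z²≢z h = z²≢1 (≡m-trans (≡m-sym (≡m-* (≡m-refl {q} {z}) h)) z³)

  zp-inj : ∀ x y → zp x ≡ zp y [mod q ] → x ≡ y
  zp-inj z0 z0 h = refl
  zp-inj z0 z1 h = ⊥-elim (z≢1 (≡m-sym h))
  zp-inj z0 z2 h = ⊥-elim (z²≢1 (≡m-sym h))
  zp-inj z1 z0 h = ⊥-elim (z≢1 h)
  zp-inj z1 z1 h = refl
  zp-inj z1 z2 h = ⊥-elim (z²≢z (≡m-sym h))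
  zp-inj z2 z0 h = ⊥-elim (z²≢1 h)
  zp-inj z2 z1 h = ⊥-elim (z²≢z h)
  zp-inj z2 z2 h = refl

  cube-root : ∀ A → ⟦ q ⟧ ∣ (A * (A * A) - 1ℤ) → ∃ λ x → A ≡ zp x [mod q ]
  cube-root A A³ = fin (euclid pq (A - 1ℤ) ((A - z) * (A - z * z)) (subst (⟦ q ⟧ ∣_) (l A z) (∣m∣n⇒∣m-n {⟦ q ⟧} {A * (A * A) - 1ℤ} {(A * A - z * A + (z - 1ℤ)) * (z * z + z + 1ℤ)} A³ (∣n⇒∣m*n (A * A - z * A + (z - 1ℤ)) hz))))
   where
   l = solveℤ 2 (λ A z → (A :* (A :* A) :- # 1) :- (A :* A :- z :* A :+ (z :- # 1)) :* (z :* z :+ z :+ # 1) := (A :- # 1) :* ((A :- z) :* (A :- z :* z))) refl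
   fin : (⟦ q ⟧ ∣ (A - 1ℤ)) ⊎ (⟦ q ⟧ ∣ ((A - z) * (A - z * z))) → ∃ λ x → A ≡ zp x [mod q ]
   fin (inj₁ d) = z0 , cg d
   fin (inj₂ d) with euclid pq (A - z) (A - z * z) d
   ... | inj₁ e = z1 , cg e
   ... | inj₂ e = z2 , cg e

  opaque
   -- By Fermat a^m is a root of T³ - 1 modulo q = 3m + 1, and this polynomial splits into the
   -- powers of z.
   class : ∀ a → ¬ ⟦ q ⟧ ∣ a → ∃ λ x → a ^ m ≡ zp x [mod q ]
   class a n = cube-root (a ^ m) (subst (λ w → ⟦ q ⟧ ∣ (w - 1ℤ)) (sym (trans (cong (a ^ m *_) (sym (ℤP.^-distribˡ-+-* a m m))) (trans (sym (ℤP.^-distribˡ-+-* a m (m ℕ.+ m))) (cong (λ w → a ^ (m ℕ.+ (m ℕ.+ w))) (sym (ℕP.+-identityʳ m)))))) (dm (fermat' pq (3 ℕ.* m) qe a n)))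

  χd : ∀ a → Dec (⟦ q ⟧ ∣ a) → E
  χd a (yes _) = 0E
  χd a (no n) = wp (proj₁ (class a n))

  opaque
   χ : ℤ → E
   χ a = χd a (⟦ q ⟧ ∣? a)

   χ-0 : ∀ a → ⟦ q ⟧ ∣ a → χ a ≡ 0E
   χ-0 a d with ⟦ q ⟧ ∣? a
   ... | yes _ = refl
   ... | no n = ⊥-elim (n d)

   χ-wp : ∀ a x → ¬ ⟦ q ⟧ ∣ a → a ^ m ≡ zp x [mod q ] → χ a ≡ wp x
   χ-wp a x n h with ⟦ q ⟧ ∣? a
   ... | yes d = ⊥-elim (n d)
   ... | no n' = cong wp (zp-inj _ x (≡m-trans (≡m-sym (proj₂ (class a n'))) h))

  χ-unit : ∀ a → ¬ ⟦ q ⟧ ∣ a → ∃ λ x → (χ a ≡ wp x) × (a ^ m ≡ zp x [mod q ])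
  χ-unit a n = proj₁ (class a n) , χ-wp a _ n (proj₂ (class a n)) , proj₂ (class a n)

  χ-mul : ∀ a b → χ (a * b) ≡ χ a ⊗ χ b
  χ-mul a b = go (⟦ q ⟧ ∣? a) (⟦ q ⟧ ∣? b)
   where
   go : Dec (⟦ q ⟧ ∣ a) → Dec (⟦ q ⟧ ∣ b) → χ (a * b) ≡ χ a ⊗ χ b
   go (yes d) _ = trans (χ-0 (a * b) (∣m⇒∣m*n b d)) (sym (trans (cong (_⊗ χ b) (χ-0 a d)) (⊗-zeroˡ (χ b))))
   go (no _) (yes d) = trans (χ-0 (a * b) (∣n⇒∣m*n a d)) (sym (trans (cong (χ a ⊗_) (χ-0 b d)) (⊗-zeroʳ (χ a))))
   go (no n) (no n') with χ-unit a n | χ-unit b n'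
   ... | x , ex , hx | y , ey , hy = trans (χ-wp (a * b) (x ⊞ y) nab (≡m-trans (≡m-reflexive (^-* a b m)) (≡m-trans (≡m-* hx hy) (≡m-sym (zp-⊞ x y))))) (trans (wp-⊞ x y) (sym (cong₂ _⊗_ ex ey)))
     where
     ^-* : ∀ a b n → (a * b) ^ n ≡ a ^ n * b ^ n
     ^-* a b zero = refl
     ^-* a b (suc n) = trans (cong (a * b *_) (^-* a b n)) (solveℤ 4 (λ a b c d → a :* b :* (c :* d) := a :* c :* (b :* d)) refl a b (a ^ n) (b ^ n))
     nab : ¬ ⟦ q ⟧ ∣ a * b
     nab d with euclid pq a b d
     ... | inj₁ e = n e
     ... | inj₂ e = n' e

  χ-per : ∀ {a b} → a ~ b → χ a ≡ χ b
  χ-per {a} {b} h = go (⟦ q ⟧ ∣? b)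
   where
   go : Dec (⟦ q ⟧ ∣ b) → χ a ≡ χ b
   go (yes d) = trans (χ-0 a (≡m0⇒∣ (≡m-trans h (∣⇒≡m0 d)))) (sym (χ-0 b d))
   go (no n) with χ-unit b n
   ... | x , ex , hx = trans (χ-wp a x (λ d → n (≡m0⇒∣ (≡m-trans (≡m-sym h) (∣⇒≡m0 d)))) (≡m-trans (≡m-^ m h) hx)) (sym ex)

  χ³ : ∀ a → ¬ ⟦ q ⟧ ∣ a → χ a ⊗ (χ a ⊗ χ a) ≡ 1E
  χ³ a n with χ-unit a n
  ... | x , ex , _ = trans (cong (λ w → w ⊗ (w ⊗ w)) ex) (wp³ x)

  χ-conj : ∀ a → conjE (χ a) ≡ χ a ⊗ χ a
  χ-conj a = go (⟦ q ⟧ ∣? a)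
   where
   go : Dec (⟦ q ⟧ ∣ a) → conjE (χ a) ≡ χ a ⊗ χ a
   go (yes d) = trans (cong conjE (χ-0 a d)) (sym (cong (λ w → w ⊗ w) (χ-0 a d)))
   go (no n) with χ-unit a n
   ... | x , ex , _ = trans (cong conjE ex) (trans (wp-conj x) (sym (cong (λ w → w ⊗ w) ex)))

  q∤1 : ¬ ⟦ q ⟧ ∣ 1ℤ
  q∤1 = ∤-small (s≤s z≤n) (p≥2 pq)

  q∤-1 : ¬ ⟦ q ⟧ ∣ -1ℤ
  q∤-1 d = q∤1 (∣m⇒∣-m d)

  χ-1 : χ 1ℤ ≡ 1E
  χ-1 = χ-wp 1ℤ z0 q∤1 (≡m-reflexive (1^ m))
   where
   1^ : ∀ n → 1ℤ ^ n ≡ 1ℤ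
   1^ zero = refl
   1^ (suc n) = trans (ℤP.*-identityˡ (1ℤ ^ n)) (1^ n)

  χ--1 : χ -1ℤ ≡ 1E
  χ--1 = trans (trans (χ-mul -1ℤ 1ℤ) (cong (χ -1ℤ ⊗_) (χ-mul -1ℤ -1ℤ))) (χ³ -1ℤ q∤-1)

  χ-neg : ∀ a → χ (- a) ≡ χ a
  χ-neg a = trans (cong χ (solveℤ 1 (λ a → :- a := Κ -1ℤ :* a) refl a)) (trans (χ-mul -1ℤ a) (trans (cong (_⊗ χ a) χ--1) (⊗-identityˡ (χ a))))

  S-scale : ∀ f → Periodic f → ∀ g → ¬ ⟦ q ⟧ ∣ g → S (λ a → f (g * a)) ≡ S f
  S-scale f per g n with inverse pq g n
  ... | u , k , eq = S-reindex f per (g *_) (u *_) (≡m-* (≡m-refl {q} {g})) (≡m-* (≡m-refl {q} {u}))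
      (λ a → ≡m-trans (≡m-reflexive (sym (ℤP.*-assoc g u a))) (one a gu)) (λ a → ≡m-trans (≡m-reflexive (trans (sym (ℤP.*-assoc u g a)) (cong (_* a) (ℤP.*-comm u g)))) (one a gu))
   where
   l = solveℤ 2 (λ k q → # 1 :+ k :* q :- # 1 := k :* q) refl
   gu : g * u ~ 1ℤ
   gu = cg (divides k (trans (cong (_- 1ℤ) eq) (l k ⟦ q ⟧)))
   one : ∀ a {w} → w ~ 1ℤ → w * a ~ a
   one a {w} h = ≡m-trans (≡m-* h (≡m-refl {q} {a})) (≡m-reflexive (ℤP.*-identityˡ a))

  private
   -- The hypothesis says (1 - w)S = 0. Multiplying by the conjugate of 1 - w turns the factor into
   -- 3, which cancels in ℤ[ω].
   kill : ∀ w → (1E ⊕ (⊝ w)) ⊗ conjE (1E ⊕ (⊝ w)) ≡ ι ⟦ 3 ⟧ → w ⊗ S χ ≡ S χ → S χ ≡ 0E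
   kill w e k = ι-cancel ⟦ 3 ⟧ (trans (cong (_⊗ S χ) (sym e)) (trans (l w (conjE (1E ⊕ (⊝ w))) (S χ)) (trans (cong (λ v → conjE (1E ⊕ (⊝ w)) ⊗ (S χ ⊕ (⊝ v))) k) (l2 (conjE (1E ⊕ (⊝ w))) (S χ) (ι ⟦ 3 ⟧)))))
     where
     l = solveE 3 (λ w c s → (Κ 1E :+ (:- w)) :* c :* s := c :* (s :+ (:- (w :* s)))) refl
     l2 = solveE 3 (λ c s t → c :* (s :+ (:- s)) := t :* Κ 0E) refl

  -- since χ(g) ≠ 1 for some g
  Sχ : S χ ≡ 0E
  Sχ with non-root pq m m≥1 (subst (suc m ℕ.<_) (sym qe) (s≤s (ℕP.m<m+n m (ℕP.≤-trans m≥1 (ℕP.m≤m+n m (m ℕ.+ 0))))))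
  ... | a , n , h = go (χ-unit ⟦ suc a ⟧ n)
   where
   mulg : χ ⟦ suc a ⟧ ⊗ S χ ≡ S χ
   mulg = trans (sym (S-⊗ (χ ⟦ suc a ⟧) χ)) (trans (S-cong (λ b → sym (χ-mul ⟦ suc a ⟧ b))) (S-scale χ χ-per ⟦ suc a ⟧ n))
   go : (∃ λ x → (χ ⟦ suc a ⟧ ≡ wp x) × (⟦ suc a ⟧ ^ m ≡ zp x [mod q ])) → S χ ≡ 0E
   go (z0 , _ , hx) = ⊥-elim (h hx)
   go (z1 , ex , _) = kill ωE refl (trans (cong (_⊗ S χ) (sym ex)) mulg)
   go (z2 , ex , _) = kill (ωE ⊗ ωE) refl (trans (cong (_⊗ S χ) (sym ex)) mulg)

  -- G = Σ χ(a) [a],  Ḡ = Σ χ̄(a) [a],  J the Jacobi sum,  X = q [0] - Σ [a]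

  G Ḡ X : GR
  G = gr χ χ-per
  Ḡ = gr (λ a → conjE (χ a)) (λ h → cong conjE (χ-per h))
  X = gr (λ c → at (single (ι ⟦ q ⟧) 0ℤ) c ⊕ (⊝ 1E)) (λ h → cong (_⊕ (⊝ 1E)) (per (single (ι ⟦ q ⟧) 0ℤ) h))

  J : E
  J = S (λ a → χ a ⊗ χ (1ℤ - a))

  sc : E → GR → GR
  sc e f = gr (λ c → e ⊗ at f c) (λ h → cong (e ⊗_) (per f h))

  Sχ̄ : S (λ a → conjE (χ a)) ≡ 0E
  Sχ̄ = trans (sym (sumE-conj (λ i → χ ⟦ toℕ i ⟧) (allFin q))) (cong conjE Sχ)

  -- a convolution of homogeneous functions at c ≢ 0 reduces to c = 1
  homog : ∀ (f g : ℤ → E) → Periodic f → Periodic g → (∀ a b → f (a * b) ≡ f a ⊗ f b) → (∀ a b → g (a * b) ≡ g a ⊗ g b) → ∀ c → ¬ ⟦ q ⟧ ∣ c →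
        S (λ a → f a ⊗ g (c - a)) ≡ f c ⊗ g c ⊗ S (λ a → f a ⊗ g (1ℤ - a))
  homog f g pf pg mf mg c n = trans (sym (S-scale (λ a → f a ⊗ g (c - a)) (λ h → cong₂ _⊗_ (pf h) (pg (c-~ c h))) c n))
    (trans (S-cong (λ a → trans (cong₂ _⊗_ (mf c a) (trans (cong g (l c a)) (mg c (1ℤ - a)))) (l2 (f c) (f a) (g c) (g (1ℤ - a))))) (S-⊗ (f c ⊗ g c) (λ a → f a ⊗ g (1ℤ - a))))
   where
   l = solveℤ 2 (λ c a → c :- c :* a := c :* (# 1 :- a)) refl
   l2 = solveE 4 (λ a b c d → (a :* b) :* (c :* d) := a :* c :* (b :* d)) refl

  0- : ∀ c → ⟦ q ⟧ ∣ c → ∀ a → c - a ~ - a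
  0- c d a = ≡m-trans (~-c a (∣⇒≡m0 d)) (≡m-reflexive (ℤP.+-identityˡ (- a)))

  -- Away from 0, homogeneity reduces the coefficient to the one at 1, which is J. At 0, since χ(-1)
  -- = 1, it is Σ χ(a)² = Σ χ̄(a) = 0.
  GG : G *g G ≐ sc J Ḡ
  GG c = go (⟦ q ⟧ ∣? c)
   where
   go : Dec (⟦ q ⟧ ∣ c) → S (λ a → χ a ⊗ χ (c - a)) ≡ J ⊗ conjE (χ c)
   go (no n) = trans (homog χ χ χ-per χ-per χ-mul χ-mul c n) (trans (cong (_⊗ J) (sym (χ-conj c))) (⊗-comm (conjE (χ c)) J))
   go (yes d) = trans (S-cong (λ a → trans (cong (χ a ⊗_) (trans (χ-per (0- c d a)) (χ-neg a))) (sym (χ-conj a)))) (trans Sχ̄ (sym (trans (cong (λ w → J ⊗ conjE w) (χ-0 c d)) (⊗-zeroʳ J))))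

  ḠḠ : Ḡ *g Ḡ ≐ sc (conjE J) G
  ḠḠ c = trans (S-cong (λ a → sym (conj-⊗ (χ a) (χ (c - a))))) (trans (sym (sumE-conj (λ i → χ ⟦ toℕ i ⟧ ⊗ χ (c - ⟦ toℕ i ⟧)) (allFin q))) (trans (cong conjE (GG c)) (trans (conj-⊗ J (conjE (χ c))) (cong (conjE J ⊗_) (conj-invol (χ c))))))

  private
   δ : ℤ → E
   δ c = at (single 1E 0ℤ) c

   δ-yes : ∀ e c → ⟦ q ⟧ ∣ c → at (single e 0ℤ) c ≡ e
   δ-yes e c d = pick-yes (⟦ q ⟧ ∣? (c - 0ℤ)) e (subst (⟦ q ⟧ ∣_) (sym (ℤP.+-identityʳ c)) d)
   δ-no : ∀ e c → ¬ ⟦ q ⟧ ∣ c → at (single e 0ℤ) c ≡ 0E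
   δ-no e c n = pick-no (⟦ q ⟧ ∣? (c - 0ℤ)) e (λ d → n (subst (⟦ q ⟧ ∣_) (ℤP.+-identityʳ c) d))

  S-const : ∀ e → S (λ _ → e) ≡ ι ⟦ q ⟧ ⊗ e
  S-const e = trans (len (allFin q)) (cong (λ k → ι ⟦ k ⟧ ⊗ e) (Data.List.Properties.length-tabulate {n = q} (λ i → i)))
   where
   import Data.List.Properties
   len : (xs : List (Fin q)) → sumE (λ _ → e) xs ≡ ι ⟦ Data.List.length xs ⟧ ⊗ e
   len [] = sym (⊗-zeroˡ e)
   len (x ∷ xs) = trans (cong (e ⊕_) (len xs)) (sym (trans (cong (λ k → ι k ⊗ e) (ℤP.pos-+ 1 (Data.List.length xs))) (trans (⊗-distribʳ e (ι 1ℤ) (ι ⟦ Data.List.length xs ⟧)) (cong (_⊕ ι ⟦ Data.List.length xs ⟧ ⊗ e) (⊗-identityˡ e)))))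

  S-single0 : ∀ e → S (at (single e 0ℤ)) ≡ e
  S-single0 e = trans (S-cong (λ a → sym (⊗-identityʳ (at (single e 0ℤ) a)))) (trans (S-single e 0ℤ (λ _ → 1E) (λ _ → refl)) (⊗-identityʳ e))

  X-conv : ∀ f → X *g f ≐ gr (λ c → ι ⟦ q ⟧ ⊗ at f c ⊕ (⊝ S (at f))) (λ h → cong (λ w → ι ⟦ q ⟧ ⊗ w ⊕ (⊝ S (at f))) (per f h))
  X-conv f c = trans (S-cong (λ a → ⊗-distribʳ (at f (c - a)) (at (single (ι ⟦ q ⟧) 0ℤ) a) (⊝ 1E))) (trans (S-⊕ (λ a → at (single (ι ⟦ q ⟧) 0ℤ) a ⊗ at f (c - a)) (λ a → (⊝ 1E) ⊗ at f (c - a)))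
    (cong₂ _⊕_ (trans (S-single (ι ⟦ q ⟧) 0ℤ (λ a → at f (c - a)) (λ h → per f (c-~ c h))) (cong (λ w → ι ⟦ q ⟧ ⊗ at f w) (ℤP.+-identityʳ c)))
       (trans (S-⊗ (⊝ 1E) (λ a → at f (c - a))) (trans (l (S (λ a → at f (c - a)))) (cong ⊝_ (S-reflect (at f) (per f) c))))))
   where
   l = solveE 1 (λ a → (:- Κ 1E) :* a := :- a) refl

  -- With a primitive ζ this would be GḠ = q. In the group ring the trivial character survives, and
  -- q is replaced by X, which annihilates constants. The coefficient away from 0 is a constant K₀;
  -- it equals -1 because the total mass of the product is (Σχ)(Σχ̄) = 0.
  GḠ : G *g Ḡ ≐ X
  GḠ c = trans (form c) (trans (cong (λ w → w ⊕ δ c ⊗ (ι ⟦ q ⟧ ⊕ (⊝ 1E) ⊕ (⊝ w))) K≡) (fin (⟦ q ⟧ ∣? c)))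
   where
   K₀ : E
   K₀ = S (λ a → χ a ⊗ conjE (χ (1ℤ - a)))
   cm : ∀ a b → conjE (χ (a * b)) ≡ conjE (χ a) ⊗ conjE (χ b)
   cm a b = trans (cong conjE (χ-mul a b)) (conj-⊗ (χ a) (χ b))
   χχ̄ : ∀ a → χ a ⊗ conjE (χ a) ≡ 1E ⊕ (⊝ 1E) ⊗ δ a
   χχ̄ a = go (⟦ q ⟧ ∣? a)
     where
     go : Dec (⟦ q ⟧ ∣ a) → χ a ⊗ conjE (χ a) ≡ 1E ⊕ (⊝ 1E) ⊗ δ a
     go (yes d) = trans (cong (λ w → w ⊗ conjE w) (χ-0 a d)) (cong (λ w → 1E ⊕ (⊝ 1E) ⊗ w) (sym (δ-yes 1E a d)))
     go (no n) with χ-unit a n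
     ... | x , ex , _ = trans (cong (λ w → w ⊗ conjE w) ex) (trans (wp-x⊗conj x) (cong (λ w → 1E ⊕ (⊝ 1E) ⊗ w) (sym (δ-no 1E a n))))
   Sχχ̄ : S (λ a → χ a ⊗ conjE (χ a)) ≡ ι ⟦ q ⟧ ⊕ (⊝ 1E)
   Sχχ̄ = trans (S-cong χχ̄) (trans (S-⊕ (λ _ → 1E) (λ a → (⊝ 1E) ⊗ δ a)) (cong₂ _⊕_ (trans (S-const 1E) (⊗-identityʳ (ι ⟦ q ⟧))) (trans (S-⊗ (⊝ 1E) δ) (trans (cong ((⊝ 1E) ⊗_) (S-single0 1E)) refl))))
   form : ∀ c → at (G *g Ḡ) c ≡ K₀ ⊕ δ c ⊗ (ι ⟦ q ⟧ ⊕ (⊝ 1E) ⊕ (⊝ K₀))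
   form c = go (⟦ q ⟧ ∣? c)
     where
     l0 = solveE 2 (λ k x → k := k :+ Κ 0E :* x) refl
     l1 = solveE 2 (λ k x → x := k :+ Κ 1E :* (x :+ (:- k))) refl
     go : Dec (⟦ q ⟧ ∣ c) → S (λ a → χ a ⊗ conjE (χ (c - a))) ≡ K₀ ⊕ δ c ⊗ (ι ⟦ q ⟧ ⊕ (⊝ 1E) ⊕ (⊝ K₀))
     go (no n) = trans (homog χ (λ a → conjE (χ a)) χ-per (λ h → cong conjE (χ-per h)) χ-mul cm c n) (trans (cong (_⊗ K₀) (trans (χχ̄ c) (cong (λ w → 1E ⊕ (⊝ 1E) ⊗ w) (δ-no 1E c n)))) (trans (⊗-identityˡ K₀) (trans (l0 K₀ (ι ⟦ q ⟧ ⊕ (⊝ 1E) ⊕ (⊝ K₀))) (cong (λ w → K₀ ⊕ w ⊗ (ι ⟦ q ⟧ ⊕ (⊝ 1E) ⊕ (⊝ K₀))) (sym (δ-no 1E c n))))))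
     go (yes d) = trans (S-cong (λ a → cong (λ w → χ a ⊗ conjE w) (trans (χ-per (0- c d a)) (χ-neg a)))) (trans Sχχ̄ (trans (l1 K₀ (ι ⟦ q ⟧ ⊕ (⊝ 1E))) (cong (λ w → K₀ ⊕ w ⊗ (ι ⟦ q ⟧ ⊕ (⊝ 1E) ⊕ (⊝ K₀))) (sym (δ-yes 1E c d)))))
   total : S (at (G *g Ḡ)) ≡ 0E
   total = trans (S-swap (λ c a → χ a ⊗ conjE (χ (c - a)))) (trans (S-cong (λ a → trans (S-⊗ (χ a) (λ c → conjE (χ (c - a)))) (trans (cong (χ a ⊗_) (trans (S-shift (λ c → conjE (χ c)) (λ h → cong conjE (χ-per h)) a) Sχ̄)) (⊗-zeroʳ (χ a))))) (trans (S-const 0E) (⊗-zeroʳ (ι ⟦ q ⟧))))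
   total' : S (at (G *g Ḡ)) ≡ ι ⟦ q ⟧ ⊗ K₀ ⊕ (ι ⟦ q ⟧ ⊕ (⊝ 1E) ⊕ (⊝ K₀))
   total' = trans (S-cong form) (trans (S-⊕ (λ _ → K₀) (λ c → δ c ⊗ (ι ⟦ q ⟧ ⊕ (⊝ 1E) ⊕ (⊝ K₀)))) (cong₂ _⊕_ (S-const K₀) (trans (S-⊗ʳ (ι ⟦ q ⟧ ⊕ (⊝ 1E) ⊕ (⊝ K₀)) δ) (trans (cong (_⊗ (ι ⟦ q ⟧ ⊕ (⊝ 1E) ⊕ (⊝ K₀))) (S-single0 1E)) (⊗-identityˡ (ι ⟦ q ⟧ ⊕ (⊝ 1E) ⊕ (⊝ K₀)))))))
   q-1 : ι ⟦ q ⟧ ⊕ (⊝ 1E) ≡ ι ⟦ 3 ℕ.* m ⟧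
   q-1 = cong ι (trans (cong (λ k → ⟦ k ⟧ - 1ℤ) qe) (solveℤ 1 (λ a → # 1 :+ a :- # 1 := a) refl ⟦ 3 ℕ.* m ⟧))
   K≡ : K₀ ≡ ⊝ 1E
   K≡ = ι-cancel ⟦ 3 ℕ.* m ⟧ {{ℕ.>-nonZero (ℕP.≤-trans m≥1 (ℕP.m≤n*m m 3))}} (trans (cong (_⊗ K₀) (sym q-1)) (trans (l (ι ⟦ q ⟧) K₀) (trans (cong (_⊕ (⊝ (ι ⟦ q ⟧ ⊕ (⊝ 1E)))) (trans (sym total') total)) (trans (l2 (ι ⟦ q ⟧ ⊕ (⊝ 1E))) (cong (_⊗ (⊝ 1E)) q-1)))))
     where
     l = solveE 2 (λ a k → (a :+ (:- Κ 1E)) :* k := (a :* k :+ (a :+ (:- Κ 1E) :+ (:- k))) :+ (:- (a :+ (:- Κ 1E)))) refl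
     l2 = solveE 1 (λ a → Κ 0E :+ (:- a) := a :* (:- Κ 1E)) refl
   fin : Dec (⟦ q ⟧ ∣ c) → (⊝ 1E) ⊕ δ c ⊗ (ι ⟦ q ⟧ ⊕ (⊝ 1E) ⊕ (⊝ (⊝ 1E))) ≡ at X c
   fin (yes d) = trans (cong (λ w → (⊝ 1E) ⊕ w ⊗ (ι ⟦ q ⟧ ⊕ (⊝ 1E) ⊕ (⊝ (⊝ 1E)))) (δ-yes 1E c d)) (trans (solveE 1 (λ a → (:- Κ 1E) :+ Κ 1E :* (a :+ (:- Κ 1E) :+ (:- (:- Κ 1E))) := a :+ (:- Κ 1E)) refl (ι ⟦ q ⟧)) (cong (_⊕ (⊝ 1E)) (sym (δ-yes (ι ⟦ q ⟧) c d))))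
   fin (no n) = trans (cong (λ w → (⊝ 1E) ⊕ w ⊗ (ι ⟦ q ⟧ ⊕ (⊝ 1E) ⊕ (⊝ (⊝ 1E)))) (δ-no 1E c n)) (trans (solveE 1 (λ a → (:- Κ 1E) :+ Κ 0E :* (a :+ (:- Κ 1E) :+ (:- (:- Κ 1E))) := Κ 0E :+ (:- Κ 1E)) refl (ι ⟦ q ⟧)) (cong (_⊕ (⊝ 1E)) (sym (δ-no (ι ⟦ q ⟧) c n))))

  X-1 : at X 1ℤ ≡ ⊝ 1E
  X-1 = cong (_⊕ (⊝ 1E)) (δ-no (ι ⟦ q ⟧) 1ℤ q∤1)

  SX : S (at X) ≡ 0E
  SX = trans (S-⊕ (at (single (ι ⟦ q ⟧) 0ℤ)) (λ _ → ⊝ 1E)) (trans (cong₂ _⊕_ (S-single0 (ι ⟦ q ⟧)) (S-const (⊝ 1E))) (solveE 1 (λ a → a :+ a :* (:- Κ 1E) := Κ 0E) refl (ι ⟦ q ⟧)))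

  sc-* : ∀ e f g → sc e f *g g ≐ sc e (f *g g)
  sc-* e f g c = trans (S-cong (λ a → ⊗-assoc e (at f a) (at g (c - a)))) (S-⊗ e (λ a → at f a ⊗ at g (c - a)))

  *-sc : ∀ e f g → f *g sc e g ≐ sc e (f *g g)
  *-sc e f g c = trans (*g-comm f (sc e g) c) (trans (sc-* e g f c) (cong (e ⊗_) (*g-comm g f c)))

  -- (G G)(Ḡ Ḡ) = (G Ḡ)(G Ḡ), evaluated at 1
  norm-J : J ⊗ conjE J ≡ ι ⟦ q ⟧
  norm-J = trans (l (J ⊗ conjE J)) (trans (cong ⊝_ (trans (cong ((J ⊗ conjE J) ⊗_) (sym X-1)) both)) (l2 (ι ⟦ q ⟧)))
   where
   l = solveE 1 (λ a → a := :- (a :* (:- Κ 1E))) refl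
   l2 = solveE 1 (λ a → :- (a :* (:- Κ 1E) :+ (:- Κ 0E)) := a) refl
   lhs : (G *g G) *g (Ḡ *g Ḡ) ≐ sc J (sc (conjE J) X)
   lhs c = trans (*g-cong {G *g G} {sc J Ḡ} {Ḡ *g Ḡ} {sc (conjE J) G} GG ḠḠ c) (trans (sc-* J Ḡ (sc (conjE J) G) c) (cong (J ⊗_) (trans (*-sc (conjE J) Ḡ G c) (cong (conjE J ⊗_) (trans (*g-comm Ḡ G c) (GḠ c))))))
   rhs : (G *g G) *g (Ḡ *g Ḡ) ≐ X *g X
   rhs c = trans (*g-assoc G G (Ḡ *g Ḡ) c) (trans (*g-cong {G} {G} {G *g (Ḡ *g Ḡ)} {(G *g Ḡ) *g Ḡ} (λ _ → refl) (λ k → sym (*g-assoc G Ḡ Ḡ k)) c)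
       (trans (*g-comm G ((G *g Ḡ) *g Ḡ) c) (trans (*g-assoc (G *g Ḡ) Ḡ G c) (*g-cong {G *g Ḡ} {X} {Ḡ *g G} {X} GḠ (λ k → trans (*g-comm Ḡ G k) (GḠ k)) c))))
   both : (J ⊗ conjE J) ⊗ at X 1ℤ ≡ ι ⟦ q ⟧ ⊗ (⊝ 1E) ⊕ (⊝ 0E)
   both = trans (⊗-assoc J (conjE J) (at X 1ℤ)) (trans (sym (lhs 1ℤ)) (trans (rhs 1ℤ) (trans (X-conv X 1ℤ) (cong₂ (λ a b → ι ⟦ q ⟧ ⊗ a ⊕ (⊝ b)) X-1 SX))))

  G³ : G *g (G *g G) ≐ sc J X
  G³ c = trans (*g-cong {G} {G} {G *g G} {sc J Ḡ} (λ _ → refl) GG c) (trans (*-sc J G Ḡ c) (cong (J ⊗_) (GḠ c)))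

  XG : X *g G ≐ sc (ι ⟦ q ⟧) G
  XG c = trans (X-conv G c) (trans (cong (λ w → ι ⟦ q ⟧ ⊗ χ c ⊕ (⊝ w)) Sχ) (⊕-identityʳ (ι ⟦ q ⟧ ⊗ χ c)))

  -- Since Σχ = 0, X acts on G as the scalar q. So multiplication by G³ scales G by qJ, and the
  -- powers G^(1+3n) are (qJ)^n G.
  G⁴ : G *g (G *g (G *g G)) ≐ sc (ι ⟦ q ⟧ ⊗ J) G
  G⁴ c = trans (*g-cong {G} {G} {G *g (G *g G)} {sc J X} (λ _ → refl) G³ c) (trans (*-sc J G X c) (trans (cong (J ⊗_) (trans (*g-comm G X c) (XG c))) (solveE 3 (λ a b d → a :* (b :* d) := (b :* a) :* d) refl J (ι ⟦ q ⟧) (χ c))))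

  G≐Fam : G ≐ Fam (λ i → χ ⟦ toℕ i ⟧) (λ i → ⟦ toℕ i ⟧)
  G≐Fam = decompose G

-- The reciprocity law for Jacobi sums

module CubicReciprocityLaw where
 open import Data.Fin using (Fin; toℕ)
 open import Data.Integer as ℤ using (ℤ; _+_; _*_)
 open import Data.List using (allFin)
 open import Relation.Binary.PropositionalEquality hiding (J)
 open Integers
 open Eisenstein
 open PrimeField
 open GroupRing
 open CubicGaussSums

 ^E-1+3 : ∀ a n → a ⊗ (a ⊗ a) ≡ 1E → a ^E suc (n ℕ.* 3) ≡ a
 ^E-1+3 a zero h = ⊗-identityʳ a
 ^E-1+3 a (suc n) h = trans (solveE 2 (λ a b → a :* (a :* (a :* b)) := a :* (a :* a) :* b) refl a (a ^E suc (n ℕ.* 3))) (trans (cong₂ _⊗_ h (^E-1+3 a n h)) (⊗-identityˡ a))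

 module CubicReciprocity (q m : ℕ) (pq : Prime q) (ne3 : q ≢ 3) (qe : q ≡ suc (3 ℕ.* m)) (m≥1 : 1 ℕ.≤ m) (z : ℤ) (hz : ⟦ q ⟧ ∣ (z * z + z + 1ℤ)) where
  open CubicGauss q m pq ne3 qe m≥1 z hz public

  private
   e₀ : Fin q → E
   e₀ i = χ ⟦ toℕ i ⟧
   k₀ : Fin q → ℤ
   k₀ i = ⟦ toℕ i ⟧
   c : E
   c = ι ⟦ q ⟧ ⊗ J

   unit : ∀ i t → i * t ≡ 1ℤ [mod q ] → ¬ ⟦ q ⟧ ∣ i
   unit i t h d = q∤1 (≡m0⇒∣ (≡m-trans (≡m-sym h) (∣⇒≡m0 (∣m⇒∣m*n t d))))

  -- The coefficient of G³ at 1 is -J by `G³`. By the Frobenius map modulo 3 it is the cube of a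
  -- character value at a unit, that is 1. So J is congruent to -1 modulo 3, and its ω-coordinate is
  -- divisible by 3.
  J-mod-3 : J ⊗ (⊝ 1E) ≋ 1E [ 3 ]
  J-mod-3 = ≋-trans (≋-reflexive (sym lhs)) (≋-trans (to-at {G F.^ 3} {Fam (λ i → e₀ i ^E 3) (λ i → ⟦ 3 ⟧ * k₀ i)} (Q.≈ₙ-trans {G F.^ 3} {Fam e₀ k₀ F.^ 3} {Fam (λ i → e₀ i ^E 3) (λ i → ⟦ 3 ⟧ * k₀ i)} (F.^-congˡ 3 {G} {Fam e₀ k₀} (Q.lift {G} {Fam e₀ k₀} G≐Fam)) (Fam-frob e₀ k₀)) 1ℤ) (≋-reflexive (rhs (Fam-at ⟦ 3 ⟧ (λ i → e₀ i ^E 3) (λ d → ne3 (p∣q pq prime[3] d))))))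
   where
   open ModP 3 prime[3]
   lhs : at (G F.^ 3) 1ℤ ≡ J ⊗ (⊝ 1E)
   lhs = trans (*g-cong {G} {G} {G *g (G *g 1g)} {G *g G} (λ _ → refl) (*g-cong {G} {G} {G *g 1g} {G} (λ _ → refl) (λ k → trans (*g-comm G 1g k) (*g-identityˡ G k))) 1ℤ) (trans (G³ 1ℤ) (cong (J ⊗_) X-1))
   rhs : (∃ λ i₀ → (⟦ toℕ i₀ ⟧ * ⟦ 3 ⟧ ≡ 1ℤ [mod q ]) × at (Fam (λ i → e₀ i ^E 3) (λ i → ⟦ 3 ⟧ * ⟦ toℕ i ⟧)) 1ℤ ≡ e₀ i₀ ^E 3) → at (Fam (λ i → e₀ i ^E 3) (λ i → ⟦ 3 ⟧ * k₀ i)) 1ℤ ≡ 1E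
   rhs (i₀ , h , e) = trans e (trans (cong (λ w → e₀ i₀ ⊗ (e₀ i₀ ⊗ w)) (⊗-identityʳ (e₀ i₀))) (χ³ ⟦ toℕ i₀ ⟧ (unit ⟦ toℕ i₀ ⟧ ⟦ 3 ⟧ h)))

  -- G^(ρ²) is computed from G⁴ = q J G and from two applications of the Frobenius map modulo ρ
  qJ^n≡χ : ∀ ρ → Prime ρ → ρ ≢ q → ∀ n → ρ ℕ.* ρ ≡ suc (n ℕ.* 3) → c ^E n ≋ χ ⟦ ρ ⟧ [ ρ ]
  qJ^n≡χ ρ pρ ne n eρ = ≋-trans (≋-reflexive (sym lhs)) (≋-trans (to-at {(G F.^ ρ) F.^ ρ} {Fam e₂ (λ i → ⟦ ρ ⟧ * k₁ i)} twice 1ℤ) (≋-reflexive (rhs (Fam-at (⟦ ρ ⟧ * ⟦ ρ ⟧) e₂ (λ d → q∤ρ (euclid-sq pq ⟦ ρ ⟧ d))))))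
   where
   open ModP ρ pρ
   q∤ρ : ¬ ⟦ q ⟧ ∣ ⟦ ρ ⟧
   q∤ρ d = ne (sym (p∣q pq pρ d))
   e₁ e₂ : Fin q → E
   e₁ i = e₀ i ^E ρ
   e₂ i = e₁ i ^E ρ
   k₁ : Fin q → ℤ
   k₁ i = ⟦ ρ ⟧ * k₀ i
   twice : (G F.^ ρ) F.^ ρ Q.≈ₙ Fam e₂ (λ i → ⟦ ρ ⟧ * k₁ i)
   twice = Q.≈ₙ-trans {(G F.^ ρ) F.^ ρ} {Fam e₁ k₁ F.^ ρ} {Fam e₂ (λ i → ⟦ ρ ⟧ * k₁ i)}
     (F.^-congˡ ρ {G F.^ ρ} {Fam e₁ k₁} (Q.≈ₙ-trans {G F.^ ρ} {Fam e₀ k₀ F.^ ρ} {Fam e₁ k₁} (F.^-congˡ ρ {G} {Fam e₀ k₀} (Q.lift {G} {Fam e₀ k₀} G≐Fam)) (Fam-frob e₀ k₀)))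
     (Fam-frob e₁ k₁)
   ^-add : ∀ x a b → x F.^ (a ℕ.+ b) ≐ x F.^ a *g x F.^ b
   ^-add x zero b k = sym (*g-identityˡ (x F.^ b) k)
   ^-add x (suc a) b k = trans (*g-cong {x} {x} {x F.^ (a ℕ.+ b)} {x F.^ a *g x F.^ b} (λ _ → refl) (^-add x a b) k) (sym (*g-assoc x (x F.^ a) (x F.^ b) k))
   ^-mul : ∀ x a b → (x F.^ a) F.^ b ≐ x F.^ (b ℕ.* a)
   ^-mul x a zero k = refl
   ^-mul x a (suc b) k = trans (*g-cong {x F.^ a} {x F.^ a} {(x F.^ a) F.^ b} {x F.^ (b ℕ.* a)} (λ _ → refl) (^-mul x a b) k) (sym (^-add x a (b ℕ.* a) k))
   pw : ∀ n → G F.^ suc (n ℕ.* 3) ≐ sc (c ^E n) G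
   pw zero k = trans (*g-comm G 1g k) (trans (*g-identityˡ G k) (sym (⊗-identityˡ (at G k))))
   pw (suc n) k = trans (3x G' k) (trans (*g-cong {G³'} {G³'} {G'} {sc (c ^E n) G} (λ _ → refl) (pw n) k) (trans (*-sc (c ^E n) G³' G k) (trans (cong ((c ^E n) ⊗_) (trans (*g-comm G³' G k) (G⁴ k))) (l (c ^E n) c (at G k)))))
    where
    G' G³' : GR
    G' = G F.^ suc (n ℕ.* 3)
    G³' = G *g (G *g G)
    3x : ∀ f → G *g (G *g (G *g f)) ≐ G³' *g f
    3x f k = trans (*g-cong {G} {G} {G *g (G *g f)} {G *g G *g f} (λ _ → refl) (λ k → sym (*g-assoc G G f k)) k) (sym (*g-assoc G (G *g G) f k))
    l = solveE 3 (λ a b d → a :* (b :* d) := (b :* a) :* d) refl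
   lhs : at ((G F.^ ρ) F.^ ρ) 1ℤ ≡ c ^E n
   lhs = trans (^-mul G ρ ρ 1ℤ) (trans (cong (λ k → at (G F.^ k) 1ℤ) eρ) (trans (pw n 1ℤ) (trans (cong ((c ^E n) ⊗_) χ-1) (⊗-identityʳ (c ^E n)))))
   rhs : (∃ λ i₀ → (⟦ toℕ i₀ ⟧ * (⟦ ρ ⟧ * ⟦ ρ ⟧) ≡ 1ℤ [mod q ]) × at (Fam e₂ (λ i → ⟦ ρ ⟧ * ⟦ ρ ⟧ * ⟦ toℕ i ⟧)) 1ℤ ≡ e₂ i₀) → at (Fam e₂ (λ i → ⟦ ρ ⟧ * k₁ i)) 1ℤ ≡ χ ⟦ ρ ⟧
   rhs (i₀ , h , e) = trans (trans (sumG-at (λ i → single (e₂ i) (⟦ ρ ⟧ * k₁ i)) (allFin q) 1ℤ) (trans (sumE-cong (allFin q) (λ i → cong (λ k → at (single (e₂ i) k) 1ℤ) (sym (ℤP.*-assoc ⟦ ρ ⟧ ⟦ ρ ⟧ ⟦ toℕ i ⟧)))) (sym (sumG-at (λ i → single (e₂ i) (⟦ ρ ⟧ * ⟦ ρ ⟧ * ⟦ toℕ i ⟧)) (allFin q) 1ℤ))))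
      (trans e (trans (^E-assocʳ χi ρ ρ) (trans (cong (χi ^E_) eρ) (trans (^E-1+3 χi n (χ³ ⟦ toℕ i₀ ⟧ (unit _ _ h))) χi≡))))
    where
    χi χρ : E
    χi = χ ⟦ toℕ i₀ ⟧
    χρ = χ ⟦ ρ ⟧
    l = solveE 2 (λ a b → a :* (b :* (b :* b)) := a :* (b :* b) :* b) refl
    χi≡ : χi ≡ χρ
    χi≡ = trans (sym (⊗-identityʳ χi)) (trans (cong (χi ⊗_) (sym (χ³ ⟦ ρ ⟧ q∤ρ))) (trans (l χi χρ) (trans (cong (_⊗ χρ) (trans (cong (χi ⊗_) (sym (χ-mul ⟦ ρ ⟧ ⟦ ρ ⟧))) (trans (sym (χ-mul ⟦ toℕ i₀ ⟧ (⟦ ρ ⟧ * ⟦ ρ ⟧))) (trans (χ-per h) χ-1)))) (⊗-identityˡ χρ))))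

-- Cubic symbols of rational integers and their reciprocity

module RationalReciprocity where
 open import Data.Nat.Induction using (<-rec)
 open import Data.Nat.DivMod using (_%_; _/_; m≡m%n+[m/n]*n; m%n<n)
 open import Data.Integer as ℤ using (ℤ; _+_; _*_; _-_; -_; _^_)
 open import Relation.Binary.PropositionalEquality hiding (J)
 open Valuations using (p≥1; p≥2; prime-div)
 open Integers
 open Eisenstein
 open PrimeField
 open CubicGaussSums
 open CubicReciprocityLaw
 open RingClassWeights using (z0; _⊞_)

 -- The cubic residue symbol modulo γ, restricted to rational integers.
 record Symbol (γ : E) (n : ℕ) : Set where
  field
    X : ℤ → E
    X-* : ∀ a b → X (a * b) ≡ X a ⊗ X b
    X-per : ∀ {a b} → a ≡ b [mod n ] → X a ≡ X b
    X-wp : ∀ a → (∀ q → Prime q → ⟦ q ⟧ ∣ ⟦ n ⟧ → ¬ ⟦ q ⟧ ∣ a) → ∃ λ x → X a ≡ wp x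
    law : ∀ ρ → Prime ρ → ¬ ⟦ ρ ⟧ ∣ ⟦ n ⟧ → ∀ k → ρ ℕ.* ρ ≡ suc (k ℕ.* 3) → (ι ⟦ n ⟧ ⊗ γ) ^E k ≋ X ⟦ ρ ⟧ [ ρ ]

 conj-^ : ∀ x n → conjE (x ^E n) ≡ conjE x ^E n
 conj-^ x zero = refl
 conj-^ x (suc n) = trans (conj-⊗ x (x ^E n)) (cong (conjE x ⊗_) (conj-^ x n))

 conj-ι : ∀ a → conjE (ι a) ≡ ι a
 conj-ι a = cong₂ _,_ (ℤP.+-identityʳ a) refl

 Symbol-conj : ∀ {γ n} → Symbol γ n → Symbol (conjE γ) n
 Symbol-conj {γ} {n} s = record
  { X = λ a → conjE (X a)
  ; X-* = λ a b → trans (cong conjE (X-* a b)) (conj-⊗ (X a) (X b))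
  ; X-per = λ h → cong conjE (X-per h)
  ; X-wp = λ a h → conj-wp (X-wp a h)
  ; law = λ ρ pρ nd k e → ≋-trans (≋-reflexive (trans (cong (_^E k) (trans (cong (_⊗ conjE γ) (sym (conj-ι ⟦ n ⟧))) (sym (conj-⊗ (ι ⟦ n ⟧) γ)))) (sym (conj-^ (ι ⟦ n ⟧ ⊗ γ) k)))) (≋-conj (law ρ pρ nd k e)) }
  where
  open Symbol s
  conj-wp : ∀ {u} → (∃ λ x → u ≡ wp x) → ∃ λ x → conjE u ≡ wp x
  conj-wp (x , e) = x ⊞ x , trans (cong conjE e) (trans (wp-conj x) (sym (wp-⊞ x x)))

 Symbol-⊗ : ∀ {γ δ m n} → Symbol γ m → Symbol δ n → Symbol (γ ⊗ δ) (m ℕ.* n)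
 Symbol-⊗ {γ} {δ} {m} {n} s t = record
  { X = λ a → S.X a ⊗ T.X a
  ; X-* = λ a b → trans (cong₂ _⊗_ (S.X-* a b) (T.X-* a b)) (med (S.X a) (S.X b) (T.X a) (T.X b))
  ; X-per = λ h → cong₂ _⊗_ (S.X-per (down m∣ h)) (T.X-per (down n∣ h))
  ; X-wp = λ a h → combine (S.X-wp a (λ q pq d → h q pq (∣-trans d m∣))) (T.X-wp a (λ q pq d → h q pq (∣-trans d n∣)))
  ; law = λ ρ pρ nd k e → ≋-trans (≋-reflexive (trans (cong (_^E k) base) (^E-distrib-* (ι ⟦ m ⟧ ⊗ γ) (ι ⟦ n ⟧ ⊗ δ) k))) (≋-⊗ (S.law ρ pρ (λ d → nd (∣-trans d m∣)) k e) (T.law ρ pρ (λ d → nd (∣-trans d n∣)) k e)) }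
  where
  module S = Symbol s
  module T = Symbol t
  m∣ : ⟦ m ⟧ ∣ ⟦ m ℕ.* n ⟧
  m∣ = ℕ∣ (ℕD.m∣m*n n)
  n∣ : ⟦ n ⟧ ∣ ⟦ m ℕ.* n ⟧
  n∣ = ℕ∣ (ℕD.n∣m*n m)
  down : ∀ {r s a b} → ⟦ r ⟧ ∣ ⟦ s ⟧ → a ≡ b [mod s ] → a ≡ b [mod r ]
  down h (cg d) = cg (∣-trans h d)
  med = solveE 4 (λ a b c d → (a :* b) :* (c :* d) := (a :* c) :* (b :* d)) refl
  combine : ∀ {u v} → (∃ λ x → u ≡ wp x) → (∃ λ y → v ≡ wp y) → ∃ λ z → u ⊗ v ≡ wp z
  combine (x , e) (y , f) = x ⊞ y , trans (cong₂ _⊗_ e f) (sym (wp-⊞ x y))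
  base : ι ⟦ m ℕ.* n ⟧ ⊗ (γ ⊗ δ) ≡ (ι ⟦ m ⟧ ⊗ γ) ⊗ (ι ⟦ n ⟧ ⊗ δ)
  base = trans (cong (_⊗ (γ ⊗ δ)) (trans (cong ι (ℤP.pos-* m n)) (ι-⊗ ⟦ m ⟧ ⟦ n ⟧))) (med (ι ⟦ m ⟧) (ι ⟦ n ⟧) γ δ)

 ^-mul : ∀ a b n → (a * b) ^ n ≡ a ^ n * b ^ n
 ^-mul a b zero = refl
 ^-mul a b (suc n) = trans (cong (a * b *_) (^-mul a b n)) (solveℤ 4 (λ a b c d → a :* b :* (c :* d) := a :* c :* (b :* d)) refl a b (a ^ n) (b ^ n))

 -- Three times the exponent is ρ² - 1, and a^(ρ²) = a holds modulo ρ for every rational a by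
 -- applying Fermat twice.
 cube-^ : ∀ {ρ} → Prime ρ → ∀ k → ρ ℕ.* ρ ≡ suc (k ℕ.* 3) → ∀ a → ¬ ⟦ ρ ⟧ ∣ a → (a * (a * a)) ^ k ≡ 1ℤ [mod ρ ]
 cube-^ {ρ} pρ k e a n = ≡m-trans (≡m-reflexive (trans (trans (cong (_^ k) (cong (λ w → a * (a * w)) (sym (ℤP.*-identityʳ a)))) (ℤP.^-*-assoc a 3 k)) (cong (a ^_) (ℕP.*-comm 3 k)))) (cancel-m pρ a n (≡m-trans (≡m-reflexive (cong (a ^_) (sym e))) (≡m-trans sq (≡m-reflexive (sym (ℤP.*-identityʳ a))))))
  where
  sq : a ^ (ρ ℕ.* ρ) ≡ a [mod ρ ]
  sq = ≡m-trans (≡m-reflexive (sym (ℤP.^-*-assoc a ρ ρ))) (≡m-trans (≡m-^ ρ (fermat pρ a)) (fermat pρ a))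

 -- The units ±1 are their own cubes, so the trivial symbol satisfies the law.
 Symbol-unit : ∀ {ε} → ε * ε ≡ 1ℤ → Symbol (ι ε) 1
 Symbol-unit {ε} h = record
  { X = λ _ → 1E ; X-* = λ _ _ → refl ; X-per = λ _ → refl ; X-wp = λ _ _ → z0 , refl
  ; law = λ ρ pρ nd k e → ≋-trans (≋-reflexive (trans (cong (_^E k) (trans (⊗-identityˡ (ι ε)) (cong ι (sym cube)))) (sym (ι-^ (ε * (ε * ε)) k)))) (ι-mod (cube-^ pρ k e ε (λ d → nd (subst (⟦ ρ ⟧ ∣_) h (∣m⇒∣m*n ε d))))) }
  where
  cube : ε * (ε * ε) ≡ ε
  cube = trans (cong (ε *_) h) (ℤP.*-identityʳ ε)

 module JacobiSum (q m : ℕ) (pq : Prime q) (ne3 : q ≢ 3) (qe : q ≡ suc (3 ℕ.* m)) (m≥1 : 1 ℕ.≤ m) (z : ℤ) (hz : ⟦ q ⟧ ∣ (z * z + z + 1ℤ)) where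
  private
    module C = CubicReciprocity q m pq ne3 qe m≥1 z hz

  unit-wp : ∀ a → ¬ ⟦ q ⟧ ∣ a → ∃ λ x → C.χ a ≡ wp x
  unit-wp a n = proj₁ (C.χ-unit a n) , proj₁ (proj₂ (C.χ-unit a n))

  symJ : Symbol C.J q
  symJ = record { X = C.χ ; X-* = C.χ-mul ; X-per = C.χ-per ; X-wp = λ a h → unit-wp a (h q pq ∣-refl)
         ; law = λ ρ pρ nd k e → C.qJ^n≡χ ρ pρ (λ { refl → nd ∣-refl }) k e }

  normJ : normE C.J ≡ ⟦ q ⟧
  normJ = cong proj₁ (trans (sym (x⊗conj C.J)) C.norm-J)

  3∣J : ⟦ 3 ⟧ ∣ proj₂ C.J
  3∣J = subst (⟦ 3 ⟧ ∣_) (solveℤ 2 (λ a b → :- (a :* (:- # 0) :+ b :* (:- # 1) :- b :* (:- # 0) :- # 0) := b) refl (proj₁ C.J) (proj₂ C.J)) (∣m⇒∣-m (≋⇒∣₂ C.J-mod-3))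

  symbol-of-norm-q : ∃ λ J → Symbol J q × (normE J ≡ ⟦ q ⟧) × (⟦ 3 ⟧ ∣ proj₂ J)
  symbol-of-norm-q = C.J , symJ , normJ , 3∣J

 Primitive : E → Set
 Primitive γ = ∀ q → Prime q → ⟦ q ⟧ ∣ proj₁ γ → ⟦ q ⟧ ∣ proj₂ γ → ⊥

 norm-∣ : ∀ {q} → Prime q → ∀ a b → ⟦ q ⟧ ∣ normE (a , b) → ⟦ q ⟧ ∣ b → ⟦ q ⟧ ∣ a
 norm-∣ {q} pq a b d e = euclid-sq pq a (subst (⟦ q ⟧ ∣_) (solveℤ 2 (λ a b → a :* a :- a :* b :+ b :* b :+ b :* (a :- b) := a :* a) refl a b) (∣m∣n⇒∣m+n d (∣m⇒∣m*n (a - b) e)))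

 -- As q divides the norm of γ times the conjugate of λ', divisibility of the ω-coordinate implies
 -- that of the other one. Division by q then yields δ.
 divide : ∀ {q} → Prime q → ∀ γ λ' → normE λ' ≡ ⟦ q ⟧ → ⟦ q ⟧ ∣ normE γ → ⟦ q ⟧ ∣ proj₂ (γ ⊗ conjE λ') → ∃ λ δ → (γ ≡ δ ⊗ λ') × (ι ⟦ q ⟧ ⊗ δ ≡ γ ⊗ conjE λ')
 divide {q} pq γ λ' hλ dγ d₂ = fin (norm-∣ pq (proj₁ (γ ⊗ conjE λ')) (proj₂ (γ ⊗ conjE λ')) (subst (⟦ q ⟧ ∣_) (sym (norm-⊗ γ (conjE λ'))) (∣m⇒∣m*n (normE (conjE λ')) dγ)) d₂) d₂
  where
  instance
    nz : ℕ.NonZero q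
    nz = ℕ.>-nonZero (p≥1 pq)
  fin : ⟦ q ⟧ ∣ proj₁ (γ ⊗ conjE λ') → ⟦ q ⟧ ∣ proj₂ (γ ⊗ conjE λ') → _
  fin (divides u eu) (divides v ev) = (u , v) , ι-cancel ⟦ q ⟧ {γ} {(u , v) ⊗ λ'} (trans (⊗-comm (ι ⟦ q ⟧) γ) (trans (cong (γ ⊗_) (trans (cong ι (sym hλ)) (trans (sym (x⊗conj λ')) (⊗-comm λ' (conjE λ'))))) (trans (sym (⊗-assoc γ (conjE λ') λ')) (trans (cong (_⊗ λ') (sym eq)) (⊗-assoc (ι ⟦ q ⟧) (u , v) λ'))))) , eq
    where
    eq : ι ⟦ q ⟧ ⊗ (u , v) ≡ γ ⊗ conjE λ'
    eq = trans (ι-⊗-scale ⟦ q ⟧ (u , v)) (sym (cong₂ _,_ (trans eu (ℤP.*-comm u ⟦ q ⟧)) (trans ev (ℤP.*-comm v ⟦ q ⟧))))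

 Goal : ℕ → Set
 Goal n = ∀ γ → normE γ ≡ ⟦ n ⟧ → Primitive γ → ⟦ 3 ⟧ ∣ proj₂ γ → 1 ℕ.≤ n → Symbol γ n

 -- A prime q dividing the norm of a primitive γ splits in ℤ[ω], and the Jacobi sum of norm q or its
 -- conjugate divides γ. The quotient is again primitive with ω-coordinate divisible by 3, so the
 -- induction on the norm applies and the symbols multiply.
 module Step (n : ℕ) (rec : ∀ {m} → m ℕ.< n → Goal m) (γ : E) (hγ : normE γ ≡ ⟦ n ⟧) (prim : Primitive γ) (d3 : ⟦ 3 ⟧ ∣ proj₂ γ) (n≥1 : 1 ℕ.≤ n)
        (q : ℕ) (pq : Prime q) (q∣n : q ℕD.∣ n) where
  a b : ℤ
  a = proj₁ γ
  b = proj₂ γ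

  q∣γ : ⟦ q ⟧ ∣ normE γ
  q∣γ = subst (⟦ q ⟧ ∣_) (sym hγ) (ℕ∣ q∣n)

  ne3 : q ≢ 3
  ne3 refl = prim 3 prime[3] (norm-∣ prime[3] a b q∣γ d3) d3

  q∤b : ¬ ⟦ q ⟧ ∣ b
  q∤b d = prim q pq (norm-∣ pq a b q∣γ d) d

  opaque
   -- Modulo a prime above q that divides γ = a + bω, ω becomes -a/b; b is invertible because γ is
   -- primitive.
   root : ∃ λ z → ⟦ q ⟧ ∣ (z * z + z + 1ℤ)
   root = go (inverse pq b q∤b)
    where
    go : (∃ λ u → ∃ λ k → b * u ≡ 1ℤ + k * ⟦ q ⟧) → ∃ λ z → ⟦ q ⟧ ∣ (z * z + z + 1ℤ)
    go (u , k , e) = - (a * u) , subst (⟦ q ⟧ ∣_) (l a b u) (∣m∣n⇒∣m+n {⟦ q ⟧} {u * u * (a * a - a * b + b * b)} {(a * u - (b * u + 1ℤ)) * (b * u - 1ℤ)} (∣n⇒∣m*n (u * u) q∣γ) (∣n⇒∣m*n (a * u - (b * u + 1ℤ)) (subst (⟦ q ⟧ ∣_) (sym (trans (cong (_- 1ℤ) e) (l2 (k * ⟦ q ⟧)))) (divides k refl))))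
     where
     l2 : ∀ x → 1ℤ + x - 1ℤ ≡ x
     l2 = solveℤ 1 (λ x → # 1 :+ x :- # 1 := x) refl
     l : ∀ a b u → u * u * (a * a - a * b + b * b) + (a * u - (b * u + 1ℤ)) * (b * u - 1ℤ) ≡ (- (a * u)) * (- (a * u)) + (- (a * u)) + 1ℤ
     l = solveℤ 3 (λ a b u → u :* u :* (a :* a :- a :* b :+ b :* b) :+ (a :* u :- (b :* u :+ # 1)) :* (b :* u :- # 1) := (:- (a :* u)) :* (:- (a :* u)) :+ (:- (a :* u)) :+ # 1) refl

  z : ℤ
  z = proj₁ root
  hz : ⟦ q ⟧ ∣ (z * z + z + 1ℤ)
  hz = proj₂ root

  z≢1 : ¬ z ≡ 1ℤ [mod q ]
  z≢1 (cg d) = ne3 (p∣q pq prime[3] (subst (⟦ q ⟧ ∣_) (solveℤ 1 (λ z → z :* z :+ z :+ # 1 :- (z :- # 1) :* (z :+ # 2) := # 3) refl z) (∣m∣n⇒∣m-n hz (∣m⇒∣m*n (z + ℤ.+ 2) d))))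

  z³ : z * (z * z) ≡ 1ℤ [mod q ]
  z³ = cg (subst (⟦ q ⟧ ∣_) (solveℤ 1 (λ z → (z :- # 1) :* (z :* z :+ z :+ # 1) := z :* (z :* z) :- # 1) refl z) (∣n⇒∣m*n (z - 1ℤ) hz))

  z-unit : ¬ ⟦ q ⟧ ∣ z
  z-unit d = ∤-small {q} {1} (s≤s z≤n) (p≥2 pq) (≡m0⇒∣ (≡m-trans (≡m-sym z³) (∣⇒≡m0 (∣m⇒∣m*n (z * z) d))))

  z^3m : ∀ m → z ^ (m ℕ.* 3) ≡ 1ℤ [mod q ]
  z^3m zero = ≡m-refl
  z^3m (suc m) = ≡m-trans (≡m-reflexive (solveℤ 2 (λ z w → z :* (z :* (z :* w)) := z :* (z :* z) :* w) refl z (z ^ (m ℕ.* 3)))) (≡m-* z³ (z^3m m))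

  q≡1 : ∃ λ m → (q ≡ suc (3 ℕ.* m)) × (1 ℕ.≤ m)
  q≡1 = go (q % 3) (m%n<n q 3) (m≡m%n+[m/n]*n q 3)
    where
    go : ∀ r → r ℕ.< 3 → q ≡ r ℕ.+ (q / 3) ℕ.* 3 → ∃ λ m → (q ≡ suc (3 ℕ.* m)) × (1 ℕ.≤ m)
    go 0 _ e = ⊥-elim (ne3 (sym (p∣q prime[3] pq (ℕ∣ (ℕD.divides (q / 3) e)))))
    go 1 _ e = q / 3 , trans e (cong suc (ℕP.*-comm (q / 3) 3)) , m≥1 (q / 3) e
      where
      m≥1 : ∀ m → q ≡ suc (m ℕ.* 3) → 1 ℕ.≤ m
      m≥1 zero e = ⊥-elim (ℕP.<⇒≢ (p≥2 pq) (sym e))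
      m≥1 (suc m) e = s≤s z≤n
    -- For q = 3k + 2 the power z^(q-1) is z, and Fermat would force z = 1.
    go 2 _ e = ⊥-elim (z≢1 (≡m-trans (≡m-sym (≡m-trans (≡m-* (≡m-refl {q} {z}) (z^3m (q / 3))) (≡m-reflexive (ℤP.*-identityʳ z)))) (fermat' pq (suc (q / 3 ℕ.* 3)) e z z-unit)))
    go (suc (suc (suc _))) (s≤s (s≤s (s≤s ()))) _

  finish : ∀ λ' → Symbol λ' q → normE λ' ≡ ⟦ q ⟧ → ⟦ 3 ⟧ ∣ proj₂ λ' → ⟦ q ⟧ ∣ proj₂ (γ ⊗ conjE λ') → Symbol γ n
  finish λ' s nλ 3∣λ d = go (divide pq γ λ' nλ q∣γ d) q∣n
   where
   go : (∃ λ δ → (γ ≡ δ ⊗ λ') × (ι ⟦ q ⟧ ⊗ δ ≡ γ ⊗ conjE λ')) → q ℕD.∣ n → Symbol γ n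
   go (δ , γ≡ , qδ) (ℕD.divides m n≡) = subst₂ Symbol (sym γ≡) (sym n≡) (Symbol-⊗ (rec m<n δ nδ primδ 3∣δ m≥1) s)
    where
    instance
      nzq : ℕ.NonZero q
      nzq = ℕ.>-nonZero (p≥1 pq)
    m≥1 : 1 ℕ.≤ m
    m≥1 = pos m n≡
      where
      pos : ∀ m → n ≡ m ℕ.* q → 1 ℕ.≤ m
      pos zero e = ⊥-elim (ℕP.<⇒≢ n≥1 (sym e))
      pos (suc m) e = s≤s z≤n
    m<n : m ℕ.< n
    m<n = subst (m ℕ.<_) (sym n≡) (ℕP.m<m*n m q {{ℕ.>-nonZero m≥1}} (p≥2 pq))
    nδ : normE δ ≡ ⟦ m ⟧
    nδ = ℤP.*-cancelʳ-≡ (normE δ) ⟦ m ⟧ ⟦ q ⟧ (trans (cong (normE δ *_) (sym nλ)) (trans (sym (norm-⊗ δ λ')) (trans (cong normE (sym γ≡)) (trans hγ (trans (cong ⟦_⟧ n≡) (ℤP.pos-* m q))))))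
    primδ : Primitive δ
    primδ r pr d₁ d₂ = prim r pr (subst (λ w → ⟦ r ⟧ ∣ proj₁ w) (sym γ≡) (∣m∣n⇒∣m-n (∣m⇒∣m*n (proj₁ λ') d₁) (∣m⇒∣m*n (proj₂ λ') d₂)))
       (subst (λ w → ⟦ r ⟧ ∣ proj₂ w) (sym γ≡) (∣m∣n⇒∣m-n (∣m∣n⇒∣m+n (∣m⇒∣m*n (proj₂ λ') d₁) (∣m⇒∣m*n (proj₁ λ') d₂)) (∣m⇒∣m*n (proj₂ λ') d₂)))
    3∣δ : ⟦ 3 ⟧ ∣ proj₂ δ
    3∣δ = or (euclid prime[3] ⟦ q ⟧ (proj₂ δ) (subst (⟦ 3 ⟧ ∣_) (trans (sym (cong proj₂ qδ)) (cong proj₂ (ι-⊗-scale ⟦ q ⟧ δ))) 3∣))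
      where
      3∣ : ⟦ 3 ⟧ ∣ proj₂ (γ ⊗ conjE λ')
      3∣ = ∣m∣n⇒∣m-n (∣m∣n⇒∣m+n (∣n⇒∣m*n a (∣m⇒∣-m 3∣λ)) (∣m⇒∣m*n (proj₁ λ' - proj₂ λ') d3)) (∣m⇒∣m*n (- proj₂ λ') d3)
      or : (⟦ 3 ⟧ ∣ ⟦ q ⟧) ⊎ (⟦ 3 ⟧ ∣ proj₂ δ) → ⟦ 3 ⟧ ∣ proj₂ δ
      or (inj₁ x) = ⊥-elim (ne3 (sym (p∣q prime[3] pq x)))
      or (inj₂ x) = x

  symbol : Symbol γ n
  symbol = fromJ (JacobiSum.symbol-of-norm-q q (proj₁ q≡1) pq ne3 (proj₁ (proj₂ q≡1)) (proj₂ (proj₂ q≡1)) (proj₁ root) (proj₂ root))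
    where
    -- With J = A + Bω, the difference b²N(J) - B²N(γ) splits into two factors. The one divisible by
    -- q tells whether J or its conjugate divides γ.
    l = solveℤ 4 (λ A B a b → b :* b :* (A :* A :- A :* B :+ B :* B) :- B :* B :* (a :* a :- a :* b :+ b :* b) := (A :* b :- a :* B) :* (A :* b :+ a :* B :- b :* B)) refl
    l1 = solveℤ 4 (λ A B a b → A :* b :- a :* B := a :* (:- B) :+ b :* (A :- B) :- b :* (:- B)) refl
    l2 = solveℤ 4 (λ A B a b → A :* b :+ a :* B :- b :* B := a :* (:- :- B) :+ b :* (A :- B :- (:- B)) :- b :* (:- :- B)) refl
    fromJ : (∃ λ J → Symbol J q × (normE J ≡ ⟦ q ⟧) × (⟦ 3 ⟧ ∣ proj₂ J)) → Symbol γ n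
    fromJ ((A , B) , symJ , normJ , 3∣J) = go (euclid pq (A * b - a * B) (A * b + a * B - b * B) (subst (⟦ q ⟧ ∣_) (l A B a b) (∣m∣n⇒∣m-n (∣n⇒∣m*n (b * b) (subst (⟦ q ⟧ ∣_) (sym normJ) ∣-refl)) (∣n⇒∣m*n (B * B) q∣γ))))
      where
      go : (⟦ q ⟧ ∣ (A * b - a * B)) ⊎ (⟦ q ⟧ ∣ (A * b + a * B - b * B)) → Symbol γ n
      go (inj₁ d) = finish (A , B) symJ normJ 3∣J (subst (⟦ q ⟧ ∣_) (l1 A B a b) d)
      go (inj₂ d) = finish (conjE (A , B)) (Symbol-conj symJ) (trans (norm-conj (A , B)) normJ) (∣m⇒∣-m 3∣J) (subst (⟦ q ⟧ ∣_) (l2 A B a b) d)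

 -- Writing b = 3k, four times the norm is (2a - b)² + 27k² = 4, hence k = 0. The units other than
 -- ±1 are thereby excluded.
 unit-norm : ∀ a b → normE (a , b) ≡ 1ℤ → ⟦ 3 ⟧ ∣ b → (b ≡ 0ℤ) × (a * a ≡ 1ℤ)
 unit-norm a b h d = b0 , trans (l₀ a) (trans (cong (λ w → a * a - a * w + w * w) (sym b0)) h)
  where
  l₀ = solveℤ 1 (λ a → a :* a := a :* a :- a :* # 0 :+ # 0 :* # 0) refl
  b0 : b ≡ 0ℤ
  b0 = go d
    where
    sq : ∀ x → ∃ λ n → x * x ≡ ⟦ n ⟧
    sq x = ℤ.∣ x ∣ ℕ.* ℤ.∣ x ∣ , trans (sym (abs² x)) (sym (ℤP.pos-* ℤ.∣ x ∣ ℤ.∣ x ∣))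
      where
      abs² : ∀ x → ⟦ ℤ.∣ x ∣ ⟧ * ⟦ ℤ.∣ x ∣ ⟧ ≡ x * x
      abs² (ℤ.+ n) = refl
      abs² (ℤ.-[1+ n ]) = refl
    go : ⟦ 3 ⟧ ∣ b → b ≡ 0ℤ
    go (divides k e) with sq (a + a - b) | sq k
    ... | u , eu | w , ew = trans e (cong (_* ⟦ 3 ⟧) (k0 w ew (small w (ℤP.+-injective key))))
      where
      lk : ∀ a b k → (a + a - k * ⟦ 3 ⟧) * (a + a - k * ⟦ 3 ⟧) + ℤ.+ 27 * (k * k) ≡ ℤ.+ 4 * (a * a - a * (k * ⟦ 3 ⟧) + k * ⟦ 3 ⟧ * (k * ⟦ 3 ⟧))
      lk a b k = solveℤ 2 (λ a k → (a :+ a :- k :* # 3) :* (a :+ a :- k :* # 3) :+ # 27 :* (k :* k) := # 4 :* (a :* a :- a :* (k :* # 3) :+ k :* # 3 :* (k :* # 3))) refl a k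
      key : ⟦ u ℕ.+ 27 ℕ.* w ⟧ ≡ ⟦ 4 ⟧
      key = trans (ℤP.pos-+ u (27 ℕ.* w)) (trans (cong₂ _+_ (trans (sym eu) (cong (λ v → (a + a - v) * (a + a - v)) e)) (trans (ℤP.pos-* 27 w) (cong (ℤ.+ 27 *_) (sym ew)))) (trans (lk a b k) (cong (ℤ.+ 4 *_) (trans (cong (λ v → a * a - a * v + v * v) (sym e)) h))))
      small : ∀ w → u ℕ.+ 27 ℕ.* w ≡ 4 → w ≡ 0
      small zero _ = refl
      small (suc w) x = ⊥-elim (ℕP.<⇒≢ (ℕP.<-≤-trans {4} {27} {u ℕ.+ 27 ℕ.* suc w} (s≤s (s≤s (s≤s (s≤s (s≤s z≤n))))) (ℕP.≤-trans (ℕP.m≤m*n 27 (suc w)) (ℕP.m≤n+m (27 ℕ.* suc w) u))) (sym x))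
      k0 : ∀ w → k * k ≡ ⟦ w ⟧ → w ≡ 0 → k ≡ 0ℤ
      k0 w x refl with ℤP.i*j≡0⇒i≡0∨j≡0 k x
      ... | inj₁ y = y
      ... | inj₂ y = y

 symbol : ∀ n → Goal n
 symbol = <-rec Goal λ n rec γ hγ prim d3 n≥1 → go n rec γ hγ prim d3 n≥1 (n ℕP.≟ 1)
  where
  go : ∀ n → (∀ {m} → m ℕ.< n → Goal m) → ∀ γ → normE γ ≡ ⟦ n ⟧ → Primitive γ → ⟦ 3 ⟧ ∣ proj₂ γ → 1 ℕ.≤ n → Dec (n ≡ 1) → Symbol γ n
  go n rec γ hγ prim d3 n≥1 (no ne) with prime-div n (ℕP.≤∧≢⇒< n≥1 (λ e → ne (sym e)))
  ... | q , pq , m , e , _ = Step.symbol n rec γ hγ prim d3 n≥1 q pq (ℕD.divides m (trans e (ℕP.*-comm q m)))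
  go .1 rec γ hγ prim d3 n≥1 (yes refl) with unit-norm (proj₁ γ) (proj₂ γ) hγ d3
  ... | b0 , a² = subst (λ w → Symbol w 1) (cong (proj₁ γ ,_) (sym b0)) (Symbol-unit a²)

-- Rotations of (1,1,1) and Fibonacci numbers

module RotationOrder where
 open import Defs
 open import Data.Bool using (Bool; true; false; _∧_; _∨_; not; T)
 open import Data.Bool.Properties using (∧-zeroʳ)
 open import Data.Bool.ListAction using (all; any)
 open import Data.Nat.DivMod using (_%_; _/_; m≡m%n+[m/n]*n; m%n<n)
 open import Data.Fin using (Fin; zero; suc)
 open import Data.Integer as ℤ using (ℤ; _+_; _*_; _-_; -_)
 open import Data.List using ([]; _∷_)
 open import Data.List.Membership.Propositional using (_∈_)
 open import Data.List.Membership.Propositional.Properties using (∈-upTo⁺)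
 open import Data.List.Relation.Unary.Any using (here; there)
 open import Relation.Binary.Definitions using (Tri; tri<; tri≈; tri>)
 open import Relation.Binary.PropositionalEquality
 open Integers
 open PrimeField

 -- the Fibonacci numbers F(2n)
 a : ℕ → ℤ
 a 0 = 0ℤ
 a 1 = 1ℤ
 a (suc (suc n)) = ℤ.+ 3 * a (suc n) - a n

 -- [[0,1],[-1,3]]^(n+1) ≡ 1 modulo p
 Period : ℕ → ℕ → Set
 Period p n = (⟦ p ⟧ ∣ a (suc n)) × (⟦ p ⟧ ∣ (a n + 1ℤ))

 -- the coordinates of the orbit of (1,1,1)
 b : ℕ → ℤ
 b 0 = 1ℤ
 b (suc n) = a (suc n) - a n

 b-rec : ∀ n → b (suc (suc n)) ≡ ℤ.+ 3 * b (suc n) - b n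
 b-rec 0 = refl
 b-rec (suc n) = solveℤ 2 (λ x y → # 3 :* (# 3 :* x :- y) :- x :- (# 3 :* x :- y) := # 3 :* (# 3 :* x :- y :- x) :- (x :- y)) refl (a (suc n)) (a n)

 module Orbit (k m : ℕ) (per : Period (suc k) m) where
  open Fp k

  b-M : b (suc m) ≡ 1ℤ [mod p ]
  b-M = cg (subst (⟦ p ⟧ ∣_) (solveℤ 2 (λ x y → x :- (y :+ # 1) := x :- y :- # 1) refl (a (suc m)) (a m)) (∣m∣n⇒∣m-n (proj₁ per) (proj₂ per)))

  b-M+1 : b (suc (suc m)) ≡ 1ℤ [mod p ]
  b-M+1 = cg (subst (⟦ p ⟧ ∣_) (solveℤ 2 (λ x y → # 2 :* x :- (y :+ # 1) := # 3 :* x :- y :- x :- # 1) refl (a (suc m)) (a m)) (∣m∣n⇒∣m-n (∣n⇒∣m*n (ℤ.+ 2) (proj₁ per)) (proj₂ per)))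

  red-≡ : ∀ x → ⟦ red x ⟧ ≡ ⟦ x ⟧ [mod p ]
  red-≡ x = ≡m-sym (cg (divides ⟦ x / p ⟧ (trans (cong (_- ⟦ x % p ⟧) (trans (cong ⟦_⟧ (m≡m%n+[m/n]*n x p)) (trans (ℤP.pos-+ (x % p) (x / p ℕ.* p)) (cong (⟦ x % p ⟧ +_) (ℤP.pos-* (x / p) p))))) (solveℤ 2 (λ r y → r :+ y :- r := y) refl ⟦ x % p ⟧ (⟦ x / p ⟧ * ⟦ p ⟧)))))

  sub-≡ : ∀ x y → ⟦ sub x y ⟧ ≡ ⟦ x ⟧ - ⟦ y ⟧ [mod p ]
  sub-≡ x y = ≡m-trans (red-≡ (x ℕ.+ (p ℕ.∸ y % p))) (≡m-trans (≡m-reflexive (trans (ℤP.pos-+ x (p ℕ.∸ y % p)) (cong (⟦ x ⟧ +_) (trans (sym (ℤP.⊖-≥ (ℕP.<⇒≤ (m%n<n y p)))) (sym (ℤP.m-n≡m⊖n p (y % p))))))) (≡m-+ (≡m-refl {p} {⟦ x ⟧}) (fin (red-≡ y))))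
   where
   fin : ∀ {r} → r ≡ ⟦ y ⟧ [mod p ] → ⟦ p ⟧ - r ≡ - ⟦ y ⟧ [mod p ]
   fin {r} (cg d) = cg (subst (⟦ p ⟧ ∣_) (solveℤ 3 (λ p r y → p :- (r :- y) := p :- r :- :- y) refl ⟦ p ⟧ r ⟦ y ⟧) (∣m∣n⇒∣m-n ∣-refl d))

  eqF-true : ∀ x y → ⟦ x ⟧ ≡ ⟦ y ⟧ [mod p ] → eqF x y ≡ true
  eqF-true x y h = toTrue (ℕP.≡⇒≡ᵇ _ _ (go (ℕP.<-cmp (x % p) (y % p))))
   where
   toTrue : ∀ {v} → T v → v ≡ true
   toTrue {true} _ = refl
   h' : ⟦ x % p ⟧ ≡ ⟦ y % p ⟧ [mod p ]
   h' = ≡m-trans (red-≡ x) (≡m-trans h (≡m-sym (red-≡ y)))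
   bad : ∀ u w → w ℕ.< p → u ℕ.< w → ¬ ⟦ w ⟧ ≡ ⟦ u ⟧ [mod p ]
   bad u w w<p u<w (cg d) = ∤-small {p} {w ℕ.∸ u} (ℕP.m<n⇒0<n∸m u<w) (ℕP.≤-<-trans (ℕP.m∸n≤m w u) w<p) (subst (⟦ p ⟧ ∣_) (trans (ℤP.m-n≡m⊖n w u) (ℤP.⊖-≥ (ℕP.<⇒≤ u<w))) d)
   go : Tri (x % p ℕ.< y % p) (x % p ≡ y % p) (y % p ℕ.< x % p) → x % p ≡ y % p
   go (tri< u _ _) = ⊥-elim (bad (x % p) (y % p) (m%n<n y p) u (≡m-sym h'))
   go (tri≈ _ e _) = e
   go (tri> _ _ w) = ⊥-elim (bad (y % p) (x % p) (m%n<n x p) w h')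

  Near : Triple → ℤ × ℤ × ℤ → Set
  Near (x , y , z) (x' , y' , z') = (⟦ x ⟧ ≡ x' [mod p ]) × ((⟦ y ⟧ ≡ y' [mod p ]) × (⟦ z ⟧ ≡ z' [mod p ]))

  near-eqT : ∀ t → Near t (1ℤ , 1ℤ , 1ℤ) → eqT t (1 , 1 , 1) ≡ true
  near-eqT (x , y , z) (hx , hy , hz) = cong₂ _∧_ (eqF-true x 1 hx) (cong₂ _∧_ (eqF-true y 1 hy) (eqF-true z 1 hz))

  orbit : Fin 3 → ℕ → ℤ × ℤ × ℤ
  orbit zero n = 1ℤ , b n , b (suc n)
  orbit (suc zero) n = b n , 1ℤ , b (suc n)
  orbit (suc (suc zero)) n = b n , b (suc n) , 1ℤ

  step-≡ : ∀ n x y z → ⟦ x ⟧ ≡ 1ℤ [mod p ] → ⟦ y ⟧ ≡ b (suc n) [mod p ] → ⟦ z ⟧ ≡ b n [mod p ] → ⟦ sub (3 ℕ.* x ℕ.* y) z ⟧ ≡ b (suc (suc n)) [mod p ]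
  step-≡ n x y z hx hy (cg hz) = ≡m-trans (sub-≡ (3 ℕ.* x ℕ.* y) z) (≡m-trans (≡m-reflexive (cong (_- ⟦ z ⟧) (trans (ℤP.pos-* (3 ℕ.* x) y) (cong (_* ⟦ y ⟧) (ℤP.pos-* 3 x)))))
    (≡m-trans (≡m-+ (≡m-* (≡m-* (≡m-refl {p} {ℤ.+ 3}) hx) hy) neg) (≡m-reflexive (sym (b-rec n)))))
   where
   l = solveℤ 2 (λ z w → :- (z :- w) := :- z :- :- w) refl
   neg : - ⟦ z ⟧ ≡ - b n [mod p ]
   neg = cg (subst (⟦ p ⟧ ∣_) (l ⟦ z ⟧ (b n)) (∣m⇒∣-m hz))

  swap-step : ∀ n x y z → ⟦ x ⟧ ≡ 1ℤ [mod p ] → ⟦ y ⟧ ≡ b (suc n) [mod p ] → ⟦ z ⟧ ≡ b n [mod p ] → ⟦ sub (3 ℕ.* y ℕ.* x) z ⟧ ≡ b (suc (suc n)) [mod p ]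
  swap-step n x y z hx hy hz = subst (λ w → ⟦ sub w z ⟧ ≡ b (suc (suc n)) [mod p ]) (trans (ℕP.*-assoc 3 x y) (trans (cong (3 ℕ.*_) (ℕP.*-comm x y)) (sym (ℕP.*-assoc 3 y x)))) (step-≡ n x y z hx hy hz)

  red-near : ∀ {x w} → ⟦ x ⟧ ≡ w [mod p ] → ⟦ red x ⟧ ≡ w [mod p ]
  red-near {x} h = ≡m-trans (red-≡ x) h

  follow : ∀ i n → Near (iter n (rot i) (1 , 1 , 1)) (orbit i n)
  follow zero zero = ≡m-refl , ≡m-refl , ≡m-refl
  follow (suc zero) zero = ≡m-refl , ≡m-refl , ≡m-refl
  follow (suc (suc zero)) zero = ≡m-refl , ≡m-refl , ≡m-refl
  follow zero (suc n) = go (iter n (rot zero) (1 , 1 , 1)) (follow zero n)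
   where
   go : ∀ t → Near t (orbit zero n) → Near (rot zero t) (orbit zero (suc n))
   go (x , y , z) (hx , hy , hz) = red-near hx , red-near hz , step-≡ n x z y hx hz hy
  follow (suc zero) (suc n) = go (iter n (rot (suc zero)) (1 , 1 , 1)) (follow (suc zero) n)
   where
   go : ∀ t → Near t (orbit (suc zero) n) → Near (rot (suc zero) t) (orbit (suc zero) (suc n))
   go (x , y , z) (hx , hy , hz) = red-near hz , red-near hy , step-≡ n y z x hy hz hx
  follow (suc (suc zero)) (suc n) = go (iter n (rot (suc (suc zero))) (1 , 1 , 1)) (follow (suc (suc zero)) n)
   where
   go : ∀ t → Near t (orbit (suc (suc zero)) n) → Near (rot (suc (suc zero)) t) (orbit (suc (suc zero)) (suc n))
   go (x , y , z) (hx , hy , hz) = red-near hy , swap-step n z y x hz hy hx , red-near hz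

  returns : ∀ i → eqT (iter (suc m) (rot i) (1 , 1 , 1)) (1 , 1 , 1) ≡ true
  returns i = near-eqT (iter (suc m) (rot i) (1 , 1 , 1)) (go i (follow i (suc m)))
   where
   go : ∀ i {t} → Near t (orbit i (suc m)) → Near t (1ℤ , 1ℤ , 1ℤ)
   go zero (x , y , z) = x , ≡m-trans y b-M , ≡m-trans z b-M+1
   go (suc zero) (x , y , z) = ≡m-trans x b-M , y , ≡m-trans z b-M+1
   go (suc (suc zero)) (x , y , z) = ≡m-trans x b-M , ≡m-trans y b-M+1 , z

  all-false : ∀ (f : ℕ → Bool) {x xs} → x ∈ xs → f x ≡ false → all f xs ≡ false
  all-false f {xs = y ∷ ys} (here refl) h = cong (_∧ all f ys) h
  all-false f {xs = y ∷ ys} (there i) h = trans (cong (f y ∧_) (all-false f i h)) (∧-zeroʳ (f y))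

  ordIs-false : ∀ i n → suc m ℕ.< n → ordIs i (1 , 1 , 1) n ≡ false
  ordIs-false i (suc n) (s≤s h) = trans (cong (eqT (iter (suc n) (rot i) (1 , 1 , 1)) (1 , 1 , 1) ∧_) (all-false (λ j → not (eqT (iter (suc j) (rot i) (1 , 1 , 1)) (1 , 1 , 1))) (∈-upTo⁺ h) (cong not (returns i)))) (∧-zeroʳ _)

  -- Each rotation fixes a coordinate 1 and moves the other two by the same recurrence, so all three
  -- return after m + 1 steps. Since p - 1 is the least of the admissible orders, this earlier
  -- return contradicts minimality in every case.
  not-in-cage : suc m ℕ.< k → oneInCage (suc k) ≡ false
  not-in-cage h = trans (cong (inXstar (1 , 1 , 1) ∧_) max) (∧-zeroʳ _)
   where
   row : ∀ i → any (ordIs i (1 , 1 , 1)) ((p ℕ.∸ 1) ∷ (p ℕ.+ 1) ∷ (2 ℕ.* p) ∷ []) ≡ false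
   row i = cong₂ _∨_ (ordIs-false i k h) (cong₂ _∨_ (ordIs-false i (p ℕ.+ 1) (ℕP.<-≤-trans h (ℕP.≤-trans (ℕP.n≤1+n k) (ℕP.m≤m+n p 1)))) (cong (_∨ false) (ordIs-false i (2 ℕ.* p) (ℕP.<-≤-trans h (ℕP.≤-trans (ℕP.n≤1+n k) (ℕP.m≤m+n p (p ℕ.+ 0)))))))
   max : maximal (1 , 1 , 1) ≡ false
   max = cong₂ _∨_ (row zero) (cong₂ _∨_ (row (suc zero)) (cong (_∨ false) (row (suc (suc zero)))))

-- Primes of the form 5x² + 5xy + 8y²

module CubicCase where
 open import Data.Nat.Induction using (<-rec)
 open import Data.Nat.DivMod using (_%_; _/_; m≡m%n+[m/n]*n; m%n<n)
 open import Data.Integer as ℤ using (ℤ; _+_; _*_; _-_; -_; _^_)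
 open import Relation.Binary.PropositionalEquality hiding (J)
 open Valuations using (p≥2; prime-div)
 open Integers
 open Eisenstein
 open PrimeField
 open RingClassWeights using (z0; z1; z2)
 open CubicGaussSums using (wp; wp³)
 open CubicReciprocityLaw using (^E-1+3)
 open RationalReciprocity
 open RotationOrder using (a; Period)

 p∤ : ∀ {p q} → Prime p → Prime q → p ≢ q → ¬ ⟦ p ⟧ ∣ ⟦ q ⟧
 p∤ pp pq ne d = ne (p∣q pp pq d)

 ι-∤-cancel : ∀ {p} → Prime p → ∀ c {x y} → ¬ ⟦ p ⟧ ∣ c → ι c ⊗ x ≋ ι c ⊗ y [ p ] → x ≋ y [ p ]
 ι-∤-cancel {p} pp c {x} {y} n h = ∣⇒≋ (fin (proj₁ x) (proj₁ y) (subst₂ (λ u w → ⟦ p ⟧ ∣ (u - w)) (cong proj₁ (ι-⊗-scale c x)) (cong proj₁ (ι-⊗-scale c y)) (≋⇒∣₁ h))) (fin (proj₂ x) (proj₂ y) (subst₂ (λ u w → ⟦ p ⟧ ∣ (u - w)) (cong proj₂ (ι-⊗-scale c x)) (cong proj₂ (ι-⊗-scale c y)) (≋⇒∣₂ h)))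
  where
  fin : ∀ a b → ⟦ p ⟧ ∣ (c * a - c * b) → ⟦ p ⟧ ∣ (a - b)
  fin a b d = _≡_[mod_].d (cancel-m pp c n (cg d))

 1E^ : ∀ n → 1E ^E n ≡ 1E
 1E^ zero = refl
 1E^ (suc n) = trans (⊗-identityˡ (1E ^E n)) (1E^ n)

 ≋-1+3 : ∀ {p} ψ n → ψ ⊗ (ψ ⊗ ψ) ≋ 1E [ p ] → ψ ^E suc (n ℕ.* 3) ≋ ψ [ p ]
 ≋-1+3 ψ zero h = ≋-reflexive (⊗-identityʳ ψ)
 ≋-1+3 {p} ψ (suc n) h = go (ψ ^E suc (n ℕ.* 3)) (≋-1+3 ψ n h)
  where
  l = solveE 2 (λ a b → a :* (a :* (a :* b)) := a :* (a :* a) :* b) refl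
  go : ∀ w → w ≋ ψ [ p ] → ψ ⊗ (ψ ⊗ (ψ ⊗ w)) ≋ ψ [ p ]
  go w k = subst (λ u → u ≋ ψ [ p ]) (sym (l ψ w)) (≋-trans (≋-⊗ h k) (≋-reflexive (⊗-identityˡ ψ)))

 ι^p-1 : ∀ {p'} → Prime (suc p') → ∀ c → ¬ ⟦ suc p' ⟧ ∣ c → ∀ m → ι c ^E (p' ℕ.* m) ≋ 1E [ suc p' ]
 ι^p-1 {p'} pp c n m = ≋-trans (≋-reflexive (sym (^E-assocʳ (ι c) p' m))) (≋-trans (≋-^ m (≋-trans (≋-reflexive (sym (ι-^ c p'))) (ι-mod (fermat' pp p' refl c n)))) (≋-reflexive (1E^ m)))

 -- primes congruent to 2 modulo 3 are inert in ℤ[ω]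
 frob-conj : ∀ {m'} (pp : Prime (suc (suc (m' ℕ.* 3)))) w → w ^E suc (suc (m' ℕ.* 3)) ≋ conjE w [ suc (suc (m' ℕ.* 3)) ]
 frob-conj {m'} pp (u , v) = ≋-trans (≋-reflexive (cong (_^E p) (dec u v))) (≋-trans (frobE (ι u) (ι v ⊗ ωE)) (≋-trans (≋-⊕ (fι u) (≋-trans (≋-reflexive (^E-distrib-* (ι v) ωE p)) (≋-⊗ (fι v) (≋-reflexive ω^p)))) (≋-reflexive (dec' u v))))
  where
  p = suc (suc (m' ℕ.* 3))
  open FrobE p pp using (frobE)
  fι : ∀ u → ι u ^E p ≋ ι u [ p ]
  fι u = ≋-trans (≋-reflexive (sym (ι-^ u p))) (ι-mod (fermat pp u))
  ω^p : ωE ^E p ≡ ωE ⊗ ωE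
  ω^p = cong (ωE ⊗_) (^E-1+3 ωE m' refl)
  dec : ∀ u v → (u , v) ≡ ι u ⊕ ι v ⊗ ωE
  dec u v = cong₂ _,_ (l1 u v) (l2 v)
   where
   l1 = solveℤ 2 (λ u v → u := u :+ (v :* # 0 :- # 0 :* # 1)) refl
   l2 = solveℤ 1 (λ v → v := # 0 :+ (v :* # 1 :+ # 0 :* # 0 :- # 0 :* # 1)) refl
  dec' : ∀ u v → ι u ⊕ ι v ⊗ (ωE ⊗ ωE) ≡ (u - v , - v)
  dec' u v = cong₂ _,_ (l1 u v) (l2 v)
   where
   l1 = solveℤ 2 (λ u v → u :+ (v :* Κ -1ℤ :- # 0 :* Κ -1ℤ) := u :- v) refl
   l2 = solveℤ 1 (λ v → # 0 :+ (v :* Κ -1ℤ :+ # 0 :* Κ -1ℤ :- # 0 :* Κ -1ℤ) := :- v) refl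

 -- √-3
 r : E
 r = 1ℤ , ℤ.+ 2

 -- The p-th power is conjugation, which changes the sign of √-3; a factor r is cancelled by
 -- multiplying with it once more, as r² = -3.
 r^p-1 : ∀ {m'} (pp : Prime (suc (suc (m' ℕ.* 3)))) → r ^E suc (m' ℕ.* 3) ≋ ι -1ℤ [ suc (suc (m' ℕ.* 3)) ]
 r^p-1 {m'} pp = ι-∤-cancel pp (ℤ.-[1+ 2 ]) (λ d → ne3 m' (p∣q pp prime[3] (∣m⇒∣-m d))) (≋-trans (≋-reflexive (⊗-assoc r r (r ^E suc (m' ℕ.* 3)))) (≋-⊗ (≋-refl {_} {r}) (frob-conj {m'} pp r)))
  where
  ne3 : ∀ m' → suc (suc (m' ℕ.* 3)) ≢ 3
  ne3 zero ()
  ne3 (suc m') ()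

 -- The powers of θ modulo θ² = 3θ - 1 follow the recurrence that defines `a`.
 root-^ : ∀ {p θ} → θ ⊗ θ ≋ ι (ℤ.+ 3) ⊗ θ ⊕ (⊝ 1E) [ p ] → ∀ n → θ ^E suc n ≋ ι (a (suc n)) ⊗ θ ⊕ (⊝ ι (a n)) [ p ]
 root-^ {p} {θ} h zero = ≋-reflexive (solveE 1 (λ θ → θ :* Κ 1E := Κ 1E :* θ :+ (:- Κ 0E)) refl θ)
 root-^ {p} {θ} h (suc n) = ≋-trans (≋-⊗ (≋-refl {p} {θ}) (root-^ h n)) (≋-trans (≋-reflexive (l1 θ (ι (a (suc n))) (ι (a n)))) (≋-trans (≋-⊕ (≋-⊗ (≋-refl {p} {ι (a (suc n))}) h) (≋-refl {p} {⊝ (ι (a n) ⊗ θ)})) (≋-reflexive (trans (l2 θ (ι (a (suc n))) (ι (a n)) (ι (ℤ.+ 3))) (cong (λ w → w ⊗ θ ⊕ (⊝ ι (a (suc n)))) (sym (trans ι-- (cong (_⊕ (⊝ ι (a n))) (ι-⊗ (ℤ.+ 3) (a (suc n)))))))))))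
  where
  l1 = solveE 3 (λ θ x y → θ :* (x :* θ :+ (:- y)) := x :* (θ :* θ) :+ (:- (y :* θ))) refl
  l2 = solveE 4 (λ θ x y t → x :* (t :* θ :+ (:- Κ 1E)) :+ (:- (y :* θ)) := (t :* x :+ (:- y)) :* θ :+ (:- x)) refl
  ι-- : ι (ℤ.+ 3 * a (suc n) - a n) ≡ ι (ℤ.+ 3 * a (suc n)) ⊕ (⊝ ι (a n))
  ι-- = refl

 wp-inj-1 : ∀ {ρ} → Prime ρ → ∀ x → wp x ≋ 1E [ ρ ] → wp x ≡ 1E
 wp-inj-1 pρ z0 h = refl
 wp-inj-1 pρ z1 h = ⊥-elim (∤-small (s≤s z≤n) (p≥2 pρ) (≋⇒∣₂ h))
 wp-inj-1 pρ z2 h = ⊥-elim (∤-small (s≤s z≤n) (p≥2 pρ) (∣m⇒∣-m (≋⇒∣₂ h)))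

 wp-idem : ∀ x → wp x ≡ wp x ⊗ wp x → wp x ≡ 1E
 wp-idem z0 e = refl
 wp-idem z1 ()
 wp-idem z2 ()

 square-mod-3 : ∀ {ρ} → Prime ρ → ρ ≢ 3 → ∃ λ k → ρ ℕ.* ρ ≡ suc (k ℕ.* 3)
 square-mod-3 {ρ} pρ ne = go (ρ % 3) (m%n<n ρ 3) (m≡m%n+[m/n]*n ρ 3)
  where
  l1 = solveℕ 1 (λ q → (Κ 1 :+ q :* Κ 3) :* (Κ 1 :+ q :* Κ 3) := Κ 1 :+ (q :+ q :+ q :* q :* Κ 3) :* Κ 3) refl
  l2 = solveℕ 1 (λ q → (Κ 2 :+ q :* Κ 3) :* (Κ 2 :+ q :* Κ 3) := Κ 1 :+ (Κ 1 :+ q :* Κ 4 :+ q :* q :* Κ 3) :* Κ 3) refl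
  go : ∀ r → r ℕ.< 3 → ρ ≡ r ℕ.+ (ρ / 3) ℕ.* 3 → ∃ λ k → ρ ℕ.* ρ ≡ suc (k ℕ.* 3)
  go 0 _ e = ⊥-elim (ne (sym (p∣q prime[3] pρ (ℕ∣ (ℕD.divides (ρ / 3) e)))))
  go 1 _ e = (ρ / 3 ℕ.+ ρ / 3 ℕ.+ ρ / 3 ℕ.* (ρ / 3) ℕ.* 3) , trans (cong₂ ℕ._*_ e e) (l1 (ρ / 3))
  go 2 _ e = (1 ℕ.+ ρ / 3 ℕ.* 4 ℕ.+ ρ / 3 ℕ.* (ρ / 3) ℕ.* 3) , trans (cong₂ ℕ._*_ e e) (l2 (ρ / 3))
  go (suc (suc (suc _))) (s≤s (s≤s (s≤s ()))) _

 Q : ℤ → ℤ → ℤ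
 Q x y = ℤ.+ 5 * (x * x) + ℤ.+ 5 * (x * y) + ℤ.+ 8 * (y * y)

 private
  θ₁ : ∀ {n} → Expr ℤ n → Expr ℤ n → Expr ℤ n
  θ₁ h s = h :* (# 9 :- s)
  θ₂ : ∀ {n} → Expr ℤ n → Expr ℤ n → Expr ℤ n
  θ₂ h s = h :* (:- (# 2 :* s))
  root : ∀ {n} → Expr ℤ n → Expr ℤ n → Expr ℤ n → Expr ℤ n
  root x y v = (# 16 :* y :+ # 5 :* x) :* v
  form : ∀ {n} → Expr ℤ n → Expr ℤ n → Expr ℤ n
  form x y = # 5 :* (x :* x) :+ # 5 :* (x :* y) :+ # 8 :* (y :* y)

 -- For p = Q(x,y) put β = 8y + 7x + 9xω, of norm n = 8p + 27x². The cubic character X of β satisfies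
 -- X(p) = X(8p) = X(-27x²) = X(x)² = 1, so β is a cube modulo p.  On the other hand 2β ≡ 3x(s + 3√-3) with s² = -15, and
 -- θ = (s + 3√-3)/(2√-3) is a root of θ² = 3θ - 1.
 module BadPrime (m' : ℕ) (pp : Prime (suc (suc (m' ℕ.* 3)))) (ne2 : suc (suc (m' ℕ.* 3)) ≢ 2) (ne5 : suc (suc (m' ℕ.* 3)) ≢ 5)
        (x y : ℤ) (hp : ⟦ suc (suc (m' ℕ.* 3)) ⟧ ≡ Q x y) (3∤x : ¬ ⟦ 3 ⟧ ∣ x) where
  p p' m : ℕ
  p' = suc (m' ℕ.* 3)
  p = suc p'
  m = suc m'

  ne3 : ∀ m' → suc (suc (m' ℕ.* 3)) ≢ 3
  ne3 zero ()
  ne3 (suc m') ()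

  p∤2 : ¬ ⟦ p ⟧ ∣ ⟦ 2 ⟧
  p∤2 = p∤ pp prime[2] ne2
  p∤3 : ¬ ⟦ p ⟧ ∣ ⟦ 3 ⟧
  p∤3 = p∤ pp prime[3] (ne3 m')
  p∤5 : ¬ ⟦ p ⟧ ∣ ⟦ 5 ⟧
  p∤5 = p∤ pp prime[5] ne5

  ∤-* : ∀ {q} → Prime q → ∀ u v → ¬ ⟦ q ⟧ ∣ u → ¬ ⟦ q ⟧ ∣ v → ¬ ⟦ q ⟧ ∣ u * v
  ∤-* pq u v nu nv d with euclid pq u v d
  ... | inj₁ e = nu e
  ... | inj₂ e = nv e

  div-Q : ∀ {q} → ⟦ q ⟧ ∣ x → ⟦ q ⟧ ∣ ℤ.+ 8 * (y * y) → ⟦ q ⟧ ∣ ⟦ p ⟧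
  div-Q d e = subst (_ ∣_) (sym hp) (∣m∣n⇒∣m+n (∣m∣n⇒∣m+n (∣n⇒∣m*n (ℤ.+ 5) (∣m⇒∣m*n x d)) (∣n⇒∣m*n (ℤ.+ 5) (∣m⇒∣m*n y d))) e)

  2∤x : ¬ ⟦ 2 ⟧ ∣ x
  2∤x d = ne2 (sym (p∣q prime[2] pp (div-Q d (∣m⇒∣m*n (y * y) (divides (ℤ.+ 4) refl)))))

  p∤x : ¬ ⟦ p ⟧ ∣ x
  p∤x d = go (euclid pp (ℤ.+ 8) (y * y) p∣8y²)
   where
   p∣8y² : ⟦ p ⟧ ∣ ℤ.+ 8 * (y * y)
   p∣8y² = subst (⟦ p ⟧ ∣_) (trans (cong (_- (ℤ.+ 5 * (x * x) + ℤ.+ 5 * (x * y))) hp) (solveℤ 2 (λ a b → a :+ b :- a := b) refl (ℤ.+ 5 * (x * x) + ℤ.+ 5 * (x * y)) (ℤ.+ 8 * (y * y)))) (∣m∣n⇒∣m-n ∣-refl (∣m∣n⇒∣m+n (∣n⇒∣m*n (ℤ.+ 5) (∣m⇒∣m*n x d)) (∣n⇒∣m*n (ℤ.+ 5) (∣m⇒∣m*n y d))))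
   sq : ∀ u v w → ⟦ p ⟧ ≡ Q x y → x ≡ u * w → y ≡ v * w → ⟦ p ⟧ ≡ Q u v * w * w
   sq u v w e refl refl = trans e (solveℤ 3 (λ u v w → form (u :* w) (v :* w) := form u v :* w :* w) refl u v w)
   go : (⟦ p ⟧ ∣ ℤ.+ 8) ⊎ (⟦ p ⟧ ∣ y * y) → ⊥
   go (inj₁ e) = ∤-* pp ⟦ 2 ⟧ (⟦ 2 ⟧ * ⟦ 2 ⟧) p∤2 (∤-* pp ⟦ 2 ⟧ ⟦ 2 ⟧ p∤2 p∤2) e
   go (inj₂ e) = both d (euclid-sq pp y e)
     where
     both : ⟦ p ⟧ ∣ x → ⟦ p ⟧ ∣ y → ⊥
     both (divides u eu) (divides v ev) = unit∤ pp (Q u v) (sq u v ⟦ p ⟧ hp eu ev)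

  n : ℕ
  n = 8 ℕ.* p ℕ.+ 27 ℕ.* (ℤ.∣ x ∣ ℕ.* ℤ.∣ x ∣)

  abs² : ∀ x → ⟦ ℤ.∣ x ∣ ℕ.* ℤ.∣ x ∣ ⟧ ≡ x * x
  abs² (ℤ.+ n) = ℤP.pos-* n n
  abs² (ℤ.-[1+ n ]) = refl

  n≡ : ⟦ n ⟧ ≡ ℤ.+ 8 * ⟦ p ⟧ + ℤ.+ 27 * (x * x)
  n≡ = trans (ℤP.pos-+ (8 ℕ.* p) (27 ℕ.* (ℤ.∣ x ∣ ℕ.* ℤ.∣ x ∣))) (cong₂ _+_ (ℤP.pos-* 8 p) (trans (ℤP.pos-* 27 (ℤ.∣ x ∣ ℕ.* ℤ.∣ x ∣)) (cong (ℤ.+ 27 *_) (abs² x))))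

  β : E
  β = ℤ.+ 8 * y + ℤ.+ 7 * x , ℤ.+ 9 * x

  normβ : normE β ≡ ⟦ n ⟧
  normβ = trans (solveℤ 2 (λ x y → (# 8 :* y :+ # 7 :* x) :* (# 8 :* y :+ # 7 :* x) :- (# 8 :* y :+ # 7 :* x) :* (# 9 :* x) :+ # 9 :* x :* (# 9 :* x) := # 8 :* form x y :+ # 27 :* (x :* x)) refl x y) (trans (cong (λ w → ℤ.+ 8 * w + ℤ.+ 27 * (x * x)) (sym hp)) (sym n≡))

  n-odd : ¬ ⟦ 2 ⟧ ∣ ⟦ n ⟧
  n-odd d = ∤-* prime[2] (ℤ.+ 27) (x * x) (p∤27) (∤-* prime[2] x x 2∤x 2∤x) (subst (⟦ 2 ⟧ ∣_) (trans (cong (_- ℤ.+ 8 * ⟦ p ⟧) n≡) (l (ℤ.+ 8 * ⟦ p ⟧) (ℤ.+ 27 * (x * x)))) (∣m∣n⇒∣m-n d (∣m⇒∣m*n ⟦ p ⟧ (divides (ℤ.+ 4) refl))))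
   where
   p∤27 : ¬ ⟦ 2 ⟧ ∣ ℤ.+ 27
   p∤27 d = ∤-small {2} {1} (s≤s z≤n) (s≤s (s≤s z≤n)) (subst (⟦ 2 ⟧ ∣_) {ℤ.+ 27 - ℤ.+ 26} refl (∣m∣n⇒∣m-n d (divides (ℤ.+ 13) refl)))
   l = solveℤ 2 (λ a b → a :+ b :- a := b) refl

  8p∤ : ∀ {q} → Prime q → q ≢ 2 → q ≢ p → ¬ ⟦ q ⟧ ∣ ℤ.+ 8 * ⟦ p ⟧
  8p∤ {q} pq n2 np = ∤-* pq (ℤ.+ 8) ⟦ p ⟧ (∤-* pq ⟦ 2 ⟧ (⟦ 2 ⟧ * ⟦ 2 ⟧) q2 (∤-* pq ⟦ 2 ⟧ ⟦ 2 ⟧ q2 q2)) (p∤ pq pp np)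
   where
   q2 : ¬ ⟦ q ⟧ ∣ ⟦ 2 ⟧
   q2 = p∤ pq prime[2] n2

  n-8p : ∀ {q} → ⟦ q ⟧ ∣ ⟦ n ⟧ → ⟦ q ⟧ ∣ ℤ.+ 27 * (x * x) → ⟦ q ⟧ ∣ ℤ.+ 8 * ⟦ p ⟧
  n-8p {q} d e = subst (⟦ q ⟧ ∣_) (trans (cong (_- ℤ.+ 27 * (x * x)) n≡) (solveℤ 2 (λ a b → a :+ b :- b := a) refl (ℤ.+ 8 * ⟦ p ⟧) (ℤ.+ 27 * (x * x)))) (∣m∣n⇒∣m-n d e)

  3∤n : ¬ ⟦ 3 ⟧ ∣ ⟦ n ⟧
  3∤n d = 8p∤ prime[3] (λ ()) (λ e → ne3 m' (sym e)) (n-8p d (∣m⇒∣m*n (x * x) (divides (ℤ.+ 9) refl)))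

  x-n : ∀ {q} → Prime q → ⟦ q ⟧ ∣ x → ¬ ⟦ q ⟧ ∣ ⟦ n ⟧
  x-n {q} pq dx dn = 8p∤ pq (λ { refl → 2∤x dx }) (λ { refl → p∤x dx }) (n-8p dn (∣n⇒∣m*n (ℤ.+ 27) (∣m⇒∣m*n x dx)))

  p∤n : ¬ ⟦ p ⟧ ∣ ⟦ n ⟧
  p∤n d = ∤-* pp (ℤ.+ 27) (x * x) (∤-* pp ⟦ 3 ⟧ (⟦ 3 ⟧ * ⟦ 3 ⟧) p∤3 (∤-* pp ⟦ 3 ⟧ ⟦ 3 ⟧ p∤3 p∤3)) (∤-* pp x x p∤x p∤x)
    (subst (⟦ p ⟧ ∣_) (trans (cong (_- ℤ.+ 8 * ⟦ p ⟧) n≡) (l (ℤ.+ 8 * ⟦ p ⟧) (ℤ.+ 27 * (x * x)))) (∣m∣n⇒∣m-n d (∣n⇒∣m*n (ℤ.+ 8) ∣-refl)))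
   where
   l = solveℤ 2 (λ a b → a :+ b :- a := b) refl

  8y-unit : ∀ {q} → Prime q → ⟦ q ⟧ ∣ x → ¬ ⟦ q ⟧ ∣ ℤ.+ 8 * y
  8y-unit {q} pq d e = go (p∣q pq pp (div-Q d (subst (⟦ q ⟧ ∣_) (ℤP.*-assoc (ℤ.+ 8) y y) (∣m⇒∣m*n y e))))
   where
   go : q ≡ p → ⊥
   go refl = p∤x d

  prim : Primitive β
  prim q pq d₁ d₂ = go (euclid pq (ℤ.+ 9) x d₂)
   where
   x-case : ⟦ q ⟧ ∣ x → ⊥
   x-case d = 8y-unit pq d (subst (⟦ q ⟧ ∣_) (solveℤ 2 (λ a b → a :+ b :- b := a) refl (ℤ.+ 8 * y) (ℤ.+ 7 * x)) (∣m∣n⇒∣m-n d₁ (∣n⇒∣m*n (ℤ.+ 7) d)))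
   go : (⟦ q ⟧ ∣ ℤ.+ 9) ⊎ (⟦ q ⟧ ∣ x) → ⊥
   go (inj₂ d) = x-case d
   go (inj₁ d) = three (p∣q pq prime[3] (euclid-sq pq ⟦ 3 ⟧ d))
     where
     three : q ≡ 3 → ⊥
     three refl = 3∤n (subst (⟦ 3 ⟧ ∣_) normβ (∣m∣n⇒∣m+n (∣m∣n⇒∣m-n (∣m⇒∣m*n (proj₁ β) d₁) (∣m⇒∣m*n (proj₂ β) d₁)) (∣m⇒∣m*n (proj₂ β) d₂)))

  opaque
   sym-β : Symbol β n
   sym-β = symbol n β normβ prim (∣m⇒∣m*n x (divides (ℤ.+ 3) refl)) (ℕP.≤-trans (s≤s z≤n) (ℕP.m≤m+n (8 ℕ.* p) (27 ℕ.* (ℤ.∣ x ∣ ℕ.* ℤ.∣ x ∣))))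

  module S = Symbol sym-β
  open S using (X; X-*)

  cube : ∀ {v} → (∃ λ z → v ≡ wp z) → v ⊗ (v ⊗ v) ≡ 1E
  cube (z , refl) = wp³ z

  X-1 : X 1ℤ ≡ 1E
  X-1 = go (S.X-wp 1ℤ (λ q pq _ → ∤-small (s≤s z≤n) (p≥2 pq)))
   where
   go : (∃ λ z → X 1ℤ ≡ wp z) → X 1ℤ ≡ 1E
   go (z , e) = trans e (wp-idem z (trans (sym e) (trans (X-* 1ℤ 1ℤ) (cong₂ _⊗_ e e))))

  -- Modulo a prime ρ dividing x, n becomes (8y)² and β becomes 8y, so nβ is a rational cube and the
  -- law gives X(ρ) = 1. The law concerns ρ ≠ 3, which is what 3 ∤ x ensures.
  X-prime : ∀ ρ → Prime ρ → ⟦ ρ ⟧ ∣ x → X ⟦ ρ ⟧ ≡ 1E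
  X-prime ρ pρ d = go (S.X-wp ⟦ ρ ⟧ (λ q pq dn dρ → x-n pρ d (subst (λ w → ⟦ w ⟧ ∣ ⟦ n ⟧) (p∣q pq pρ dρ) dn))) (square-mod-3 pρ (λ { refl → 3∤x d }))
   where
   ≡8y : ι ⟦ n ⟧ ⊗ β ≋ ι (ℤ.+ 8 * y * (ℤ.+ 8 * y * (ℤ.+ 8 * y))) [ ρ ]
   ≡8y = ≋-trans (≋-⊗ {ρ} {ι ⟦ n ⟧} {ι (ℤ.+ 8 * y * (ℤ.+ 8 * y))} {β} {ι (ℤ.+ 8 * y)} (ι-≋ (subst (⟦ ρ ⟧ ∣_) l1' (∣m⇒∣m*n (ℤ.+ 40 * y + ℤ.+ 67 * x) d)))
      (∣⇒≋ (subst (⟦ ρ ⟧ ∣_) (l2 x y) (∣n⇒∣m*n (ℤ.+ 7) d)) (subst (⟦ ρ ⟧ ∣_) (l3 x) (∣n⇒∣m*n (ℤ.+ 9) d))))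
      (≋-reflexive (trans (sym (ι-⊗ (ℤ.+ 8 * y * (ℤ.+ 8 * y)) (ℤ.+ 8 * y))) (cong ι (ℤP.*-assoc (ℤ.+ 8 * y) (ℤ.+ 8 * y) (ℤ.+ 8 * y)))))
     where
     l1 = solveℤ 2 (λ x y → x :* (# 40 :* y :+ # 67 :* x) := # 8 :* form x y :+ # 27 :* (x :* x) :- # 8 :* y :* (# 8 :* y)) refl
     l1' : x * (ℤ.+ 40 * y + ℤ.+ 67 * x) ≡ ⟦ n ⟧ - ℤ.+ 8 * y * (ℤ.+ 8 * y)
     l1' = trans (l1 x y) (cong (_- ℤ.+ 8 * y * (ℤ.+ 8 * y)) (trans (cong (λ w → ℤ.+ 8 * w + ℤ.+ 27 * (x * x)) (sym hp)) (sym n≡)))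
     l2 = solveℤ 2 (λ x y → # 7 :* x := # 8 :* y :+ # 7 :* x :- # 8 :* y) refl
     l3 = solveℤ 1 (λ x → # 9 :* x := # 9 :* x :- # 0) refl
   go : (∃ λ z → X ⟦ ρ ⟧ ≡ wp z) → (∃ λ k → ρ ℕ.* ρ ≡ suc (k ℕ.* 3)) → X ⟦ ρ ⟧ ≡ 1E
   go (z , e) (k , ek) = trans e (wp-inj-1 pρ z (≋-trans (≋-reflexive (sym e)) (≋-trans (≋-sym (S.law ρ pρ (x-n pρ d) k ek)) (≋-trans (≋-^ k ≡8y)
      (≋-trans (≋-reflexive (sym (ι-^ (ℤ.+ 8 * y * (ℤ.+ 8 * y * (ℤ.+ 8 * y))) k))) (ι-mod (cube-^ pρ k ek (ℤ.+ 8 * y) (8y-unit pρ d))))))))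

  X-dvd : ∀ u → 1 ℕ.≤ u → ⟦ u ⟧ ∣ x → X ⟦ u ⟧ ≡ 1E
  X-dvd = <-rec (λ u → 1 ℕ.≤ u → ⟦ u ⟧ ∣ x → X ⟦ u ⟧ ≡ 1E) λ u rec h d → go u rec h d (u ℕP.≟ 1)
   where
   go : ∀ u → (∀ {v} → v ℕ.< u → 1 ℕ.≤ v → ⟦ v ⟧ ∣ x → X ⟦ v ⟧ ≡ 1E) → 1 ℕ.≤ u → ⟦ u ⟧ ∣ x → Dec (u ≡ 1) → X ⟦ u ⟧ ≡ 1E
   go .1 rec h d (yes refl) = X-1
   go u rec h d (no ne) with prime-div u (ℕP.≤∧≢⇒< h (λ e → ne (sym e)))
   ... | q , pq , v , e , v≥1 , v<u = trans (cong X (trans (cong ⟦_⟧ e) (ℤP.pos-* q v))) (trans (X-* ⟦ q ⟧ ⟦ v ⟧) (trans (cong₂ _⊗_ (X-prime q pq (∣-trans (ℕ∣ (subst (q ℕD.∣_) (sym e) (ℕD.m∣m*n v))) d)) (rec v<u v≥1 (∣-trans (ℕ∣ (subst (v ℕD.∣_) (sym e) (ℕD.n∣m*n q))) d))) refl))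

  X-x² : X (x * x) ≡ 1E
  X-x² = trans (cong X (trans (sym (abs² x)) (ℤP.pos-* ℤ.∣ x ∣ ℤ.∣ x ∣))) (trans (X-* ⟦ ℤ.∣ x ∣ ⟧ ⟦ ℤ.∣ x ∣ ⟧) (cong (λ w → w ⊗ w) (X-dvd ℤ.∣ x ∣ (pos x 3∤x) (∣ᵤ⇒∣ {⟦ ℤ.∣ x ∣ ⟧} {x} ℕD.∣-refl))))
   where
   pos : ∀ x → ¬ ⟦ 3 ⟧ ∣ x → 1 ℕ.≤ ℤ.∣ x ∣
   pos (ℤ.+ zero) n = ⊥-elim (n (divides 0ℤ refl))
   pos (ℤ.+ suc k) n = s≤s z≤n
   pos (ℤ.-[1+ k ]) n = s≤s z≤n

  X-p : X ⟦ p ⟧ ≡ 1E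
  X-p = trans (sym (trans (X3* ⟦ 2 ⟧ ⟦ p ⟧ (λ q pq dn d → n-odd (subst (λ w → ⟦ w ⟧ ∣ ⟦ n ⟧) (p∣q pq prime[2] d) dn))) refl)) (trans (S.X-per (cg (divides 1ℤ (trans (l ⟦ p ⟧ (x * x)) (trans (sym n≡) (sym (ℤP.*-identityˡ ⟦ n ⟧)))))))
     (trans (X3* (ℤ.-[1+ 2 ]) (x * x) (λ q pq dn d → 3∤n (subst (λ w → ⟦ w ⟧ ∣ ⟦ n ⟧) (p∣q pq prime[3] (∣m⇒∣-m d)) dn))) X-x²))
   where
   l = solveℤ 2 (λ p w → # 8 :* p :- Κ ℤ.-[1+ 26 ] :* w := # 8 :* p :+ # 27 :* w) refl
   X3* : ∀ c w → (∀ q → Prime q → ⟦ q ⟧ ∣ ⟦ n ⟧ → ¬ ⟦ q ⟧ ∣ c) → X (c * (c * c) * w) ≡ X w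
   X3* c w h = trans (X-* (c * (c * c)) w) (trans (cong (_⊗ X w) (trans (X-* c (c * c)) (trans (cong (X c ⊗_) (X-* c c)) (cube (S.X-wp c h))))) (⊗-identityˡ (X w)))

  -- k = (p² - 1)/3

  k : ℕ
  k = p' ℕ.* m

  k-eq : p ℕ.* p ≡ suc (k ℕ.* 3)
  k-eq = cong suc (trans (cong (p' ℕ.+_) (ℕP.*-suc p' p')) (trans (solveℕ 1 (λ p' → p' :+ (p' :+ p' :* p') := p' :* (Κ 2 :+ p')) refl p') (sym (ℕP.*-assoc p' m 3))))

  -- This is the law at ρ = p, where X(p) = 1; the factor n^k is 1 because p - 1 divides k.
  β^k : β ^E k ≋ 1E [ p ]
  β^k = ≋-trans (≋-reflexive (sym (⊗-identityˡ (β ^E k)))) (≋-trans (≋-⊗ (≋-sym (ι^p-1 pp ⟦ n ⟧ p∤n m)) (≋-refl {p} {β ^E k})) (≋-trans (≋-reflexive (sym (^E-distrib-* (ι ⟦ n ⟧) β k))) (≋-trans (S.law p pp p∤n k k-eq) (≋-reflexive X-p))))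

  -- By `r^p-1` the power is (-1)^m. It equals (-1)^(3m) = (-1)^(p+1), and Fermat shows that this is
  -- 1.
  r^k : r ^E k ≋ 1E [ p ]
  r^k = ≋-trans (≋-reflexive (sym (^E-assocʳ r p' m))) (≋-trans (≋-^ m (r^p-1 {m'} pp)) (≋-trans (≋-reflexive (trans (sym (ι-^ -1ℤ m)) (cong ι (trans (ℤP.^-*-assoc -1ℤ 3 m) (cong (-1ℤ ^_) (ℕP.*-comm 3 m))))))
     (ι-mod (≡m-trans (≡m-* (≡m-refl {p} { -1ℤ}) (fermat pp -1ℤ)) ≡m-refl))))

  module WithInverses (h v : ℤ) (e₁ : ⟦ p ⟧ ∣ (ℤ.+ 6 * h - 1ℤ)) (e₂ : ⟦ p ⟧ ∣ (ℤ.+ 3 * x * v - 1ℤ)) where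
   -- Here h and v are the inverses of 6 and 3x modulo p. The square root of -15 comes from the
   -- form: (16y + 5x)² + 135x² = 32 Q(x,y).
   s : ℤ
   s = (ℤ.+ 16 * y + ℤ.+ 5 * x) * v

   s² : ⟦ p ⟧ ∣ (s * s + ℤ.+ 15)
   s² = subst (⟦ p ⟧ ∣_) (solveℤ 3 (λ x y v → form x y :* (# 32 :* (v :* v)) :- (# 3 :* x :* v :- # 1) :* (# 15 :* (# 3 :* x :* v :+ # 1)) := root x y v :* root x y v :+ # 15) refl x y v) (∣m∣n⇒∣m-n (∣m⇒∣m*n (ℤ.+ 32 * (v * v)) (subst (⟦ p ⟧ ∣_) hp ∣-refl)) (∣m⇒∣m*n (ℤ.+ 15 * (ℤ.+ 3 * x * v + 1ℤ)) e₂))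

   θ : E
   θ = h * (ℤ.+ 9 - s) , h * (- (ℤ.+ 2 * s))

   β≋ : β ≋ ι (ℤ.+ 3 * x) ⊗ (r ⊗ θ) [ p ]
   β≋ = ∣⇒≋ (subst (⟦ p ⟧ ∣_) (l1 x y h v) (∣m∣n⇒∣m-n (∣n⇒∣m*n (- (ℤ.+ 8 * y + ℤ.+ 7 * x)) e₁) (∣n⇒∣m*n (ℤ.+ 3 * h * (ℤ.+ 16 * y + ℤ.+ 5 * x)) e₂)))
       (subst (⟦ p ⟧ ∣_) (l2 x y h v) (∣n⇒∣m*n (- (ℤ.+ 9 * x)) e₁))
     where
     l1 = solveℤ 4 (λ x y h v → :- (# 8 :* y :+ # 7 :* x) :* (# 6 :* h :- # 1) :- # 3 :* h :* (# 16 :* y :+ # 5 :* x) :* (# 3 :* x :* v :- # 1) := # 8 :* y :+ # 7 :* x :- (# 3 :* x :* (# 1 :* θ₁ h (root x y v) :- # 2 :* θ₂ h (root x y v)) :- # 0 :* (# 1 :* θ₂ h (root x y v) :+ # 2 :* θ₁ h (root x y v) :- # 2 :* θ₂ h (root x y v)))) refl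
     l2 = solveℤ 4 (λ x y h v → :- (# 9 :* x) :* (# 6 :* h :- # 1) := # 9 :* x :- (# 3 :* x :* (# 1 :* θ₂ h (root x y v) :+ # 2 :* θ₁ h (root x y v) :- # 2 :* θ₂ h (root x y v)) :+ # 0 :* (# 1 :* θ₁ h (root x y v) :- # 2 :* θ₂ h (root x y v)) :- # 0 :* (# 1 :* θ₂ h (root x y v) :+ # 2 :* θ₁ h (root x y v) :- # 2 :* θ₂ h (root x y v)))) refl

   θ² : θ ⊗ θ ≋ ι (ℤ.+ 3) ⊗ θ ⊕ (⊝ 1E) [ p ]
   θ² = ∣⇒≋ (subst (⟦ p ⟧ ∣_) (l1 h s) (∣m∣n⇒∣m-n (∣m⇒∣m*n (ℤ.+ 21 * h - 1ℤ - ℤ.+ 3 * (h * s)) e₁) (∣m⇒∣m*n (ℤ.+ 3 * (h * h)) s²)))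
       (subst (⟦ p ⟧ ∣_) (l2 h s) (∣m⇒∣m*n (- (ℤ.+ 6 * (h * s))) e₁))
     where
     l1 = solveℤ 2 (λ h s → (# 6 :* h :- # 1) :* (# 21 :* h :- # 1 :- # 3 :* (h :* s)) :- (s :* s :+ # 15) :* (# 3 :* (h :* h)) := θ₁ h s :* θ₁ h s :- θ₂ h s :* θ₂ h s :- (# 3 :* θ₁ h s :- # 0 :* θ₂ h s :+ :- # 1)) refl
     l2 = solveℤ 2 (λ h s → (# 6 :* h :- # 1) :* :- (# 6 :* (h :* s)) := θ₁ h s :* θ₂ h s :+ θ₂ h s :* θ₁ h s :- θ₂ h s :* θ₂ h s :- (# 3 :* θ₂ h s :+ # 0 :* θ₁ h s :- # 0 :* θ₂ h s :+ :- # 0)) refl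

   normθ : θ ⊗ conjE θ ≋ 1E [ p ]
   normθ = ≋-trans (≋-reflexive (x⊗conj θ)) (ι-≋ (subst (⟦ p ⟧ ∣_) (solveℤ 2 (λ h s → (# 6 :* h :- # 1) :* (# 6 :* h :+ # 1) :+ (s :* s :+ # 15) :* (# 3 :* (h :* h)) := θ₁ h s :* θ₁ h s :- θ₁ h s :* θ₂ h s :+ θ₂ h s :* θ₂ h s :- # 1) refl h s) (∣m∣n⇒∣m+n (∣m⇒∣m*n (ℤ.+ 6 * h + 1ℤ) e₁) (∣m⇒∣m*n (ℤ.+ 3 * (h * h)) s²))))

   θ^k : θ ^E k ≋ 1E [ p ]
   θ^k = ≋-trans (≋-reflexive (trans (sym (⊗-identityˡ (θ ^E k))) (sym (⊗-identityˡ (1E ⊗ θ ^E k))))) (≋-trans (≋-⊗ (≋-sym (ι^p-1 pp (ℤ.+ 3 * x) (∤-* pp (ℤ.+ 3) x p∤3 p∤x) m)) (≋-⊗ (≋-sym r^k) (≋-refl {p} {θ ^E k})))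
      (≋-trans (≋-reflexive (sym (trans (^E-distrib-* (ι (ℤ.+ 3 * x)) (r ⊗ θ) k) (cong (ι (ℤ.+ 3 * x) ^E k ⊗_) (^E-distrib-* r θ k))))) (≋-trans (≋-sym (≋-^ k β≋)) β^k)))

   θ^p+1 : θ ^E (m ℕ.* 3) ≋ 1E [ p ]
   θ^p+1 = ≋-trans (≋-⊗ (≋-refl {p} {θ}) (frob-conj {m'} pp θ)) normθ

   ψ : E
   ψ = θ ^E m

   ψ³ : ψ ⊗ (ψ ⊗ ψ) ≋ 1E [ p ]
   ψ³ = ≋-trans (≋-reflexive (trans (cong (λ w → ψ ⊗ (ψ ⊗ w)) (sym (⊗-identityʳ ψ))) (^E-assocʳ θ m 3))) θ^p+1

   -- The element ψ = θ^m has ψ³ = θ^(p+1) = 1, while p - 1 = 3m' + 1. Therefore ψ = ψ^(p-1) = θ^k,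
   -- which is 1.
   θ^m : θ ^E m ≋ 1E [ p ]
   θ^m = ≋-trans (≋-sym (≋-1+3 ψ m' ψ³)) (≋-trans (≋-reflexive (trans (^E-assocʳ θ m p') (cong (θ ^E_) (ℕP.*-comm m p')))) θ^k)

   θ₂-unit : ¬ ⟦ p ⟧ ∣ proj₂ θ
   θ₂-unit d = go (euclid pp h (- (ℤ.+ 2 * s)) d)
     where
     l1 = solveℤ 1 (λ h → # 6 :* h :- (# 6 :* h :- # 1) := # 1) refl
     l2 = solveℤ 1 (λ s → s :* s :+ # 15 :- s :* s := # 15) refl
     go' : (⟦ p ⟧ ∣ ℤ.+ 2) ⊎ (⟦ p ⟧ ∣ s) → ⊥
     go' (inj₁ e) = p∤2 e
     go' (inj₂ e) = ∤-* pp (ℤ.+ 3) (ℤ.+ 5) p∤3 p∤5 (subst (⟦ p ⟧ ∣_) (l2 s) (∣m∣n⇒∣m-n s² (∣m⇒∣m*n s e)))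
     go : (⟦ p ⟧ ∣ h) ⊎ (⟦ p ⟧ ∣ - (ℤ.+ 2 * s)) → ⊥
     go (inj₁ e) = ∤-small {p} {1} (s≤s z≤n) (p≥2 pp) (subst (⟦ p ⟧ ∣_) (l1 h) (∣m∣n⇒∣m-n (∣n⇒∣m*n (ℤ.+ 6) e) e₁))
     go (inj₂ e) = go' (euclid pp (ℤ.+ 2) s (subst (⟦ p ⟧ ∣_) (ℤP.neg-involutive (ℤ.+ 2 * s)) (∣m⇒∣-m e)))

   -- Write 1 = θ^m as a(m)θ - a(m'). The ω-coordinate of θ is a unit, so p divides a(m), and the
   -- other coordinate then gives a(m') = -1.
   period : Period p m'
   period = p∣a , subst (⟦ p ⟧ ∣_) (l2 (a m) (a m') (proj₁ θ) (proj₂ θ)) (∣m∣n⇒∣m-n (∣m⇒∣m*n (proj₁ θ) p∣a) (≋⇒∣₁ key))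
     where
     key : ι (a m) ⊗ θ ⊕ (⊝ ι (a m')) ≋ 1E [ p ]
     key = ≋-trans (≋-sym (root-^ θ² m')) θ^m
     l1 : ∀ u w c d → u * d + 0ℤ * c - 0ℤ * d + - 0ℤ - 0ℤ ≡ u * d
     l1 u w c d = solveℤ 3 (λ u c d → u :* d :+ # 0 :* c :- # 0 :* d :+ :- # 0 :- # 0 := u :* d) refl u c d
     l2 = solveℤ 4 (λ u w c d → u :* c :- (u :* c :- # 0 :* d :+ :- w :- # 1) := w :+ # 1) refl
     p∣a : ⟦ p ⟧ ∣ a m
     p∣a = or (euclid pp (a m) (proj₂ θ) (subst (⟦ p ⟧ ∣_) (l1 (a m) (a m') (proj₁ θ) (proj₂ θ)) (≋⇒∣₂ key)))
      where
      or : (⟦ p ⟧ ∣ a m) ⊎ (⟦ p ⟧ ∣ proj₂ θ) → ⟦ p ⟧ ∣ a m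
      or (inj₁ e) = e
      or (inj₂ e) = ⊥-elim (θ₂-unit e)

  period : Period p m'
  period = go (inverse pp (ℤ.+ 6) (∤-* pp (ℤ.+ 2) (ℤ.+ 3) p∤2 p∤3)) (inverse pp (ℤ.+ 3 * x) (∤-* pp (ℤ.+ 3) x p∤3 p∤x))
   where
   l = solveℤ 2 (λ k q → # 1 :+ k :* q :- # 1 := k :* q) refl
   go : (∃ λ h → ∃ λ k → ℤ.+ 6 * h ≡ 1ℤ + k * ⟦ p ⟧) → (∃ λ v → ∃ λ k → ℤ.+ 3 * x * v ≡ 1ℤ + k * ⟦ p ⟧) → Period p m'
   go (h , k , e) (v , k' , e') = WithInverses.period h v (divides k (trans (cong (_- 1ℤ) e) (l k ⟦ p ⟧))) (divides k' (trans (cong (_- 1ℤ) e') (l k' ⟦ p ⟧)))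

-- Quadratic reciprocity for 5 and the primes ±1 modulo 5

module QuadraticCase where
 open import Data.Nat.DivMod using (_%_; m%n<n)
 open import Data.Fin using (Fin; zero; suc; toℕ)
 import Data.Fin.Properties as FP
 open import Data.Integer as ℤ using (ℤ; _+_; _*_; _-_; -_; _^_)
 open import Relation.Nullary using (_→-dec_)
 open import Relation.Nullary.Decidable using (from-yes)
 open import Relation.Binary.PropositionalEquality hiding (J)
 open Valuations using (p≥2)
 open Integers
 open Eisenstein
 open PrimeField
 open GroupRing
 open CubicGaussSums
 open Characters using (f5)
 open RationalReciprocity using (^-mul)
 open CubicCase using (r; r^p-1; p∤)
 open RotationOrder using (a; Period)
 open Masses 5 prime[5]

 χ : ℤ → E
 χ c = ι (f5 (toℕ (red c)))

 red-cong : ∀ {c d} → c ~ d → red c ≡ red d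
 red-cong {c} {d} h = toℕ-~ (≡m-trans (≡m-sym (red-~ c)) (≡m-trans h (red-~ d)))

 χ-per : ∀ {c d} → c ~ d → χ c ≡ χ d
 χ-per h = cong (λ i → ι (f5 (toℕ i))) (red-cong h)

 G : GR
 G = gr χ χ-per

 -- In the group ring the square of the Gauss sum is 5[0] - Σ[a] and not 5. One more factor G, of
 -- total mass 0, removes the difference, and the identity is a finite check.
 G³ : ∀ c → at (G *g (G *g G)) c ≡ ι (ℤ.+ 5) ⊗ χ c
 G³ c = trans (per (G *g (G *g G)) (red-~ c)) (trans (table (red c)) (cong (ι (ℤ.+ 5) ⊗_) (sym (χ-per (red-~ c)))))
  where
  table : ∀ i → at (G *g (G *g G)) ⟦ toℕ i ⟧ ≡ ι (ℤ.+ 5) ⊗ χ ⟦ toℕ i ⟧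
  table zero = refl
  table (suc zero) = refl
  table (suc (suc zero)) = refl
  table (suc (suc (suc zero))) = refl
  table (suc (suc (suc (suc zero)))) = refl

 Inverses : Fin 5 → Fin 5 → Set
 Inverses i j = red (⟦ toℕ i ⟧ * ⟦ toℕ j ⟧) ≡ red 1ℤ → (f5 (toℕ i) ≡ f5 (toℕ j)) × (f5 (toℕ i) * f5 (toℕ i) ≡ 1ℤ)

 inverse-class : ∀ i j → Inverses i j
 inverse-class = from-yes (FP.all? {P = λ i → ∀ j → Inverses i j} λ i → FP.all? {P = Inverses i} λ j → (red (⟦ toℕ i ⟧ * ⟦ toℕ j ⟧) FP.≟ red 1ℤ) →-dec ((f5 (toℕ i) ℤ.≟ f5 (toℕ j)) ×-dec (f5 (toℕ i) * f5 (toℕ i) ℤ.≟ 1ℤ)))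
  where open import Relation.Nullary.Decidable using (_×-dec_)

 -- (5/p) = (p/5)
 5^h : ∀ p → Prime p → p ≢ 5 → ∀ h → p ≡ suc (h ℕ.* 2) → (ℤ.+ 5) ^ h ≡ f5 (p % 5) [mod p ]
 5^h p pp ne h ep = mod-ι (≋-trans (≋-reflexive (sym lhs)) (≋-trans (to-at {G F.^ p} {Fam (λ i → e₀ i ^E p) (λ i → ⟦ p ⟧ * k₀ i)} (Q.≈ₙ-trans {G F.^ p} {Fam e₀ k₀ F.^ p} {Fam (λ i → e₀ i ^E p) (λ i → ⟦ p ⟧ * k₀ i)} (F.^-congˡ p {G} {Fam e₀ k₀} (Q.lift {G} {Fam e₀ k₀} (decompose G))) (Fam-frob e₀ k₀)) 1ℤ) (≋-reflexive (rhs (Fam-at ⟦ p ⟧ (λ i → e₀ i ^E p) (λ d → ne (sym (p∣q prime[5] pp d))))))))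
  where
  open ModP p pp
  e₀ : Fin 5 → E
  e₀ i = χ ⟦ toℕ i ⟧
  k₀ : Fin 5 → ℤ
  k₀ i = ⟦ toℕ i ⟧
  sc : E → GR → GR
  sc e f = gr (λ c → e ⊗ at f c) (λ h → cong (e ⊗_) (per f h))
  *-sc : ∀ e f g → f *g sc e g ≐ sc e (f *g g)
  *-sc e f g c = trans (S-cong (λ b → (solveE 3 (λ e x y → x :* (e :* y) := e :* (x :* y)) refl) e (at f b) (at g (c - b)))) (S-⊗ e (λ b → at f b ⊗ at g (c - b)))
  pw : ∀ n → G F.^ suc (n ℕ.* 2) ≐ sc (ι ((ℤ.+ 5) ^ n)) G
  pw zero k = trans (*g-comm G 1g k) (trans (*g-identityˡ G k) (sym (⊗-identityˡ (at G k))))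
  pw (suc n) k = trans (*g-cong {G} {G} {G *g G'} {sc e (G *g G)} (λ _ → refl) (λ k → trans (*g-cong {G} {G} {G'} {sc e G} (λ _ → refl) (pw n) k) (*-sc e G G k)) k)
    (trans (*-sc e G (G *g G) k) (trans (cong (e ⊗_) (G³ k)) (trans (l e (ι (ℤ.+ 5)) (χ k)) (cong (_⊗ χ k) (sym (ι-⊗ (ℤ.+ 5) ((ℤ.+ 5) ^ n)))))))
   where
   G' : GR
   G' = G F.^ suc (n ℕ.* 2)
   e : E
   e = ι ((ℤ.+ 5) ^ n)
   l = solveE 3 (λ a b d → a :* (b :* d) := (b :* a) :* d) refl
  lhs : at (G F.^ p) 1ℤ ≡ ι ((ℤ.+ 5) ^ h)
  lhs = trans (cong (λ k → at (G F.^ k) 1ℤ) ep) (trans (pw h 1ℤ) (⊗-identityʳ (ι ((ℤ.+ 5) ^ h))))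
  odd : ∀ x n → x * x ≡ 1ℤ → x ^ suc (n ℕ.* 2) ≡ x
  odd x zero e = ℤP.*-identityʳ x
  odd x (suc n) e = trans (solveℤ 2 (λ x y → x :* (x :* y) := x :* x :* y) refl x (x ^ suc (n ℕ.* 2))) (trans (cong₂ _*_ e (odd x n e)) (ℤP.*-identityˡ x))
  toℕ-red : toℕ (red ⟦ p ⟧) ≡ p % 5
  toℕ-red = FP.toℕ-fromℕ< (m%n<n p 5)
  rhs : (∃ λ i₀ → (⟦ toℕ i₀ ⟧ * ⟦ p ⟧ ≡ 1ℤ [mod 5 ]) × at (Fam (λ i → e₀ i ^E p) (λ i → ⟦ p ⟧ * ⟦ toℕ i ⟧)) 1ℤ ≡ e₀ i₀ ^E p) → at (Fam (λ i → e₀ i ^E p) (λ i → ⟦ p ⟧ * k₀ i)) 1ℤ ≡ ι (f5 (p % 5))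
  rhs (i₀ , hi , e) = trans e (trans (cong (_^E p) (cong (λ i → ι (f5 (toℕ i))) ri)) (trans (sym (ι-^ (f5 (toℕ i₀)) p)) (cong ι (trans (trans (cong (f5 (toℕ i₀) ^_) ep) (odd (f5 (toℕ i₀)) h (proj₂ ic))) (trans (proj₁ ic) (cong f5 toℕ-red))))))
   where
   ri : red ⟦ toℕ i₀ ⟧ ≡ i₀
   ri = toℕ-~ (≡m-sym (red-~ ⟦ toℕ i₀ ⟧))
   ic : (f5 (toℕ i₀) ≡ f5 (toℕ (red ⟦ p ⟧))) × (f5 (toℕ i₀) * f5 (toℕ i₀) ≡ 1ℤ)
   ic = inverse-class i₀ (red ⟦ p ⟧) (red-cong (≡m-trans (≡m-* (≡m-refl {5} {⟦ toℕ i₀ ⟧}) (≡m-sym (red-~ ⟦ p ⟧))) hi))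

 int-root-^ : ∀ {p} θ → θ * θ ≡ ℤ.+ 3 * θ - 1ℤ [mod p ] → ∀ n → θ ^ suc n ≡ a (suc n) * θ - a n [mod p ]
 int-root-^ θ h zero = ≡m-reflexive (solveℤ 1 (λ θ → θ :* # 1 := # 1 :* θ :- # 0) refl θ)
 int-root-^ {p} θ h (suc n) = ≡m-trans (≡m-* (≡m-refl {p} {θ}) (int-root-^ θ h n)) (≡m-trans (≡m-reflexive (l1 θ (a (suc n)) (a n))) (≡m-trans (≡m-+ (≡m-* (≡m-refl {p} {a (suc n)}) h) (≡m-refl {p} { - (a n * θ)})) (≡m-reflexive (l2 θ (a (suc n)) (a n)))))
  where
  l1 = solveℤ 3 (λ θ x y → θ :* (x :* θ :- y) := x :* (θ :* θ) :+ :- (y :* θ)) refl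
  l2 = solveℤ 3 (λ θ x y → x :* (# 3 :* θ :- # 1) :+ :- (y :* θ) := (# 3 :* x :- y) :* θ :- x) refl

 -- If 5 is a square modulo p = 2h + 1, the roots of θ² = 3θ - 1 are squares of elements of 𝔽_p, so that θ^h = 1.
 golden-period : ∀ p → Prime p → p ≢ 2 → p ≢ 5 → ∀ h' → p ≡ suc (suc h' ℕ.* 2) → (ℤ.+ 5) ^ suc h' ≡ 1ℤ [mod p ] → Period p h'
 golden-period p pp ne2 ne5 h' ep five = go (euler pp h' (trans ep (cong suc (dbl (suc h')))) (ℤ.+ 5) five) (inverse pp (ℤ.+ 2) p∤2)
  where
  h : ℕ
  h = suc h'
  dbl : ∀ n → n ℕ.* 2 ≡ n ℕ.+ n
  dbl n = trans (ℕP.*-comm n 2) (cong (n ℕ.+_) (ℕP.+-identityʳ n))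
  p∤2 : ¬ ⟦ p ⟧ ∣ ℤ.+ 2
  p∤2 = p∤ pp prime[2] ne2
  p∤1 : ¬ ⟦ p ⟧ ∣ 1ℤ
  p∤1 = ∤-small (s≤s z≤n) (p≥2 pp)
  module _ (u : ℤ) (e : ⟦ p ⟧ ∣ (ℤ.+ 2 * u - 1ℤ)) where
   module _ (t : ℤ) (ht : ⟦ p ⟧ ∣ (t * t - ℤ.+ 5)) where
    φ θ : ℤ
    φ = (1ℤ + t) * u
    θ = (ℤ.+ 3 + t) * u
    φ² : φ * φ ≡ θ [mod p ]
    φ² = cg (subst (⟦ p ⟧ ∣_) (solveℤ 2 (λ t u → (# 3 :+ t) :* u :* (# 2 :* u :- # 1) :+ u :* u :* (t :* t :- # 5) := (# 1 :+ t) :* u :* ((# 1 :+ t) :* u) :- (# 3 :+ t) :* u) refl t u) (∣m∣n⇒∣m+n (∣n⇒∣m*n ((ℤ.+ 3 + t) * u) e) (∣n⇒∣m*n (u * u) ht)))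
    θ² : θ * θ ≡ ℤ.+ 3 * θ - 1ℤ [mod p ]
    θ² = cg (subst (⟦ p ⟧ ∣_) (solveℤ 2 (λ t u → (# 7 :* u :- # 1 :+ # 3 :* (t :* u)) :* (# 2 :* u :- # 1) :+ u :* u :* (t :* t :- # 5) := (# 3 :+ t) :* u :* ((# 3 :+ t) :* u) :- (# 3 :* ((# 3 :+ t) :* u) :- # 1)) refl t u) (∣m∣n⇒∣m+n (∣n⇒∣m*n (ℤ.+ 7 * u - 1ℤ + ℤ.+ 3 * (t * u)) e) (∣n⇒∣m*n (u * u) ht)))
    φ-unit : ¬ ⟦ p ⟧ ∣ φ
    φ-unit d = p∤1 (subst (⟦ p ⟧ ∣_) (l θ) (∣m∣n⇒∣m-n (∣n⇒∣m*n (ℤ.+ 3 - θ) θ0) (_≡_[mod_].d (≡m-sym θ²))))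
     where
     θ0 : ⟦ p ⟧ ∣ θ
     θ0 = ≡m0⇒∣ (≡m-trans (≡m-sym φ²) (∣⇒≡m0 (∣m⇒∣m*n φ d)))
     l = solveℤ 1 (λ θ → (# 3 :- θ) :* θ :- (# 3 :* θ :- # 1 :- θ :* θ) := # 1) refl
    θ^h : θ ^ h ≡ 1ℤ [mod p ]
    θ^h = ≡m-trans (≡m-^ h (≡m-sym φ²)) (≡m-trans (≡m-reflexive (trans (^-mul φ φ h) (trans (sym (ℤP.^-distribˡ-+-* φ h h)) (cong (φ ^_) (sym (dbl h)))))) (fermat' pp (h ℕ.* 2) ep φ φ-unit))
    θ-lin : ⟦ p ⟧ ∣ (a h * ((ℤ.+ 3 + t) * u) - a h' - 1ℤ)
    θ-lin = _≡_[mod_].d (≡m-trans (≡m-sym (int-root-^ θ θ² h')) θ^h)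

   from-root : ∀ t → ⟦ p ⟧ ∣ (t * t - ℤ.+ 5) → Period p h'
   from-root t ht = p∣a , subst (⟦ p ⟧ ∣_) (l2 (a h) (a h') t u) (∣m∣n⇒∣m-n (∣m⇒∣m*n ((ℤ.+ 3 + t) * u) p∣a) (θ-lin t ht))
    where
    l0 = solveℤ 1 (λ t → t :* t :- # 5 := :- t :* :- t :- # 5) refl
    l1 = solveℤ 4 (λ A B t u → A :* ((# 3 :+ t) :* u) :- B :- # 1 :- (A :* ((# 3 :+ :- t) :* u) :- B :- # 1) :- A :* t :* (# 2 :* u :- # 1) := A :* t) refl
    l2 = solveℤ 4 (λ A B t u → A :* ((# 3 :+ t) :* u) :- (A :* ((# 3 :+ t) :* u) :- B :- # 1) := B :+ # 1) refl
    l3 = solveℤ 1 (λ t → t :* t :- (t :* t :- # 5) := # 5) refl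
    t-unit : ¬ ⟦ p ⟧ ∣ t
    t-unit d = p∤ pp prime[5] ne5 (subst (⟦ p ⟧ ∣_) (l3 t) (∣m∣n⇒∣m-n (∣m⇒∣m*n t d) ht))
    -- Both roots, for t and for -t, satisfy a(h)θ - a(h') = 1; the difference of the two equations
    -- is a(h)t, and t is a unit.
    p∣a : ⟦ p ⟧ ∣ a h
    p∣a = or (euclid pp (a h) t (subst (⟦ p ⟧ ∣_) (l1 (a h) (a h') t u) (∣m∣n⇒∣m-n (∣m∣n⇒∣m-n (θ-lin t ht) (θ-lin (- t) (subst (⟦ p ⟧ ∣_) (l0 t) ht))) (∣n⇒∣m*n (a h * t) e))))
     where
     or : (⟦ p ⟧ ∣ a h) ⊎ (⟦ p ⟧ ∣ t) → ⟦ p ⟧ ∣ a h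
     or (inj₁ d) = d
     or (inj₂ d) = ⊥-elim (t-unit d)
  go : (∃ λ t → t * t ≡ ℤ.+ 5 [mod p ]) → (∃ λ u → ∃ λ k → ℤ.+ 2 * u ≡ 1ℤ + k * ⟦ p ⟧) → Period p h'
  go (t , cg ht) (u , k , e) = from-root u (divides k (trans (cong (_- 1ℤ) e) (solveℤ 2 (λ k q → # 1 :+ k :* q :- # 1 := k :* q) refl k ⟦ p ⟧))) t ht

 -- -3 and 5 are both non-squares modulo p
 -15-square : ∀ m' (pp : Prime (suc (suc (m' ℕ.* 3)))) h' → suc (suc (m' ℕ.* 3)) ≡ suc (suc h' ℕ.* 2) → (ℤ.+ 5) ^ suc h' ≡ -1ℤ [mod suc (suc (m' ℕ.* 3)) ] → ∃ λ s → s * s ≡ ℤ.-[1+ 14 ] [mod suc (suc (m' ℕ.* 3)) ]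
 -15-square m' pp h' ep five = euler pp h' (trans ep (cong suc (dbl (suc h')))) (ℤ.-[1+ 14 ]) (≡m-trans (≡m-reflexive (^-mul (ℤ.-[1+ 2 ]) (ℤ.+ 5) (suc h'))) (≡m-trans (≡m-* three five) ≡m-refl))
  where
  dbl : ∀ n → n ℕ.* 2 ≡ n ℕ.+ n
  dbl n = trans (ℕP.*-comm n 2) (cong (n ℕ.+_) (ℕP.+-identityʳ n))
  three : (ℤ.-[1+ 2 ]) ^ suc h' ≡ -1ℤ [mod suc (suc (m' ℕ.* 3)) ]
  three = mod-ι (≋-trans (≋-reflexive (sym (trans (cong (r ^E_) (trans (ℕP.suc-injective ep) (ℕP.*-comm (suc h') 2))) (trans (sym (^E-assocʳ r 2 (suc h'))) (sym (ι-^ (ℤ.-[1+ 2 ]) (suc h'))))))) (r^p-1 {m'} pp))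

-- Splitting types of primes and the pointwise inequality

module PrimeClasses where
 open import Defs using (oneInCage)
 open import Data.Bool using (Bool; true; false)
 open import Data.Nat.DivMod using (_%_; _/_; m≡m%n+[m/n]*n; m%n<n)
 open import Data.Integer as ℤ using (ℤ; _+_; _*_; _-_; -_; _≤_)
 open import Data.Rational as ℚ using (ℚ)
 import Data.Rational.Properties as ℚP
 open import Relation.Nullary using (_→-dec_; _⊎-dec_; ¬?)
 open import Relation.Nullary.Decidable using (from-yes)
 open import Relation.Binary.PropositionalEquality
 open Rationals using (qz; qn; qz-+; qz-*; qz-neg; qz-mono)
 open Valuations using (p≥2)
 open Integers
 open PrimeField
 open NormForms using (N; _∣∣_)
 open RingClassWeights using (z0; z1; z2; _⊞_; _⊠_; res; resN; res-+; res-*; W; ω; wt; all3; _≟3_)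
 open FormSeries using (Cls; is3; is5; split; inert; cls)
 open FormCertificates using (module C₊; module C₋)
 open Characters using (f5; f3; module χ5; module χ3; module χ15)
 open RotationOrder using (Period; module Orbit)
 open CubicCase using (module BadPrime)
 open QuadraticCase using (5^h; golden-period; -15-square)

 bit : Bool → ℕ
 bit true = 1
 bit false = 0

 mod-dec : ∀ n q → .{{_ : ℕ.NonZero q}} → ⟦ n ⟧ ≡ ⟦ n % q ⟧ + ⟦ n / q ⟧ * ⟦ q ⟧
 mod-dec n q = trans (cong ⟦_⟧ (m≡m%n+[m/n]*n n q)) (trans (ℤP.pos-+ (n % q) (n / q ℕ.* q)) (cong (⟦ n % q ⟧ +_) (ℤP.pos-* (n / q) q)))

 res-0 : ∀ c → res c ≡ z0 → ⟦ 3 ⟧ ∣ c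
 res-0 c h with reduce 3 (s≤s z≤n) c
 ... | r , r<3 , k , refl = go r r<3 (trans (sym (r⊞0 (resN r))) (trans (cong (resN r ⊞_) (sym (trans (res-* k ⟦ 3 ⟧) (⊠z0 (res k))))) (trans (sym (res-+ ⟦ r ⟧ (k * ⟦ 3 ⟧))) h)))
  where
  r⊞0 : ∀ x → x ⊞ z0 ≡ x
  r⊞0 = from-yes (all3 λ x → (x ⊞ z0) ≟3 x)
  ⊠z0 : ∀ x → x ⊠ z0 ≡ z0
  ⊠z0 = from-yes (all3 λ x → (x ⊠ z0) ≟3 z0)
  go : ∀ r → r ℕ.< 3 → resN r ≡ z0 → ⟦ 3 ⟧ ∣ (⟦ r ⟧ + k * ⟦ 3 ⟧)
  go 0 _ _ = divides k (ℤP.+-identityˡ (k * ⟦ 3 ⟧))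
  go 1 _ ()
  go 2 _ ()
  go (suc (suc (suc _))) (s≤s (s≤s (s≤s ()))) _

 W-values : ∀ x y → x ≢ z0 → ((ω true x y ≡ ℤ.+ 2) × (x ⊞ y ≡ z0)) ⊎ (ω true x y ≡ -1ℤ)
 W-values z0 y h = ⊥-elim (h refl)
 W-values z1 z0 h = inj₂ refl
 W-values z1 z1 h = inj₂ refl
 W-values z1 z2 h = inj₁ (refl , refl)
 W-values z2 z0 h = inj₂ refl
 W-values z2 z1 h = inj₁ (refl , refl)
 W-values z2 z2 h = inj₂ refl

 ±1-5 : ∀ {r} → r ℕ.< 5 → (r ≡ 0) ⊎ ((f5 r ≡ 1ℤ) ⊎ (f5 r ≡ -1ℤ))
 ±1-5 = from-yes (ℕP.allUpTo? (λ r → (r ℕ.≟ 0) ⊎-dec ((f5 r ℤ.≟ 1ℤ) ⊎-dec (f5 r ℤ.≟ -1ℤ))) 5)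

 ±1-3 : ∀ {r} → r ℕ.< 3 → (r ≡ 0) ⊎ ((f3 r ≡ 1ℤ) ⊎ ((f3 r ≡ -1ℤ) × (r ≡ 2)))
 ±1-3 {0} _ = inj₁ refl
 ±1-3 {1} _ = inj₂ (inj₁ refl)
 ±1-3 {2} _ = inj₂ (inj₂ (refl , refl))
 ±1-3 {suc (suc (suc _))} (s≤s (s≤s (s≤s ())))

 true-3 : ∀ {r} → r ℕ.< 3 → ∀ {σ} → σ ℕ.< 3 → ⟦ 3 ⟧ ∣ (⟦ r ⟧ - ℤ.+ 2 * (⟦ σ ⟧ * ⟦ σ ⟧)) → (f3 r ≡ 1ℤ) → ⊥
 true-3 = from-yes (ℕP.allUpTo? (λ r → ℕP.allUpTo? (λ σ → (⟦ 3 ⟧ ∣? (⟦ r ⟧ - ℤ.+ 2 * (⟦ σ ⟧ * ⟦ σ ⟧))) →-dec ¬? (f3 r ℤ.≟ 1ℤ)) 3) 3)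

 false-3 : ∀ {r} → r ℕ.< 3 → ∀ {σ} → σ ℕ.< 3 → ⟦ 3 ⟧ ∣ (⟦ r ⟧ - ⟦ σ ⟧ * ⟦ σ ⟧) → (f3 r ≡ -1ℤ) → ⊥
 false-3 = from-yes (ℕP.allUpTo? (λ r → ℕP.allUpTo? (λ σ → (⟦ 3 ⟧ ∣? (⟦ r ⟧ - ⟦ σ ⟧ * ⟦ σ ⟧)) →-dec ¬? (f3 r ℤ.≟ -1ℤ)) 3) 3)

 true-5 : ∀ {r} → r ℕ.< 5 → ∀ {σ} → σ ℕ.< 5 → ⟦ 5 ⟧ ∣ (ℤ.+ 8 * ⟦ r ⟧ - ⟦ σ ⟧ * ⟦ σ ⟧) → (f5 r ≡ 1ℤ) → ⊥
 true-5 = from-yes (ℕP.allUpTo? (λ r → ℕP.allUpTo? (λ σ → (⟦ 5 ⟧ ∣? (ℤ.+ 8 * ⟦ r ⟧ - ⟦ σ ⟧ * ⟦ σ ⟧)) →-dec ¬? (f5 r ℤ.≟ 1ℤ)) 5) 5)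

 module Large (p : ℕ) (pp : Prime p) (p≥7 : 7 ℕ.≤ p) where

  ne : ∀ k → k ℕ.< 7 → p ≢ k
  ne k h refl = ℕP.<⇒≱ h p≥7

  ne2 : p ≢ 2
  ne2 = ne 2 (s≤s (s≤s (s≤s z≤n)))
  ne3 : p ≢ 3
  ne3 = ne 3 (s≤s (s≤s (s≤s (s≤s z≤n))))
  ne5 : p ≢ 5
  ne5 = ne 5 (s≤s (s≤s (s≤s (s≤s (s≤s (s≤s z≤n))))))

  a5 a3 : ℤ
  a5 = f5 (p % 5)
  a3 = f3 (p % 3)

  %≢0 : ∀ q → Prime q → .{{_ : ℕ.NonZero q}} → p ≢ q → p % q ≢ 0
  %≢0 q pq n e = n (sym (p∣q pq pp (ℕ∣ (ℕD.m%n≡0⇒n∣m p q e))))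

  a5-values : (a5 ≡ 1ℤ) ⊎ (a5 ≡ -1ℤ)
  a5-values with ±1-5 (m%n<n p 5)
  ... | inj₁ e = ⊥-elim (%≢0 5 prime[5] ne5 e)
  ... | inj₂ h = h

  a3-values : (a3 ≡ 1ℤ) ⊎ ((a3 ≡ -1ℤ) × (p % 3 ≡ 2))
  a3-values with ±1-3 (m%n<n p 3)
  ... | inj₁ e = ⊥-elim (%≢0 3 prime[3] ne3 e)
  ... | inj₂ h = h

  half : ∃ λ h' → p ≡ suc (suc h' ℕ.* 2)
  half = go (p % 2) (p / 2) (m%n<n p 2) (m≡m%n+[m/n]*n p 2)
   where
   go : ∀ r q → r ℕ.< 2 → p ≡ r ℕ.+ q ℕ.* 2 → ∃ λ h' → p ≡ suc (suc h' ℕ.* 2)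
   go 0 q _ e = ⊥-elim (ne2 (sym (p∣q prime[2] pp (ℕ∣ (ℕD.divides q e)))))
   go 1 zero _ e = ⊥-elim (ne 1 (s≤s (s≤s z≤n)) e)
   go 1 (suc q) _ e = q , e
   go (suc (suc _)) _ (s≤s (s≤s ())) _

  cage-5 : a5 ≡ 1ℤ → oneInCage p ≡ false
  cage-5 e = go (proj₁ half) (proj₂ half)
   where
   go : ∀ h' → p ≡ suc (suc h' ℕ.* 2) → oneInCage p ≡ false
   go h' ep = trans (cong oneInCage ep) (Orbit.not-in-cage (suc h' ℕ.* 2) h' (subst (λ q → Period q h') ep (golden-period p pp ne2 ne5 h' ep (≡m-trans (5^h p pp ne5 (suc h') ep) (≡m-reflexive e))))
     (ℕP.m<m*n (suc h') 2 (s≤s (s≤s z≤n))))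

  form-3 : ∀ s → ⟦ 3 ⟧ ∣ (⟦ p ⟧ - ℤ.+ 2 * (s * s)) → a3 ≢ 1ℤ
  form-3 s d = go (reduce 3 (s≤s z≤n) s)
   where
   l = solveℤ 4 (λ r q σ k → r :+ q :* # 3 :- # 2 :* ((σ :+ k :* # 3) :* (σ :+ k :* # 3)) :- # 3 :* (q :- # 4 :* (σ :* k) :- # 6 :* (k :* k)) := r :- # 2 :* (σ :* σ)) refl
   go : (∃ λ σ → σ ℕ.< 3 × ∃ λ k → s ≡ ⟦ σ ⟧ + k * ⟦ 3 ⟧) → a3 ≢ 1ℤ
   go (σ , σ<3 , k , e) = true-3 (m%n<n p 3) σ<3 (subst (⟦ 3 ⟧ ∣_) (trans (cong₂ (λ u v → u - ℤ.+ 2 * (v * v) - ℤ.+ 3 * (⟦ p / 3 ⟧ - ℤ.+ 4 * (⟦ σ ⟧ * k) - ℤ.+ 6 * (k * k))) (mod-dec p 3) e) (l ⟦ p % 3 ⟧ ⟦ p / 3 ⟧ ⟦ σ ⟧ k)) (∣m∣n⇒∣m-n d (∣m⇒∣m*n (⟦ p / 3 ⟧ - ℤ.+ 4 * (⟦ σ ⟧ * k) - ℤ.+ 6 * (k * k)) ∣-refl)))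

  form₀-3 : ∀ s → ⟦ 3 ⟧ ∣ (⟦ p ⟧ - s * s) → a3 ≢ -1ℤ
  form₀-3 s d = go (reduce 3 (s≤s z≤n) s)
   where
   l = solveℤ 4 (λ r q σ k → r :+ q :* # 3 :- (σ :+ k :* # 3) :* (σ :+ k :* # 3) :- # 3 :* (q :- # 2 :* (σ :* k) :- # 3 :* (k :* k)) := r :- σ :* σ) refl
   go : (∃ λ σ → σ ℕ.< 3 × ∃ λ k → s ≡ ⟦ σ ⟧ + k * ⟦ 3 ⟧) → a3 ≢ -1ℤ
   go (σ , σ<3 , k , e) = false-3 (m%n<n p 3) σ<3 (subst (⟦ 3 ⟧ ∣_) (trans (cong₂ (λ u v → u - v * v - ℤ.+ 3 * (⟦ p / 3 ⟧ - ℤ.+ 2 * (⟦ σ ⟧ * k) - ℤ.+ 3 * (k * k))) (mod-dec p 3) e) (l ⟦ p % 3 ⟧ ⟦ p / 3 ⟧ ⟦ σ ⟧ k)) (∣m∣n⇒∣m-n d (∣m⇒∣m*n (⟦ p / 3 ⟧ - ℤ.+ 2 * (⟦ σ ⟧ * k) - ℤ.+ 3 * (k * k)) ∣-refl)))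

  -- If 8p is a square modulo 5, then p is a non-residue, because 8 is one.
  form-5 : ∀ s → ⟦ 5 ⟧ ∣ (ℤ.+ 8 * ⟦ p ⟧ - s * s) → a5 ≢ 1ℤ
  form-5 s d = go (reduce 5 (s≤s z≤n) s)
   where
   l = solveℤ 4 (λ r q σ k → # 8 :* (r :+ q :* # 5) :- (σ :+ k :* # 5) :* (σ :+ k :* # 5) :- # 5 :* (# 8 :* q :- # 2 :* (σ :* k) :- # 5 :* (k :* k)) := # 8 :* r :- σ :* σ) refl
   go : (∃ λ σ → σ ℕ.< 5 × ∃ λ k → s ≡ ⟦ σ ⟧ + k * ⟦ 5 ⟧) → a5 ≢ 1ℤ
   go (σ , σ<5 , k , e) = true-5 (m%n<n p 5) σ<5 (subst (⟦ 5 ⟧ ∣_) (trans (cong₂ (λ u v → ℤ.+ 8 * u - v * v - ℤ.+ 5 * (ℤ.+ 8 * ⟦ p / 5 ⟧ - ℤ.+ 2 * (⟦ σ ⟧ * k) - ℤ.+ 5 * (k * k))) (mod-dec p 5) e) (l ⟦ p % 5 ⟧ ⟦ p / 5 ⟧ ⟦ σ ⟧ k)) (∣m∣n⇒∣m-n d (∣m⇒∣m*n (ℤ.+ 8 * ⟦ p / 5 ⟧ - ℤ.+ 2 * (⟦ σ ⟧ * k) - ℤ.+ 5 * (k * k)) ∣-refl)))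

  module DegTrue (s t : ℤ) (hN : N true (s , t) ≡ ⟦ p ⟧) where
   not-a3 : a3 ≢ 1ℤ
   not-a3 = form-3 s (subst (⟦ 3 ⟧ ∣_) (trans (solveℤ 2 (λ s t → # 3 :* (t :* t :- s :* t) := # 2 :* (s :* s) :- # 3 :* (s :* t) :+ # 3 :* (t :* t) :- # 2 :* (s :* s)) refl s t) (cong (_- ℤ.+ 2 * (s * s)) hN)) (∣m⇒∣m*n (t * t - s * t) ∣-refl))

   not-a5 : a5 ≢ 1ℤ
   not-a5 = form-5 (ℤ.+ 4 * s - ℤ.+ 3 * t) (subst (⟦ 5 ⟧ ∣_) (trans (solveℤ 2 (λ s t → # 5 :* (# 3 :* (t :* t)) := # 8 :* (# 2 :* (s :* s) :- # 3 :* (s :* t) :+ # 3 :* (t :* t)) :- (# 4 :* s :- # 3 :* t) :* (# 4 :* s :- # 3 :* t)) refl s t) (cong (λ w → ℤ.+ 8 * w - (ℤ.+ 4 * s - ℤ.+ 3 * t) * (ℤ.+ 4 * s - ℤ.+ 3 * t)) hN)) (∣m⇒∣m*n (ℤ.+ 3 * (t * t)) ∣-refl))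

   3∤s : ¬ ⟦ 3 ⟧ ∣ s
   3∤s d = ne3 (sym (p∣q prime[3] pp (subst (⟦ 3 ⟧ ∣_) hN (∣m∣n⇒∣m+n (∣m∣n⇒∣m-n (∣n⇒∣m*n (ℤ.+ 2) (∣m⇒∣m*n s d)) (∣m⇒∣m*n (s * t) ∣-refl)) (∣m⇒∣m*n (t * t) ∣-refl)))))

   -- s = 2x + y, t = x + 2y turns N into 5x² + 5xy + 8y²; the substitution (x,y) ↦ (-x-y,y) preserves the form
   cage-W : a3 ≡ -1ℤ → p % 3 ≡ 2 → res s ⊞ res t ≡ z0 → oneInCage p ≡ false
   cage-W _ e2 h = go (res-0 (s + t) (trans (res-+ s t) h))
    where
    m' : ℕ
    m' = p / 3
    ep : p ≡ suc (suc (m' ℕ.* 3))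
    ep = trans (m≡m%n+[m/n]*n p 3) (cong (ℕ._+ m' ℕ.* 3) e2)
    fin : ∀ m' → p ≡ suc (suc (m' ℕ.* 3)) → ∀ x y → ⟦ p ⟧ ≡ ℤ.+ 5 * (x * x) + ℤ.+ 5 * (x * y) + ℤ.+ 8 * (y * y) → ¬ ⟦ 3 ⟧ ∣ x → oneInCage p ≡ false
    fin zero refl x y hp n = ⊥-elim (ne2 refl)
    fin (suc m) refl x y hp n = Orbit.not-in-cage (suc (suc m ℕ.* 3)) (suc m) (BadPrime.period (suc m) pp ne2 ne5 x y hp n) (s≤s (ℕP.m<m*n (suc m) 3 (s≤s (s≤s z≤n))))
    choose : ∀ x y → ⟦ p ⟧ ≡ ℤ.+ 5 * (x * x) + ℤ.+ 5 * (x * y) + ℤ.+ 8 * (y * y) → Dec (⟦ 3 ⟧ ∣ x) → oneInCage p ≡ false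
    choose x y hp (no n) = fin m' ep x y hp n
    choose x y hp (yes d) = fin m' ep (- (x + y)) y (trans hp (l x y)) λ d' → ne3 (sym (p∣q prime[3] pp (subst (⟦ 3 ⟧ ∣_) (sym hp) (∣m∣n⇒∣m+n (∣m∣n⇒∣m+n (∣n⇒∣m*n (ℤ.+ 5) (∣m⇒∣m*n x d)) (∣n⇒∣m*n (ℤ.+ 5) (∣m⇒∣m*n y d))) (∣n⇒∣m*n (ℤ.+ 8) (∣m⇒∣m*n y (subst (⟦ 3 ⟧ ∣_) (l2 x y) (∣m∣n⇒∣m-n (∣m⇒∣-m d') d))))))))
      where
      l = solveℤ 2 (λ x y → # 5 :* (x :* x) :+ # 5 :* (x :* y) :+ # 8 :* (y :* y) := # 5 :* (:- (x :+ y) :* :- (x :+ y)) :+ # 5 :* (:- (x :+ y) :* y) :+ # 8 :* (y :* y)) refl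
      l2 = solveℤ 2 (λ x y → :- (:- (x :+ y)) :- x := y) refl
    go : ⟦ 3 ⟧ ∣ (s + t) → oneInCage p ≡ false
    go (divides k e) = choose (s - k) (t - k) (trans (sym hN) (form s t k e)) (⟦ 3 ⟧ ∣? (s - k))
      where
      form : ∀ s t k → s + t ≡ k * ⟦ 3 ⟧ → ℤ.+ 2 * (s * s) - ℤ.+ 3 * (s * t) + ℤ.+ 3 * (t * t) ≡ ℤ.+ 5 * ((s - k) * (s - k)) + ℤ.+ 5 * ((s - k) * (t - k)) + ℤ.+ 8 * ((t - k) * (t - k))
      form s t k e = trans (cong (λ w → ℤ.+ 2 * (s * s) - ℤ.+ 3 * (s * w) + ℤ.+ 3 * (w * w)) et) (trans (l s k) (cong (λ w → ℤ.+ 5 * ((s - k) * (s - k)) + ℤ.+ 5 * ((s - k) * (w - k)) + ℤ.+ 8 * ((w - k) * (w - k))) (sym et)))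
       where
       l0 = solveℤ 2 (λ s t → t := s :+ t :- s) refl
       et : t ≡ k * ⟦ 3 ⟧ - s
       et = trans (l0 s t) (cong (_- s) e)
       l = solveℤ 2 (λ s k → # 2 :* (s :* s) :- # 3 :* (s :* (k :* # 3 :- s)) :+ # 3 :* ((k :* # 3 :- s) :* (k :* # 3 :- s)) := # 5 :* ((s :- k) :* (s :- k)) :+ # 5 :* ((s :- k) :* (k :* # 3 :- s :- k)) :+ # 8 :* ((k :* # 3 :- s :- k) :* (k :* # 3 :- s :- k))) refl

  not-deg-false : ∀ s t → N false (s , t) ≡ ⟦ p ⟧ → a3 ≢ -1ℤ
  not-deg-false s t hN = form₀-3 s (subst (⟦ 3 ⟧ ∣_) (trans (solveℤ 2 (λ s t → # 3 :* (s :* t :+ # 2 :* (t :* t)) := s :* s :+ # 3 :* (s :* t) :+ # 6 :* (t :* t) :- s :* s) refl s t) (cong (_- s * s) hN)) (∣m⇒∣m*n (s * t + ℤ.+ 2 * (t * t)) ∣-refl))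

  -- then -15 is a square modulo p
  not-inert : a5 ≡ -1ℤ → p % 3 ≡ 2 → ¬ (∀ i v → ⟦ p ⟧ ∣ N i v → ⟦ p ⟧ ∣∣ v)
  not-inert e5 e2 h = go m' ep (proj₁ half) (proj₂ half) (inverse pp (ℤ.+ 2) p∤2)
   where
   m' : ℕ
   m' = p / 3
   ep : p ≡ suc (suc (m' ℕ.* 3))
   ep = trans (m≡m%n+[m/n]*n p 3) (cong (ℕ._+ m' ℕ.* 3) e2)
   p∤2 : ¬ ⟦ p ⟧ ∣ ℤ.+ 2
   p∤2 d = ne2 (p∣q pp prime[2] d)
   root : ∀ s → s * s ≡ ℤ.-[1+ 14 ] [mod p ] → (∃ λ u → ∃ λ k → ℤ.+ 2 * u ≡ 1ℤ + k * ⟦ p ⟧) → ⊥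
   root s (cg ds) (u , k , e) = ∤-small (s≤s z≤n) (p≥2 pp) (proj₂ (h false (u * (s - ℤ.+ 3) , 1ℤ) (or (euclid pp (ℤ.+ 2 * ℤ.+ 2) (N false (u * (s - ℤ.+ 3) , 1ℤ)) (subst (⟦ p ⟧ ∣_) (l s u) (∣m∣n⇒∣m+n (∣m⇒∣m*n ((s - ℤ.+ 3) * ((ℤ.+ 2 * u + 1ℤ) * (s - ℤ.+ 3) + ℤ.+ 6)) du) ds))))))
    where
    l1 = solveℤ 1 (λ x → # 1 :+ x :- # 1 := x) refl
    du : ⟦ p ⟧ ∣ (ℤ.+ 2 * u - 1ℤ)
    du = divides k (trans (cong (_- 1ℤ) e) (l1 (k * ⟦ p ⟧)))
    l = solveℤ 2 (λ s u → (# 2 :* u :- # 1) :* ((s :- # 3) :* ((# 2 :* u :+ # 1) :* (s :- # 3) :+ # 6)) :+ (s :* s :- Κ ℤ.-[1+ 14 ]) := # 2 :* # 2 :* (u :* (s :- # 3) :* (u :* (s :- # 3)) :+ # 3 :* (u :* (s :- # 3) :* # 1) :+ # 6 :* (# 1 :* # 1))) refl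
    or : ∀ {w} → (⟦ p ⟧ ∣ ℤ.+ 2 * ℤ.+ 2) ⊎ (⟦ p ⟧ ∣ w) → ⟦ p ⟧ ∣ w
    or (inj₁ d) = ⊥-elim (p∤2 (euclid-sq pp (ℤ.+ 2) d))
    or (inj₂ d) = d
   go : ∀ m' → p ≡ suc (suc (m' ℕ.* 3)) → ∀ h' → p ≡ suc (suc h' ℕ.* 2) → (∃ λ u → ∃ λ k → ℤ.+ 2 * u ≡ 1ℤ + k * ⟦ p ⟧) → ⊥
   go m' refl h' eh inv = fin (-15-square m' pp h' eh (≡m-trans (5^h p pp ne5 (suc h') eh) (≡m-reflexive e5))) inv
    where
    fin : (∃ λ s → s * s ≡ ℤ.-[1+ 14 ] [mod p ]) → (∃ λ u → ∃ λ k → ℤ.+ 2 * u ≡ 1ℤ + k * ⟦ p ⟧) → ⊥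
    fin (s , hs) = root s hs

  -- For x = χ5(p), y = χ3(p), d = κ₊(p) - κ₋(p) the right side is 12 times the indicator of the
  -- classes that are not excluded. It is 0 at x = 1 and 12 at (-1,1), where d = 0; at (-1,-1) it is
  -- 8 - 2d with d = 4 for the primes 5x² + 5xy + 8y² and d = -2 otherwise. Only the constant 5 has
  -- a nonzero mean.
  Ineq : ℤ → ℤ → ℤ → ℕ → Set
  Ineq x y d b = ℤ.+ 12 * ⟦ b ⟧ ≤ ℤ.+ 5 - ℤ.+ 5 * x + y - x * y - ℤ.+ 2 * d

  bit≤ : ∀ b → (ℤ.+ 12 * ⟦ bit b ⟧ ≤ ℤ.+ 12)
  bit≤ true = ℤP.≤-refl
  bit≤ false = ℤ.+≤+ z≤n

  -- the case of κ₊ = κ₋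
  no-deg-true : ¬ (a5 ≡ -1ℤ × (a3 ≡ -1ℤ × p % 3 ≡ 2)) → Ineq a5 a3 0ℤ (bit (oneInCage p))
  no-deg-true h = go a5-values a3-values
   where
   go : (a5 ≡ 1ℤ) ⊎ (a5 ≡ -1ℤ) → (a3 ≡ 1ℤ) ⊎ ((a3 ≡ -1ℤ) × (p % 3 ≡ 2)) → Ineq a5 a3 0ℤ (bit (oneInCage p))
   go (inj₁ e) _ = subst₂ (λ x b → Ineq x a3 0ℤ (bit b)) (sym e) (sym (cage-5 e)) (ℤP.≤-reflexive (solveℤ 1 (λ y → # 0 := # 5 :- # 5 :* # 1 :+ y :- # 1 :* y :- # 2 :* # 0) refl a3))
   go (inj₂ e) (inj₁ f) = subst₂ (λ x y → Ineq x y 0ℤ (bit (oneInCage p))) (sym e) (sym f) (bit≤ (oneInCage p))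
   go (inj₂ e) (inj₂ f) = ⊥-elim (h (e , f))

  deg-true : ∀ s t → N true (s , t) ≡ ⟦ p ⟧ → Ineq a5 a3 (ℤ.+ 2 * W true (s , t)) (bit (oneInCage p))
  deg-true s t hN = go a5-values a3-values (W-values (res s) (res t) (λ e → 3∤s (res-0 s e)))
   where
   open DegTrue s t hN
   go : (a5 ≡ 1ℤ) ⊎ (a5 ≡ -1ℤ) → (a3 ≡ 1ℤ) ⊎ ((a3 ≡ -1ℤ) × (p % 3 ≡ 2)) → ((W true (s , t) ≡ ℤ.+ 2) × (res s ⊞ res t ≡ z0)) ⊎ (W true (s , t) ≡ -1ℤ) → Ineq a5 a3 (ℤ.+ 2 * W true (s , t)) (bit (oneInCage p))
   go (inj₁ e) _ _ = ⊥-elim (not-a5 e)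
   go _ (inj₁ f) _ = ⊥-elim (not-a3 f)
   go (inj₂ e) (inj₂ (f , e2)) (inj₁ (w , h)) = subst₂ (λ x y → Ineq x y (ℤ.+ 2 * W true (s , t)) (bit (oneInCage p))) (sym e) (sym f) (subst₂ (λ d b → Ineq -1ℤ -1ℤ (ℤ.+ 2 * d) (bit b)) (sym w) (sym (cage-W f e2 h)) ℤP.≤-refl)
   go (inj₂ e) (inj₂ (f , e2)) (inj₂ w) = subst₂ (λ x y → Ineq x y (ℤ.+ 2 * W true (s , t)) (bit (oneInCage p))) (sym e) (sym f) (subst (λ d → Ineq -1ℤ -1ℤ (ℤ.+ 2 * d) (bit (oneInCage p))) (sym w) (bit≤ (oneInCage p)))

  R : ℚ
  R = qn 5 ℚ.- qn 5 ℚ.* qz (χ5.χ p) ℚ.+ qz (χ3.χ p) ℚ.- qz (χ15.χ p) ℚ.- qn 2 ℚ.* (C₊.κ p ℚ.- C₋.κ p)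

  finish : ∀ d → C₊.κ p ℚ.- C₋.κ p ≡ qz d → Ineq a5 a3 d (bit (oneInCage p)) → qn 12 ℚ.* qn (bit (oneInCage p)) ℚ.≤ R
  finish d e i = subst₂ ℚ._≤_ (qz-* (ℤ.+ 12) ⟦ bit (oneInCage p) ⟧) conv (qz-mono i)
   where
   qz-- : ∀ x y → qz (x - y) ≡ qz x ℚ.- qz y
   qz-- x y = trans (qz-+ x (- y)) (cong (qz x ℚ.+_) (qz-neg y))
   conv : qz (ℤ.+ 5 - ℤ.+ 5 * a5 + a3 - a5 * a3 - ℤ.+ 2 * d) ≡ R
   conv = trans (qz-- (ℤ.+ 5 - ℤ.+ 5 * a5 + a3 - a5 * a3) (ℤ.+ 2 * d)) (cong₂ ℚ._-_ (trans (qz-- (ℤ.+ 5 - ℤ.+ 5 * a5 + a3) (a5 * a3)) (cong₂ ℚ._-_ (trans (qz-+ (ℤ.+ 5 - ℤ.+ 5 * a5) a3) (cong (ℚ._+ qz a3) (trans (qz-- (ℤ.+ 5) (ℤ.+ 5 * a5)) (cong (λ w → qn 5 ℚ.- w) (qz-* (ℤ.+ 5) a5))))) a15))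
      (trans (qz-* (ℤ.+ 2) d) (cong (qn 2 ℚ.*_) (sym e))))
    where
    open import Data.Nat.DivMod using (%-remove-+ʳ; m∣n⇒o%n%m≡o%m)
    a15 : qz (a5 * a3) ≡ qz (χ15.χ p)
    a15 = cong₂ (λ u v → qz (f5 u * f3 v)) (sym (m∣n⇒o%n%m≡o%m 5 15 p (ℕD.divides 3 refl))) (sym (m∣n⇒o%n%m≡o%m 3 15 p (ℕD.divides 5 refl)))

  same-cls : ∃ λ (c : Cls p) → (C₊.κ p ≡ C₊.κ' c) × (C₋.κ p ≡ C₋.κ' c)
  same-cls with prime? p
  ... | yes qq = cls p qq , refl , refl
  ... | no n = ⊥-elim (n pp)

  place : qn 12 ℚ.* qn (bit (oneInCage p)) ℚ.≤ R
  place = go (proj₁ same-cls) (cong₂ ℚ._-_ (proj₁ (proj₂ same-cls)) (proj₂ (proj₂ same-cls)))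
   where
   qz0 : ∀ x → x ℚ.- x ≡ qz 0ℤ
   qz0 x = trans (ℚP.+-inverseʳ x) (sym Rationals.qz-0)
   diff : ∀ w → qz w ℚ.* qz 1ℤ ℚ.- qz w ℚ.* qz -1ℤ ≡ qz (ℤ.+ 2 * w)
   diff w = trans (sym (trans (qz-+ (w * 1ℤ) (- (w * -1ℤ))) (cong₂ ℚ._+_ (qz-* w 1ℤ) (trans (qz-neg (w * -1ℤ)) (cong ℚ.-_ (qz-* w -1ℤ)))))) (cong qz (solveℤ 1 (λ w → w :* # 1 :+ :- (w :* Κ -1ℤ) := # 2 :* w) refl w))
   go : (c : Cls p) → C₊.κ p ℚ.- C₋.κ p ≡ C₊.κ' c ℚ.- C₋.κ' c → qn 12 ℚ.* qn (bit (oneInCage p)) ℚ.≤ R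
   go (is3 e) _ = ⊥-elim (ne3 e)
   go (is5 e) _ = ⊥-elim (ne5 e)
   go (inert _ _ h) e = finish 0ℤ (trans e (qz0 ℚ.0ℚ)) (no-deg-true λ (e5 , _ , e2) → not-inert e5 e2 h)
   go (split _ _ false (s , t) hN _) e = finish 0ℤ (trans e (qz0 (wt false (s , t) ℚ.* ℚ.1ℚ))) (no-deg-true λ (_ , e3 , _) → not-deg-false s t hN e3)
   go (split _ _ true (s , t) hN _) e = finish (ℤ.+ 2 * W true (s , t)) (trans e (diff (W true (s , t)))) (deg-true s t hN)

-- From weighted sums to the natural density

module Density where
 open import Defs
 open import Data.Bool using (true; false; _∧_; T?)
 open import Data.Integer as ℤ using (ℤ)
 open import Data.List using ([]; _∷_; filter; length; upTo; _∷ʳ_)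
 import Data.List.Properties as LP
 open import Data.Rational using (ℚ; _+_; _*_; _-_; -_; 0ℚ; 1ℚ; ½; _≤_; _<_; _≤?_; ∣_∣; _/_; mkℚ)
 open import Data.Rational.Properties
 import Data.Rational.Unnormalised as U
 import Data.Rational.Unnormalised.Properties as UP
 open import Relation.Nullary using (does)
 open import Relation.Nullary.Decidable using (from-yes)
 open import Relation.Unary using (Decidable)
 open import Relation.Binary.PropositionalEquality
 open Rationals
 open HarmonicLog
 open Valuations
 open Mertens using (Hecke)
 open MertensLower using (W-lower)
 open Characters using (H5; H3; H15; S5; S3; S15; dec≤; module χ5; module χ3; module χ15)
 open FormCertificates using (module C₊; module C₋; S₊; S₋)
 open PrimeClasses using (bit; module Large)

 opaque
  unfolding qz
  qn≡ : ∀ n → qn n ≡ ℤ.+ n / 1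
  qn≡ n = refl

 A : ℕ → ℚ
 A p = qn (bit (oneInCage p))

 filter-∷ʳ : ∀ {P : ℕ → Set} (P? : Decidable P) xs y → qn (length (filter P? (xs ∷ʳ y))) ≡ qn (length (filter P? xs)) + qn (bit (does (P? y)))
 filter-∷ʳ P? xs y = trans (cong (λ ys → qn (length ys)) (LP.filter-++ P? xs (y ∷ []))) (trans (cong qn (LP.length-++ (filter P? xs))) (trans (qn-+ (length (filter P? xs)) _) (cong (qn (length (filter P? xs)) +_) last)))
  where
  last : qn (length (filter P? (y ∷ []))) ≡ qn (bit (does (P? y)))
  last with does (P? y)
  ... | true = refl
  ... | false = refl

 primeCount-sum : ∀ x → qn (primeCount x) ≡ sumP (λ _ → 1ℚ) x
 primeCount-sum zero = qz-0
 primeCount-sum (suc x) = trans (cong (λ ys → qn (length (filter prime? ys))) (sym (LP.upTo-∷ʳ (suc x)))) (trans (filter-∷ʳ prime? (upTo (suc x)) (suc x)) (cong₂ _+_ (primeCount-sum x) last))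
  where
  last : qn (bit (does (prime? (suc x)))) ≡ onP (λ _ → 1ℚ) (suc x)
  last with prime? (suc x)
  ... | yes _ = qz-1
  ... | no _ = qz-0

 cageCount-sum : ∀ x → qn (cageCount x) ≡ sumP A x
 cageCount-sum zero = qz-0
 cageCount-sum (suc x) = trans (cong (λ ys → qn (length (filter inC? ys))) (sym (LP.upTo-∷ʳ (suc x)))) (trans (filter-∷ʳ inC? (upTo (suc x)) (suc x)) (cong₂ _+_ (cageCount-sum x) last))
  where
  inC? = λ p → T? (does (prime? p) ∧ oneInCage p)
  last : qn (bit (does (prime? (suc x)) ∧ oneInCage (suc x))) ≡ onP A (suc x)
  last with prime? (suc x)
  ... | yes _ = refl
  ... | no _ = qz-0

 ratio-≥ : ∀ x → ℤ.+ 7 / 16 ≤ ratio x → qn 7 * sumP (λ _ → 1ℚ) x ≤ qn 16 * sumP A x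
 ratio-≥ x h = subst₂ (λ u v → qn 7 * u ≤ qn 16 * v) (primeCount-sum x) (cageCount-sum x) (go h)
  where
  go : ℤ.+ 7 / 16 ≤ ratio x → qn 7 * qn (primeCount x) ≤ qn 16 * qn (cageCount x)
  go h with primeCount x
  ... | zero = ≤-trans (≤-reflexive (trans (cong (qn 7 *_) qz-0) (*-zeroʳ (qn 7)))) (*-nn (qn-nn 16) (qn-nn (cageCount x)))
  ... | suc n = subst₂ _≤_ (qz-* (ℤ.+ 7) (ℤ.+ suc n)) (trans (qz-* (ℤ.+ cageCount x) (ℤ.+ 16)) (*-comm (qn (cageCount x)) (qn 16))) (qz-mono (UP.drop-*≤* (UP.≤-respʳ-≃ (toℚᵘ-fromℚᵘ (U.mkℚᵘ (ℤ.+ cageCount x) n)) (toℚᵘ-mono-≤ h))))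

 ≤-qn : ∀ q → ∃ λ n → q ≤ qn n
 ≤-qn q@(mkℚ i d _) = ℤ.∣ i ∣ , subst (q ≤_) (sym (qn≡ ℤ.∣ i ∣)) (toℚᵘ-cancel-≤ (UP.≤-respʳ-≃ (UP.≃-sym (toℚᵘ-fromℚᵘ (U.mkℚᵘ (ℤ.+ ℤ.∣ i ∣) 0))) (U.*≤* (ℤP.≤-trans (ℤP.≤-reflexive (ℤP.*-identityʳ i)) (ℤP.≤-trans (i≤ i) (subst (ℤ._≤ ℤ.+ ℤ.∣ i ∣ ℤ.* ℤ.+ suc d) (ℤP.*-identityʳ (ℤ.+ ℤ.∣ i ∣)) (ℤP.*-monoˡ-≤-nonNeg (ℤ.+ ℤ.∣ i ∣) (ℤ.+≤+ {1} {suc d} (s≤s z≤n)))))))))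
  where
  i≤ : ∀ i → i ℤ.≤ ℤ.+ ℤ.∣ i ∣
  i≤ (ℤ.+ n) = ℤP.≤-refl
  i≤ (ℤ.-[1+ n ]) = ℤ.-≤+

 onP-*ʳ : ∀ (f g : ℕ → ℚ) n → onP (λ p → f p * g p) n ≡ onP f n * g n
 onP-*ʳ f g n with prime? n
 ... | yes _ = refl
 ... | no _ = sym (*-zeroˡ (g n))

 -- Partial summation: a density at least 7/16 from N on carries over to the decreasing weight w.
 module Below (a : ℕ → ℚ) (a≤ : ∀ p → ∣ a p ∣ ≤ qn 16) (N : ℕ) (D≥0 : ∀ x → N ℕ.≤ x → 0ℚ ≤ sumP a x) (w : ℕ → ℚ) (w≥0 : ∀ n → 0ℚ ≤ w n) (w≤1 : ∀ n → w n ≤ 1ℚ) (w-mono : ∀ n → 4 ℕ.≤ n → w (suc n) ≤ w n) where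
  M : ℕ
  M = 4 ℕ.+ N
  C : ℚ
  C = qn M * qn 16 + qn M * qn 16

  T : ℕ → ℚ
  T = sumP (λ p → a p * w p)

  onP-≤ : ∀ n → ∣ onP a n ∣ ≤ qn 16
  onP-≤ n = onP-elim a (λ z → ∣ z ∣ ≤ qn 16) n (λ _ → a≤ n) (qn-nn 16)

  base : sumP a M * w M - C ≤ T M
  base = ≤-by (T M - sumP a M * w M + C) (l (sumP a M * w M) C (T M)) (≤-trans (sub-nn (≤-trans (-a≤∣a∣ (T M - sumP a M * w M)) (abs--≤ {T M} {sumP a M * w M} T≤ (≤-trans (≤-reflexive (∣p*q∣≡∣p∣*∣q∣ (sumP a M) (w M))) (≤-trans (*-mono {∣ sumP a M ∣} {qn M * qn 16} {∣ w M ∣} {1ℚ} (0≤∣p∣ (sumP a M)) 0≤1 D≤ (≤-trans (≤-reflexive (abs-nn (w≥0 M))) (w≤1 M))) (≤-reflexive (*-identityʳ (qn M * qn 16)))))))) (≤-reflexive (l2 C (T M - sumP a M * w M))))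
    where
    l = solveℚ 3 (λ d c t → d :- c :+ (t :- d :+ c) := t) refl
    l2 = solveℚ 2 (λ c t → c :- :- t := t :+ c) refl
    D≤ : ∣ sumP a M ∣ ≤ qn M * qn 16
    D≤ = ≤-trans (sum-abs≤ M (λ n _ _ → onP-≤ n)) (≤-reflexive (sum-const (qn 16) M))
    T≤ : ∣ T M ∣ ≤ qn M * qn 16
    T≤ = ≤-trans (sum-abs≤ M (λ n _ _ → subst (λ z → ∣ z ∣ ≤ qn 16) (sym (onP-*ʳ a w n)) (≤-trans (≤-reflexive (∣p*q∣≡∣p∣*∣q∣ (onP a n) (w n))) (≤-trans (*-mono {∣ onP a n ∣} {qn 16} {∣ w n ∣} {1ℚ} (0≤∣p∣ (onP a n)) 0≤1 (onP-≤ n) (≤-trans (≤-reflexive (abs-nn (w≥0 n))) (w≤1 n))) (≤-reflexive (*-identityʳ (qn 16))))))) (≤-reflexive (sum-const (qn 16) M))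

  step : ∀ j → sumP a (j ℕ.+ M) * w (j ℕ.+ M) - C ≤ T (j ℕ.+ M)
  step zero = base
  step (suc j) = ≤-trans (≤-reflexive (l (sumP a y) (onP a (suc y)) (w (suc y)) C)) (≤-trans (+-monoˡ-≤ (onP a (suc y) * w (suc y)) (≤-trans (+-monoˡ-≤ (- C) (*-monoˡ (sumP a y) (D≥0 y (ℕP.≤-trans (ℕP.m≤n+m N 4) (ℕP.m≤n+m M j))) (w-mono y (ℕP.≤-trans (ℕP.m≤m+n 4 N) (ℕP.m≤n+m M j))))) (step j))) (≤-reflexive (cong (T y +_) (sym (onP-*ʳ a w (suc y))))))
    where
    y : ℕ
    y = j ℕ.+ M
    l = solveℚ 4 (λ s d w c → (s :+ d) :* w :- c := s :* w :- c :+ d :* w) refl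

  bound : ∀ x → M ℕ.≤ x → - C ≤ T x
  bound x h = subst (λ y → - C ≤ T y) (ℕP.m∸n+n≡m h) (≤-trans (≤-by (sumP a y * w y) (+-comm (- C) (sumP a y * w y)) (*-nn (D≥0 y (ℕP.≤-trans (ℕP.m≤n+m N 4) (ℕP.m≤n+m M (x ℕ.∸ M)))) (w≥0 y))) (step (x ℕ.∸ M)))
    where
    y : ℕ
    y = x ℕ.∸ M ℕ.+ M

 -- The pointwise inequality is summed over p ≤ x with weights in [0,1]. The primes below 7, for
 -- which it is not claimed, contribute at most a constant independent of x and of the weights.
 module Above (a k5 k3 k15 k₊ k₋ : ℕ → ℚ) (place : ∀ p → Prime p → 7 ℕ.≤ p → qn 12 * a p ≤ qn 5 - qn 5 * k5 p + k3 p - k15 p - qn 2 * (k₊ p - k₋ p)) where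
  R : ℕ → ℚ
  R p = qn 5 - qn 5 * k5 p + k3 p - k15 p - qn 2 * (k₊ p - k₋ p)

  f : ℕ → ℚ
  f p = qn 12 * a p - R p

  C : ℚ
  C = sum (λ n → ∣ f n ∣) 6

  module _ (w : ℕ → ℚ) (w≥0 : ∀ n → 0ℚ ≤ w n) (w≤1 : ∀ n → w n ≤ 1ℚ) (x : ℕ) (x≥6 : 6 ℕ.≤ x) where
    Σ_ : (ℕ → ℚ) → ℚ
    Σ g = sumP (λ p → g p * w p) x

    excess : Σ f ≤ C
    excess = subst (λ y → sumP (λ p → f p * w p) y ≤ C) (ℕP.m+[n∸m]≡n x≥6) (≤-trans (≤-reflexive (sum-split (onP (λ p → f p * w p)) 6 (x ℕ.∸ 6)))
      (≤-trans (+-mono-≤ (sum-mono 6 (λ n _ _ → small n)) (≤-trans (sum-mono (x ℕ.∸ 6) (λ i h _ → onP-elim (λ p → f p * w p) (_≤ 0ℚ) (6 ℕ.+ i) (λ pp → large (6 ℕ.+ i) pp (ℕP.+-monoʳ-≤ 6 h)) ≤-refl)) (≤-reflexive (sum-0 (x ℕ.∸ 6))))) (≤-reflexive (+-identityʳ C))))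
     where
     small : ∀ n → onP (λ p → f p * w p) n ≤ ∣ f n ∣
     small n = onP-elim (λ p → f p * w p) (_≤ ∣ f n ∣) n (λ _ → ≤-trans (*-monoʳ (w n) (w≥0 n) (a≤∣a∣ (f n))) (≤-trans (*-monoˡ ∣ f n ∣ (0≤∣p∣ (f n)) (w≤1 n)) (≤-reflexive (*-identityʳ ∣ f n ∣)))) (0≤∣p∣ (f n))
     large : ∀ p → Prime p → 7 ℕ.≤ p → f p * w p ≤ 0ℚ
     large p pp h = ≤-trans (*-monoʳ (w p) (w≥0 p) (≤-trans (+-monoˡ-≤ (- R p) (place p pp h)) (≤-reflexive (+-inverseʳ (R p))))) (≤-reflexive (*-zeroˡ (w p)))

    W : ℚ
    W = sumP w x

    expand : Σ f ≡ qn 12 * Σ a - (qn 5 * W - qn 5 * Σ k5 + Σ k3 - Σ k15 - qn 2 * (Σ k₊ - Σ k₋))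
    expand = trans (sumP-cong x (λ p _ _ → l (qn 12) (a p) (qn 5) (k5 p) (k3 p) (k15 p) (qn 2) (k₊ p) (k₋ p) (w p)))
      (sumP-lin- (λ p → qn 12 * (a p * w p)) (λ p → qn 5 * w p - qn 5 * (k5 p * w p) + k3 p * w p - k15 p * w p - qn 2 * (k₊ p * w p - k₋ p * w p)) (sumP-* (qn 12) (λ p → a p * w p) x)
        (sumP-lin- (λ p → qn 5 * w p - qn 5 * (k5 p * w p) + k3 p * w p - k15 p * w p) (λ p → qn 2 * (k₊ p * w p - k₋ p * w p))
         (sumP-lin- (λ p → qn 5 * w p - qn 5 * (k5 p * w p) + k3 p * w p) (λ p → k15 p * w p)
           (trans (sumP-+ (λ p → qn 5 * w p - qn 5 * (k5 p * w p)) (λ p → k3 p * w p) x) (cong (_+ Σ k3) (sumP-lin- (λ p → qn 5 * w p) (λ p → qn 5 * (k5 p * w p)) (sumP-* (qn 5) w x) (sumP-* (qn 5) (λ p → k5 p * w p) x))))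
           refl)
         (trans (sumP-* (qn 2) (λ p → k₊ p * w p - k₋ p * w p) x) (cong (qn 2 *_) (sumP-- (λ p → k₊ p * w p) (λ p → k₋ p * w p) x)))))
     where
     sumP-lin- : ∀ g h {u v} → sumP g x ≡ u → sumP h x ≡ v → sumP (λ p → g p - h p) x ≡ u - v
     sumP-lin- g h e e' = trans (sumP-- g h x) (cong₂ _-_ e e')
     l = solveℚ 10 (λ t a c k5 k3 k15 d k₊ k₋ w → (t :* a :- (c :- c :* k5 :+ k3 :- k15 :- d :* (k₊ :- k₋))) :* w := t :* (a :* w) :- (c :* w :- c :* (k5 :* w) :+ k3 :* w :- k15 :* w :- d :* (k₊ :* w :- k₋ :* w))) refl

    bound : ∀ {b5 b3 b15 b₊ b₋} → ∣ Σ k5 ∣ ≤ b5 → ∣ Σ k3 ∣ ≤ b3 → ∣ Σ k15 ∣ ≤ b15 → ∣ Σ k₊ ∣ ≤ b₊ → ∣ Σ k₋ ∣ ≤ b₋ →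
          qn 12 * Σ a ≤ qn 5 * W + (C + (qn 5 * b5 + b3 + b15 + qn 2 * (b₊ + b₋)))
    bound {b5} {b3} {b15} {b₊} {b₋} h5 h3 h15 h₊ h₋ = ≤-by (C - Σ f + (qn 5 * (Σ k5 + b5) + (b3 - Σ k3) + (Σ k15 + b15) + qn 2 * ((Σ k₊ + b₊) + (b₋ - Σ k₋))))
      (trans (cong (λ z → qn 12 * Σ a + (C - z + (qn 5 * (Σ k5 + b5) + (b3 - Σ k3) + (Σ k15 + b15) + qn 2 * ((Σ k₊ + b₊) + (b₋ - Σ k₋))))) expand) (l (qn 12 * Σ a) (qn 5) W (Σ k5) (Σ k3) (Σ k15) (qn 2) (Σ k₊) (Σ k₋) C b5 b3 b15 b₊ b₋))
      (+-nn (sub-nn excess) (+-nn (+-nn (+-nn (*-nn (qn-nn 5) (lo h5)) (hi h3)) (lo h15)) (*-nn (qn-nn 2) (+-nn (lo h₊) (hi h₋)))))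
     where
     hi : ∀ {s b} → ∣ s ∣ ≤ b → 0ℚ ≤ b - s
     hi {s} h = sub-nn (≤-trans (a≤∣a∣ s) h)
     lo : ∀ {s b} → ∣ s ∣ ≤ b → 0ℚ ≤ s + b
     lo {s} {b} h = subst (0ℚ ≤_) (solveℚ 2 (λ s b → b :- :- s := s :+ b) refl s b) (sub-nn (≤-trans (-a≤∣a∣ s) h))
     l = solveℚ 15 (λ t c w s5 s3 s15 d s₊ s₋ e b5 b3 b15 b₊ b₋ → t :+ (e :- (t :- (c :* w :- c :* s5 :+ s3 :- s15 :- d :* (s₊ :- s₋))) :+ (c :* (s5 :+ b5) :+ (b3 :- s3) :+ (s15 :+ b15) :+ d :* ((s₊ :+ b₊) :+ (b₋ :- s₋)))) := c :* w :+ (e :+ (c :* b5 :+ b3 :+ b15 :+ d :* (b₊ :+ b₋)))) refl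

 -- The multipliers 4 and 3 eliminate V, as 4 · 12 = 3 · 16, and leave W with coefficient 21 - 20 =
 -- 1. This surplus is the inequality 7/16 > 5/12.
 arith : ∀ W V C C' → qn 12 * V ≤ qn 5 * W + C' → - C ≤ qn 16 * V - qn 7 * W → W ≤ qn 4 * C' + qn 3 * C
 arith W V C C' u h = subst₂ (λ a b → W ≤ a * C' + b * C) (sym (qn≡ 4)) (sym (qn≡ 3)) (≤-by (q 4 * (q 5 * W + C' - q 12 * V) + q 3 * ((q 16 * V - q 7 * W) - - C)) (l W V C C')
   (+-nn (*-nn (nnq 4) (sub-nn (subst₂ (λ a b → a * V ≤ b * W + C') (qn≡ 12) (qn≡ 5) u))) (*-nn (nnq 3) (sub-nn (subst₂ (λ a b → - C ≤ a * V - b * W) (qn≡ 16) (qn≡ 7) h)))))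
  where
  q : ℕ → ℚ
  q n = ℤ.+ n / 1
  nnq : ∀ n → 0ℚ ≤ q n
  nnq n = subst (0ℚ ≤_) (qn≡ n) (qn-nn n)
  l = solveℚ 4 (λ W V C C' → W :+ (Κ (ℤ.+ 4 / 1) :* (Κ (ℤ.+ 5 / 1) :* W :+ C' :- Κ (ℤ.+ 12 / 1) :* V) :+ Κ (ℤ.+ 3 / 1) :* ((Κ (ℤ.+ 16 / 1) :* V :- Κ (ℤ.+ 7 / 1) :* W) :- :- C)) := Κ (ℤ.+ 4 / 1) :* C' :+ Κ (ℤ.+ 3 / 1) :* C) refl

 bigO : Hecke → ℚ
 bigO H = qn 100 * (qn 71 * K + (qn 38 * (qn 5 * K) * qn 12 + qn 8 * K * qn 648))
  where open Hecke H

 place' : ∀ p → Prime p → 7 ℕ.≤ p → qn 12 * A p ≤ qn 5 - qn 5 * qz (χ5.χ p) + qz (χ3.χ p) - qz (χ15.χ p) - qn 2 * (C₊.κ p - C₋.κ p)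
 place' p pp h = Large.place p pp h

 module Density (N : ℕ) (dense : ∀ x → N ℕ.≤ x → qn 7 * sumP (λ _ → 1ℚ) x ≤ qn 16 * sumP A x) where
  d : ℕ → ℚ
  d p = qn 16 * A p - qn 7

  d≤ : ∀ p → ∣ d p ∣ ≤ qn 16
  d≤ p with oneInCage p
  ... | true = num₁
    where
    opaque
     unfolding qz
     num₁ : ∣ qn 16 * qn 1 - qn 7 ∣ ≤ qn 16
     num₁ = dec≤
  ... | false = num₀
    where
    opaque
     unfolding qz
     num₀ : ∣ qn 16 * qn 0 - qn 7 ∣ ≤ qn 16
     num₀ = dec≤

  D≥0 : ∀ x → N ℕ.≤ x → 0ℚ ≤ sumP d x
  D≥0 x h = subst (0ℚ ≤_) (sym (trans (sumP-- (λ p → qn 16 * A p) (λ _ → qn 7) x) (cong₂ _-_ (sumP-* (qn 16) A x) (trans (sumP-cong x (λ _ _ _ → sym (*-identityʳ (qn 7)))) (sumP-* (qn 7) (λ _ → 1ℚ) x))))) (sub-nn (dense x h))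

  open Above A (λ p → qz (χ5.χ p)) (λ p → qz (χ3.χ p)) (λ p → qz (χ15.χ p)) C₊.κ C₋.κ place' using () renaming (C to C₁; bound to above)

  -- None of these constants depends on x, although the weight w changes with X = x². This
  -- uniformity is what contradicts the divergence of Σ L(p)/p.
  C₂ C₃ Z : ℚ
  C₂ = C₁ + (qn 5 * bigO H5 + bigO H3 + bigO H15 + qn 2 * (bigO C₊.H + bigO C₋.H))
  C₃ = qn (4 ℕ.+ N) * qn 16 + qn (4 ℕ.+ N) * qn 16
  Z = qn 4 * C₂ + qn 3 * C₃

  module At (x : ℕ) (x≥1 : 1 ℕ.≤ x) (x≥2500 : 2500 ℕ.≤ x) (x≥N : 4 ℕ.+ N ℕ.≤ x) where
    X : ℕ
    X = x ℕ.* x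
    X≥1 : 1 ℕ.≤ X
    X≥1 = ℕP.*-mono-≤ x≥1 x≥1
    open Lg X X≥1

    w≤1 : ∀ n → w n ≤ 1ℚ
    w≤1 zero = ≤-trans (≤-reflexive (trans (cong (L 0 *_) iv-0) (*-zeroʳ (L 0)))) 0≤1
    w≤1 (suc n) = iv≤ (suc n) {1ℚ} {L (suc n)} (s≤s z≤n) (≤-trans (≤-by {L (suc n)} {L (suc n) + 1ℚ} 1ℚ refl 0≤1) (≤-trans (L-≤ (suc n) (s≤s z≤n)) (≤-reflexive (sym (*-identityʳ (qn (suc n)))))))

    x≥256 : 256 ℕ.≤ x
    x≥256 = ℕP.≤-trans (ℕP.m≤m+n 256 2244) x≥2500

    module B5 = MertensSeries.Main.Final H5 x X x≥1 ℕP.≤-refl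
    module B3 = MertensSeries.Main.Final H3 x X x≥1 ℕP.≤-refl
    module B15 = MertensSeries.Main.Final H15 x X x≥1 ℕP.≤-refl
    module B₊ = MertensSeries.Main.Final C₊.H x X x≥1 ℕP.≤-refl
    module B₋ = MertensSeries.Main.Final C₋.H x X x≥1 ℕP.≤-refl

    up : qn 12 * sumP (λ p → A p * w p) x ≤ qn 5 * sumP w x + C₂
    up = above w w-nn w≤1 x (ℕP.≤-trans (ℕP.m≤m+n 6 2494) x≥2500) (B5.bounded 100 (s≤s z≤n) (S5 x x≥256)) (B3.bounded 100 (s≤s z≤n) (S3 x x≥256)) (B15.bounded 100 (s≤s z≤n) (S15 x x≥256)) (B₊.bounded 100 (s≤s z≤n) (S₊ x x≥2500)) (B₋.bounded 100 (s≤s z≤n) (S₋ x x≥2500))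

    down : - C₃ ≤ qn 16 * sumP (λ p → A p * w p) x - qn 7 * sumP w x
    down = ≤-trans (Below.bound d d≤ N D≥0 w w-nn w≤1 w-decr x x≥N) (≤-reflexive (trans (sumP-cong x (λ p _ _ → (solveℚ 4 (λ a b c w → (a :* b :- c) :* w := a :* (b :* w) :- c :* w) refl) (qn 16) (A p) (qn 7) (w p))) (trans (sumP-- (λ p → qn 16 * (A p * w p)) (λ p → qn 7 * w p) x) (cong₂ _-_ (sumP-* (qn 16) (λ p → A p * w p) x) (sumP-* (qn 7) w x)))))

    W≤ : sumP w x ≤ Z
    W≤ = arith (sumP w x) (sumP (λ p → A p * w p) x) C₃ C₂ up down

  -- Σ L(p)/p is unbounded
  absurd : ⊥
  absurd = go (≤-qn ((qn 4 * Z + 1ℚ) * qn 2))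
    where
    2^-≥ : ∀ k → k ℕ.≤ 2 ℕ.^ k
    2^-≥ zero = z≤n
    2^-≥ (suc k) = ℕP.≤-trans (ℕP.+-mono-≤ (ℕP.m^n>0 2 k) (2^-≥ k)) (ℕP.≤-reflexive (cong (2 ℕ.^ k ℕ.+_) (sym (ℕP.+-identityʳ (2 ℕ.^ k)))))
    go : (∃ λ n → (qn 4 * Z + 1ℚ) * qn 2 ≤ qn n) → ⊥
    go (n , h) = bad (2500 ℕ.+ ((4 ℕ.+ N) ℕ.+ suc n)) (ℕP.m≤m+n 2500 _) (ℕP.≤-trans (ℕP.m≤m+n (4 ℕ.+ N) (suc n)) (ℕP.m≤n+m _ 2500)) (ℕP.≤-trans (ℕP.m≤n+m (suc n) (4 ℕ.+ N)) (ℕP.m≤n+m _ 2500))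
     where
     bad : ∀ k → 2500 ℕ.≤ k → 4 ℕ.+ N ℕ.≤ k → suc n ℕ.≤ k → ⊥
     bad k h₁ h₂ h₃ = <-irrefl (+-identityˡ (qn n)) (<-≤-trans (+-monoˡ-< (qn n) (positive⁻¹ 1ℚ)) (≤-trans (≤-reflexive (sym (qn-suc n))) (≤-trans (qn-mono h₃) k≤n)))
       where
       x : ℕ
       x = 2 ℕ.^ k ℕ.+ 2 ℕ.^ k
       k≤x : k ℕ.≤ x
       k≤x = ℕP.≤-trans (2^-≥ k) (ℕP.m≤m+n (2 ℕ.^ k) (2 ℕ.^ k))
       x≥1 : 1 ℕ.≤ x
       x≥1 = ℕP.≤-trans (s≤s z≤n) (ℕP.≤-trans h₁ k≤x)
       open At x x≥1 (ℕP.≤-trans h₁ k≤x) (ℕP.≤-trans h₂ k≤x)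
       key : qn k * iv 2 ≤ qn 4 * Z + 1ℚ
       key = ≤-trans (W-lower k (x ℕ.* x) x≥1 ℕP.≤-refl) (+-monoˡ-≤ 1ℚ (*-monoˡ (qn 4) (qn-nn 4) W≤))
       l : ∀ a b c → b * c ≡ 1ℚ → (a * c) * b ≡ a
       l a b c e = trans (solveℚ 3 (λ a b c → (a :* c) :* b := a :* (b :* c)) refl a b c) (trans (cong (a *_) e) (*-identityʳ a))
       k≤n : qn k ≤ qn n
       k≤n = ≤-trans (≤-reflexive (sym (l (qn k) (qn 2) (iv 2) (iv-inv' 2 (s≤s z≤n))))) (≤-trans (*-monoʳ (qn 2) (qn-nn 2) key) h)

 -- The tolerance 1/48 separates two cases. If some late ratio is at most 22/48, all later ones are
 -- at most 23/48 < 1/2. Otherwise all of them exceed 21/48 = 7/16, which is impossible.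
 limit-below-half : IsCauchy ratio →
  ∃ λ (δ' : ℚ) → (δ' < ½) × (∃ λ (N : ℕ) → ∀ x → N ℕ.≤ x → ratio x ≤ δ')
 limit-below-half cauchy = go (cauchy (ℤ.+ 1 / 48) (positive⁻¹ (ℤ.+ 1 / 48)))
  where
  go : (∃ λ N → ∀ m n → N ℕ.≤ m → N ℕ.≤ n → ∣ ratio m - ratio n ∣ < ℤ.+ 1 / 48) → ∃ λ (δ' : ℚ) → (δ' < ½) × (∃ λ (N : ℕ) → ∀ x → N ℕ.≤ x → ratio x ≤ δ')
  go (N , near) with ratio N ≤? ℤ.+ 11 / 24
  ... | yes small = ℤ.+ 23 / 48 , from-yes (ℤ.+ 23 / 48 Data.Rational.<? ½) , N , λ x h → ≤-by (ℤ.+ 1 / 48 - (ratio x - ratio N) + (ℤ.+ 11 / 24 - ratio N)) (solveℚ 2 (λ r s → r :+ (Κ (ℤ.+ 1 / 48) :- (r :- s) :+ (Κ (ℤ.+ 11 / 24) :- s)) := Κ (ℤ.+ 23 / 48)) refl (ratio x) (ratio N)) (+-nn (sub-nn (≤-trans (a≤∣a∣ (ratio x - ratio N)) (<⇒≤ (near x N h ℕP.≤-refl)))) (sub-nn small))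
  ... | no big = ⊥-elim (Density.absurd N λ x h → ratio-≥ x (≤-by (ratio N - ℤ.+ 11 / 24 + (ℤ.+ 1 / 48 - (ratio N - ratio x))) (solveℚ 2 (λ r s → Κ (ℤ.+ 7 / 16) :+ (s :- Κ (ℤ.+ 11 / 24) :+ (Κ (ℤ.+ 1 / 48) :- (s :- r))) := r) refl (ratio x) (ratio N)) (+-nn (sub-nn (<⇒≤ (≰⇒> big))) (sub-nn (≤-trans (a≤∣a∣ (ratio N - ratio x)) (<⇒≤ (near N x ℕP.≤-refl h)))))))

open import Defs
open import Data.Product using (∃; _×_)
open import Data.Nat using (ℕ)
open import Data.Rational using (ℚ; ½; _<_; _≤_)

theorem5p2 : IsCauchy ratio →
    ∃ λ (δ' : ℚ) → (δ' < ½) × (∃ λ (N : ℕ) → ∀ x → N Data.Nat.≤ x → ratio x ≤ δ')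
theorem5p2 = Density.limit-below-half
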